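{- There is an absolute constant $c$ such that for every prime $p$ and any integers $r>s>1$ we have $$N_p(r,s)\leqslant c\,\frac{rs}{\log p}+4.$$
   Context: For a prime $p$ and positive integers $r,s$, $N_p(r,s)$ denotes the number of solutions $(x,y)\in\mathbb{F}_p^*\times\mathbb{F}_p^*$ of the system $x^r=y^r+1$, $x^s=y^s+1$, $x=y+1$; equivalently, it counts common zeros $y$ in $\mathbb{F}_p$ of the polynomials $F_r(Y)=(Y+1)^r-Y^r-1$ and $F_s(Y)=(Y+1)^s-Y^s-1$ subject to $y\neq 0$, $y+1\neq 0$. -}

module Defs where

open import Data.Nat using (ℕ; zero; suc; _+_; _^_; _≡ᵇ_)
open import Data.Nat.DivMod using (_%_)
open import Data.Bool using (Bool; true; false; not; _∧_)
open import Data.List using (List; length; filterᵇ; upTo)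

-- Congruence a ≡ b (mod p) as a Boolean test (p = 0 is never used: p is prime).
infix 4 _≡ᵇ_[mod_]
_≡ᵇ_[mod_] : ℕ → ℕ → ℕ → Bool
a ≡ᵇ b [mod zero ]  = false
a ≡ᵇ b [mod suc q ] = (a % suc q) ≡ᵇ (b % suc q)

-- y ∈ 𝔽_p (represented by 0 ≤ y < p) gives a solution (x , y) = (y+1 , y) in
-- 𝔽_p^* × 𝔽_p^* of  x^r = y^r + 1,  x^s = y^s + 1,  x = y + 1.
isSol : (p r s y : ℕ) → Bool
isSol p r s y =
  not (y ≡ᵇ 0 [mod p ]) ∧ (not ((y + 1) ≡ᵇ 0 [mod p ])
  ∧ (((y + 1) ^ r ≡ᵇ (y ^ r + 1) [mod p ])
  ∧ ((y + 1) ^ s ≡ᵇ (y ^ s + 1) [mod p ])))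

-- N_p(r,s): number of solutions; y ranges over 0,1,…,p-1 (i.e. 𝔽_p), and x = y+1 is determined.
N : (p r s : ℕ) → ℕ
N p r s = length (filterᵇ (isSol p r s) (upTo p))

{-# OPTIONS --safe #-}
-- Write F n = (Y + 1)^n - Y^n - 1.  For p ≤ s the bound is trivial.  For p > s the solutions, together with
-- 0 (and -1 if r and s are odd), are common roots of F r and F s modulo p.
--
-- Siegel's method: let σ be 7 if r and s are odd and 6 otherwise.  For polynomials U and V with r-σ and s-σ
-- coefficients from [0, p 2^r) and [0, p 2^s), the polynomial U F s + V F r has small coefficients and
-- vanishes modulo p at the common roots.  If p^(N - 4) > 2^(12 r s) there are more pairs (U , V) than
-- values, and a difference of two pairs with the same value gives U F s + V F r = 0 over ℤ.  By degrees, F r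
-- and F s then have a common zero outside Q = (Y + 1) Y (Y² + Y + 1) = 0, against a theorem of Beukers.
--
-- Beukers' theorem: a common zero gives A = B + 1 for A = X^s and B = Y^s with X = Y + 1, and X^r = Y^r + 1.
-- Padé approximants to the power function (homogeneous identities in A, B, 1) turn the second equation into
-- an algebraic number L whose products with high powers of X and Y are forms of low degree in X and Y with
-- small coefficients.  On the other hand, D Q^τ = Φ (X , Y) with Φ of coefficient sum below D shows that Q
-- is small at all archimedean places relative to max(∣X∣, ∣Y∣, 1), so that powers of L become divisible by
-- arbitrarily large integers without growing, and L = 0.  Two neighbouring approximants have a nonzero
-- constant determinant, so they cannot both give L = 0.  The pairs (r , s) with small s that this leaves
-- open are excluded by resultants modulo a prime.
--
-- Number fields are avoided by computing in an ideal of functions ℕ → ℤ, the multiples of F s up to a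
-- constant and a fixed polynomial, for which statements are needed only at all large arguments.
module Submission where

open import Data.Bool using (Bool; true; false; not; if_then_else_; _∧_; _∨_; T)
open import Data.Bool.Properties using (T?)
open import Data.Empty using (⊥-elim)
open import Data.Fin using (toℕ; fromℕ<)
open import Data.Fin.Properties using (pigeonhole; toℕ<n; toℕ-fromℕ<)
open import Data.Integer using (ℤ; +_; -[1+_]; ∣_∣; 0ℤ; 1ℤ; NonZero; ≢-nonZero)
open import Data.Integer.Tactic.RingSolver using (solve-∀)
open import Data.List using (List; []; _∷_; map; length; filterᵇ; upTo)
open import Data.List.Membership.Propositional.Properties using (∈-upTo⁺)
open import Data.List.Properties using (length-filter; length-upTo)
open import Data.List.Relation.Unary.All as All using (All; []; _∷_)
open import Data.List.Relation.Unary.AllPairs using (AllPairs; []; _∷_)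
open import Data.Nat as ℕ using (ℕ; zero; suc; z≤n; s≤s; ⌊_/2⌋; ⌈_/2⌉)
open import Data.Nat.Coprimality using (Coprime; coprime-divisor; gcd≡1⇒coprime)
open import Data.Nat.DivMod using (_%_; _/_; m≡m%n+[m/n]*n; m%n<n; m<n*o⇒m/o<n; [m+kn]%n≡m%n; m<n⇒m%n≡m; m*n/n≡m; /-monoˡ-≤; n%n≡0)
open import Data.Nat.GCD using (gcd)
open import Data.Nat.Induction using (<-rec)
open import Data.Nat.Logarithm using (⌊log₂_⌋; ⌊log₂⌋-mono-≤; ⌊log₂⌊n/2⌋⌋≡⌊log₂n⌋∸1)
open import Data.Nat.Primality using (Prime; euclidsLemma; prime⇒nonZero)
open import Data.Product using (∃; _×_; _,_; proj₁; proj₂)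
open import Data.Sum using (_⊎_; inj₁; inj₂)
open import Data.Unit using (tt)
open import Data.Vec using (Vec; []; _∷_)
open import Function using (_∘_)
open import Relation.Binary.PropositionalEquality using (_≡_; _≢_; refl; sym; trans; cong; cong₂; subst; module ≡-Reasoning)
open import Relation.Nullary using (¬_; Dec; yes; no)
import Data.List.Relation.Unary.All.Properties as Allₚ
import Data.List.Relation.Unary.Unique.Propositional.Properties as Uniqueₚ
import Data.Nat.Divisibility as ℕ∣
import Data.Nat.Properties as ℕₚ
import Data.Nat.Tactic.RingSolver as ℕR

-- The summand 4 results from a balance. Up to constants `F n` contains `Y` once, `X` once for odd n
-- and not at all for even n, and `q` at most twice. So the common part of `F r` and `F s` supported
-- on Q divides Y X q², of degree 6, if both exponents are odd, and Y q², of degree 5, otherwise;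
-- this degree is σ - 1. Without common zeros outside Q, the equation U F s = - V F r is therefore
-- impossible for a nonzero V with s - σ coefficients. On the counting side U F s + V F r has r + s
-- - σ - 1 coefficients for r + s - 2σ parameters, a deficit of σ - 1, while the known roots bring
-- the number of common roots to N + σ - 5. The net gain is p^(N - 4) for either σ.
--
-- The obstacle in Beukers' theorem: an element whose products with X^μ and Y^μ are forms of degree
-- E < μ is small only where max(∣X∣, ∣Y∣, 1) is large. Where this maximum is near 1 the degrees
-- give nothing, and the smallness of Q has to take over.

-- Integer polynomials as functions on the natural numbers, with bounded coefficient sums.

module Polynomials where
  open import Data.Integer using (_+_; _*_; _-_; -_; _^_)
  open import Data.Integer.Properties

  Fn : Set
  Fn = ℕ → ℤ

  ev : ℕ → Fn → Fn
  ev zero    a t = 0ℤ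
  ev (suc n) a t = ev n a t + a n * (+ t) ^ n

  norm : ℕ → Fn → ℕ
  norm zero    a = 0
  norm (suc n) a = norm n a ℕ.+ ∣ a n ∣

  -- The polynomial is only a witness for the function `A`, because the ideals used later consist of
  -- functions. The size is the sum of the absolute values of the coefficients, which is
  -- submultiplicative.
  record P (n b : ℕ) (A : Fn) : Set where
    constructor poly
    field
      coef   : Fn
      isEv   : ∀ t → A t ≡ ev n coef t
      normed : norm n coef ℕ.≤ b

  ev-cong : ∀ n {a b : Fn} → (∀ i → i ℕ.< n → a i ≡ b i) → ∀ t → ev n a t ≡ ev n b t
  ev-cong zero    e t = refl
  ev-cong (suc n) e t =
    cong₂ (λ u v → u + v * (+ t) ^ n)
      (ev-cong n (λ i i<n → e i (ℕₚ.m<n⇒m<1+n i<n)) t) (e n (ℕₚ.n<1+n n))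

  ev-0 : ∀ n {a : Fn} → (∀ i → i ℕ.< n → a i ≡ 0ℤ) → ∀ t → ev n a t ≡ 0ℤ
  ev-0 zero    e t = refl
  ev-0 (suc n) e t rewrite ev-0 n (λ i i<n → e i (ℕₚ.m<n⇒m<1+n i<n)) t | e n (ℕₚ.n<1+n n) = refl

  ev-+ : ∀ n (a b : Fn) t → ev n (λ i → a i + b i) t ≡ ev n a t + ev n b t
  ev-+ zero    a b t = refl
  ev-+ (suc n) a b t rewrite ev-+ n a b t = l (ev n a t) (ev n b t) (a n) (b n) ((+ t) ^ n)
    where
    l : ∀ p q u v w → p + q + (u + v) * w ≡ p + u * w + (q + v * w)
    l = solve-∀

  ev-* : ∀ n k (a : Fn) t → ev n (λ i → k * a i) t ≡ k * ev n a t
  ev-* zero    k a t = sym (*-zeroʳ k)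
  ev-* (suc n) k a t rewrite ev-* n k a t = l k (ev n a t) (a n) ((+ t) ^ n)
    where
    l : ∀ k p u w → k * p + k * u * w ≡ k * (p + u * w)
    l = solve-∀

  shift : Fn → Fn
  shift a zero    = 0ℤ
  shift a (suc i) = a i

  ev-shift : ∀ n (a : Fn) t → ev (suc n) (shift a) t ≡ + t * ev n a t
  ev-shift zero    a t = sym (*-zeroʳ (+ t))
  ev-shift (suc n) a t rewrite ev-shift n a t = l (+ t) (ev n a t) (a n) ((+ t) ^ n)
    where
    l : ∀ t p u w → t * p + u * (t * w) ≡ t * (p + u * w)
    l = solve-∀

  norm-+ : ∀ n (a b : Fn) → norm n (λ i → a i + b i) ℕ.≤ norm n a ℕ.+ norm n b
  norm-+ zero    a b = z≤n
  norm-+ (suc n) a b = ℕₚ.≤-trans (ℕₚ.+-mono-≤ (norm-+ n a b) (∣i+j∣≤∣i∣+∣j∣ (a n) (b n)))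
    (ℕₚ.≤-reflexive (l (norm n a) (norm n b) (∣ a n ∣) (∣ b n ∣)))
    where
    l : ∀ p q u v → p ℕ.+ q ℕ.+ (u ℕ.+ v) ≡ p ℕ.+ u ℕ.+ (q ℕ.+ v)
    l = ℕR.solve-∀

  norm-* : ∀ n k (a : Fn) → norm n (λ i → k * a i) ≡ ∣ k ∣ ℕ.* norm n a
  norm-* zero    k a = sym (ℕₚ.*-zeroʳ ∣ k ∣)
  norm-* (suc n) k a rewrite norm-* n k a | abs-* k (a n) = sym (ℕₚ.*-distribˡ-+ (∣ k ∣) (norm n a) (∣ a n ∣))

  norm-shift : ∀ n (a : Fn) → norm (suc n) (shift a) ≡ norm n a
  norm-shift zero    a = refl
  norm-shift (suc n) a = cong (ℕ._+ ∣ a n ∣) (norm-shift n a)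

  norm-coef : ∀ n (a : Fn) i → i ℕ.< n → ∣ a i ∣ ℕ.≤ norm n a
  norm-coef (suc n) a i i<1+n with ℕₚ.m<1+n⇒m<n∨m≡n i<1+n
  ... | inj₁ i<n  = ℕₚ.≤-trans (norm-coef n a i i<n) (ℕₚ.m≤m+n _ _)
  ... | inj₂ refl = ℕₚ.m≤n+m _ _

  P-cast : ∀ {n b c A B} → b ℕ.≤ c → (∀ t → A t ≡ B t) → P n b A → P n c B
  P-cast b≤c e (poly a ea na) = poly a (λ t → trans (sym (e t)) (ea t)) (ℕₚ.≤-trans na b≤c)

  P-+ : ∀ {n b c A B} → P n b A → P n c B → P n (b ℕ.+ c) (λ t → A t + B t)
  P-+ {n} (poly a ea na) (poly b eb nb) = poly (λ i → a i + b i)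
    (λ t → trans (cong₂ _+_ (ea t) (eb t)) (sym (ev-+ n a b t)))
    (ℕₚ.≤-trans (norm-+ n a b) (ℕₚ.+-mono-≤ na nb))

  P-scale : ∀ {n b A} k → P n b A → P n (∣ k ∣ ℕ.* b) (λ t → k * A t)
  P-scale {n} k (poly a ea na) = poly (λ i → k * a i)
    (λ t → trans (cong (k *_) (ea t)) (sym (ev-* n k a t)))
    (ℕₚ.≤-trans (ℕₚ.≤-reflexive (norm-* n k a)) (ℕₚ.*-monoʳ-≤ ∣ k ∣ na))

  P-t* : ∀ {n b A} → P n b A → P (suc n) b (λ t → + t * A t)
  P-t* {n} (poly a ea na) = poly (shift a)
    (λ t → trans (cong (+ t *_) (ea t)) (sym (ev-shift n a t)))
    (ℕₚ.≤-trans (ℕₚ.≤-reflexive (norm-shift n a)) na)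

  -- The entries of `coef` from `n` on are unconstrained, so they have to be cleared before a
  -- polynomial can be viewed as one with more coefficients.
  cut : ℕ → Fn → Fn
  cut zero    a i       = 0ℤ
  cut (suc n) a zero    = a zero
  cut (suc n) a (suc i) = cut n (λ j → a (suc j)) i

  cut-< : ∀ n a i → i ℕ.< n → cut n a i ≡ a i
  cut-< (suc n) a zero    _         = refl
  cut-< (suc n) a (suc i) (s≤s i<n) = cut-< n (λ j → a (suc j)) i i<n

  cut-≥ : ∀ n a i → n ℕ.≤ i → cut n a i ≡ 0ℤ
  cut-≥ zero    a i       _         = refl
  cut-≥ (suc n) a (suc i) (s≤s n≤i) = cut-≥ n (λ j → a (suc j)) i n≤i

  norm-cong : ∀ n {a b : Fn} → (∀ i → i ℕ.< n → a i ≡ b i) → norm n a ≡ norm n b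
  norm-cong zero    e = refl
  norm-cong (suc n) e = cong₂ (λ u v → u ℕ.+ ∣ v ∣)
    (norm-cong n (λ i i<n → e i (ℕₚ.m<n⇒m<1+n i<n))) (e n (ℕₚ.n<1+n n))

  P-suc : ∀ {n b A} → P n b A → P (suc n) b A
  P-suc {n} {b} (poly a ea na) = poly (cut n a)
    (λ t → trans (ea t) (trans (ev-cong n (λ i i<n → sym (cut-< n a i i<n)) t)
      (sym (trans (cong (λ z → ev n (cut n a) t + z * (+ t) ^ n) (cut-≥ n a n ℕₚ.≤-refl)) (+-identityʳ _)))))
    (subst (ℕ._≤ b) (sym (trans (cong₂ (λ u v → u ℕ.+ ∣ v ∣) (norm-cong n (cut-< n a)) (cut-≥ n a n ℕₚ.≤-refl))
      (ℕₚ.+-identityʳ _))) na)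

  P-+ʳ : ∀ {n b A} k → P n b A → P (k ℕ.+ n) b A
  P-+ʳ zero    p = p
  P-+ʳ (suc k) p = P-suc (P-+ʳ k p)

  P-pad : ∀ {n m b A} → n ℕ.≤ m → P n b A → P m b A
  P-pad {n} {m} {b} {A} n≤m p = subst (λ k → P k b A) (ℕₚ.m∸n+n≡m n≤m) (P-+ʳ (m ℕ.∸ n) p)

  P-0 : ∀ {n} → P n 0 (λ _ → 0ℤ)
  P-0 {n} = poly (λ _ → 0ℤ) (λ t → sym (ev-0 n (λ _ _ → refl) t)) (z n)
    where
    z : ∀ n → norm n (λ _ → 0ℤ) ℕ.≤ 0
    z zero    = z≤n
    z (suc n) = subst (ℕ._≤ 0) (sym (ℕₚ.+-identityʳ _)) (z n)

  P-const : ∀ k → P 1 ∣ k ∣ (λ _ → k)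
  P-const k = poly (λ _ → k) (λ t → sym (trans (+-identityˡ _) (*-identityʳ k))) ℕₚ.≤-refl

  P-t^ : ∀ i {n b A} → P n b A → P (i ℕ.+ n) b (λ t → (+ t) ^ i * A t)
  P-t^ zero    p = P-cast ℕₚ.≤-refl (λ t → sym (*-identityˡ _)) p
  P-t^ (suc i) p = P-cast ℕₚ.≤-refl (λ t → sym (*-assoc (+ t) _ _)) (P-t* (P-t^ i p))

  P-ev* : ∀ n (a : Fn) {m c B} → P m c B → P (n ℕ.+ m) (norm n a ℕ.* c) (λ t → ev n a t * B t)
  P-ev* zero    a {m} {c} {B} p = P-cast z≤n (λ t → sym (*-zeroˡ (B t))) (P-0 {m})
  P-ev* (suc n) a {m} {c} {B} p =
    P-cast (ℕₚ.≤-reflexive (sym (ℕₚ.*-distribʳ-+ c (norm n a) (∣ a n ∣))))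
      (λ t → l (ev n a t) (a n) ((+ t) ^ n) (B t))
      (P-+ (P-suc (P-ev* n a p)) (P-suc (P-scale (a n) (P-t^ n p))))
    where
    l : ∀ u v w x → u * x + v * (w * x) ≡ (u + v * w) * x
    l = solve-∀

  P-* : ∀ {n m b c A B} → P n b A → P m c B → P (n ℕ.+ m) (b ℕ.* c) (λ t → A t * B t)
  P-* {n} {m} {c = c} {B = B} (poly a ea na) p = P-cast (ℕₚ.*-monoˡ-≤ c na)
    (λ t → cong (_* B t) (sym (ea t))) (P-ev* n a p)

  Poly : Fn → Set
  Poly A = ∃ λ n → ∃ λ b → P n b A

  Poly-* : ∀ {A B} → Poly A → Poly B → Poly (λ t → A t * B t)
  Poly-* (_ , _ , p) (_ , _ , q) = _ , _ , P-* p q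

  Poly-+ : ∀ {A B} → Poly A → Poly B → Poly (λ t → A t + B t)
  Poly-+ (n , _ , p) (m , _ , q) = n ℕ.+ m , _ , P-+ (P-pad (ℕₚ.m≤m+n n m) p) (P-pad (ℕₚ.m≤n+m m n) q)

  Poly-const : ∀ k → Poly (λ _ → k)
  Poly-const k = _ , _ , P-const k

  Poly-^ : ∀ {A} n → Poly A → Poly (λ t → A t ^ n)
  Poly-^ zero    p = Poly-const 1ℤ
  Poly-^ (suc n) p = Poly-* p (Poly-^ n p)

  Poly-t : Poly (λ t → + t)
  Poly-t = _ , _ , P-cast ℕₚ.≤-refl (λ t → *-identityʳ (+ t)) (P-t* (P-const 1ℤ))

  Poly-neg : ∀ {A} → Poly A → Poly (λ t → - A t)
  Poly-neg {A} (_ , _ , p) = _ , _ , P-cast ℕₚ.≤-refl (λ t → -1*i≡-i (A t)) (P-scale -[1+ 0 ] p)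

  abs-^ : ∀ i n → ∣ i ^ n ∣ ≡ ∣ i ∣ ℕ.^ n
  abs-^ i zero    = refl
  abs-^ i (suc n) = trans (abs-* i (i ^ n)) (cong (∣ i ∣ ℕ.*_) (abs-^ i n))

  -- The degree is at most `n - 1`; the factor `t` on the left avoids that exponent, which makes no
  -- sense for `n = 0`.
  ev-growth : ∀ n a t → 1 ℕ.≤ t → ∣ ev n a t ∣ ℕ.* t ℕ.≤ norm n a ℕ.* t ℕ.^ n
  ev-growth zero    a t 1≤t = z≤n
  ev-growth (suc n) a t 1≤t = begin
    ∣ ev n a t + a n * (+ t) ^ n ∣ ℕ.* t
      ≤⟨ ℕₚ.*-monoˡ-≤ t (∣i+j∣≤∣i∣+∣j∣ (ev n a t) (a n * (+ t) ^ n)) ⟩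
    (∣ ev n a t ∣ ℕ.+ ∣ a n * (+ t) ^ n ∣) ℕ.* t
      ≡⟨ cong (λ z → (∣ ev n a t ∣ ℕ.+ z) ℕ.* t) (trans (abs-* (a n) _) (cong (∣ a n ∣ ℕ.*_) (abs-^ (+ t) n))) ⟩
    (∣ ev n a t ∣ ℕ.+ ∣ a n ∣ ℕ.* t ℕ.^ n) ℕ.* t
      ≡⟨ l (∣ ev n a t ∣) (∣ a n ∣) t (t ℕ.^ n) ⟩
    ∣ ev n a t ∣ ℕ.* t ℕ.+ ∣ a n ∣ ℕ.* (t ℕ.* t ℕ.^ n)
      ≤⟨ ℕₚ.+-monoˡ-≤ _ (ℕₚ.≤-trans (ev-growth n a t 1≤t) (ℕₚ.*-monoʳ-≤ (norm n a) (ℕₚ.m≤n*m (t ℕ.^ n) t {{ℕ.>-nonZero 1≤t}}))) ⟩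
    norm n a ℕ.* (t ℕ.* t ℕ.^ n) ℕ.+ ∣ a n ∣ ℕ.* (t ℕ.* t ℕ.^ n)
      ≡⟨ sym (ℕₚ.*-distribʳ-+ (t ℕ.* t ℕ.^ n) (norm n a) (∣ a n ∣)) ⟩
    (norm n a ℕ.+ ∣ a n ∣) ℕ.* (t ℕ.* t ℕ.^ n) ∎
    where
    open ℕₚ.≤-Reasoning
    l : ∀ u v t w → (u ℕ.+ v ℕ.* w) ℕ.* t ≡ u ℕ.* t ℕ.+ v ℕ.* (t ℕ.* w)
    l = ℕR.solve-∀

  ev-< : ∀ n a c t → c ℕ.* norm n a ℕ.< t → c ℕ.* ∣ ev n a t ∣ ℕ.< t ℕ.^ n
  ev-< n a c t h = ℕₚ.*-cancelʳ-< _ _ (t ℕ.^ n) (begin-strict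
    c ℕ.* ∣ ev n a t ∣ ℕ.* t   ≡⟨ ℕₚ.*-assoc c _ t ⟩
    c ℕ.* (∣ ev n a t ∣ ℕ.* t) ≤⟨ ℕₚ.*-monoʳ-≤ c (ev-growth n a t 1≤t) ⟩
    c ℕ.* (norm n a ℕ.* t ℕ.^ n) ≡⟨ sym (ℕₚ.*-assoc c _ _) ⟩
    c ℕ.* norm n a ℕ.* t ℕ.^ n <⟨ ℕₚ.*-monoˡ-< (t ℕ.^ n) {{ℕₚ.m^n≢0 t n {{ℕ.>-nonZero 1≤t}}}} h ⟩
    t ℕ.* t ℕ.^ n ≡⟨ ℕₚ.*-comm t _ ⟩
    t ℕ.^ n ℕ.* t ∎)
    where
    open ℕₚ.≤-Reasoning
    1≤t : 1 ℕ.≤ t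
    1≤t = ℕₚ.≤-trans (s≤s z≤n) h

  Eventually : (ℕ → Set) → Set
  Eventually Q = ∃ λ t₀ → ∀ t → t₀ ℕ.≤ t → Q t

  -- At an argument larger than the sum of the lower coefficients, the lower terms together stay
  -- below `t ^ n`, so they cannot cancel a nonzero top term.
  ev-top : ∀ n a → Eventually (λ t → ev (suc n) a t ≡ 0ℤ) → a n ≡ 0ℤ
  ev-top n a (t₀ , z) = go (∣ a n ∣) refl
    where
    open ℕₚ.≤-Reasoning
    t = suc (1 ℕ.* norm n a ℕ.+ t₀)
    l : ∀ u v → v ≡ - u + (u + v)
    l = solve-∀
    e : a n * (+ t) ^ n ≡ - ev n a t
    e = trans (l (ev n a t) _) (trans (cong (_+_ (- ev n a t)) (z t (ℕₚ.≤-trans (ℕₚ.m≤n+m t₀ _) (ℕₚ.n≤1+n _)))) (+-identityʳ _))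
    go : ∀ m → ∣ a n ∣ ≡ m → a n ≡ 0ℤ
    go zero    eq = ∣i∣≡0⇒i≡0 eq
    go (suc m) eq = ⊥-elim (ℕₚ.<⇒≱ (ev-< n a 1 t (s≤s (ℕₚ.≤-trans (ℕₚ.m≤m+n _ t₀) ℕₚ.≤-refl)))
      (begin
        t ℕ.^ n ≤⟨ ℕₚ.m≤n*m (t ℕ.^ n) (suc m) ⟩
        suc m ℕ.* t ℕ.^ n ≡⟨ cong₂ ℕ._*_ (sym eq) (sym (abs-^ (+ t) n)) ⟩
        ∣ a n ∣ ℕ.* ∣ (+ t) ^ n ∣ ≡⟨ sym (abs-* (a n) _) ⟩
        ∣ a n * (+ t) ^ n ∣ ≡⟨ cong ∣_∣ e ⟩
        ∣ - ev n a t ∣ ≡⟨ ∣-i∣≡∣i∣ (ev n a t) ⟩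
        ∣ ev n a t ∣ ≡⟨ sym (ℕₚ.*-identityˡ _) ⟩
        1 ℕ.* ∣ ev n a t ∣ ∎))

  ev-zero : ∀ n a → Eventually (λ t → ev n a t ≡ 0ℤ) → ∀ i → i ℕ.< n → a i ≡ 0ℤ
  ev-zero (suc n) a (t₀ , z) i i<1+n with ev-top n a (t₀ , z) | ℕₚ.m<1+n⇒m<n∨m≡n i<1+n
  ... | top | inj₂ refl = top
  ... | top | inj₁ i<n  = ev-zero n a (t₀ , λ t t₀≤t →
    trans (sym (trans (cong (λ u → ev n a t + u * (+ t) ^ n) top) (+-identityʳ _))) (z t t₀≤t)) i i<n

open Polynomials

-- The polynomials `F n`, division by them, and uniqueness of remainders.

module FermatPolynomials where
  open import Data.Integer using (_+_; _*_; _-_; -_; _^_)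
  open import Data.Integer.Properties
  open import Data.Integer.Divisibility.Signed

  X Y q Q : Fn
  Y t = + t
  X t = + t + 1ℤ
  q t = Y t * Y t + Y t + 1ℤ
  Q t = X t * Y t * q t

  abstract
    F : ℕ → Fn
    F n t = X t ^ n - Y t ^ n - 1ℤ

    F-def : ∀ n t → F n t ≡ X t ^ n - Y t ^ n - 1ℤ
    F-def n t = refl

  bin : ℕ → ℕ → ℕ
  bin n       zero    = 1
  bin zero    (suc k) = 0
  bin (suc n) (suc k) = bin n k ℕ.+ bin n (suc k)

  bin-> : ∀ n k → n ℕ.< k → bin n k ≡ 0
  bin-> zero    (suc k) _         = refl
  bin-> (suc n) (suc k) (s≤s n<k) rewrite bin-> n k n<k | bin-> n (suc k) (ℕₚ.m<n⇒m<1+n n<k) = refl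

  bin-self : ∀ n → bin n n ≡ 1
  bin-self zero    = refl
  bin-self (suc n) rewrite bin-self n | bin-> n (suc n) (ℕₚ.n<1+n n) = refl

  bin-pred : ∀ n → bin (suc n) n ≡ suc n
  bin-pred zero    = refl
  bin-pred (suc n) rewrite bin-pred n | bin-self n | bin-> n (suc n) (ℕₚ.n<1+n n) = ℕₚ.+-comm (suc n) 1

  bin-shift : ∀ n i → + bin (suc n) i ≡ shift (λ j → + bin n j) i + + bin n i
  bin-shift n zero    = refl
  bin-shift n (suc i) = refl

  binomial : ∀ n t → X t ^ n ≡ ev (suc n) (λ i → + bin n i) t
  binomial zero    t = refl
  binomial (suc n) t = begin
    X t * X t ^ n ≡⟨ cong (X t *_) (binomial n t) ⟩
    (+ t + 1ℤ) * ev (suc n) b t ≡⟨ l (+ t) (ev (suc n) b t) ((+ t) ^ suc n) ⟩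
    + t * ev (suc n) b t + (ev (suc n) b t + 0ℤ * (+ t) ^ suc n)
      ≡⟨ cong₂ (λ u v → u + (ev (suc n) b t + v * (+ t) ^ suc n)) (sym (ev-shift (suc n) b t)) (cong +_ (sym (bin-> n (suc n) (ℕₚ.n<1+n n)))) ⟩
    ev (suc (suc n)) (shift b) t + ev (suc (suc n)) b t ≡⟨ sym (ev-+ (suc (suc n)) (shift b) b t) ⟩
    ev (suc (suc n)) (λ i → shift b i + b i) t ≡⟨ ev-cong (suc (suc n)) (λ i _ → sym (bin-shift n i)) t ⟩
    ev (suc (suc n)) (λ i → + bin (suc n) i) t ∎
    where
    open ≡-Reasoning
    b : Fn
    b i = + bin n i
    l : ∀ t e w → (t + 1ℤ) * e ≡ t * e + (e + 0ℤ * w)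
    l = solve-∀

  norm-bin : ∀ n → norm (suc n) (λ i → + bin n i) ℕ.≤ 2 ℕ.^ n
  norm-bin zero    = ℕₚ.≤-refl
  norm-bin (suc n) = begin
    norm (suc (suc n)) (λ i → + bin (suc n) i) ≡⟨ norm-cong (suc (suc n)) (λ i _ → bin-shift n i) ⟩
    norm (suc (suc n)) (λ i → shift b i + b i) ≤⟨ norm-+ (suc (suc n)) (shift b) b ⟩
    norm (suc (suc n)) (shift b) ℕ.+ norm (suc (suc n)) b
      ≡⟨ cong₂ ℕ._+_ (norm-shift (suc n) b) (trans (cong (norm (suc n) b ℕ.+_) (bin-> n (suc n) (ℕₚ.n<1+n n))) (ℕₚ.+-identityʳ _)) ⟩
    norm (suc n) b ℕ.+ norm (suc n) b ≤⟨ ℕₚ.+-mono-≤ (norm-bin n) (norm-bin n) ⟩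
    2 ℕ.^ n ℕ.+ 2 ℕ.^ n ≡⟨ cong (2 ℕ.^ n ℕ.+_) (sym (ℕₚ.+-identityʳ _)) ⟩
    2 ℕ.^ suc n ∎
    where
    open ℕₚ.≤-Reasoning
    b : Fn
    b i = + bin n i

  -- In `F n` only the indices below `n` occur, since the two leading terms cancel; the entry at 0
  -- has absorbed the `- 1`.
  fc : ℕ → ℕ → ℕ
  fc n zero    = 0
  fc n (suc i) = bin n (suc i)

  δ₀ : Fn
  δ₀ zero    = 1ℤ
  δ₀ (suc i) = 0ℤ

  ev-δ₀ : ∀ n t → ev (suc n) δ₀ t ≡ 1ℤ
  ev-δ₀ zero    t = refl
  ev-δ₀ (suc n) t = trans (+-identityʳ (ev (suc n) δ₀ t)) (ev-δ₀ n t)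

  F-ev : ∀ n t → F (suc n) t ≡ ev (suc n) (λ i → + fc (suc n) i) t
  F-ev n t = begin
    F (suc n) t ≡⟨ F-def (suc n) t ⟩
    X t ^ suc n - Y t ^ suc n - 1ℤ ≡⟨ cong (λ z → z - Y t ^ suc n - 1ℤ) (binomial (suc n) t) ⟩
    ev (suc n) b t + b (suc n) * (+ t) ^ suc n - (+ t) ^ suc n - 1ℤ
      ≡⟨ cong₂ (λ u v → u + + v * (+ t) ^ suc n - (+ t) ^ suc n - 1ℤ) (ev-cong (suc n) (λ i _ → split i) t) (bin-self (suc n)) ⟩
    ev (suc n) (λ i → + fc (suc n) i + δ₀ i) t + 1ℤ * (+ t) ^ suc n - (+ t) ^ suc n - 1ℤ
      ≡⟨ cong (λ z → z + 1ℤ * (+ t) ^ suc n - (+ t) ^ suc n - 1ℤ) (trans (ev-+ (suc n) g δ₀ t) (cong (_+_ (ev (suc n) g t)) (ev-δ₀ n t))) ⟩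
    ev (suc n) (λ i → + fc (suc n) i) t + 1ℤ + 1ℤ * (+ t) ^ suc n - (+ t) ^ suc n - 1ℤ ≡⟨ l (ev (suc n) g t) ((+ t) ^ suc n) ⟩
    ev (suc n) (λ i → + fc (suc n) i) t ∎
    where
    open ≡-Reasoning
    b : Fn
    b i = + bin (suc n) i
    g : Fn
    g i = + fc (suc n) i
    split : ∀ i → b i ≡ + fc (suc n) i + δ₀ i
    split zero    = refl
    split (suc i) = sym (+-identityʳ _)
    l : ∀ u v → u + 1ℤ + 1ℤ * v - v - 1ℤ ≡ u
    l = solve-∀

  norm-fc : ∀ n m → m ℕ.≤ suc n → norm m (λ i → + fc n i) ℕ.≤ 2 ℕ.^ n
  norm-fc n m m≤ = ℕₚ.≤-trans (le m) (ℕₚ.≤-trans (mono m (suc n) m≤) (norm-bin n))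
    where
    c≤ : ∀ i → fc n i ℕ.≤ bin n i
    c≤ zero    = z≤n
    c≤ (suc i) = ℕₚ.≤-refl
    le : ∀ m → norm m (λ i → + fc n i) ℕ.≤ norm m (λ i → + bin n i)
    le zero    = z≤n
    le (suc m) = ℕₚ.+-mono-≤ (le m) (c≤ m)
    mono : ∀ m k → m ℕ.≤ k → norm m (λ i → + bin n i) ℕ.≤ norm k (λ i → + bin n i)
    mono m k m≤k = subst (λ z → norm m _ ℕ.≤ norm z _) (ℕₚ.m∸n+n≡m m≤k) (up (k ℕ.∸ m))
      where
      up : ∀ j → norm m (λ i → + bin n i) ℕ.≤ norm (j ℕ.+ m) (λ i → + bin n i)
      up zero    = ℕₚ.≤-refl
      up (suc j) = ℕₚ.≤-trans (up j) (ℕₚ.m≤m+n _ _)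

  evℕ : ℕ → (ℕ → ℕ) → ℕ → ℕ
  evℕ zero    a t = 0
  evℕ (suc n) a t = evℕ n a t ℕ.+ a n ℕ.* t ℕ.^ n

  pos-^ : ∀ m n → + (m ℕ.^ n) ≡ (+ m) ^ n
  pos-^ m zero    = refl
  pos-^ m (suc n) = trans (pos-* m (m ℕ.^ n)) (cong (+ m *_) (pos-^ m n))

  ev-pos : ∀ n a t → ev n (λ i → + a i) t ≡ + evℕ n a t
  ev-pos zero    a t = refl
  ev-pos (suc n) a t = begin
    ev n _ t + + a n * (+ t) ^ n ≡⟨ cong₂ (λ u v → u + + a n * v) (ev-pos n a t) (sym (pos-^ t n)) ⟩
    + evℕ n a t + + a n * + (t ℕ.^ n) ≡⟨ cong (_+_ (+ evℕ n a t)) (sym (pos-* (a n) (t ℕ.^ n))) ⟩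
    + evℕ n a t + + (a n ℕ.* t ℕ.^ n) ≡⟨ sym (pos-+ (evℕ n a t) _) ⟩
    + (evℕ n a t ℕ.+ a n ℕ.* t ℕ.^ n) ∎
    where open ≡-Reasoning

  -- F n has degree n - 1, so it is taken at n = 2 + m when its degree has to be positive.
  F-lead : ∀ m t → F (suc (suc m)) t ≡ ev (suc m) (λ i → + fc (suc (suc m)) i) t + + suc (suc m) * (+ t) ^ suc m
  F-lead m t = trans (F-ev (suc m) t)
    (cong (λ z → ev (suc m) (λ i → + fc (suc (suc m)) i) t + + z * (+ t) ^ suc m) (bin-pred (suc m)))

  -- All coefficients are nonnegative and the leading one is `n`.
  F-large : ∀ m t → t ℕ.^ suc m ℕ.≤ ∣ F (suc (suc m)) t ∣
  F-large m t = begin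
    t ℕ.^ suc m ≤⟨ ℕₚ.m≤n*m (t ℕ.^ suc m) n ⟩
    n ℕ.* t ℕ.^ suc m ≤⟨ ℕₚ.m≤n+m (n ℕ.* t ℕ.^ suc m) (evℕ (suc m) (fc n) t) ⟩
    evℕ (suc m) (fc n) t ℕ.+ n ℕ.* t ℕ.^ suc m
      ≡⟨ cong ∣_∣ (sym (trans (F-lead m t) (cong₂ _+_ (ev-pos (suc m) (fc n) t) (trans (cong (+ n *_) (sym (pos-^ t (suc m)))) (sym (pos-* n (t ℕ.^ suc m))))))) ⟩
    ∣ F n t ∣ ∎
    where
    open ℕₚ.≤-Reasoning
    n = suc (suc m)

  -- One step of pseudo-division. The leading coefficient of `F n` is `n`, so clearing the top term
  -- costs a factor `n`, and the coefficient sum grows by a factor of at most `n + 2 ^ n`.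
  pseudo-rem₁ : ∀ m k {b A} → let n = suc (suc m) in P (suc k ℕ.+ suc m) b A →
    ∃ λ (R : Fn) → P (k ℕ.+ suc m) ((n ℕ.+ 2 ℕ.^ n) ℕ.* b) R × ∃ λ (K : Fn) → ∀ t → + n * A t ≡ K t * F n t + R t
  pseudo-rem₁ m k {b} {A} (poly a ea na) = R , PR , K , eq
    where
    n = suc (suc m)
    d = suc m
    top : ℤ
    top = a (k ℕ.+ d)
    f : Fn
    f t = ev d (λ i → + fc n i) t
    pf : P d (2 ℕ.^ n) f
    pf = poly _ (λ _ → refl) (norm-fc n d (s≤s (ℕₚ.≤-trans (ℕₚ.n≤1+n m) (ℕₚ.n≤1+n _))))
    K R : Fn
    K t = top * (+ t) ^ k
    R t = + n * ev (k ℕ.+ d) a t + - top * ((+ t) ^ k * f t)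
    PR : P (k ℕ.+ d) ((n ℕ.+ 2 ℕ.^ n) ℕ.* b) R
    PR = P-cast le (λ _ → refl) (P-+ (P-scale (+ n) (poly a (λ _ → refl) ℕₚ.≤-refl)) (P-scale (- top) (P-t^ k pf)))
      where
      open ℕₚ.≤-Reasoning
      le : n ℕ.* norm (k ℕ.+ d) a ℕ.+ ∣ - top ∣ ℕ.* 2 ℕ.^ n ℕ.≤ (n ℕ.+ 2 ℕ.^ n) ℕ.* b
      le = begin
        n ℕ.* norm (k ℕ.+ d) a ℕ.+ ∣ - top ∣ ℕ.* 2 ℕ.^ n
          ≤⟨ ℕₚ.+-mono-≤ (ℕₚ.*-monoʳ-≤ n {norm (k ℕ.+ d) a} {b} (ℕₚ.≤-trans (ℕₚ.m≤m+n (norm (k ℕ.+ d) a) (∣ top ∣)) na))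
               (ℕₚ.*-monoˡ-≤ (2 ℕ.^ n) (subst (ℕ._≤ b) (sym (∣-i∣≡∣i∣ top)) (ℕₚ.≤-trans (ℕₚ.m≤n+m (∣ top ∣) (norm (k ℕ.+ d) a)) na))) ⟩
        n ℕ.* b ℕ.+ b ℕ.* 2 ℕ.^ n ≡⟨ cong (n ℕ.* b ℕ.+_) (ℕₚ.*-comm b _) ⟩
        n ℕ.* b ℕ.+ 2 ℕ.^ n ℕ.* b ≡⟨ sym (ℕₚ.*-distribʳ-+ b n _) ⟩
        (n ℕ.+ 2 ℕ.^ n) ℕ.* b ∎
    l : ∀ n e c u v f → n * (e + c * (u * v)) ≡ c * u * (f + n * v) + (n * e + - c * (u * f))
    l = solve-∀
    eq : ∀ t → + n * A t ≡ K t * F n t + R t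
    eq t = trans (cong (+ n *_) (trans (ea t) (cong (λ z → ev (k ℕ.+ d) a t + top * z) (^-distribˡ-+-* (+ t) k d))))
      (trans (l (+ n) (ev (k ℕ.+ d) a t) top ((+ t) ^ k) ((+ t) ^ d) (f t))
        (cong (λ z → K t * z + R t) (sym (F-lead m t))))

  pseudo-rem : ∀ m k {b A} → let n = suc (suc m) in P (k ℕ.+ suc m) b A →
    ∃ λ (R : Fn) → P (suc m) ((n ℕ.+ 2 ℕ.^ n) ℕ.^ k ℕ.* b) R × ∃ λ (K : Fn) → ∀ t → (+ n) ^ k * A t ≡ K t * F n t + R t
  pseudo-rem m zero {b} {A} p = A , P-cast (ℕₚ.≤-reflexive (sym (ℕₚ.*-identityˡ b))) (λ _ → refl) p ,
    (λ _ → 0ℤ) , λ t → trans (*-identityˡ (A t)) (sym (trans (cong (_+ A t) (*-zeroˡ (F (suc (suc m)) t))) (+-identityˡ (A t))))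
  pseudo-rem m (suc k) {b} {A} p = R , P-cast (ℕₚ.≤-reflexive (l₁ (n ℕ.+ 2 ℕ.^ n) ((n ℕ.+ 2 ℕ.^ n) ℕ.^ k) b)) (λ _ → refl) pR ,
    (λ t → (+ n) ^ k * K₁ t + K t) , λ t → begin
      + n * (+ n) ^ k * A t ≡⟨ l₂ (+ n) ((+ n) ^ k) (A t) ⟩
      (+ n) ^ k * (+ n * A t) ≡⟨ cong ((+ n) ^ k *_) (e₁ t) ⟩
      (+ n) ^ k * (K₁ t * F n t + R₁ t) ≡⟨ l₃ ((+ n) ^ k) (K₁ t) (F n t) (R₁ t) ⟩
      (+ n) ^ k * K₁ t * F n t + (+ n) ^ k * R₁ t ≡⟨ cong (_+_ ((+ n) ^ k * K₁ t * F n t)) (e t) ⟩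
      (+ n) ^ k * K₁ t * F n t + (K t * F n t + R t) ≡⟨ l₄ ((+ n) ^ k * K₁ t) (F n t) (K t) (R t) ⟩
      ((+ n) ^ k * K₁ t + K t) * F n t + R t ∎
    where
    open ≡-Reasoning
    n = suc (suc m)
    step = pseudo-rem₁ m k p
    R₁ = proj₁ step
    K₁ = proj₁ (proj₂ (proj₂ step))
    e₁ = proj₂ (proj₂ (proj₂ step))
    rest = pseudo-rem m k (proj₁ (proj₂ step))
    R = proj₁ rest
    pR = proj₁ (proj₂ rest)
    K = proj₁ (proj₂ (proj₂ rest))
    e = proj₂ (proj₂ (proj₂ rest))
    l₁ : ∀ u v b → v ℕ.* (u ℕ.* b) ≡ u ℕ.* v ℕ.* b
    l₁ = ℕR.solve-∀
    l₂ : ∀ u v b → u * v * b ≡ v * (u * b)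
    l₂ = solve-∀
    l₃ : ∀ u k f r → u * (k * f + r) ≡ u * k * f + u * r
    l₃ = solve-∀
    l₄ : ∀ u f k r → u * f + (k * f + r) ≡ (u + k) * f + r
    l₄ = solve-∀

  ∣-small : ∀ {u v} → u ∣ v → ∣ v ∣ ℕ.< ∣ u ∣ → v ≡ 0ℤ
  ∣-small {u} {v} (divides k e) lt = go (∣ k ∣) refl
    where
    eq : ∣ v ∣ ≡ ∣ k ∣ ℕ.* ∣ u ∣
    eq = trans (cong ∣_∣ e) (abs-* k u)
    go : ∀ j → ∣ k ∣ ≡ j → v ≡ 0ℤ
    go zero    k0 = ∣i∣≡0⇒i≡0 (trans eq (cong (ℕ._* ∣ u ∣) k0))
    go (suc j) kj = ⊥-elim (ℕₚ.<⇒≱ lt (subst (∣ u ∣ ℕ.≤_) (sym (trans eq (cong (ℕ._* ∣ u ∣) kj))) (ℕₚ.m≤m+n _ _)))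

  -- Divisibility is only known for values at large integers. This suffices: a polynomial of lower
  -- degree is eventually smaller than `t ^ suc m`, hence smaller than `F n t`, and a multiple that
  -- is smaller is 0.
  rem-unique : ∀ m c {a : Fn} → 0 ℕ.< c → let n = suc (suc m) in
    Eventually (λ t → F n t ∣ + c * ev (suc m) a t) → ∀ i → i ℕ.< suc m → a i ≡ 0ℤ
  rem-unique m c {a} 0<c (t₀ , h) = ev-zero (suc m) a (t₁ , zer)
    where
    n = suc (suc m)
    t₁ = suc (c ℕ.* norm (suc m) a) ℕ.+ t₀
    lt : ∀ t → t₁ ℕ.≤ t → ∣ + c * ev (suc m) a t ∣ ℕ.< ∣ F n t ∣
    lt t t₁≤t = subst (ℕ._< ∣ F n t ∣) (sym (abs-* (+ c) (ev (suc m) a t)))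
      (ℕₚ.<-≤-trans (ev-< (suc m) a c t (ℕₚ.≤-trans (ℕₚ.m≤m+n _ t₀) t₁≤t)) (F-large m t))
    pick : ∀ {z} → + c ≡ 0ℤ ⊎ z ≡ 0ℤ → z ≡ 0ℤ
    pick (inj₂ z) = z
    pick (inj₁ z) = ⊥-elim (ℕₚ.<⇒≢ 0<c (sym (cong ∣_∣ z)))
    zer : ∀ t → t₁ ℕ.≤ t → ev (suc m) a t ≡ 0ℤ
    zer t t₁≤t = pick (i*j≡0⇒i≡0∨j≡0 (+ c) (∣-small {F n t} (h t (ℕₚ.≤-trans (ℕₚ.m≤n+m t₀ _) t₁≤t)) (lt t t₁≤t)))

open FermatPolynomials

-- Orders of vanishing of `F n` at the zeros of `Q`.

module Multiplicities where
  open import Data.Integer using (_+_; _*_; _-_; -_; _^_)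
  open import Data.Integer.Properties
  open import Data.Integer.Divisibility.Signed

  -- The first hypothesis puts `n` into the ideal generated by `K` and `g`: the two are coprime up
  -- to the constant `n`.
  coprime-cancel : ∀ {K} K' n g S Z → K * K' ≡ n + g * S → K ∣ g * Z → K ∣ n * Z
  coprime-cancel {K} K' n g S Z e (divides k eq) = divides (K' * Z - S * k)
    (trans (l₁ n g S Z) (trans (cong₂ (λ u v → u * Z - S * v) (sym e) eq) (l₂ K K' Z S k)))
    where
    l₁ : ∀ n g S Z → n * Z ≡ (n + g * S) * Z - S * (g * Z)
    l₁ = solve-∀
    l₂ : ∀ K K' Z S k → K * K' * Z - S * (k * K) ≡ (K' * Z - S * k) * K
    l₂ = solve-∀

  -- Up to the constant `n`, the factor `g` occurs in `f` exactly once, so of two factors `g` in a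
  -- multiple of `f` one can be traded for `n`.
  strip : ∀ {f} K g n S Z .{{_ : NonZero g}} → f ≡ g * K → K ≡ n + g * S → f ∣ g * (g * Z) → f ∣ n * (g * Z)
  strip K g n S Z refl e h = subst ((g * K) ∣_) (l g n Z)
    (*-monoʳ-∣ g (coprime-cancel 1ℤ n g S Z (trans (*-identityʳ K) e) (*-cancelˡ-∣ g h)))
    where
    l : ∀ g n Z → g * (n * Z) ≡ n * (g * Z)
    l = solve-∀

  bernoulli : ∀ u n → ∃ λ (R : ℤ) → (1ℤ + u) ^ n ≡ 1ℤ + + n * u + u * u * R
  bernoulli u zero    = 0ℤ , l u
    where
    l : ∀ u → 1ℤ ≡ 1ℤ + 0ℤ * u + u * u * 0ℤ
    l = solve-∀
  bernoulli u (suc n) with bernoulli u n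
  ... | R , e = R + + n + u * R , trans (cong ((1ℤ + u) *_) e) (trans (l u (+ n) R)
      (cong (λ z → 1ℤ + z * u + u * u * (R + + n + u * R)) (sym (pos-+ 1 n))))
    where
    l : ∀ u n R → (1ℤ + u) * (1ℤ + n * u + u * u * R) ≡ 1ℤ + (1ℤ + n) * u + u * u * (R + n + u * R)
    l = solve-∀

  neg^-even : ∀ u k → (- u) ^ (k ℕ.+ k) ≡ u ^ (k ℕ.+ k)
  neg^-even u k = trans (^-distribˡ-+-* (- u) k k) (trans (sq k) (sym (^-distribˡ-+-* u k k)))
    where
    l : ∀ u a b → (- u) * a * ((- u) * b) ≡ u * u * (a * b)
    l = solve-∀
    l' : ∀ u a b → u * u * (a * b) ≡ u * a * (u * b)
    l' = solve-∀
    sq : ∀ k → (- u) ^ k * (- u) ^ k ≡ u ^ k * u ^ k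
    sq zero    = refl
    sq (suc k) = trans (l u ((- u) ^ k) ((- u) ^ k)) (trans (cong (u * u *_) (sq k)) (l' u (u ^ k) (u ^ k)))

  neg^-odd : ∀ u k → (- u) ^ suc (k ℕ.+ k) ≡ - (u ^ suc (k ℕ.+ k))
  neg^-odd u k = trans (cong (- u *_) (neg^-even u k)) (sym (neg-distribˡ-* u (u ^ (k ℕ.+ k))))

  Even Odd : ℕ → Set
  Even n = ∃ λ k → n ≡ k ℕ.+ k
  Odd n = ∃ λ k → n ≡ suc (k ℕ.+ k)

  parity : ∀ n → Even n ⊎ Odd n
  parity zero    = inj₁ (0 , refl)
  parity (suc n) with parity n
  ... | inj₁ (k , e) = inj₂ (k , cong suc e)
  ... | inj₂ (k , e) = inj₁ (suc k , trans (cong suc e) (cong suc (sym (ℕₚ.+-suc k k))))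

  -- A simple zero at `Y = 0` with derivative `n`. At `X = 0` the next two lemmas find a simple zero
  -- with derivative `- n` for odd `n`, but the value - 2 for even `n`.
  F-Y : ∀ m t → let n = suc (suc m) in ∃ λ (S : ℤ) → F n t ≡ Y t * (+ n + Y t * S)
  F-Y m t = R - Y t ^ m ,
    trans (trans (F-def n t) (cong (λ z → z ^ n - Y t ^ n - 1ℤ) (+-comm (+ t) 1ℤ)))
      (trans (cong (λ z → z - Y t ^ n - 1ℤ) e) (l (Y t) (+ n) R (Y t ^ m)))
    where
    n = suc (suc m)
    R = proj₁ (bernoulli (Y t) n)
    e = proj₂ (bernoulli (Y t) n)
    l : ∀ y n R w → 1ℤ + n * y + y * y * R - y * (y * w) - 1ℤ ≡ y * (n + y * (R - w))
    l = solve-∀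

  F-X-odd : ∀ m t → let n = suc (suc m) in Odd n → ∃ λ (S : ℤ) → F n t ≡ - X t * (+ n + X t * S)
  F-X-odd m t (k , n≡) = - (R + X t ^ m) ,
    trans (trans (F-def n t) (cong (λ z → X t ^ n + z - 1ℤ) (trans (trans (cong (λ z → - (Y t ^ z)) n≡) (trans (sym (neg^-odd (Y t) k)) (cong ((- Y t) ^_) (sym n≡))))
        (trans (cong (_^ n) (y-x (Y t))) e))))
      (l (X t) (+ n) R (X t ^ m))
    where
    n = suc (suc m)
    R = proj₁ (bernoulli (- X t) n)
    e = proj₂ (bernoulli (- X t) n)
    y-x : ∀ y → - y ≡ 1ℤ + - (y + 1ℤ)
    y-x = solve-∀
    l : ∀ x n R w → x * (x * w) + (1ℤ + n * (- x) + (- x) * (- x) * R) - 1ℤ ≡ - x * (n + x * (- (R + w)))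
    l = solve-∀

  F-X-even : ∀ m t → let n = suc (suc m) in Even n → ∃ λ (S : ℤ) → F n t * - 1ℤ ≡ + 2 + X t * S
  F-X-even m t (k , n≡) = X t * R - + n - X t * X t ^ m ,
    trans (trans (cong (_* - 1ℤ) (F-def n t)) (cong (λ z → (X t ^ n - z - 1ℤ) * - 1ℤ) (trans (trans (cong (Y t ^_) n≡) (trans (sym (neg^-even (Y t) k)) (cong ((- Y t) ^_) (sym n≡))))
        (trans (cong (_^ n) (y-x (Y t))) e))))
      (l (X t) (+ n) R (X t ^ m))
    where
    n = suc (suc m)
    R = proj₁ (bernoulli (- X t) n)
    e = proj₂ (bernoulli (- X t) n)
    y-x : ∀ y → - y ≡ 1ℤ + - (y + 1ℤ)
    y-x = solve-∀
    l : ∀ x n R w → (x * (x * w) - (1ℤ + n * (- x) + (- x) * (- x) * R) - 1ℤ) * - 1ℤ ≡ + 2 + x * (x * R - n - x * w)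
    l = solve-∀

  -- Modulo q both X and - Y are primitive sixth roots of unity; this is the third order expansion of their 6k-th powers.
  sixth : ∀ a q k → a ^ 3 ≡ q * (a + 1ℤ) - 1ℤ →
    ∃ λ (S : ℤ) → a ^ (k ℕ.* 6) ≡ 1ℤ - + 2 * + k * q * (a + 1ℤ) + (+ 2 * + k * + k - + k) * (q * q) * ((a + 1ℤ) * (a + 1ℤ)) + q * q * q * S
  sixth a q zero    e = 0ℤ , l a q
    where
    l : ∀ a q → 1ℤ ≡ 1ℤ - + 2 * 0ℤ * q * (a + 1ℤ) + (+ 2 * 0ℤ * 0ℤ - 0ℤ) * (q * q) * ((a + 1ℤ) * (a + 1ℤ)) + q * q * q * 0ℤ
    l = solve-∀
  sixth a q (suc k) e with sixth a q k e
  ... | S , ih = S' , trans (^-distribˡ-+-* a 6 (k ℕ.* 6)) (trans (cong₂ _*_ a⁶ ih)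
      (trans (l q (a + 1ℤ) (+ k) S) (cong (λ κ → 1ℤ - + 2 * κ * q * (a + 1ℤ) + (+ 2 * κ * κ - κ) * (q * q) * ((a + 1ℤ) * (a + 1ℤ)) + q * q * q * S') (sym (pos-+ 1 k)))))
    where
    S' : ℤ
    S' = S * (1ℤ - + 2 * q * (a + 1ℤ) + q * q * ((a + 1ℤ) * (a + 1ℤ))) - + 2 * (a + 1ℤ) * (+ 2 * + k * + k - + k) * ((a + 1ℤ) * (a + 1ℤ))
       - + 2 * + k * (a + 1ℤ) * ((a + 1ℤ) * (a + 1ℤ)) + q * (+ 2 * + k * + k - + k) * ((a + 1ℤ) * (a + 1ℤ)) * ((a + 1ℤ) * (a + 1ℤ))
    a⁶ : a ^ 6 ≡ (q * (a + 1ℤ) - 1ℤ) * (q * (a + 1ℤ) - 1ℤ)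
    a⁶ = trans (^-distribˡ-+-* a 3 3) (cong₂ _*_ e e)
    l : ∀ q v k S → (q * v - 1ℤ) * (q * v - 1ℤ) * (1ℤ - + 2 * k * q * v + (+ 2 * k * k - k) * (q * q) * (v * v) + q * q * q * S)
      ≡ 1ℤ - + 2 * (1ℤ + k) * q * v + (+ 2 * (1ℤ + k) * (1ℤ + k) - (1ℤ + k)) * (q * q) * (v * v)
        + q * q * q * (S * (1ℤ - + 2 * q * v + q * q * (v * v)) - + 2 * v * (+ 2 * k * k - k) * (v * v)
          - + 2 * k * v * (v * v) + q * (+ 2 * k * k - k) * (v * v) * (v * v))
    l = solve-∀

  module Sextic (t k : ℕ) where
    y x g : ℤ
    y = Y t
    x = X t
    g = q t
    x³ : ∀ y → (y + 1ℤ) * ((y + 1ℤ) * ((y + 1ℤ) * 1ℤ)) ≡ (y * y + y + 1ℤ) * (y + 1ℤ + 1ℤ) - 1ℤ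
    x³ = solve-∀
    y³ : ∀ y → (- y) * ((- y) * ((- y) * 1ℤ)) ≡ (y * y + y + 1ℤ) * (- y + 1ℤ) - 1ℤ
    y³ = solve-∀
    S₁ S₂ c κ : ℤ
    S₁ = proj₁ (sixth x g k (x³ y))
    S₂ = proj₁ (sixth (- y) g k (y³ y))
    κ = + k
    c = + 2 * κ * κ - κ
    x⁶ : x ^ (k ℕ.* 6) ≡ 1ℤ - + 2 * κ * g * (x + 1ℤ) + c * (g * g) * ((x + 1ℤ) * (x + 1ℤ)) + g * g * g * S₁
    x⁶ = proj₂ (sixth x g k (x³ y))
    y⁶ : y ^ (k ℕ.* 6) ≡ 1ℤ - + 2 * κ * g * (- y + 1ℤ) + c * (g * g) * ((- y + 1ℤ) * (- y + 1ℤ)) + g * g * g * S₂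
    y⁶ = trans (trans (cong (y ^_) e6) (trans (sym (neg^-even y (k ℕ.* 3))) (cong ((- y) ^_) (sym e6)))) (proj₂ (sixth (- y) g k (y³ y)))
      where
      e6 : k ℕ.* 6 ≡ k ℕ.* 3 ℕ.+ k ℕ.* 3
      e6 = l k
        where
        l : ∀ k → k ℕ.* 6 ≡ k ℕ.* 3 ℕ.+ k ℕ.* 3
        l = ℕR.solve-∀
    F-split : ∀ j → F (j ℕ.+ k ℕ.* 6) t ≡
       x ^ j * (1ℤ - + 2 * κ * g * (x + 1ℤ) + c * (g * g) * ((x + 1ℤ) * (x + 1ℤ)) + g * g * g * S₁)
       - y ^ j * (1ℤ - + 2 * κ * g * (- y + 1ℤ) + c * (g * g) * ((- y + 1ℤ) * (- y + 1ℤ)) + g * g * g * S₂) - 1ℤ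
    F-split j = trans (F-def (j ℕ.+ k ℕ.* 6) t) (cong₂ (λ u v → u - v - 1ℤ) (trans (^-distribˡ-+-* x j (k ℕ.* 6)) (cong (x ^ j *_) x⁶))
      (trans (^-distribˡ-+-* y j (k ℕ.* 6)) (cong (y ^ j *_) y⁶)))

    A₁ B₁ A₂ B₂ : ℤ
    A₂ = c * ((x + 1ℤ) * (x + 1ℤ)) + g * S₁
    B₂ = c * ((- y + 1ℤ) * (- y + 1ℤ)) + g * S₂
    A₁ = - (+ 2 * κ * (x + 1ℤ)) + g * A₂
    B₁ = - (+ 2 * κ * (- y + 1ℤ)) + g * B₂
    F₁ : ∀ j → F (j ℕ.+ k ℕ.* 6) t ≡ x ^ j * (1ℤ + g * A₁) - y ^ j * (1ℤ + g * B₁) - 1ℤ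
    F₁ j = trans (F-split j) (cong₂ (λ u v → x ^ j * u - y ^ j * v - 1ℤ) (l κ g (x + 1ℤ) c S₁) (l κ g (- y + 1ℤ) c S₂))
      where
      l : ∀ κ g v c S → 1ℤ - + 2 * κ * g * v + c * (g * g) * (v * v) + g * g * g * S ≡ 1ℤ + g * (- (+ 2 * κ * v) + g * (c * (v * v) + g * S))
      l = solve-∀
    T₀ : ℤ
    T₀ = - (A₁ - B₁)
    case0 : F (0 ℕ.+ k ℕ.* 6) t * - 1ℤ ≡ 1ℤ + g * T₀
    case0 = trans (cong (_* - 1ℤ) (F₁ 0)) (l g A₁ B₁)
      where
      l : ∀ g A B → (1ℤ * (1ℤ + g * A) - 1ℤ * (1ℤ + g * B) - 1ℤ) * - 1ℤ ≡ 1ℤ + g * - (A - B)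
      l = solve-∀
    T₂ : ℤ
    T₂ = (+ 2 * (y - 1ℤ) + y * y * (x * x * A₁ - y * y * B₁))
    case2 : F (2 ℕ.+ k ℕ.* 6) t * (y * y) ≡ + 2 + g * T₂
    case2 = trans (cong (_* (y * y)) (F₁ 2)) (l y A₁ B₁)
      where
      l : ∀ y A B → ((y + 1ℤ) * ((y + 1ℤ) * 1ℤ) * (1ℤ + (y * y + y + 1ℤ) * A) - y * (y * 1ℤ) * (1ℤ + (y * y + y + 1ℤ) * B) - 1ℤ) * (y * y)
        ≡ + 2 + (y * y + y + 1ℤ) * (+ 2 * (y - 1ℤ) + y * y * ((y + 1ℤ) * (y + 1ℤ) * A - y * y * B))
      l = solve-∀
    T₃ : ℤ
    T₃ = (- + 3 - (x * x * x * A₁ - y * y * y * B₁))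
    case3 : F (3 ℕ.+ k ℕ.* 6) t * - 1ℤ ≡ + 3 + g * T₃
    case3 = trans (cong (_* - 1ℤ) (F₁ 3)) (l y A₁ B₁)
      where
      l : ∀ y A B → ((y + 1ℤ) * ((y + 1ℤ) * ((y + 1ℤ) * 1ℤ)) * (1ℤ + (y * y + y + 1ℤ) * A) - y * (y * (y * 1ℤ)) * (1ℤ + (y * y + y + 1ℤ) * B) - 1ℤ) * - 1ℤ
        ≡ + 3 + (y * y + y + 1ℤ) * (- + 3 - ((y + 1ℤ) * (y + 1ℤ) * (y + 1ℤ) * A - y * y * y * B))
      l = solve-∀
    T₄ : ℤ
    T₄ = (+ 2 * (y - 1ℤ) + + 4 * (y * y) + y * (x * x * x * x * A₁ - y * y * y * y * B₁))
    case4 : F (4 ℕ.+ k ℕ.* 6) t * y ≡ + 2 + g * T₄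
    case4 = trans (cong (_* y) (F₁ 4)) (l y A₁ B₁)
      where
      l : ∀ y A B → ((y + 1ℤ) * ((y + 1ℤ) * ((y + 1ℤ) * ((y + 1ℤ) * 1ℤ))) * (1ℤ + (y * y + y + 1ℤ) * A) - y * (y * (y * (y * 1ℤ))) * (1ℤ + (y * y + y + 1ℤ) * B) - 1ℤ) * y
        ≡ + 2 + (y * y + y + 1ℤ) * (+ 2 * (y - 1ℤ) + + 4 * (y * y) + y * ((y + 1ℤ) * (y + 1ℤ) * (y + 1ℤ) * (y + 1ℤ) * A - y * y * y * y * B))
      l = solve-∀
    T₅ : ℤ
    T₅ = + 5 - + 2 * κ * (+ 2 * (y * y * y * y) + + 4 * (y * y * y) + + 14 * (y * y) + + 12 * y - 1ℤ) + (x * x * x * x * x * A₂ - y * y * y * y * y * B₂)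
    case5 : F (5 ℕ.+ k ℕ.* 6) t ≡ - g * (+ 5 + κ * + 6 + g * - T₅)
    case5 = trans (F₁ 5) (l y κ A₂ B₂)
      where
      l : ∀ y κ A B →
        (y + 1ℤ) * ((y + 1ℤ) * ((y + 1ℤ) * ((y + 1ℤ) * ((y + 1ℤ) * 1ℤ)))) * (1ℤ + (y * y + y + 1ℤ) * (- (+ 2 * κ * ((y + 1ℤ) + 1ℤ)) + (y * y + y + 1ℤ) * A))
        - y * (y * (y * (y * (y * 1ℤ)))) * (1ℤ + (y * y + y + 1ℤ) * (- (+ 2 * κ * (- y + 1ℤ)) + (y * y + y + 1ℤ) * B)) - 1ℤ
        ≡ - (y * y + y + 1ℤ) * (+ 5 + κ * + 6 + (y * y + y + 1ℤ) * - (+ 5 - + 2 * κ * (+ 2 * (y * y * y * y) + + 4 * (y * y * y) + + 14 * (y * y) + + 12 * y - 1ℤ)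
            + ((y + 1ℤ) * (y + 1ℤ) * (y + 1ℤ) * (y + 1ℤ) * (y + 1ℤ) * A - y * y * y * y * y * B)))
      l = solve-∀
    case1 : F (1 ℕ.+ k ℕ.* 6) t ≡ - g * (g * (κ * + 6 * κ + κ + g * - (+ 7 * c + x * S₁ - y * S₂)))
    case1 = trans (F₁ 1) (l y κ S₁ S₂)
      where
      l : ∀ y κ S₁ S₂ →
        (y + 1ℤ) * 1ℤ * (1ℤ + (y * y + y + 1ℤ) * (- (+ 2 * κ * ((y + 1ℤ) + 1ℤ)) + (y * y + y + 1ℤ) * ((+ 2 * κ * κ - κ) * (((y + 1ℤ) + 1ℤ) * ((y + 1ℤ) + 1ℤ)) + (y * y + y + 1ℤ) * S₁)))
        - y * 1ℤ * (1ℤ + (y * y + y + 1ℤ) * (- (+ 2 * κ * (- y + 1ℤ)) + (y * y + y + 1ℤ) * ((+ 2 * κ * κ - κ) * ((- y + 1ℤ) * (- y + 1ℤ)) + (y * y + y + 1ℤ) * S₂))) - 1ℤ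
        ≡ - (y * y + y + 1ℤ) * ((y * y + y + 1ℤ) * (κ * + 6 * κ + κ + (y * y + y + 1ℤ) * - (+ 7 * (+ 2 * κ * κ - κ) + (y + 1ℤ) * S₁ - y * S₂)))
      l = solve-∀

  q-nonZero : ∀ t → NonZero (q t)
  q-nonZero t = ≢-nonZero {q t} λ e → absurd (trans (sym (ℕₚ.+-comm (t ℕ.* t ℕ.+ t) 1)) (cong ∣_∣ (trans (cong (λ z → z + + t + 1ℤ) (pos-* t t)) e)))
    where
    absurd : ∀ {n} → ¬ suc n ≡ 0
    absurd ()

  neg-∣ : ∀ {u v w} → u ≡ - v * w → ∀ {Z} → u ∣ Z → v * w ∣ Z
  neg-∣ {u} {v} {w} e {Z} (divides k eq) = divides (- k) (trans eq (trans (cong (k *_) e) (l k v w)))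
    where
    l : ∀ k v w → k * (- v * w) ≡ - k * (v * w)
    l = solve-∀

  ∣-neg : ∀ {u v w} → u ≡ - v * w → ∀ {Z} → v * w ∣ Z → u ∣ Z
  ∣-neg {u} {v} {w} e {Z} (divides k eq) = divides (- k) (trans eq (trans (l k v w) (cong (- k *_) (sym e))))
    where
    l : ∀ k v w → k * (v * w) ≡ - k * (- v * w)
    l = solve-∀

  strip-Y : ∀ m t Z → .{{_ : NonZero (Y t)}} → let n = suc (suc m) in F n t ∣ Y t * (Y t * Z) → F n t ∣ + n * (Y t * Z)
  strip-Y m t Z h = strip (+ n + Y t * S) (Y t) (+ n) S Z (proj₂ (F-Y m t)) refl h
    where
    n = suc (suc m)
    S = proj₁ (F-Y m t)

  X-nonZero : ∀ t → NonZero (X t)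
  X-nonZero t = ≢-nonZero {X t} λ e → absurd (trans (sym (ℕₚ.+-comm t 1)) (cong ∣_∣ e))
    where
    absurd : ∀ {n} → ¬ suc n ≡ 0
    absurd ()

  strip-X-odd : ∀ m t Z → let n = suc (suc m) in Odd n → F n t ∣ X t * (X t * Z) → F n t ∣ + n * (X t * Z)
  strip-X-odd m t Z o h = ∣-neg {v = X t} {w = + n + X t * S} (proj₂ (F-X-odd m t o))
    (strip (+ n + X t * S) (X t) (+ n) S Z {{X-nonZero t}} refl refl (neg-∣ {v = X t} {w = + n + X t * S} (proj₂ (F-X-odd m t o)) h))
    where
    n = suc (suc m)
    S = proj₁ (F-X-odd m t o)

  strip-X-even : ∀ m t Z → let n = suc (suc m) in Even n → F n t ∣ X t * Z → F n t ∣ + 2 * Z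
  strip-X-even m t Z e h = coprime-cancel (- 1ℤ) (+ 2) (X t) (proj₁ (F-X-even m t e)) Z (proj₂ (F-X-even m t e)) h

  -- `F n` vanishes at the zeros of `q` to order at most two, so a third factor `q` can be traded
  -- for a constant.
  Strip-q : ℕ → Set
  Strip-q n = ∃ λ m → 0 ℕ.< m × ∀ t Z → F n t ∣ q t * (q t * (q t * Z)) → F n t ∣ + m * (q t * (q t * Z))

  -- Let n = j + 6 k. For j = 0, 2, 3, 4 the polynomial `F n` is coprime to `q` up to the constants
  -- 1, 2, 3, 2. For j = 5 it has the simple factor `q`, whose cofactor takes the value - n at the
  -- zeros of `q`; for j = 1 it has the double factor `q ^ 2`, with the value - k n there. The case
  -- n = 1 is out because `F 1` vanishes identically.
  strip-q-6 : ∀ j k → j ℕ.< 6 → 1 ℕ.< j ℕ.+ k ℕ.* 6 → Strip-q (j ℕ.+ k ℕ.* 6)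
  strip-q-6 0 k _ _ = 1 , s≤s z≤n , λ t Z → coprime-cancel (- 1ℤ) 1ℤ (q t) (Sextic.T₀ t k) (q t * (q t * Z)) (Sextic.case0 t k)
  strip-q-6 1 zero _ (s≤s ())
  strip-q-6 1 (suc k) _ _ = m , s≤s z≤n , λ t Z h →
      ∣-neg {v = q t} {w = q t * K t} (Sextic.case1 t κ)
        (subst (λ z → q t * (q t * K t) ∣ z) (l (q t) (+ m) Z) (*-monoʳ-∣ (q t) (*-monoʳ-∣ (q t)
          (coprime-cancel 1ℤ (+ m) (q t) (S t) Z (trans (*-identityʳ (K t)) (cong (_+ q t * S t) (e t)))
            (*-cancelˡ-∣ (q t) {{q-nonZero t}} (*-cancelˡ-∣ (q t) {{q-nonZero t}} (neg-∣ {v = q t} {w = q t * K t} (Sextic.case1 t κ) h)))))))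
    where
    κ = suc k
    m = κ ℕ.* 6 ℕ.* κ ℕ.+ κ
    S K : Fn
    S t = - (+ 7 * Sextic.c t κ + X t * Sextic.S₁ t κ - Y t * Sextic.S₂ t κ)
    K t = + κ * + 6 * + κ + + κ + q t * S t
    e : ∀ t → + κ * + 6 * + κ + + κ ≡ + m
    e t = refl
    l : ∀ g m Z → g * (g * (m * Z)) ≡ m * (g * (g * Z))
    l = solve-∀
  strip-q-6 2 k _ _ = 2 , s≤s z≤n , λ t Z → coprime-cancel (Y t * Y t) (+ 2) (q t) (Sextic.T₂ t k) (q t * (q t * Z)) (Sextic.case2 t k)
  strip-q-6 3 k _ _ = 3 , s≤s z≤n , λ t Z → coprime-cancel (- 1ℤ) (+ 3) (q t) (Sextic.T₃ t k) (q t * (q t * Z)) (Sextic.case3 t k)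
  strip-q-6 4 k _ _ = 2 , s≤s z≤n , λ t Z → coprime-cancel (Y t) (+ 2) (q t) (Sextic.T₄ t k) (q t * (q t * Z)) (Sextic.case4 t k)
  strip-q-6 5 k _ _ = m , s≤s z≤n , λ t Z h →
      ∣-neg {v = q t} {w = K t} (Sextic.case5 t k)
        (strip (+ 5 + + k * + 6 + q t * - Sextic.T₅ t k) (q t) (+ m) (- Sextic.T₅ t k) (q t * Z) {{q-nonZero t}} refl
          (cong (λ z → + 5 + z + q t * - Sextic.T₅ t k) (sym (pos-* k 6))) (neg-∣ {v = q t} {w = K t} (Sextic.case5 t k) h))
    where
    m = 5 ℕ.+ k ℕ.* 6
    K : Fn
    K t = + 5 + + k * + 6 + q t * - Sextic.T₅ t k
  strip-q-6 (suc (suc (suc (suc (suc (suc j)))))) k (s≤s (s≤s (s≤s (s≤s (s≤s (s≤s ())))))) _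

  strip-q : ∀ n → 1 ℕ.< n → Strip-q n
  strip-q n 1<n = subst Strip-q (sym e) (strip-q-6 (n % 6) (n / 6) (m%n<n n 6) (subst (1 ℕ.<_) e 1<n))
    where
    e : n ≡ n % 6 ℕ.+ n / 6 ℕ.* 6
    e = m≡m%n+[m/n]*n n 6

open Multiplicities

-- Ideals of functions that replace vanishing at algebraic numbers.

module Moduli where
  open import Data.Integer using (_+_; _*_; _-_; -_; _^_)
  open import Data.Integer.Properties
  open import Data.Integer.Divisibility.Signed

  -- An ideal of functions ℕ → ℤ that behaves like the functions vanishing at some algebraic numbers
  -- which are not zeros of Q.  `small` and `adic` say that the polynomials with n coefficients form a
  -- lattice modulo the ideal.
  record Modulus : Set₁ where
    field
      I       : Fn → Set
      ext     : ∀ {A B} → Eventually (λ t → A t ≡ B t) → I A → I B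
      I-0     : I (λ _ → 0ℤ)
      I-+     : ∀ {A B} → I A → I B → I (λ t → A t + B t)
      I-*     : ∀ {A} (C : Fn) → I A → I (λ t → C t * A t)
      cancelℤ : ∀ {A} c → 0 ℕ.< c → I (λ t → + c * A t) → I A
      cancelQ : ∀ {A} → I (λ t → Q t * A t) → I A
      small   : ∀ n → ∃ λ C → ∀ {A A' b b'} c → P n b A → P n b' A' → C ℕ.* b' ℕ.< c →
                I (λ t → + c * A t - A' t) → I A
      adic    : ∀ n m u {A b} → 1 ℕ.< m → Coprime m u → P n b A →
                (∀ j → ∃ λ i → ∃ λ (A' : Fn) → ∃ λ b' → P n b' A' × I (λ t → (+ u) ^ i * A t - (+ m) ^ j * A' t)) → I A

    ext≡ : ∀ {A B} → (∀ t → A t ≡ B t) → I A → I B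
    ext≡ e = ext (0 , λ t _ → e t)

    I-- : ∀ {A B} → I A → I B → I (λ t → A t - B t)
    I-- {A} {B} a b = ext≡ (λ t → cong (_+_ (A t)) (-1*i≡-i (B t))) (I-+ a (I-* (λ _ → -[1+ 0 ]) b))

  -- The colon ideal I : L, which discards zeros at which `L` vanishes. The properties `small` and
  -- `adic` survive because multiplication by the fixed polynomial `L` changes the number of
  -- coefficients by a fixed amount and the bounds by a fixed factor.
  refine : (M : Modulus) (L : Fn) → Poly L → Modulus
  refine M L (l , bl , pl) = record
    { I = λ A → I (λ t → L t * A t)
    ; ext = λ { {A} {B} (t₀ , e) → ext (t₀ , λ t h → cong (L t *_) (e t h)) }
    ; I-0 = ext≡ (λ t → sym (*-zeroʳ (L t))) I-0
    ; I-+ = λ {A} {B} a b → ext≡ (λ t → sym (*-distribˡ-+ (L t) (A t) (B t))) (I-+ a b)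
    ; I-* = λ {A} C a → ext≡ (λ t → sw (C t) (L t) (A t)) (I-* C a)
    ; cancelℤ = λ {A} c 0<c a → cancelℤ c 0<c (ext≡ (λ t → sw (L t) (+ c) (A t)) a)
    ; cancelQ = λ {A} a → cancelQ (ext≡ (λ t → sw (L t) (Q t) (A t)) a)
    ; small = λ n → let C , h = small (l ℕ.+ n) in C ℕ.* bl , λ {A} {A'} {b} {b'} c pa pa' lt i →
        h c (P-* pl pa) (P-* pl pa') (subst (ℕ._< c) (ℕₚ.*-assoc C bl b') lt)
          (ext≡ (λ t → ds (L t) (+ c) (A t) (A' t)) i)
    ; adic = λ n m u {A} {b} 1<m cop pa h → adic (l ℕ.+ n) m u 1<m cop (P-* pl pa) λ j →
        let i , A' , b' , pa' , e = h j in
        i , (λ t → L t * A' t) , bl ℕ.* b' , P-* pl pa' , ext≡ (λ t → ds' (L t) ((+ u) ^ i) (A t) ((+ m) ^ j) (A' t)) e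
    }
    where
    open Modulus M
    sw : ∀ c l a → c * (l * a) ≡ l * (c * a)
    sw = solve-∀
    ds : ∀ l c a a' → l * (c * a - a') ≡ c * (l * a) - l * a'
    ds = solve-∀
    ds' : ∀ l c a m a' → l * (c * a - m * a') ≡ c * (l * a) - m * (l * a')
    ds' = solve-∀

  _⊔E_ : ∀ {R S : ℕ → Set} → Eventually R → Eventually S → Eventually (λ t → R t × S t)
  (t₁ , r) ⊔E (t₂ , s) = t₁ ℕ.+ t₂ , λ t h → r t (ℕₚ.≤-trans (ℕₚ.m≤m+n t₁ t₂) h) , s t (ℕₚ.≤-trans (ℕₚ.m≤n+m t₂ t₁) h)

  mapE : ∀ {R S : ℕ → Set} → (∀ t → R t → S t) → Eventually R → Eventually S
  mapE f (t₀ , r) = t₀ , λ t h → f t (r t h)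

  positive : Eventually (λ t → NonZero (Y t))
  positive = 1 , λ { (suc t) _ → _ }

  n^k>0 : ∀ n k → 0 ℕ.< suc n ℕ.^ k
  n^k>0 n k = ℕₚ.m^n>0 (suc n) k

  power-coprime : ∀ m u i v → Coprime m u → m ℕ∣.∣ u ℕ.^ i ℕ.* v → m ℕ∣.∣ v
  power-coprime m u zero    v c h = subst (m ℕ∣.∣_) (ℕₚ.*-identityˡ v) h
  power-coprime m u (suc i) v c h = power-coprime m u i v c
    (coprime-divisor c (subst (m ℕ∣.∣_) (ℕₚ.*-assoc u (u ℕ.^ i) v) h))

  power-coprime^ : ∀ m u i j v → .{{_ : ℕ.NonZero m}} → Coprime m u → m ℕ.^ j ℕ∣.∣ u ℕ.^ i ℕ.* v → m ℕ.^ j ℕ∣.∣ v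
  power-coprime^ m u i zero    v c h = ℕ∣.1∣ v
  power-coprime^ m u i (suc j) v c h with power-coprime m u i v c (ℕ∣.∣-trans (ℕ∣.m∣m*n (m ℕ.^ j)) h)
  ... | ℕ∣.divides v' refl = subst (m ℕ.^ suc j ℕ∣.∣_) (ℕₚ.*-comm m v')
    (ℕ∣.*-monoʳ-∣ m (power-coprime^ m u i j v' c (ℕ∣.*-cancelˡ-∣ m (subst (m ℕ.* m ℕ.^ j ℕ∣.∣_) (l (u ℕ.^ i) v' m) h))))
    where
    l : ∀ u v m → u ℕ.* (v ℕ.* m) ≡ m ℕ.* (u ℕ.* v)
    l = ℕR.solve-∀

  n<m^n : ∀ m n → 1 ℕ.< m → n ℕ.< m ℕ.^ n
  n<m^n m zero    _   = s≤s z≤n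
  n<m^n m (suc n) 1<m = begin-strict
    suc n               ≤⟨ n<m^n m n 1<m ⟩
    m ℕ.^ n             <⟨ ℕₚ.m<m*n (m ℕ.^ n) m {{ℕₚ.m^n≢0 m n {{ℕ.>-nonZero (ℕₚ.<-trans (s≤s z≤n) 1<m)}}}} 1<m ⟩
    m ℕ.^ n ℕ.* m       ≡⟨ ℕₚ.*-comm (m ℕ.^ n) m ⟩
    m ℕ.* m ℕ.^ n ∎
    where open ℕₚ.≤-Reasoning

  ∣∧<⇒≡0 : ∀ m v → m ℕ∣.∣ v → v ℕ.< m → v ≡ 0
  ∣∧<⇒≡0 m zero    _ _  = refl
  ∣∧<⇒≡0 m (suc v) d lt = ⊥-elim (ℕₚ.<⇒≱ lt (ℕ∣.∣⇒≤ d))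

  Poly-X : Poly X
  Poly-X = Poly-+ Poly-t (Poly-const 1ℤ)

  Poly-q : Poly q
  Poly-q = Poly-+ (Poly-+ (Poly-* Poly-t Poly-t) Poly-t) (Poly-const 1ℤ)

  Poly-Q : Poly Q
  Poly-Q = Poly-* (Poly-* Poly-X Poly-t) Poly-q

  module Annihilator (m : ℕ) (V : Fn) (pV : Poly V) where
    -- The ideal (F n) : V with rational coefficients, expressed by divisibility of values at large
    -- integers. The constant `c` absorbs the powers of `n` that pseudo-division introduces.
    Null : Fn → Set
    Null A = ∃ λ c → 0 ℕ.< c × Eventually (λ t → F (suc (suc m)) t ∣ + c * (V t * A t))

    sum : ∀ {A B} → Null A → Null B → Null (λ t → A t + B t)
    sum {A} {B} (c , 0<c , a) (d , 0<d , b) = c ℕ.* d , ℕₚ.*-mono-≤ 0<c 0<d , mapE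
      (λ t h → subst (F (suc (suc m)) t ∣_) (trans (l (+ c) (+ d) (V t) (A t) (B t)) (cong (_* (V t * (A t + B t))) (sym (pos-* c d))))
        (∣m∣n⇒∣m+n (∣n⇒∣m*n (+ d) (proj₁ h)) (∣n⇒∣m*n (+ c) (proj₂ h)))) (a ⊔E b)
      where
      l : ∀ c d v a b → d * (c * (v * a)) + c * (d * (v * b)) ≡ c * d * (v * (a + b))
      l = solve-∀

    prod : ∀ {A} (C : Fn) → Null A → Null (λ t → C t * A t)
    prod {A} C (c , 0<c , a) = c , 0<c , mapE (λ t h → subst (F (suc (suc m)) t ∣_) (l (C t) (+ c) (V t) (A t)) (∣n⇒∣m*n (C t) h)) a
      where
      l : ∀ C c v a → C * (c * (v * a)) ≡ c * (v * (C * a))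
      l = solve-∀

    canℤ : ∀ {A} c → 0 ℕ.< c → Null (λ t → + c * A t) → Null A
    canℤ {A} c 0<c (d , 0<d , a) = d ℕ.* c , ℕₚ.*-mono-≤ 0<d 0<c ,
      mapE (λ t h → subst (F (suc (suc m)) t ∣_) (trans (l (+ d) (+ c) (V t) (A t)) (cong (_* (V t * A t)) (sym (pos-* d c)))) h) a
      where
      l : ∀ d c v a → d * (v * (c * a)) ≡ d * c * (v * a)
      l = solve-∀

    module Remainder (ν : ℕ) where
      k : ℕ
      k = proj₁ pV ℕ.+ ν
      factor : ℕ
      factor = (suc (suc m) ℕ.+ 2 ℕ.^ suc (suc m)) ℕ.^ k
      bound : ℕ
      bound = factor ℕ.* proj₁ (proj₂ pV)
      Rem : Fn → ℕ → Set
      Rem A b = ∃ λ (R : Fn) → P (suc m) b R × ∃ λ (K : Fn) → ∀ t → (+ suc (suc m)) ^ k * A t ≡ K t * F (suc (suc m)) t + R t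
      abstract
        rem : ∀ {A b} → P ν b A → Rem (λ t → V t * A t) (bound ℕ.* b)
        rem {A} {b} p = subst (Rem (λ t → V t * A t)) (sym (ℕₚ.*-assoc factor (proj₁ (proj₂ pV)) b)) r
          where
          pVA : P (k ℕ.+ suc m) (proj₁ (proj₂ pV) ℕ.* b) (λ t → V t * A t)
          pVA = P-pad (ℕₚ.m≤m+n k (suc m)) (P-* (proj₂ (proj₂ pV)) p)
          r : Rem (λ t → V t * A t) (factor ℕ.* (proj₁ (proj₂ pV) ℕ.* b))
          r = pseudo-rem m k pVA

      -- The coefficients of the remainder of `V A` modulo `F n` serve as integral coordinates of
      -- `A` modulo the ideal: by `rem-unique`, a linear relation modulo the ideal holds exactly
      -- between them.
      compare : ∀ {A A' b b'} c c' (p : P ν b A) (p' : P ν b' A') → Null (λ t → c * A t - c' * A' t) →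
        ∀ i → i ℕ.< suc m → c * P.coef (proj₁ (proj₂ (rem p))) i ≡ c' * P.coef (proj₁ (proj₂ (rem p'))) i
      compare {A} {A'} c c' p p' (d , 0<d , h) i i<m = i-j≡0⇒i≡j (c * a i) (c' * a' i)
        (trans (cong (_+_ (c * a i)) (neg-distribˡ-* c' (a' i))) (rem-unique m d {λ i → c * a i + (- c') * a' i} 0<d (mapE step h) i i<m))
        where
        a  = P.coef (proj₁ (proj₂ (rem p)))
        a' = P.coef (proj₁ (proj₂ (rem p')))
        K  = proj₁ (proj₂ (proj₂ (rem p)))
        K' = proj₁ (proj₂ (proj₂ (rem p')))
        R  = proj₁ (rem p)
        R' = proj₁ (rem p')
        N : ℤ
        N = (+ suc (suc m)) ^ k
        l₁ : ∀ N d v c a c' a' K f r K' r' → N * (v * a) ≡ K * f + r → N * (v * a') ≡ K' * f + r' →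
          d * (c * r + - c' * r') ≡ N * (d * (v * (c * a - c' * a'))) - d * (c * K - c' * K') * f
        l₁ N d v c a c' a' K f r K' r' e e' = trans (l₂ d c c' K f r K' r')
          (trans (cong₂ (λ u w → d * (c * u - c' * w) - d * (c * K - c' * K') * f) (sym e) (sym e')) (l₃ N d v c a c' a' (d * (c * K - c' * K') * f)))
          where
          l₂ : ∀ d c c' K f r K' r' → d * (c * r + - c' * r') ≡ d * (c * (K * f + r) - c' * (K' * f + r')) - d * (c * K - c' * K') * f
          l₂ = solve-∀
          l₃ : ∀ N d v c a c' a' w → d * (c * (N * (v * a)) - c' * (N * (v * a'))) - w ≡ N * (d * (v * (c * a - c' * a'))) - w
          l₃ = solve-∀
        step : ∀ t → F (suc (suc m)) t ∣ + d * (V t * (c * A t - c' * A' t)) → F (suc (suc m)) t ∣ + d * ev (suc m) (λ i → c * a i + (- c') * a' i) t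
        step t g = subst (F (suc (suc m)) t ∣_) (sym (trans (cong (+ d *_) (trans (ev-+ (suc m) (λ i → c * a i) (λ i → - c' * a' i) t)
            (cong₂ _+_ (trans (ev-* (suc m) c a t) (cong (c *_) (sym (P.isEv (proj₁ (proj₂ (rem p))) t))))
                       (trans (ev-* (suc m) (- c') a' t) (cong (- c' *_) (sym (P.isEv (proj₁ (proj₂ (rem p'))) t)))))))
            (l₁ N (+ d) (V t) c (A t) c' (A' t) (K t) (F (suc (suc m)) t) (R t) (K' t) (R' t) (proj₂ (proj₂ (proj₂ (rem p))) t) (proj₂ (proj₂ (proj₂ (rem p'))) t))))
          (∣m∣n⇒∣m-n (∣n⇒∣m*n N g) (∣n⇒∣m*n (+ d * (c * K t - c' * K' t)) ∣-refl))

      vanish : ∀ {A b} (p : P ν b A) → (∀ i → i ℕ.< suc m → P.coef (proj₁ (proj₂ (rem p))) i ≡ 0ℤ) → Null A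
      vanish {A} p z = suc (suc m) ℕ.^ k , n^k>0 (suc m) k , (0 , λ t _ → divides (proj₁ (proj₂ (proj₂ (rem p))) t)
        (trans (cong (_* (V t * A t)) (pos-^ (suc (suc m)) k)) (trans (proj₂ (proj₂ (proj₂ (rem p))) t)
          (trans (cong (_+_ (proj₁ (proj₂ (proj₂ (rem p))) t * F (suc (suc m)) t)) (trans (P.isEv (proj₁ (proj₂ (rem p))) t) (ev-0 (suc m) z t))) (+-identityʳ _)))))

      -- In coordinates the hypothesis reads `c a = a'` with integers satisfying `∣ a' ∣ < c`, which
      -- forces `a = 0`.
      small₁ : ∀ {A A' b b'} c → P ν b A → P ν b' A' → bound ℕ.* b' ℕ.< c → Null (λ t → + c * A t - A' t) → Null A
      small₁ {A} {A'} {b} {b'} c p p' lt (d , 0<d , h) = vanish p λ i i<m → ∣i∣≡0⇒i≡0 (∣∧<⇒≡0′ i i<m)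
        where
        a  = P.coef (proj₁ (proj₂ (rem p)))
        a' = P.coef (proj₁ (proj₂ (rem p')))
        eq : ∀ i → i ℕ.< suc m → + c * a i ≡ 1ℤ * a' i
        eq = compare (+ c) 1ℤ p p' (d , 0<d , mapE (λ t → subst (λ z → F (suc (suc m)) t ∣ + d * (V t * (+ c * A t - z))) (sym (*-identityˡ (A' t)))) h)
        ∣∧<⇒≡0′ : ∀ i → i ℕ.< suc m → ∣ a i ∣ ≡ 0
        ∣∧<⇒≡0′ i i<m = go (∣ a i ∣) refl
          where
          open ℕₚ.≤-Reasoning
          go : ∀ v → ∣ a i ∣ ≡ v → v ≡ 0
          go zero    _ = refl
          go (suc v) e = ⊥-elim (ℕₚ.<⇒≱ lt (begin
            c ≤⟨ ℕₚ.m≤m*n c (suc v) ⟩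
            c ℕ.* suc v ≡⟨ cong (c ℕ.*_) (sym e) ⟩
            c ℕ.* ∣ a i ∣ ≡⟨ sym (abs-* (+ c) (a i)) ⟩
            ∣ + c * a i ∣ ≡⟨ cong ∣_∣ (trans (eq i i<m) (*-identityˡ (a' i))) ⟩
            ∣ a' i ∣ ≤⟨ norm-coef (suc m) a' i i<m ⟩
            norm (suc m) a' ≤⟨ P.normed (proj₁ (proj₂ (rem p'))) ⟩
            bound ℕ.* b' ∎))

      -- In coordinates `u ^ i a = μ ^ j a'`, so every power `μ ^ j` divides `a`. The choice
      -- `j = ∣ a ∣` is enough, since `μ ^ j` exceeds `j`.
      adic₁ : ∀ μ u {A b} → 1 ℕ.< μ → Coprime μ u → P ν b A →
        (∀ j → ∃ λ i → ∃ λ (A' : Fn) → ∃ λ b' → P ν b' A' × Null (λ t → (+ u) ^ i * A t - (+ μ) ^ j * A' t)) → Null A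
      adic₁ μ u {A} 1<μ cop p h = vanish p λ i i<m → ∣i∣≡0⇒i≡0 (zer i i<m)
        where
        a = P.coef (proj₁ (proj₂ (rem p)))
        zer : ∀ i → i ℕ.< suc m → ∣ a i ∣ ≡ 0
        zer i i<m = ∣∧<⇒≡0 (μ ℕ.^ v) v (power-coprime^ μ u (proj₁ hv) v v {{ℕ.>-nonZero (ℕₚ.<-trans (s≤s z≤n) 1<μ)}} cop
            (ℕ∣.divides (∣ a' i ∣) (trans (sym (trans (abs-* ((+ u) ^ proj₁ hv) (a i)) (cong (ℕ._* v) (abs-^ (+ u) (proj₁ hv)))))
              (trans (cong ∣_∣ (compare ((+ u) ^ proj₁ hv) ((+ μ) ^ v) p p' (proj₂ (proj₂ (proj₂ (proj₂ hv)))) i i<m))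
                (trans (abs-* ((+ μ) ^ v) (a' i)) (trans (cong (ℕ._* ∣ a' i ∣) (abs-^ (+ μ) v)) (ℕₚ.*-comm (μ ℕ.^ v) (∣ a' i ∣))))))))
            (n<m^n μ v 1<μ)
          where
          v = ∣ a i ∣
          hv = h v
          p' = proj₁ (proj₂ (proj₂ (proj₂ hv)))
          a' = P.coef (proj₁ (proj₂ (rem p')))

    modulus : (∀ {A} → Null (λ t → Q t * A t) → Null A) → Modulus
    modulus canQ = record
      { I = Null
      ; ext = λ { {A} {B} e (c , 0<c , a) → c , 0<c , mapE (λ t h → subst (λ z → F (suc (suc m)) t ∣ + c * (V t * z)) (proj₁ h) (proj₂ h)) (e ⊔E a) }
      ; I-0 = 1 , s≤s z≤n , (0 , λ t _ → subst (F (suc (suc m)) t ∣_) (l (V t)) (divides 0ℤ refl))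
      ; I-+ = sum
      ; I-* = prod
      ; cancelℤ = canℤ
      ; cancelQ = canQ
      ; small = λ ν → Remainder.bound ν , Remainder.small₁ ν
      ; adic = λ ν μ u → Remainder.adic₁ ν μ u
      }
      where
      l : ∀ v → 0ℤ ≡ + 1 * (v * 0ℤ)
      l = solve-∀

  strip-X³ : ∀ m → let n = suc (suc m) in
    ∃ λ e → 0 ℕ.< e × ∀ t Z → F n t ∣ X t * (X t * (X t * Z)) → F n t ∣ + e * (X t * (X t * Z))
  strip-X³ m = pick (parity n)
    where
    n = suc (suc m)
    pick : Even n ⊎ Odd n → ∃ λ e → 0 ℕ.< e × ∀ t Z → F n t ∣ X t * (X t * (X t * Z)) → F n t ∣ + e * (X t * (X t * Z))
    pick (inj₁ ev) = 2 , s≤s z≤n , λ t Z → strip-X-even m t (X t * (X t * Z)) ev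
    pick (inj₂ od) = n , s≤s z≤n , λ t Z → strip-X-odd m t (X t * Z) od

  module Base (m : ℕ) (W : Fn) (pW : Poly W) where
    n : ℕ
    n = suc (suc m)

    -- `Q ^ 2` is built in so that `Q` can be cancelled, and `W` so that a second polynomial enters
    -- the ideal: any `A` for which `W A` is a multiple of `F n`.
    V : Fn
    V t = Q t * (Q t * W t)

    pV : Poly V
    pV = Poly-* Poly-Q (Poly-* Poly-Q pW)

    open Annihilator m V pV using (Null)

    -- `V` already contains `Q ^ 2`, and no zero of `Q` is more than a double zero of `F n`. So the
    -- third factor `Q` is traded for constants, first `Y`, then `X`, then `q`.
    canQ : ∀ {A} → Null (λ t → Q t * A t) → Null A
    canQ {A} (d , 0<d , a) = d ℕ.* (n ℕ.* (e ℕ.* k)) , ℕₚ.*-mono-≤ 0<d (ℕₚ.*-mono-≤ {1} {n} (s≤s z≤n) (ℕₚ.*-mono-≤ 0<e 0<k)) ,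
      mapE step (a ⊔E positive)
      where
      e = proj₁ (strip-X³ m)
      0<e = proj₁ (proj₂ (strip-X³ m))
      k = proj₁ (strip-q n (s≤s (s≤s z≤n)))
      0<k = proj₁ (proj₂ (strip-q n (s≤s (s≤s z≤n))))
      l₁ : ∀ d x y q w a → d * (x * y * q * (x * y * q * w) * (x * y * q * a)) ≡ y * (y * (y * (d * (x * x * x * (q * q * q)) * (w * a))))
      l₁ = solve-∀
      l₂ : ∀ n d x y q w a → n * (y * (y * (d * (x * x * x * (q * q * q)) * (w * a)))) ≡ x * (x * (x * (n * (y * y) * d * (q * q * q) * (w * a))))
      l₂ = solve-∀
      l₃ : ∀ e n d x y q w a → e * (x * (x * (n * (y * y) * d * (q * q * q) * (w * a)))) ≡ q * (q * (q * (e * n * d * (x * x) * (y * y) * (w * a))))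
      l₃ = solve-∀
      l₄ : ∀ k e n d x y q w a → k * (q * (q * (e * n * d * (x * x) * (y * y) * (w * a)))) ≡ d * (n * (e * k)) * (x * y * q * (x * y * q * w) * a)
      l₄ = solve-∀
      cast : + d * (+ n * (+ e * + k)) ≡ + (d ℕ.* (n ℕ.* (e ℕ.* k)))
      cast = sym (trans (pos-* d (n ℕ.* (e ℕ.* k))) (cong (+ d *_) (trans (pos-* n (e ℕ.* k)) (cong (+ n *_) (pos-* e k)))))
      step : ∀ t → F n t ∣ + d * (V t * (Q t * A t)) × NonZero (Y t) → F n t ∣ + (d ℕ.* (n ℕ.* (e ℕ.* k))) * (V t * A t)
      step t (h , nz) = subst (F n t ∣_) (trans (l₄ (+ k) (+ e) (+ n) (+ d) (X t) (Y t) (q t) (W t) (A t)) (cong (_* (V t * A t)) cast))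
        (proj₂ (proj₂ (strip-q n (s≤s (s≤s z≤n)))) t (+ e * + n * + d * (X t * X t) * (Y t * Y t) * (W t * A t)) (subst (F n t ∣_) (l₃ (+ e) (+ n) (+ d) (X t) (Y t) (q t) (W t) (A t))
          (proj₂ (proj₂ (strip-X³ m)) t (+ n * (Y t * Y t) * + d * (q t * q t * q t) * (W t * A t)) (subst (F n t ∣_) (l₂ (+ n) (+ d) (X t) (Y t) (q t) (W t) (A t))
            (strip-Y m t (Y t * (+ d * (X t * X t * X t * (q t * q t * q t)) * (W t * A t))) {{nz}} (subst (F n t ∣_) (l₁ (+ d) (X t) (Y t) (q t) (W t) (A t)) h))))))

    modulus : Modulus
    modulus = Annihilator.modulus m V pV canQ

open Moduli

-- Nontriviality of the ideals, and forms in X and Y.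

module Forms where
  open import Data.Integer using (_+_; _*_; _^_)
  open import Data.Integer.Properties
  open import Data.Integer.Divisibility.Signed

  P-X* : ∀ {n b A} → P n b A → P (suc n) (b ℕ.+ b) (λ t → X t * A t)
  P-X* {A = A} p = P-cast ℕₚ.≤-refl (λ t → l (+ t) (A t)) (P-+ (P-t* p) (P-suc p))
    where
    l : ∀ t a → t * a + a ≡ (t + 1ℤ) * a
    l = solve-∀

  P-q* : ∀ {n b A} → P n b A → P (suc (suc n)) (b ℕ.+ b ℕ.+ b) (λ t → q t * A t)
  P-q* {A = A} p = P-cast ℕₚ.≤-refl (λ t → l (+ t) (A t)) (P-+ (P-+ (P-t* (P-t* p)) (P-suc (P-t* p))) (P-suc (P-suc p)))
    where
    l : ∀ t a → t * (t * a) + t * a + a ≡ (t * t + t + 1ℤ) * a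
    l = solve-∀

  module _ (m w bw : ℕ) (W : Fn) (pW : P w bw W) where
    private
      n : ℕ
      n = suc (suc m)

    open Annihilator m (λ t → Q t * (Q t * W t)) (Poly-* Poly-Q (Poly-* Poly-Q (w , bw , pW))) using (Null)

    private
      conclude : ∀ c {b} (S : Fn) → 0 ℕ.< c → (∀ t → S t ≡ 0ℤ → NonZero (Y t) → W t ≡ 0ℤ) → P (suc m) b S →
        Eventually (λ t → F n t ∣ + c * S t) → Eventually (λ t → W t ≡ 0ℤ)
      conclude c S 0<c z (poly a ea _) h = mapE (λ t nz → z t (trans (ea t) (ev-0 (suc m) vanish t)) nz) positive
        where
        vanish = rem-unique m c {a} 0<c (mapE (λ t d → subst (λ z → F n t ∣ + c * z) (ea t) d) h)

      cancel : ∀ u v → NonZero u → u * v ≡ 0ℤ → v ≡ 0ℤ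
      cancel u v nz e = *-cancelˡ-≡ u v 0ℤ {{nz}} (trans e (sym (*-zeroʳ u)))

    -- If 1 lies in the ideal, then `F n` divides a multiple of `Q ^ 2 W`. Reducing each factor of
    -- `Q` to its largest possible multiplicity in `F n` leaves `Y X q ^ 2 W`, which has lower
    -- degree than `F n` and so vanishes. The 6 factors of degree one here are the origin of σ = 7.
    nontrivial-odd : Odd n → 6 ℕ.+ w ℕ.≤ suc m → Null (λ _ → 1ℤ) → Eventually (λ t → W t ≡ 0ℤ)
    nontrivial-odd od w≤ (c , 0<c , h) = conclude (c ℕ.* (n ℕ.* n)) S (ℕₚ.*-mono-≤ 0<c (s≤s z≤n))
        (λ t e nz → cancel (q t) (W t) (q-nonZero t) (cancel (q t) (q t * W t) (q-nonZero t)
          (cancel (X t) (q t * (q t * W t)) (X-nonZero t) (cancel (Y t) (X t * (q t * (q t * W t))) nz e))))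
        (P-pad w≤ (P-t* (P-X* (P-q* (P-q* pW))))) (mapE step (h ⊔E positive))
      where
      S : Fn
      S t = Y t * (X t * (q t * (q t * W t)))
      l₁ : ∀ c x y q w → c * (x * y * q * (x * y * q * w) * 1ℤ) ≡ y * (y * (c * (x * x) * (q * q) * w))
      l₁ = solve-∀
      l₂ : ∀ n c x y q w → n * (y * (c * (x * x) * (q * q) * w)) ≡ x * (x * (n * c * y * (q * q) * w))
      l₂ = solve-∀
      l₃ : ∀ n c x y q w → n * (x * (n * c * y * (q * q) * w)) ≡ c * (n * n) * (y * (x * (q * (q * w))))
      l₃ = solve-∀
      step : ∀ t → F n t ∣ + c * (Q t * (Q t * W t) * 1ℤ) × NonZero (Y t) → F n t ∣ + (c ℕ.* (n ℕ.* n)) * S t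
      step t (d , nz) = subst (F n t ∣_) (trans (l₃ (+ n) (+ c) (X t) (Y t) (q t) (W t)) (cong (_* S t) (sym (trans (pos-* c (n ℕ.* n)) (cong (+ c *_) (pos-* n n))))))
        (strip-X-odd m t (+ n * + c * Y t * (q t * q t) * W t) od (subst (F n t ∣_) (l₂ (+ n) (+ c) (X t) (Y t) (q t) (W t))
          (strip-Y m t (+ c * (X t * X t) * (q t * q t) * W t) {{nz}} (subst (F n t ∣_) (l₁ (+ c) (X t) (Y t) (q t) (W t)) d))))

    -- For even `n` both factors `X` can be removed, each at the cost of a factor 2, whence the 4.
    -- One degree is saved, and σ becomes 6.
    nontrivial-even : Even n → 5 ℕ.+ w ℕ.≤ suc m → Null (λ _ → 1ℤ) → Eventually (λ t → W t ≡ 0ℤ)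
    nontrivial-even en w≤ (c , 0<c , h) = conclude (c ℕ.* (n ℕ.* 4)) S (ℕₚ.*-mono-≤ 0<c (s≤s z≤n))
        (λ t e nz → cancel (q t) (W t) (q-nonZero t) (cancel (q t) (q t * W t) (q-nonZero t) (cancel (Y t) (q t * (q t * W t)) nz e)))
        (P-pad w≤ (P-t* (P-q* (P-q* pW)))) (mapE step (h ⊔E positive))
      where
      S : Fn
      S t = Y t * (q t * (q t * W t))
      l₁ : ∀ c x y q w → c * (x * y * q * (x * y * q * w) * 1ℤ) ≡ y * (y * (c * (x * x) * (q * q) * w))
      l₁ = solve-∀
      l₂ : ∀ n c x y q w → n * (y * (c * (x * x) * (q * q) * w)) ≡ x * (x * (n * c * y * (q * q) * w))
      l₂ = solve-∀
      l₃ : ∀ n c x y q w → + 2 * (x * (n * c * y * (q * q) * w)) ≡ x * (+ 2 * n * c * y * (q * q) * w)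
      l₃ = solve-∀
      l₄ : ∀ n c y q w → + 2 * (+ 2 * n * c * y * (q * q) * w) ≡ c * (n * + 4) * (y * (q * (q * w)))
      l₄ = solve-∀
      step : ∀ t → F n t ∣ + c * (Q t * (Q t * W t) * 1ℤ) × NonZero (Y t) → F n t ∣ + (c ℕ.* (n ℕ.* 4)) * S t
      step t (d , nz) = subst (F n t ∣_) (trans (l₄ (+ n) (+ c) (Y t) (q t) (W t)) (cong (_* S t) (sym (trans (pos-* c (n ℕ.* 4)) (cong (+ c *_) (pos-* n 4))))))
        (strip-X-even m t (+ 2 * + n * + c * Y t * (q t * q t) * W t) en (subst (F n t ∣_) (l₃ (+ n) (+ c) (X t) (Y t) (q t) (W t))
          (strip-X-even m t (X t * (+ n * + c * Y t * (q t * q t) * W t)) en (subst (F n t ∣_) (l₂ (+ n) (+ c) (X t) (Y t) (q t) (W t))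
            (strip-Y m t (+ c * (X t * X t) * (q t * q t) * W t) {{nz}} (subst (F n t ∣_) (l₁ (+ c) (X t) (Y t) (q t) (W t)) d))))))

  -- Integer combinations of the monomials X^i Y^j with i + j ≤ n, and a bound for the sum of the absolute
  -- values of the coefficients.
  data Form (n : ℕ) : ℕ → Fn → Set where
    mono : ∀ i j → i ℕ.+ j ℕ.≤ n → Form n 1 (λ t → X t ^ i * Y t ^ j)
    zer  : Form n 0 (λ _ → 0ℤ)
    add  : ∀ {b c A B} → Form n b A → Form n c B → Form n (b ℕ.+ c) (λ t → A t + B t)
    scl  : ∀ {b A} k → Form n b A → Form n (∣ k ∣ ℕ.* b) (λ t → k * A t)
    cast : ∀ {b c A B} → b ℕ.≤ c → (∀ t → A t ≡ B t) → Form n b A → Form n c B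

  Form-one : ∀ {n} → Form n 1 (λ _ → 1ℤ)
  Form-one = cast ℕₚ.≤-refl (λ _ → refl) (mono 0 0 z≤n)

  Form-X : ∀ i → Form i 1 (λ t → X t ^ i)
  Form-X i = cast ℕₚ.≤-refl (λ t → *-identityʳ (X t ^ i)) (mono i 0 (ℕₚ.≤-reflexive (ℕₚ.+-identityʳ i)))

  Form-Y : ∀ i → Form i 1 (λ t → Y t ^ i)
  Form-Y i = cast ℕₚ.≤-refl (λ t → *-identityˡ (Y t ^ i)) (mono 0 i ℕₚ.≤-refl)

  Form-weaken : ∀ {n m b A} → n ℕ.≤ m → Form n b A → Form m b A
  Form-weaken h (mono i j l)   = mono i j (ℕₚ.≤-trans l h)
  Form-weaken h zer            = zer
  Form-weaken h (add f g)      = add (Form-weaken h f) (Form-weaken h g)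
  Form-weaken h (scl k f)      = scl k (Form-weaken h f)
  Form-weaken h (cast l e f)   = cast l e (Form-weaken h f)

  Form-mono* : ∀ {n m b A} i j → i ℕ.+ j ℕ.≤ n → Form m b A → Form (n ℕ.+ m) b (λ t → X t ^ i * Y t ^ j * A t)
  Form-mono* {n} {m} i j l (mono i' j' l') = cast ℕₚ.≤-refl
      (λ t → trans (cong₂ _*_ (^-distribˡ-+-* (X t) i i') (^-distribˡ-+-* (Y t) j j')) (e (X t ^ i) (X t ^ i') (Y t ^ j) (Y t ^ j')))
      (mono (i ℕ.+ i') (j ℕ.+ j') (ℕₚ.≤-trans (ℕₚ.≤-reflexive (r i i' j j')) (ℕₚ.+-mono-≤ l l')))
    where
    e : ∀ a b c d → a * b * (c * d) ≡ a * c * (b * d)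
    e = solve-∀
    r : ∀ a b c d → a ℕ.+ b ℕ.+ (c ℕ.+ d) ≡ a ℕ.+ c ℕ.+ (b ℕ.+ d)
    r = ℕR.solve-∀
  Form-mono* i j l zer = cast ℕₚ.≤-refl (λ t → sym (*-zeroʳ (X t ^ i * Y t ^ j))) zer
  Form-mono* i j l (add {A = A} {B} f g) = cast ℕₚ.≤-refl (λ t → sym (*-distribˡ-+ (X t ^ i * Y t ^ j) (A t) (B t)))
    (add (Form-mono* i j l f) (Form-mono* i j l g))
  Form-mono* i j l (scl {A = A} k f) = cast ℕₚ.≤-refl (λ t → e k (X t ^ i * Y t ^ j) (A t)) (scl k (Form-mono* i j l f))
    where
    e : ∀ k m a → k * (m * a) ≡ m * (k * a)
    e = solve-∀
  Form-mono* i j l (cast h e f) = cast h (λ t → cong (X t ^ i * Y t ^ j *_) (e t)) (Form-mono* i j l f)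

  Form-* : ∀ {n m b c A B} → Form n b A → Form m c B → Form (n ℕ.+ m) (b ℕ.* c) (λ t → A t * B t)
  Form-* {c = c} (mono i j l) g = cast (ℕₚ.≤-reflexive (sym (ℕₚ.*-identityˡ c))) (λ _ → refl) (Form-mono* i j l g)
  Form-* {B = B} zer g = cast z≤n (λ t → sym (*-zeroˡ (B t))) zer
  Form-* {c = c} {B = B} (add {b₁} {b₂} {A₁} {A₂} f f') g = cast (ℕₚ.≤-reflexive (sym (ℕₚ.*-distribʳ-+ c b₁ b₂)))
    (λ t → sym (*-distribʳ-+ (B t) (A₁ t) (A₂ t))) (add (Form-* f g) (Form-* f' g))
  Form-* {c = c} {B = B} (scl {b} {A} k f) g = cast (ℕₚ.≤-reflexive (sym (ℕₚ.*-assoc (∣ k ∣) b c)))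
    (λ t → sym (*-assoc k (A t) (B t))) (scl k (Form-* f g))
  Form-* {c = c} {B = B} (cast h e f) g = cast (ℕₚ.*-monoˡ-≤ c h) (λ t → cong (_* B t) (e t)) (Form-* f g)

  Form-^ : ∀ {n b A} k → Form n b A → Form (k ℕ.* n) (b ℕ.^ k) (λ t → A t ^ k)
  Form-^ zero    f = Form-one
  Form-^ (suc k) f = Form-* f (Form-^ k f)

  -- Each factor `X = Y + 1` at most doubles the coefficient sum.
  Form⇒P : ∀ {n b A} → Form n b A → P (suc n) (2 ℕ.^ n ℕ.* b) A
  Form⇒P {n} (mono i j l) = P-cast (ℕₚ.≤-trans (ℕₚ.≤-reflexive (ℕₚ.*-identityʳ _)) (ℕₚ.≤-trans (ℕₚ.^-monoʳ-≤ 2 (ℕₚ.≤-trans (ℕₚ.m≤m+n i j) l)) (ℕₚ.≤-reflexive (sym (ℕₚ.*-identityʳ _)))))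
      (λ _ → refl) (P-pad (s≤s l) (P-mono i))
    where
    P-mono : ∀ i → P (suc (i ℕ.+ j)) (2 ℕ.^ i ℕ.* 1) (λ t → X t ^ i * Y t ^ j)
    P-mono zero    = subst (λ z → P z 1 (λ t → 1ℤ * Y t ^ j)) (ℕₚ.+-comm j 1)
      (P-cast ℕₚ.≤-refl (λ t → *-comm (Y t ^ j) 1ℤ) (P-t^ j (P-const 1ℤ)))
    P-mono (suc i) = P-cast (ℕₚ.≤-reflexive (e (2 ℕ.^ i))) (λ t → sym (*-assoc (X t) (X t ^ i) (Y t ^ j))) (P-X* (P-mono i))
      where
      e : ∀ u → u ℕ.* 1 ℕ.+ u ℕ.* 1 ≡ (u ℕ.+ (u ℕ.+ 0)) ℕ.* 1
      e = ℕR.solve-∀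
  Form⇒P {n} zer = P-cast z≤n (λ _ → refl) P-0
  Form⇒P {n} (add {b} {c} f g) = P-cast (ℕₚ.≤-reflexive (sym (ℕₚ.*-distribˡ-+ (2 ℕ.^ n) b c))) (λ _ → refl) (P-+ (Form⇒P f) (Form⇒P g))
  Form⇒P {n} (scl {b} k f) = P-cast (ℕₚ.≤-reflexive (e (∣ k ∣) (2 ℕ.^ n) b)) (λ _ → refl) (P-scale k (Form⇒P f))
    where
    e : ∀ k u b → k ℕ.* (u ℕ.* b) ≡ u ℕ.* (k ℕ.* b)
    e = ℕR.solve-∀
  Form⇒P {n} (cast h e f) = P-cast (ℕₚ.*-monoʳ-≤ (2 ℕ.^ n) h) e (Form⇒P f)

open Forms

-- Integral elements that are small at all archimedean places vanish.

module Archimedean where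
  open import Data.Integer using (_+_; _*_; _-_; -_; _^_)
  open import Data.Integer.Properties

  -- Bernoulli's inequality for (1 + 1/u)^j, with denominators cleared.
  bernoulli-≤ : ∀ u j → u ℕ.^ j ℕ.* (u ℕ.+ j) ℕ.≤ suc u ℕ.^ j ℕ.* u
  bernoulli-≤ u zero    = ℕₚ.≤-reflexive (cong (1 ℕ.*_) (ℕₚ.+-identityʳ u))
  bernoulli-≤ u (suc j) = begin
    u ℕ.* u ℕ.^ j ℕ.* (u ℕ.+ suc j)       ≤⟨ ℕₚ.m≤m+n _ (u ℕ.^ j ℕ.* j) ⟩
    u ℕ.* u ℕ.^ j ℕ.* (u ℕ.+ suc j) ℕ.+ u ℕ.^ j ℕ.* j ≡⟨ l u (u ℕ.^ j) j ⟩
    suc u ℕ.* (u ℕ.^ j ℕ.* (u ℕ.+ j))     ≤⟨ ℕₚ.*-monoʳ-≤ (suc u) (bernoulli-≤ u j) ⟩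
    suc u ℕ.* (suc u ℕ.^ j ℕ.* u)         ≡⟨ sym (ℕₚ.*-assoc (suc u) (suc u ℕ.^ j) u) ⟩
    suc u ℕ.* suc u ℕ.^ j ℕ.* u ∎
    where
    open ℕₚ.≤-Reasoning
    l : ∀ u w j → u ℕ.* w ℕ.* (u ℕ.+ (1 ℕ.+ j)) ℕ.+ w ℕ.* j ≡ (1 ℕ.+ u) ℕ.* (w ℕ.* (u ℕ.+ j))
    l = ℕR.solve-∀

  archimedean : ∀ C u v → u ℕ.< v → ∃ λ j → C ℕ.* u ℕ.^ j ℕ.< v ℕ.^ j
  archimedean C zero    v u<v = 1 , ℕₚ.≤-<-trans (ℕₚ.≤-reflexive (ℕₚ.*-zeroʳ C)) (subst (0 ℕ.<_) (sym (ℕₚ.*-identityʳ v)) u<v)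
  archimedean C (suc w) v u<v = j , ℕₚ.<-≤-trans (ℕₚ.*-cancelʳ-< u (C ℕ.* u ℕ.^ j) (suc u ℕ.^ j) lt) (ℕₚ.^-monoˡ-≤ j u<v)
    where
    open ℕₚ.≤-Reasoning
    u = suc w
    -- By Bernoulli's inequality (1 + 1/u)^j is at least 1 + j/u, which is 1 + C for this `j`.
    j = C ℕ.* u
    l : ∀ C u x → C ℕ.* x ℕ.* u ≡ x ℕ.* (C ℕ.* u)
    l = ℕR.solve-∀
    lt : C ℕ.* u ℕ.^ j ℕ.* u ℕ.< suc u ℕ.^ j ℕ.* u
    lt = begin-strict
      C ℕ.* u ℕ.^ j ℕ.* u ≡⟨ l C u (u ℕ.^ j) ⟩
      u ℕ.^ j ℕ.* j <⟨ ℕₚ.*-monoʳ-< (u ℕ.^ j) {{ℕₚ.m^n≢0 u j}} (s≤s (ℕₚ.m≤n+m j w)) ⟩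
      u ℕ.^ j ℕ.* (u ℕ.+ j) ≤⟨ bernoulli-≤ u j ⟩
      suc u ℕ.^ j ℕ.* u ∎

  module Congruence (M : Modulus) where
    open Modulus M public

    infix 4 _≈_
    _≈_ : Fn → Fn → Set
    A ≈ B = I (λ t → A t - B t)

    ≈-reflexive : ∀ {A B} → (∀ t → A t ≡ B t) → A ≈ B
    ≈-reflexive {A} {B} e = ext≡ (λ t → sym (i≡j⇒i-j≡0 (e t))) I-0

    ≈-trans : ∀ {A B C} → A ≈ B → B ≈ C → A ≈ C
    ≈-trans {A} {B} {C} p r = ext≡ (λ t → l (A t) (B t) (C t)) (I-+ p r)
      where
      l : ∀ a b c → (a - b) + (b - c) ≡ a - c
      l = solve-∀

    ≈-* : ∀ {A A' B B'} → A ≈ A' → B ≈ B' → (λ t → A t * B t) ≈ (λ t → A' t * B' t)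
    ≈-* {A} {A'} {B} {B'} p r = ext≡ (λ t → l (A t) (A' t) (B t) (B' t)) (I-+ (I-* B p) (I-* A' r))
      where
      l : ∀ a a' b b' → b * (a - a') + a' * (b - b') ≡ a * b - a' * b'
      l = solve-∀

    ≈-+ : ∀ {A A' B B'} → A ≈ A' → B ≈ B' → (λ t → A t + B t) ≈ (λ t → A' t + B' t)
    ≈-+ {A} {A'} {B} {B'} p r = ext≡ (λ t → l (A t) (A' t) (B t) (B' t)) (I-+ p r)
      where
      l : ∀ a a' b b' → (a - a') + (b - b') ≡ a + b - (a' + b')
      l = solve-∀

    ≈-^ : ∀ {A B} k → A ≈ B → (λ t → A t ^ k) ≈ (λ t → B t ^ k)
    ≈-^ zero    p = ≈-reflexive {λ _ → 1ℤ} {λ _ → 1ℤ} (λ _ → refl)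
    ≈-^ {A} {B} (suc k) p = ≈-* {A} {B} {λ t → A t ^ k} {λ t → B t ^ k} p (≈-^ {A} {B} k p)

    I-resp : ∀ {A B} → A ≈ B → I B → I A
    I-resp {A} {B} p b = ext≡ (λ t → l (A t) (B t)) (I-+ p b)
      where
      l : ∀ a b → (a - b) + b ≡ a
      l = solve-∀

  -- An element R of degree ν which, at every archimedean place and after normalising max(∣X∣,∣Y∣,1) = 1,
  -- has absolute value at most a / D.
  record Certificate (M : Modulus) (ν a D : ℕ) : Set where
    open Modulus M
    field
      R Φ     : Fn
      bR      : ℕ
      formR   : Form ν bR R
      formΦ   : Form ν a Φ
      relation : I (λ t → + D * R t - Φ t)
      cancelR : ∀ {A} → I (λ t → R t * A t) → I A

  refine-certificate : ∀ {M ν a D} L (pL : Poly L) → Certificate M ν a D → Certificate (refine M L pL) ν a D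
  refine-certificate {M} L pL c = record
    { R = R ; Φ = Φ ; bR = bR ; formR = formR ; formΦ = formΦ
    ; relation = I-* L relation
    ; cancelR = λ {A} i → cancelR (ext≡ (λ t → l (L t) (R t) (A t)) i) }
    where
    open Modulus M
    open Certificate c
    l : ∀ l r a → l * (r * a) ≡ r * (l * a)
    l = solve-∀

  -- L behaves like a form of degree E - μ.
  record Descends (M : Modulus) (L : Fn) (μ E B : ℕ) : Set where
    open Modulus M
    field
      LX LY  : Fn
      form   : Form E B L
      formX  : Form E B LX
      formY  : Form E B LY
      relX   : I (λ t → L t * X t ^ μ - LX t)
      relY   : I (λ t → L t * Y t ^ μ - LY t)

  module Contraction (M : Modulus) where
    open Congruence M

    descends-^ : ∀ {L μ E B} k → Descends M L μ E B → Descends M (λ t → L t ^ k) (μ ℕ.* k) (k ℕ.* E) (B ℕ.^ k)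
    descends-^ {L} {μ} k d = record
      { LX = λ t → LX t ^ k ; LY = λ t → LY t ^ k
      ; form = Form-^ k form ; formX = Form-^ k formX ; formY = Form-^ k formY
      ; relX = ≈-trans {λ t → L t ^ k * X t ^ (μ ℕ.* k)} {λ t → (L t * X t ^ μ) ^ k} {λ t → LX t ^ k} (≈-reflexive {λ t → L t ^ k * X t ^ (μ ℕ.* k)} {λ t → (L t * X t ^ μ) ^ k} (λ t → e (L t) (X t) k)) (≈-^ {λ t → L t * X t ^ μ} {LX} k relX)
      ; relY = ≈-trans {λ t → L t ^ k * Y t ^ (μ ℕ.* k)} {λ t → (L t * Y t ^ μ) ^ k} {λ t → LY t ^ k} (≈-reflexive {λ t → L t ^ k * Y t ^ (μ ℕ.* k)} {λ t → (L t * Y t ^ μ) ^ k} (λ t → e (L t) (Y t) k)) (≈-^ {λ t → L t * Y t ^ μ} {LY} k relY) }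
      where
      open Descends d
      l : ∀ a b c d → a * b * (c * d) ≡ a * c * (b * d)
      l = solve-∀
      dist : ∀ a b k → a ^ k * b ^ k ≡ (a * b) ^ k
      dist a b zero    = refl
      dist a b (suc k) = trans (l a (a ^ k) b (b ^ k)) (cong (a * b *_) (dist a b k))
      e : ∀ a x k → a ^ k * x ^ (μ ℕ.* k) ≡ (a * x ^ μ) ^ k
      e a x k = trans (cong (a ^ k *_) (sym (^-*-assoc x μ k))) (dist a (x ^ μ) k)

    -- As `n` is at least `3 μ`, a monomial either contains `X ^ μ` or `Y ^ μ`, which `L` turns into
    -- a form of degree `E`, or it has degree at most `2 μ`, and then it can afford to be multiplied
    -- by the form `L` itself.
    lower : ∀ {L μ E B} → Descends M L μ E B → ∀ n → 3 ℕ.* μ ℕ.≤ n → ∀ {b A} → Form n b A →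
      ∃ λ (A' : Fn) → Form (n ℕ.∸ μ ℕ.+ E) (B ℕ.* b) A' × (λ t → L t * A t) ≈ A'
    lower {L} {μ} {E} {B} d n 3μ≤n = go
      where
      open Descends d
      B1 : B ℕ.≤ B ℕ.* 1
      B1 = ℕₚ.≤-reflexive (sym (ℕₚ.*-identityʳ B))
      Goal : ℕ → Fn → Set
      Goal b A = ∃ λ (A' : Fn) → Form (n ℕ.∸ μ ℕ.+ E) (B ℕ.* b) A' × (λ t → L t * A t) ≈ A'
      high : ∀ i j → i ℕ.+ j ℕ.≤ n → μ ℕ.≤ i ⊎ μ ℕ.≤ j ⊎ (i ℕ.< μ × j ℕ.< μ) → Goal 1 (λ t → X t ^ i * Y t ^ j)
      high i j l (inj₁ μ≤i) = _ , cast B1 (λ _ → refl) (Form-mono* i' j i'j≤ formX) ,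
          ext≡ (λ t → trans (e (L t) (X t ^ i') (X t ^ μ) (Y t ^ j) (LX t))
              (cong (λ z → L t * (z * Y t ^ j) - X t ^ i' * Y t ^ j * LX t) (trans (sym (^-distribˡ-+-* (X t) i' μ)) (cong (X t ^_) (ℕₚ.m∸n+n≡m μ≤i)))))
            (I-* (λ t → X t ^ i' * Y t ^ j) relX)
        where
        i' = i ℕ.∸ μ
        i'j≤ : i' ℕ.+ j ℕ.≤ n ℕ.∸ μ
        i'j≤ = ℕₚ.≤-trans (ℕₚ.≤-reflexive (sym (ℕₚ.+-∸-comm j μ≤i))) (ℕₚ.∸-monoˡ-≤ μ l)
        e : ∀ L x m y l → x * y * (L * m - l) ≡ L * (x * m * y) - x * y * l
        e = solve-∀
      high i j l (inj₂ (inj₁ μ≤j)) = _ , cast B1 (λ _ → refl) (Form-mono* i j' ij'≤ formY) ,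
          ext≡ (λ t → trans (e (L t) (X t ^ i) (Y t ^ μ) (Y t ^ j') (LY t))
              (cong (λ z → L t * (X t ^ i * z) - X t ^ i * Y t ^ j' * LY t) (trans (sym (^-distribˡ-+-* (Y t) j' μ)) (cong (Y t ^_) (ℕₚ.m∸n+n≡m μ≤j)))))
            (I-* (λ t → X t ^ i * Y t ^ j') relY)
        where
        j' = j ℕ.∸ μ
        ij'≤ : i ℕ.+ j' ℕ.≤ n ℕ.∸ μ
        ij'≤ = ℕₚ.≤-trans (ℕₚ.≤-reflexive (sym (ℕₚ.+-∸-assoc i μ≤j))) (ℕₚ.∸-monoˡ-≤ μ l)
        e : ∀ L x m y l → x * y * (L * m - l) ≡ L * (x * (y * m)) - x * y * l
        e = solve-∀
      high i j l (inj₂ (inj₂ (i<μ , j<μ))) = _ , cast B1 (λ _ → refl) (Form-mono* i j ij≤ form) ,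
          ≈-reflexive {λ t → L t * (X t ^ i * Y t ^ j)} {λ t → X t ^ i * Y t ^ j * L t} (λ t → *-comm (L t) (X t ^ i * Y t ^ j))
        where
        e : ∀ μ → μ ℕ.+ μ ≡ 3 ℕ.* μ ℕ.∸ μ
        e μ = sym (trans (cong (ℕ._∸ μ) (ℕₚ.+-comm μ (2 ℕ.* μ))) (trans (ℕₚ.m+n∸n≡m (2 ℕ.* μ) μ) (cong (μ ℕ.+_) (ℕₚ.+-identityʳ μ))))
        ij≤ : i ℕ.+ j ℕ.≤ n ℕ.∸ μ
        ij≤ = ℕₚ.≤-trans (ℕₚ.+-mono-≤ (ℕₚ.<⇒≤ i<μ) (ℕₚ.<⇒≤ j<μ)) (ℕₚ.≤-trans (ℕₚ.≤-reflexive (e μ)) (ℕₚ.∸-monoˡ-≤ μ 3μ≤n))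
      split : ∀ i j → μ ℕ.≤ i ⊎ μ ℕ.≤ j ⊎ (i ℕ.< μ × j ℕ.< μ)
      split i j with μ ℕ.≤? i | μ ℕ.≤? j
      ... | yes h | _     = inj₁ h
      ... | no _  | yes h = inj₂ (inj₁ h)
      ... | no g  | no h  = inj₂ (inj₂ (ℕₚ.≰⇒> g , ℕₚ.≰⇒> h))
      go : ∀ {b A} → Form n b A → Goal b A
      go (mono i j l) = high i j l (split i j)
      go zer = _ , cast z≤n (λ _ → refl) zer , ≈-reflexive {λ t → L t * 0ℤ} {λ _ → 0ℤ} (λ t → *-zeroʳ (L t))
      go (add {b} {c} {A₁} {A₂} f g) = _ , cast (ℕₚ.≤-reflexive (sym (ℕₚ.*-distribˡ-+ B b c))) (λ _ → refl) (add (proj₁ (proj₂ (go f))) (proj₁ (proj₂ (go g)))) ,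
        ≈-trans {λ t → L t * (A₁ t + A₂ t)} {λ t → L t * A₁ t + L t * A₂ t} {λ t → proj₁ (go f) t + proj₁ (go g) t} (≈-reflexive {λ t → L t * (A₁ t + A₂ t)} {λ t → L t * A₁ t + L t * A₂ t} (λ t → *-distribˡ-+ (L t) (A₁ t) (A₂ t)))
          (≈-+ {λ t → L t * A₁ t} {proj₁ (go f)} {λ t → L t * A₂ t} {proj₁ (go g)} (proj₂ (proj₂ (go f))) (proj₂ (proj₂ (go g))))
      go (scl {b} {A₁} k f) = _ , cast (ℕₚ.≤-reflexive (e (∣ k ∣) B b)) (λ _ → refl) (scl k (proj₁ (proj₂ (go f)))) ,
          ext≡ (λ t → e' k (L t) (A₁ t) (proj₁ (go f) t)) (I-* (λ _ → k) (proj₂ (proj₂ (go f))))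
        where
        e : ∀ k B b → k ℕ.* (B ℕ.* b) ≡ B ℕ.* (k ℕ.* b)
        e = ℕR.solve-∀
        e' : ∀ k L a a' → k * (L * a - a') ≡ L * (k * a) - k * a'
        e' = solve-∀
      go (cast {A = A₁} {B = A₂} h e f) = _ , cast (ℕₚ.*-monoʳ-≤ B h) (λ _ → refl) (proj₁ (proj₂ (go f))) ,
        ext≡ (λ t → cong (λ z → L t * z - proj₁ (go f) t) (e t)) (proj₂ (proj₂ (go f)))

    -- Let H = max(∣X∣, ∣Y∣, 1) at an archimedean place. The three forms in `Descends` give ∣L∣ ≤ B
    -- H^(E - μ), and the certificate gives ∣R∣ ≤ (a / D) H^ν. Hence R^G L^ν has absolute value at
    -- most B^ν (a / D)^G < 1, because E + G ≤ μ makes the exponent of H at most 0. On the other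
    -- hand all powers of R^G L^ν are integral forms of one fixed degree, so high powers must be
    -- zero.
    contract : ∀ {L μ E B ν a D} → Certificate M ν a D → Descends M L μ E B → ∀ G → E ℕ.+ G ℕ.≤ μ →
      B ℕ.^ ν ℕ.* a ℕ.^ G ℕ.< D ℕ.^ G → ∃ λ j → I (λ t → L t ^ j)
    contract {L} {μ} {E} {B} {ν} {a} {D} c d₀ G le lt = ν ℕ.* j , unR (G ℕ.* j) (ext≡ (λ t → e₃ (L t) (R t)) I-mu)
      where
      open Certificate c
      d = descends-^ ν d₀
      -- The least degree that `lower` accepts for `L ^ ν`. By `deg`, multiplication by `mu` does
      -- not lead out of it.
      n = 3 ℕ.* (μ ℕ.* ν)
      n' = n ℕ.∸ μ ℕ.* ν ℕ.+ ν ℕ.* E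
      B' = B ℕ.^ ν
      u = B' ℕ.* a ℕ.^ G
      v = D ℕ.^ G
      mu : Fn
      mu t = R t ^ G * L t ^ ν
      deg : G ℕ.* ν ℕ.+ n' ℕ.≤ n
      deg = begin
        G ℕ.* ν ℕ.+ (n ℕ.∸ μ ℕ.* ν ℕ.+ ν ℕ.* E) ≡⟨ r₁ G ν (n ℕ.∸ μ ℕ.* ν) E ⟩
        n ℕ.∸ μ ℕ.* ν ℕ.+ (E ℕ.+ G) ℕ.* ν ≤⟨ ℕₚ.+-monoʳ-≤ (n ℕ.∸ μ ℕ.* ν) (ℕₚ.*-monoˡ-≤ ν le) ⟩
        n ℕ.∸ μ ℕ.* ν ℕ.+ μ ℕ.* ν ≡⟨ ℕₚ.m∸n+n≡m (ℕₚ.m≤m+n (μ ℕ.* ν) _) ⟩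
        n ∎
        where
        open ℕₚ.≤-Reasoning
        r₁ : ∀ G ν w E → G ℕ.* ν ℕ.+ (w ℕ.+ ν ℕ.* E) ≡ w ℕ.+ (E ℕ.+ G) ℕ.* ν
        r₁ = ℕR.solve-∀
      -- No control of the coefficients is needed here: integrality at a fixed degree is played off
      -- against the bound in `contracted`.
      integral : ∀ j → ∃ λ b → ∃ λ (A : Fn) → Form n b A × (λ t → mu t ^ j) ≈ A
      integral zero    = 1 , _ , Form-one , ≈-reflexive {λ _ → 1ℤ} {λ _ → 1ℤ} (λ _ → refl)
      integral (suc j) with integral j
      ... | b , A , f , e with lower d n ℕₚ.≤-refl f
      ... | A₁ , f₁ , e₁ = _ , (λ t → R t ^ G * A₁ t) , Form-weaken deg (Form-* (Form-^ G formR) f₁) ,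
        ext≡ (λ t → l (R t ^ G) (L t ^ ν) (mu t ^ j) (A t) (A₁ t)) (I-+ (I-* mu e) (I-* (λ t → R t ^ G) e₁))
        where
        l : ∀ r l m a a₁ → r * l * (m - a) + r * (l * a - a₁) ≡ r * l * m - r * a₁
        l = solve-∀
      contracted : ∀ j → ∃ λ (A : Fn) → Form n (u ℕ.^ j) A × (λ t → + (v ℕ.^ j) * mu t ^ j) ≈ A
      contracted zero    = _ , Form-one , ≈-reflexive {λ _ → + 1 * 1ℤ} {λ _ → 1ℤ} (λ _ → refl)
      contracted (suc j) with contracted j
      ... | A , f , e with lower d n ℕₚ.≤-refl f
      ... | A₁ , f₁ , e₁ = (λ t → Φ t ^ G * A₁ t) ,
          Form-weaken deg (cast (ℕₚ.≤-reflexive (r (a ℕ.^ G) B' (u ℕ.^ j))) (λ _ → refl) (Form-* (Form-^ G formΦ) f₁)) ,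
          ext≡ (λ t → trans (l (Φ t ^ G) ((+ D * R t) ^ G) (+ v) (R t ^ G) (L t ^ ν) (+ (v ℕ.^ j)) (mu t ^ j) (A t) (A₁ t) (DR t))
                 (cong (λ z → z * (R t ^ G * L t ^ ν * mu t ^ j) - Φ t ^ G * A₁ t) (sym (pos-* v (v ℕ.^ j)))))
            (I-+ (I-+ (I-* (λ t → + v * mu t) e) (I-* (λ t → (+ D * R t) ^ G) e₁)) (I-* A₁ (≈-^ {λ t → + D * R t} {Φ} G relation)))
        where
        r : ∀ a B u → a ℕ.* (B ℕ.* u) ≡ B ℕ.* a ℕ.* u
        r = ℕR.solve-∀
        dist : ∀ x y k → (x * y) ^ k ≡ x ^ k * y ^ k
        dist x y zero    = refl
        dist x y (suc k) = trans (cong (x * y *_) (dist x y k)) (sw x y (x ^ k) (y ^ k))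
          where
          sw : ∀ a b c d → a * b * (c * d) ≡ a * c * (b * d)
          sw = solve-∀
        DR : ∀ t → (+ D * R t) ^ G ≡ + v * R t ^ G
        DR t = trans (dist (+ D) (R t) G) (cong (_* R t ^ G) (sym (pos-^ D G)))
        l : ∀ φ dr v r l w m a a₁ → dr ≡ v * r →
          v * (r * l) * (w * m - a) + dr * (l * a - a₁) + a₁ * (dr - φ) ≡ v * w * (r * l * m) - φ * a₁
        l φ .(v * r) v r l w m a a₁ refl = l' φ v r l w m a a₁
          where
          l' : ∀ φ v r l w m a a₁ → v * (r * l) * (w * m - a) + v * r * (l * a - a₁) + a₁ * (v * r - φ) ≡ v * w * (r * l * m) - φ * a₁
          l' = solve-∀
      C = proj₁ (small (suc n))
      -- The power at which (v / u)^j beats the constant of `small` and the factor `2 ^ n` lost in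
      -- expanding forms as polynomials in `Y`.
      arch = archimedean (C ℕ.* 2 ℕ.^ n) u v lt
      j = proj₁ arch
      int = integral j
      con = contracted j
      A₀ = proj₁ (proj₂ int)
      A₁ = proj₁ con
      I-A₀ : I A₀
      I-A₀ = proj₂ (small (suc n)) (v ℕ.^ j) (Form⇒P (proj₁ (proj₂ (proj₂ int)))) (Form⇒P (proj₁ (proj₂ con)))
        (subst (ℕ._< v ℕ.^ j) (ℕₚ.*-assoc C (2 ℕ.^ n) (u ℕ.^ j)) (proj₂ arch))
        (ext≡ (λ t → l (+ (v ℕ.^ j)) (mu t ^ j) (A₀ t) (A₁ t)) (I-- (proj₂ (proj₂ con)) (I-* (λ _ → + (v ℕ.^ j)) (proj₂ (proj₂ (proj₂ int))))))
        where
        l : ∀ v m a a' → (v * m - a') - v * (m - a) ≡ v * a - a'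
        l = solve-∀
      I-mu : I (λ t → mu t ^ j)
      I-mu = I-resp {λ t → mu t ^ j} {A₀} (proj₂ (proj₂ (proj₂ int))) I-A₀
      unR : ∀ k {A} → I (λ t → R t ^ k * A t) → I A
      unR zero    {A} i = ext≡ (λ t → *-identityˡ (A t)) i
      unR (suc k) {A} i = unR k (cancelR (ext≡ (λ t → *-assoc (R t) (R t ^ k) (A t)) i))
      e₃ : ∀ l r → (r ^ G * l ^ ν) ^ j ≡ r ^ (G ℕ.* j) * l ^ (ν ℕ.* j)
      e₃ l r = trans (dist (r ^ G) (l ^ ν) j) (cong₂ _*_ (^-*-assoc r G j) (^-*-assoc l ν j))
        where
        sw : ∀ a b c d → a * b * (c * d) ≡ a * c * (b * d)
        sw = solve-∀
        dist : ∀ x y k → (x * y) ^ k ≡ x ^ k * y ^ k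
        dist x y zero    = refl
        dist x y (suc k) = trans (cong (x * y *_) (dist x y k)) (sw x y (x ^ k) (y ^ k))

open Archimedean

-- Complete homogeneous sums in two values and a residue identity.

module HomogeneousSums where
  open import Data.Integer using (_+_; _*_; _-_; -_; _^_)
  open import Data.Integer.Properties
  open import Data.Integer.Divisibility.Signed

  -- The complete homogeneous symmetric polynomial of degree m in i variables equal to u and j equal to v.
  h : ℕ → ℕ → ℕ → ℤ → ℤ → ℤ
  h zero    i       j       u v = 1ℤ
  h (suc m) zero    zero    u v = 0ℤ
  h (suc m) zero    (suc j) u v = h (suc m) zero j u v + v * h m zero (suc j) u v
  h (suc m) (suc i) j       u v = h (suc m) i j u v + u * h m (suc i) j u v

  h-right : ∀ m i j u v → h (suc m) i (suc j) u v ≡ h (suc m) i j u v + v * h m i (suc j) u v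
  h-right m       zero    j u v = refl
  h-right zero    (suc i) j u v = trans (cong (_+ u * 1ℤ) (h-right zero i j u v)) (l (h 1 i j u v) u v)
    where
    l : ∀ a u v → a + v * 1ℤ + u * 1ℤ ≡ a + u * 1ℤ + v * 1ℤ
    l = solve-∀
  h-right (suc m) (suc i) j u v = trans (cong₂ (λ y z → y + u * z) (h-right (suc m) i j u v) (h-right m (suc i) j u v))
    (l (h (suc (suc m)) i j u v) (h (suc m) i (suc j) u v) (h (suc m) (suc i) j u v) (h m (suc i) (suc j) u v) u v)
    where
    l : ∀ a b c d u v → a + v * b + u * (c + v * d) ≡ a + u * c + v * (b + u * d)
    l = solve-∀

  -- The binomial coefficient (m + i choose m), by the recursion that `h` satisfies when all
  -- variables are equal.
  K : ℕ → ℕ → ℕ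
  K zero    i       = 1
  K (suc m) zero    = K m zero
  K (suc m) (suc i) = K (suc m) i ℕ.+ K m (suc i)

  K-zeroʳ : ∀ m → K m 0 ≡ 1
  K-zeroʳ zero    = refl
  K-zeroʳ (suc m) = K-zeroʳ m

  K-comm : ∀ m i → K m i ≡ K i m
  K-comm zero    zero    = refl
  K-comm zero    (suc i) = sym (K-zeroʳ i)
  K-comm (suc m) zero    = K-zeroʳ m
  K-comm (suc m) (suc i) = trans (cong₂ ℕ._+_ (K-comm (suc m) i) (K-comm m (suc i))) (ℕₚ.+-comm (K i (suc m)) (K (suc i) m))

  K>0 : ∀ m i → 0 ℕ.< K m i
  K>0 zero    i       = s≤s z≤n
  K>0 (suc m) zero    = K>0 m zero
  K>0 (suc m) (suc i) = ℕₚ.≤-trans (K>0 (suc m) i) (ℕₚ.m≤m+n _ _)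

  private
    step : ∀ a b u w → + a * (u * w) + u * (+ b * w) ≡ + (a ℕ.+ b) * (u * w)
    step a b u w = trans (l (+ a) (+ b) u w) (cong (_* (u * w)) (sym (pos-+ a b)))
      where
      l : ∀ a b u w → a * (u * w) + u * (b * w) ≡ (a + b) * (u * w)
      l = solve-∀
    step₀ : ∀ b u w → 0ℤ + u * (b * w) ≡ b * (u * w)
    step₀ = solve-∀

  h-u : ∀ m i u v → h m (suc i) 0 u v ≡ + K m i * u ^ m
  h-u zero    i       u v = refl
  h-u (suc m) zero    u v = trans (cong (λ z → 0ℤ + u * z) (h-u m zero u v)) (step₀ (+ K m 0) u (u ^ m))
  h-u (suc m) (suc i) u v = trans (cong₂ (λ y z → y + u * z) (h-u (suc m) i u v) (h-u m (suc i) u v)) (step (K (suc m) i) (K m (suc i)) u (u ^ m))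

  h-v : ∀ m j u v → h m 0 (suc j) u v ≡ + K m j * v ^ m
  h-v zero    j       u v = refl
  h-v (suc m) zero    u v = trans (cong (λ z → 0ℤ + v * z) (h-v m zero u v)) (step₀ (+ K m 0) v (v ^ m))
  h-v (suc m) (suc j) u v = trans (cong₂ (λ y z → y + v * z) (h-v (suc m) j u v) (h-v m (suc j) u v)) (step (K (suc m) j) (K m (suc j)) v (v ^ m))

  -- The degree is lowered by one; the value 0 in degree - 1 is the residue at a pole of order zero.
  h⁻ : ℕ → ℕ → ℕ → ℤ → ℤ → ℤ
  h⁻ zero    i j u v = 0ℤ
  h⁻ (suc m) i j u v = h m i j u v

  h⁻-right : ∀ m i j u v → h m i (suc j) u v ≡ h m i j u v + v * h⁻ m i (suc j) u v
  h⁻-right zero    i j u v = l v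
    where
    l : ∀ v → 1ℤ ≡ 1ℤ + v * 0ℤ
    l = solve-∀
  h⁻-right (suc m) i j u v = h-right m i j u v

  ε : ℕ → ℤ
  ε p = (- 1ℤ) ^ p

  -- For a = b + 1 the three terms are a^(q + r - 1) times the residues of 1 / (z^(p + 1) (1 - b
  -- z)^q (1 + z)^r) at 0, at 1/b and at - 1.
  S : ℕ → ℕ → ℕ → ℤ → ℤ → ℤ
  S p q r a b = a ^ ℕ.pred (q ℕ.+ r) * h p q r b (- 1ℤ) - b ^ (p ℕ.+ r) * h⁻ q (suc p) r a 1ℤ - ε p * h⁻ r (suc p) q a b

  -- Partial fractions: b + 1 = b (1 + z) + (1 - b z), compared in generating functions. With the
  -- same splitting of the other two residues, this reduces `S-zero` to the cases q = 0 and r = 0.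
  h-mix : ∀ p q r b → (b + 1ℤ) * h p (suc q) (suc r) b (- 1ℤ) ≡ b * h p (suc q) r b (- 1ℤ) + h p q (suc r) b (- 1ℤ)
  h-mix zero    q r b = l b
    where
    l : ∀ b → (b + 1ℤ) * 1ℤ ≡ b * 1ℤ + 1ℤ
    l = solve-∀
  h-mix (suc p) q r b = l b (h (suc p) (suc q) (suc r) b (- 1ℤ)) (h (suc p) (suc q) r b (- 1ℤ)) (h (suc p) q (suc r) b (- 1ℤ)) (h p (suc q) (suc r) b (- 1ℤ))
    (h-right p (suc q) r b (- 1ℤ)) refl
    where
    l : ∀ b H H₁ H₂ H₃ → H ≡ H₁ + - 1ℤ * H₃ → H ≡ H₂ + b * H₃ → (b + 1ℤ) * H ≡ b * H₁ + H₂
    l b H H₁ H₂ H₃ e₁ e₂ = trans (l₁ b H) (trans (cong₂ (λ y z → b * y + z) e₁ e₂) (l₂ b H₁ H₂ H₃))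
      where
      l₁ : ∀ b H → (b + 1ℤ) * H ≡ b * H + H
      l₁ = solve-∀
      l₂ : ∀ b H₁ H₂ H₃ → b * (H₁ + - 1ℤ * H₃) + (H₂ + b * H₃) ≡ b * H₁ + H₂
      l₂ = solve-∀

  -- The sum of the residues of a rational function with three poles vanishes.
  S-zero : ∀ p q r b → S p q r (b + 1ℤ) b ≡ 0ℤ ⊎ (q ≡ 0 × r ≡ 0)
  S-zero p zero    zero    b = inj₂ (refl , refl)
  S-zero p zero    (suc r) b = inj₁ (trans (cong₂ (λ y z → a ^ r * y - b ^ (p ℕ.+ suc r) * 0ℤ - ε p * z) (h-v p r b (- 1ℤ)) (trans (h-u r p a b) (cong (λ z → + z * a ^ r) (K-comm r p))))
      (l (a ^ r) (+ K p r) (ε p) (b ^ (p ℕ.+ suc r))))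
    where
    a = b + 1ℤ
    l : ∀ w k e z → w * (k * e) - z * 0ℤ - e * (k * w) ≡ 0ℤ
    l = solve-∀
  S-zero p (suc q) zero    b = inj₁ (trans (cong (λ z → a ^ z * h p (suc q) 0 b (- 1ℤ) - b ^ (p ℕ.+ 0) * h q (suc p) 0 a 1ℤ - ε p * 0ℤ) (ℕₚ.+-identityʳ q))
      (trans (cong₂ (λ y z → a ^ q * y - b ^ (p ℕ.+ 0) * z - ε p * 0ℤ) (h-u p q b (- 1ℤ)) (trans (h-u q p a 1ℤ) (cong (λ z → + z * a ^ q) (K-comm q p))))
        (trans (cong (λ z → a ^ q * (+ K p q * b ^ p) - b ^ z * (+ K p q * a ^ q) - ε p * 0ℤ) (ℕₚ.+-identityʳ p)) (l (a ^ q) (+ K p q) (b ^ p) (ε p)))))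
    where
    a = b + 1ℤ
    l : ∀ w k x e → w * (k * x) - x * (k * w) - e * 0ℤ ≡ 0ℤ
    l = solve-∀
  S-zero p (suc q) (suc r) b = inj₁ (trans eq (trans (cong₂ (λ y z → b * y + z) (un q r (S-zero p (suc q) r b)) (un' r q (S-zero p q (suc r) b))) (l₀ b)))
    where
    a : ℤ
    a = b + 1ℤ
    l₀ : ∀ b → b * 0ℤ + 0ℤ ≡ 0ℤ
    l₀ = solve-∀
    un : ∀ q r {s} → s ≡ 0ℤ ⊎ (suc q ≡ 0 × r ≡ 0) → s ≡ 0ℤ
    un q r (inj₁ e) = e
    un' : ∀ r q {s} → s ≡ 0ℤ ⊎ (q ≡ 0 × suc r ≡ 0) → s ≡ 0ℤ
    un' r q (inj₁ e) = e
    H₁ H₁' H₂ H₂' H₂'' H₃ H₃' H₃'' w : ℤ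
    w = a ^ (q ℕ.+ r)
    H₁ = h p (suc q) r b (- 1ℤ)
    H₁' = h p q (suc r) b (- 1ℤ)
    H₂' = h q (suc p) r a 1ℤ
    H₂'' = h⁻ q (suc p) (suc r) a 1ℤ
    H₃' = h⁻ r (suc p) (suc q) a b
    H₃'' = h r (suc p) q a b
    H₂ = h q (suc p) (suc r) a 1ℤ
    H₃ = h r (suc p) (suc q) a b
    l₁ : ∀ a w H b z H₂' H₂'' e H₃' H₃'' → a * w * H - b * z * (H₂' + 1ℤ * H₂'') - e * (H₃'' + b * H₃')
       ≡ w * (a * H) - b * z * (H₂' + H₂'') - e * (H₃'' + b * H₃')
    l₁ = solve-∀
    l₂ : ∀ w b H₁ H₁' z H₂' H₂'' e H₃' H₃'' → w * (b * H₁ + H₁') - b * z * (H₂' + H₂'') - e * (H₃'' + b * H₃')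
       ≡ b * (w * H₁ - z * H₂' - e * H₃') + (w * H₁' - b * z * H₂'' - e * H₃'')
    l₂ = solve-∀
    eq : S p (suc q) (suc r) a b ≡ b * S p (suc q) r a b + S p q (suc r) a b
    eq = begin
      a ^ (q ℕ.+ suc r) * h p (suc q) (suc r) b (- 1ℤ) - b ^ (p ℕ.+ suc r) * H₂ - ε p * H₃
        ≡⟨ cong₂ (λ y z → a ^ y * h p (suc q) (suc r) b (- 1ℤ) - b ^ z * H₂ - ε p * H₃) (ℕₚ.+-suc q r) (ℕₚ.+-suc p r) ⟩
      a * w * h p (suc q) (suc r) b (- 1ℤ) - b * b ^ (p ℕ.+ r) * H₂ - ε p * H₃
        ≡⟨ cong₂ (λ y z → a * w * h p (suc q) (suc r) b (- 1ℤ) - b * b ^ (p ℕ.+ r) * y - ε p * z) (h⁻-right q (suc p) r a 1ℤ) (h⁻-right r (suc p) q a b) ⟩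
      a * w * h p (suc q) (suc r) b (- 1ℤ) - b * b ^ (p ℕ.+ r) * (H₂' + 1ℤ * H₂'') - ε p * (H₃'' + b * H₃')
        ≡⟨ l₁ a w (h p (suc q) (suc r) b (- 1ℤ)) b (b ^ (p ℕ.+ r)) H₂' H₂'' (ε p) H₃' H₃'' ⟩
      w * (a * h p (suc q) (suc r) b (- 1ℤ)) - b * b ^ (p ℕ.+ r) * (H₂' + H₂'') - ε p * (H₃'' + b * H₃')
        ≡⟨ cong (λ y → w * y - b * b ^ (p ℕ.+ r) * (H₂' + H₂'') - ε p * (H₃'' + b * H₃')) (h-mix p q r b) ⟩
      w * (b * H₁ + H₁') - b * b ^ (p ℕ.+ r) * (H₂' + H₂'') - ε p * (H₃'' + b * H₃')
        ≡⟨ l₂ w b H₁ H₁' (b ^ (p ℕ.+ r)) H₂' H₂'' (ε p) H₃' H₃'' ⟩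
      b * (w * H₁ - b ^ (p ℕ.+ r) * H₂' - ε p * H₃') + (w * H₁' - b * b ^ (p ℕ.+ r) * H₂'' - ε p * H₃'')
        ≡⟨ cong₂ (λ y z → b * (w * H₁ - b ^ (p ℕ.+ r) * H₂' - ε p * H₃') + (a ^ ℕ.pred y * H₁' - b ^ z * H₂'' - ε p * H₃'')) (sym (ℕₚ.+-suc q r)) (sym (ℕₚ.+-suc p r)) ⟩
      b * S p (suc q) r a b + S p q (suc r) a b ∎
      where open ≡-Reasoning

  h-cong : ∀ m i j u u' v → ∃ λ (k : ℤ) → h m i j u v - h m i j u' v ≡ (u - u') * k
  h-cong zero    i       j       u u' v = 0ℤ , sym (*-zeroʳ (u - u'))
  h-cong (suc m) zero    zero    u u' v = 0ℤ , sym (*-zeroʳ (u - u'))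
  h-cong (suc m) zero    (suc j) u u' v = k₁ + v * k₂ ,
      trans (l v (h (suc m) 0 j u v) (h (suc m) 0 j u' v) (h m 0 (suc j) u v) (h m 0 (suc j) u' v)) (trans (cong₂ (λ y z → y + v * z) (proj₂ c₁) (proj₂ c₂)) (l' (u - u') k₁ v k₂))
    where
    c₁ = h-cong (suc m) zero j u u' v
    c₂ = h-cong m zero (suc j) u u' v
    k₁ = proj₁ c₁
    k₂ = proj₁ c₂
    l : ∀ v a a' b b' → a + v * b - (a' + v * b') ≡ (a - a') + v * (b - b')
    l = solve-∀
    l' : ∀ d k v k' → d * k + v * (d * k') ≡ d * (k + v * k')
    l' = solve-∀
  h-cong (suc m) (suc i) j       u u' v = k₁ + u * k₂ + h m (suc i) j u' v ,
      trans (l u u' (h (suc m) i j u v) (h (suc m) i j u' v) (h m (suc i) j u v) (h m (suc i) j u' v)) (trans (cong₂ (λ y z → y + u * z + (u - u') * h m (suc i) j u' v) (proj₂ c₁) (proj₂ c₂)) (l' (u - u') k₁ u k₂ (h m (suc i) j u' v)))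
    where
    c₁ = h-cong (suc m) i j u u' v
    c₂ = h-cong m (suc i) j u u' v
    k₁ = proj₁ c₁
    k₂ = proj₁ c₂
    l : ∀ u u' a a' b b' → a + u * b - (a' + u' * b') ≡ (a - a') + u * (b - b') + (u - u') * b'
    l = solve-∀
    l' : ∀ d k u k' b → d * k + u * (d * k') + d * b ≡ d * (k + u * k' + b)
    l' = solve-∀

  -- The value of `h` at u = v = 1, that is, the sum of its coefficients.
  Nh : ℕ → ℕ → ℕ → ℕ
  Nh zero    i       j       = 1
  Nh (suc m) zero    zero    = 0
  Nh (suc m) zero    (suc j) = Nh (suc m) zero j ℕ.+ Nh m zero (suc j)
  Nh (suc m) (suc i) j       = Nh (suc m) i j ℕ.+ Nh m (suc i) j

  pascal : ∀ w x y z → w ℕ.* x ℕ.≤ z → 2 ℕ.* w ℕ.* y ℕ.≤ z → 2 ℕ.* w ℕ.* (x ℕ.+ y) ℕ.≤ 3 ℕ.* z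
  pascal w x y z p r = ℕₚ.≤-trans (ℕₚ.≤-reflexive (l w x y)) (ℕₚ.≤-trans (ℕₚ.+-mono-≤ (ℕₚ.*-monoʳ-≤ 2 p) r) (ℕₚ.≤-reflexive (l' z)))
    where
    l : ∀ w x y → 2 ℕ.* w ℕ.* (x ℕ.+ y) ≡ 2 ℕ.* (w ℕ.* x) ℕ.+ 2 ℕ.* w ℕ.* y
    l = ℕR.solve-∀
    l' : ∀ z → 2 ℕ.* z ℕ.+ z ≡ 3 ℕ.* z
    l' = ℕR.solve-∀

  -- Cauchy's estimate at z = 1/3 for the coefficient of z^m in (1 - z)^(-(i + j)). This point is
  -- the best one when i + j is about 2 m, as for diagonal approximants. The induction follows
  -- Pascal's rule.
  Nh-bound : ∀ m i j → 2 ℕ.^ (i ℕ.+ j) ℕ.* Nh m i j ℕ.≤ 3 ℕ.^ (m ℕ.+ (i ℕ.+ j))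
  Nh-bound zero    i       j       = ℕₚ.≤-trans (ℕₚ.≤-reflexive (ℕₚ.*-identityʳ _)) (ℕₚ.^-monoˡ-≤ (i ℕ.+ j) (s≤s (s≤s z≤n)))
  Nh-bound (suc m) zero    zero    = z≤n
  Nh-bound (suc m) zero    (suc j) = pascal (2 ℕ.^ j) (Nh (suc m) 0 j) (Nh m 0 (suc j)) (3 ℕ.^ (m ℕ.+ suc j))
      (ℕₚ.≤-trans (Nh-bound (suc m) 0 j) (ℕₚ.≤-reflexive (cong (3 ℕ.^_) (sym (ℕₚ.+-suc m j))))) (Nh-bound m 0 (suc j))
  Nh-bound (suc m) (suc i) j       = pascal (2 ℕ.^ (i ℕ.+ j)) (Nh (suc m) i j) (Nh m (suc i) j) (3 ℕ.^ (m ℕ.+ suc (i ℕ.+ j)))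
      (ℕₚ.≤-trans (Nh-bound (suc m) i j) (ℕₚ.≤-reflexive (cong (3 ℕ.^_) (sym (ℕₚ.+-suc m (i ℕ.+ j)))))) (Nh-bound m (suc i) j)

  Form-h : ∀ m i j e {U V} → Form e 1 U → Form e 1 V → Form (m ℕ.* e) (Nh m i j) (λ t → h m i j (U t) (V t))
  Form-h zero    i       j       e fU fV = Form-one
  Form-h (suc m) zero    zero    e fU fV = zer
  Form-h (suc m) zero    (suc j) e fU fV = add (Form-h (suc m) 0 j e fU fV)
    (cast (ℕₚ.≤-reflexive (ℕₚ.+-identityʳ _)) (λ _ → refl) (Form-* fV (Form-h m 0 (suc j) e fU fV)))
  Form-h (suc m) (suc i) j       e fU fV = add (Form-h (suc m) i j e fU fV)
    (cast (ℕₚ.≤-reflexive (ℕₚ.+-identityʳ _)) (λ _ → refl) (Form-* fU (Form-h m (suc i) j e fU fV)))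

  abs-step : ∀ a u b x y w z → ∣ a ∣ ℕ.≤ x ℕ.* (w ℕ.* z) → ∣ u ∣ ℕ.≤ w → ∣ b ∣ ℕ.≤ y ℕ.* z → ∣ a + u * b ∣ ℕ.≤ (x ℕ.+ y) ℕ.* (w ℕ.* z)
  abs-step a u b x y w z ha hu hb = ℕₚ.≤-trans (∣i+j∣≤∣i∣+∣j∣ a (u * b)) (ℕₚ.≤-trans
    (ℕₚ.+-mono-≤ ha (ℕₚ.≤-trans (ℕₚ.≤-reflexive (abs-* u b)) (ℕₚ.*-mono-≤ hu hb))) (ℕₚ.≤-reflexive (l x y w z)))
    where
    l : ∀ x y w z → x ℕ.* (w ℕ.* z) ℕ.+ w ℕ.* (y ℕ.* z) ≡ (x ℕ.+ y) ℕ.* (w ℕ.* z)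
    l = ℕR.solve-∀

  abs-h : ∀ m i j u v w → ∣ u ∣ ℕ.≤ w → ∣ v ∣ ℕ.≤ w → ∣ h m i j u v ∣ ℕ.≤ Nh m i j ℕ.* w ℕ.^ m
  abs-h zero    i       j       u v w hu hv = ℕₚ.≤-refl
  abs-h (suc m) zero    zero    u v w hu hv = z≤n
  abs-h (suc m) zero    (suc j) u v w hu hv = abs-step (h (suc m) 0 j u v) v (h m 0 (suc j) u v) (Nh (suc m) 0 j) (Nh m 0 (suc j)) w (w ℕ.^ m)
      (abs-h (suc m) 0 j u v w hu hv) hv (abs-h m 0 (suc j) u v w hu hv)
  abs-h (suc m) (suc i) j       u v w hu hv = abs-step (h (suc m) i j u v) u (h m (suc i) j u v) (Nh (suc m) i j) (Nh m (suc i) j) w (w ℕ.^ m)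
      (abs-h (suc m) i j u v w hu hv) hu (abs-h m (suc i) j u v w hu hv)

-- Padé approximants to the power function and their determinant.

module PadéApproximants where
  open import Data.Integer using (_+_; _*_; _-_; -_; _^_)
  open import Data.Integer.Properties
  open import Data.Integer.Divisibility.Signed
  open HomogeneousSums

  abs-ε : ∀ k → ∣ ε k ∣ ≡ 1
  abs-ε k = trans (abs-^ (- 1ℤ) k) (ℕₚ.^-zeroˡ k)

  ^-cong : ∀ n a a' → ∃ λ (k : ℤ) → a ^ n - a' ^ n ≡ (a - a') * k
  ^-cong zero    a a' = 0ℤ , sym (*-zeroʳ (a - a'))
  ^-cong (suc n) a a' = a ^ n + a' * k , trans (l a a' (a ^ n) (a' ^ n)) (trans (cong (λ z → (a - a') * a ^ n + a' * z) (proj₂ (^-cong n a a'))) (l' (a - a') a' (a ^ n) k))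
    where
    k = proj₁ (^-cong n a a')
    l : ∀ a a' u u' → a * u - a' * u' ≡ (a - a') * u + a' * (u - u')
    l = solve-∀
    l' : ∀ d a' u k → d * u + a' * (d * k) ≡ d * (u + a' * k)
    l' = solve-∀

  -- Two Padé approximants V and W of degree k = 1 + k', for the exponent k + r with r = 1 + r'.
  module Padé (k' r' : ℕ) where
    k r M : ℕ
    k = suc k'
    r = suc r'
    M = k ℕ.+ r

    V₁ V₂ W₁ : ℤ → ℤ
    V₃ W₂ W₃ Δ : ℤ → ℤ → ℤ
    V₁ b = h k (suc k) r b (- 1ℤ)
    V₂ a = h k (suc k) r a 1ℤ
    V₃ a b = ε k * h r' (suc k) (suc k) a b
    W₁ b = h k k (suc r) b (- 1ℤ)
    W₂ a b = b * h k' (suc k) (suc r) a 1ℤ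
    W₃ a b = ε k * h r (suc k) k a b
    Δ a b = V₁ b * W₂ a b - V₂ a * W₁ b

    N : ℕ
    N = Nh k (suc k) r ℕ.+ Nh r' (suc k) (suc k) ℕ.+ Nh k k (suc r) ℕ.+ Nh k' (suc k) (suc r) ℕ.+ Nh r (suc k) k

    S≡0 : ∀ p q r b → ¬ (q ≡ 0 × r ≡ 0) → S p q r (b + 1ℤ) b ≡ 0ℤ
    S≡0 p q r b n with S-zero p q r b
    ... | inj₁ e = e
    ... | inj₂ z = ⊥-elim (n z)

    -- The pole orders are (k + 1, k + 1, r) for V and (k + 1, k, r + 1) for W. In both cases the
    -- exponents of `a` and `b` in `S` become `M`, apart from one surplus factor `b`, which `W₂`
    -- absorbs.
    exact-V : ∀ b → (b + 1ℤ) ^ M * V₁ b - b ^ M * V₂ (b + 1ℤ) - V₃ (b + 1ℤ) b ≡ 0ℤ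
    exact-V b = S≡0 k (suc k) r b (λ ())

    exact-W : ∀ b → (b + 1ℤ) ^ M * W₁ b - b ^ M * W₂ (b + 1ℤ) b - W₃ (b + 1ℤ) b ≡ 0ℤ
    exact-W b = trans (cong (λ z → (b + 1ℤ) ^ M * W₁ b - z - W₃ (b + 1ℤ) b) (sym (trans (cong (λ z → b ^ z * H) (ℕₚ.+-suc k r)) (l b (b ^ M) H))))
      (trans (cong (λ z → (b + 1ℤ) ^ z * W₁ b - b ^ (k ℕ.+ suc r) * H - W₃ (b + 1ℤ) b) (sym (ℕₚ.+-suc k' r))) (S≡0 k k (suc r) b (λ ())))
      where
      H = h k' (suc k) (suc r) (b + 1ℤ) 1ℤ
      l : ∀ b z H → b * z * H ≡ z * (b * H)
      l = solve-∀

    private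
      divisible : ∀ {a d} → (∃ λ (k : ℤ) → a ≡ d * k) → d ∣ a
      divisible {a} {d} (k , e) = divides k (trans e (*-comm d k))

    -- In an ideal only the congruence of `a` and `b + 1` is available, so the identity is needed
    -- for independent `a` and `b`, with a multiple of `a - (b + 1)` as its defect.
    rel-V : ∀ a b → ∃ λ (κ : ℤ) → a ^ M * V₁ b - b ^ M * V₂ a - V₃ a b ≡ κ * (a - (b + 1ℤ))
    rel-V a b = proj₁ c₁ * V₁ b - b ^ M * proj₁ c₂ - ε k * proj₁ c₃ , trans (l (a ^ M) ((b + 1ℤ) ^ M) (V₁ b) (b ^ M) (V₂ a) (V₂ (b + 1ℤ)) (ε k) (H a) (H (b + 1ℤ)) (exact-V b))
        (trans (cong₂ (λ y z → y * V₁ b - b ^ M * (V₂ a - V₂ (b + 1ℤ)) - ε k * z) (proj₂ c₁) (proj₂ c₃))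
          (trans (cong (λ y → d * proj₁ c₁ * V₁ b - b ^ M * y - ε k * (d * proj₁ c₃)) (proj₂ c₂)) (l' d (proj₁ c₁) (V₁ b) (b ^ M) (proj₁ c₂) (ε k) (proj₁ c₃))))
      where
      d : ℤ
      d = a - (b + 1ℤ)
      H : ℤ → ℤ
      H a = h r' (suc k) (suc k) a b
      c₁ = ^-cong M a (b + 1ℤ)
      c₂ = h-cong k (suc k) r a (b + 1ℤ) 1ℤ
      c₃ = h-cong r' (suc k) (suc k) a (b + 1ℤ) b
      l : ∀ am am' v bm v₂ v₂' e h h' → am' * v - bm * v₂' - e * h' ≡ 0ℤ → am * v - bm * v₂ - e * h ≡ (am - am') * v - bm * (v₂ - v₂') - e * (h - h')
      l am am' v bm v₂ v₂' e h h' z = trans (sym (+-identityʳ _)) (trans (cong (λ y → am * v - bm * v₂ - e * h + - y) (sym z)) (l₁ am am' v bm v₂ v₂' e h h'))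
        where
        l₁ : ∀ am am' v bm v₂ v₂' e h h' → am * v - bm * v₂ - e * h + - (am' * v - bm * v₂' - e * h') ≡ (am - am') * v - bm * (v₂ - v₂') - e * (h - h')
        l₁ = solve-∀
      l' : ∀ d k₁ v bm k₂ e k₃ → d * k₁ * v - bm * (d * k₂) - e * (d * k₃) ≡ (k₁ * v - bm * k₂ - e * k₃) * d
      l' = solve-∀

    rel-W : ∀ a b → ∃ λ (κ : ℤ) → a ^ M * W₁ b - b ^ M * W₂ a b - W₃ a b ≡ κ * (a - (b + 1ℤ))
    rel-W a b = proj₁ c₁ * W₁ b - b ^ M * (b * proj₁ c₂) - ε k * proj₁ c₃ , trans (l (a ^ M) ((b + 1ℤ) ^ M) (W₁ b) (b ^ M) b (G a) (G (b + 1ℤ)) (ε k) (H a) (H (b + 1ℤ)) (exact-W b))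
        (trans (cong₂ (λ y z → y * W₁ b - b ^ M * (b * (G a - G (b + 1ℤ))) - ε k * z) (proj₂ c₁) (proj₂ c₃))
          (trans (cong (λ y → d * proj₁ c₁ * W₁ b - b ^ M * (b * y) - ε k * (d * proj₁ c₃)) (proj₂ c₂)) (l' d (proj₁ c₁) (W₁ b) (b ^ M) b (proj₁ c₂) (ε k) (proj₁ c₃))))
      where
      d : ℤ
      d = a - (b + 1ℤ)
      H G : ℤ → ℤ
      H a = h r (suc k) k a b
      G a = h k' (suc k) (suc r) a 1ℤ
      c₁ = ^-cong M a (b + 1ℤ)
      c₂ = h-cong k' (suc k) (suc r) a (b + 1ℤ) 1ℤ
      c₃ = h-cong r (suc k) k a (b + 1ℤ) b
      l : ∀ am am' v bm b v₂ v₂' e h h' → am' * v - bm * (b * v₂') - e * h' ≡ 0ℤ → am * v - bm * (b * v₂) - e * h ≡ (am - am') * v - bm * (b * (v₂ - v₂')) - e * (h - h')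
      l am am' v bm b v₂ v₂' e h h' z = trans (sym (+-identityʳ _)) (trans (cong (λ y → am * v - bm * (b * v₂) - e * h + - y) (sym z)) (l₁ am am' v bm b v₂ v₂' e h h'))
        where
        l₁ : ∀ am am' v bm b v₂ v₂' e h h' → am * v - bm * (b * v₂) - e * h + - (am' * v - bm * (b * v₂') - e * h') ≡ (am - am') * v - bm * (b * (v₂ - v₂')) - e * (h - h')
        l₁ = solve-∀
      l' : ∀ d k₁ v bm b k₂ e k₃ → d * k₁ * v - bm * (b * (d * k₂)) - e * (d * k₃) ≡ (k₁ * v - bm * (b * k₂) - e * k₃) * d
      l' = solve-∀

    rel-Δ : ∀ a b → ∃ λ (κ : ℤ) → Δ a b - Δ (b + 1ℤ) b ≡ κ * (a - (b + 1ℤ))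
    rel-Δ a b = V₁ b * b * proj₁ c₂ - proj₁ c₁ * W₁ b , trans (l (V₁ b) b (G a) (G (b + 1ℤ)) (V₂ a) (V₂ (b + 1ℤ)) (W₁ b))
        (trans (cong₂ (λ y z → V₁ b * (b * y) - z * W₁ b) (proj₂ c₂) (proj₂ c₁)) (l' (a - (b + 1ℤ)) (V₁ b) b (proj₁ c₂) (proj₁ c₁) (W₁ b)))
      where
      G : ℤ → ℤ
      G a = h k' (suc k) (suc r) a 1ℤ
      c₁ = h-cong k (suc k) r a (b + 1ℤ) 1ℤ
      c₂ = h-cong k' (suc k) (suc r) a (b + 1ℤ) 1ℤ
      l : ∀ v b g g' v₂ v₂' w → v * (b * g) - v₂ * w - (v * (b * g') - v₂' * w) ≡ v * (b * (g - g')) - (v₂ - v₂') * w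
      l = solve-∀
      l' : ∀ d v b k₁ k₂ w → v * (b * (d * k₁)) - d * k₂ * w ≡ (v * b * k₁ - k₂ * w) * d
      l' = solve-∀

    -- The value of `Δ` at a = 1 and b = 0, where `W₂` vanishes.
    κ : ℤ
    κ = - (V₂ 1ℤ * W₁ 0ℤ)

    V₂-1 : ∀ m i j → h m i j 1ℤ 1ℤ ≡ + Nh m i j
    V₂-1 zero    i       j       = refl
    V₂-1 (suc m) zero    zero    = refl
    V₂-1 (suc m) zero    (suc j) = trans (cong₂ (λ y z → y + 1ℤ * z) (V₂-1 (suc m) 0 j) (V₂-1 m 0 (suc j))) (trans (cong (_+_ (+ Nh (suc m) 0 j)) (*-identityˡ (+ Nh m 0 (suc j)))) (sym (pos-+ (Nh (suc m) 0 j) _)))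
    V₂-1 (suc m) (suc i) j       = trans (cong₂ (λ y z → y + 1ℤ * z) (V₂-1 (suc m) i j) (V₂-1 m (suc i) j)) (trans (cong (_+_ (+ Nh (suc m) i j)) (*-identityˡ (+ Nh m (suc i) j))) (sym (pos-+ (Nh (suc m) i j) _)))

    Nh>0 : ∀ m i j → 0 ℕ.< Nh m (suc i) j
    Nh>0 zero    i j = s≤s z≤n
    Nh>0 (suc m) i j = ℕₚ.≤-trans (Nh>0 m i j) (ℕₚ.m≤n+m _ (Nh (suc m) i j))

    W₁-0 : ∀ m i j v → h m i j 0ℤ v ≡ h m 0 j 0ℤ v
    W₁-0 zero    i       j v = refl
    W₁-0 (suc m) zero    j v = refl
    W₁-0 (suc m) (suc i) j v = trans (cong (_+_ (h (suc m) i j 0ℤ v)) (*-zeroˡ (h m (suc i) j 0ℤ v))) (trans (+-identityʳ _) (W₁-0 (suc m) i j v))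

    κ≢0 : 0 ℕ.< ∣ κ ∣
    κ≢0 = subst (0 ℕ.<_) (sym (trans (∣-i∣≡∣i∣ (V₂ 1ℤ * W₁ 0ℤ)) (trans (abs-* (V₂ 1ℤ) (W₁ 0ℤ)) (cong₂ ℕ._*_ e₁ e₂))))
        (ℕₚ.*-mono-≤ {1} {Nh k (suc k) r} (Nh>0 k k r) (K>0 k r))
      where
      e₁ : ∣ V₂ 1ℤ ∣ ≡ Nh k (suc k) r
      e₁ = cong ∣_∣ (V₂-1 k (suc k) r)
      e₂ : ∣ W₁ 0ℤ ∣ ≡ K k r
      e₂ = trans (cong ∣_∣ (trans (W₁-0 k k (suc r) (- 1ℤ)) (h-v k r 0ℤ (- 1ℤ)))) (trans (abs-* (+ K k r) (ε k)) (trans (cong (K k r ℕ.*_) (abs-ε k)) (ℕₚ.*-identityʳ _)))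

    private
      five : ∀ a b c d e → let n = a ℕ.+ b ℕ.+ c ℕ.+ d ℕ.+ e in a ℕ.≤ n × b ℕ.≤ n × c ℕ.≤ n × d ℕ.≤ n × e ℕ.≤ n
      five a b c d e =
        ℕₚ.≤-trans (ℕₚ.m≤m+n a b) (ℕₚ.≤-trans (ℕₚ.m≤m+n (a ℕ.+ b) c) abcd) ,
        ℕₚ.≤-trans (ℕₚ.m≤n+m b a) (ℕₚ.≤-trans (ℕₚ.m≤m+n (a ℕ.+ b) c) abcd) ,
        ℕₚ.≤-trans (ℕₚ.m≤n+m c (a ℕ.+ b)) abcd ,
        ℕₚ.≤-trans (ℕₚ.m≤n+m d (a ℕ.+ b ℕ.+ c)) (ℕₚ.m≤m+n (a ℕ.+ b ℕ.+ c ℕ.+ d) e) ,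
        ℕₚ.m≤n+m e (a ℕ.+ b ℕ.+ c ℕ.+ d)
        where
        abcd : a ℕ.+ b ℕ.+ c ℕ.≤ a ℕ.+ b ℕ.+ c ℕ.+ d ℕ.+ e
        abcd = ℕₚ.≤-trans (ℕₚ.m≤m+n (a ℕ.+ b ℕ.+ c) d) (ℕₚ.m≤m+n (a ℕ.+ b ℕ.+ c ℕ.+ d) e)
      all≤ = five (Nh k (suc k) r) (Nh r' (suc k) (suc k)) (Nh k k (suc r)) (Nh k' (suc k) (suc r)) (Nh r (suc k) k)
      ≤₁ : Nh k (suc k) r ℕ.≤ N
      ≤₁ = proj₁ all≤
      ≤₂ : Nh r' (suc k) (suc k) ℕ.≤ N
      ≤₂ = proj₁ (proj₂ all≤)
      ≤₄ : Nh k' (suc k) (suc r) ℕ.≤ N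
      ≤₄ = proj₁ (proj₂ (proj₂ (proj₂ all≤)))
      ≤₅ : Nh r (suc k) k ℕ.≤ N
      ≤₅ = proj₂ (proj₂ (proj₂ (proj₂ all≤)))

    -- Eliminating `V₁` and `W₁` from the two exact identities gives
    -- `a ^ M * Δ = V₃ * W₂ - V₂ * W₃`, and the right-hand side has degree at most `M`.
    Δ-bounded : ∀ b → ∣ Δ (+ b + 1ℤ) (+ b) ∣ ℕ.≤ 2 ℕ.* (N ℕ.* N)
    Δ-bounded b = ℕₚ.*-cancelˡ-≤ (w ℕ.^ M) {{ℕₚ.m^n≢0 w M {{wnz}}}} (begin
        w ℕ.^ M ℕ.* ∣ Δ a β ∣ ≡⟨ cong (ℕ._* ∣ Δ a β ∣) (sym (abs-^ a M)) ⟩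
        ∣ a ^ M ∣ ℕ.* ∣ Δ a β ∣ ≡⟨ sym (abs-* (a ^ M) (Δ a β)) ⟩
        ∣ a ^ M * Δ a β ∣ ≡⟨ cong ∣_∣ (l (a ^ M) (β ^ M) (V₁ β) (V₂ a) (V₃ a β) (W₁ β) (W₂ a β) (W₃ a β) (exact-V β) (exact-W β)) ⟩
        ∣ V₃ a β * W₂ a β - V₂ a * W₃ a β ∣ ≤⟨ ∣i-j∣≤∣i∣+∣j∣ (V₃ a β * W₂ a β) (V₂ a * W₃ a β) ⟩
        ∣ V₃ a β * W₂ a β ∣ ℕ.+ ∣ V₂ a * W₃ a β ∣ ≡⟨ cong₂ ℕ._+_ (abs-* (V₃ a β) (W₂ a β)) (abs-* (V₂ a) (W₃ a β)) ⟩
        ∣ V₃ a β ∣ ℕ.* ∣ W₂ a β ∣ ℕ.+ ∣ V₂ a ∣ ℕ.* ∣ W₃ a β ∣ ≤⟨ ℕₚ.+-mono-≤ (ℕₚ.*-mono-≤ v₃ w₂) (ℕₚ.*-mono-≤ v₂ w₃) ⟩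
        N ℕ.* w ℕ.^ r ℕ.* (N ℕ.* w ℕ.^ k) ℕ.+ N ℕ.* w ℕ.^ k ℕ.* (N ℕ.* w ℕ.^ r) ≡⟨ l₂ N (w ℕ.^ r) (w ℕ.^ k) ⟩
        w ℕ.^ k ℕ.* w ℕ.^ r ℕ.* (2 ℕ.* (N ℕ.* N)) ≡⟨ cong (ℕ._* (2 ℕ.* (N ℕ.* N))) (sym (ℕₚ.^-distribˡ-+-* w k r)) ⟩
        w ℕ.^ M ℕ.* (2 ℕ.* (N ℕ.* N)) ∎)
      where
      open ℕₚ.≤-Reasoning
      β a : ℤ
      β = + b
      a = + b + 1ℤ
      w = b ℕ.+ 1
      wnz : ℕ.NonZero w
      wnz = ℕ.>-nonZero (ℕₚ.m≤n+m 1 b)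
      β≤ : ∣ β ∣ ℕ.≤ w
      β≤ = ℕₚ.m≤m+n b 1
      1≤ : ∣ 1ℤ ∣ ℕ.≤ w
      1≤ = ℕₚ.m≤n+m 1 b
      εN : ∀ z → ∣ ε k * z ∣ ≡ ∣ z ∣
      εN z = trans (abs-* (ε k) z) (trans (cong (ℕ._* ∣ z ∣) (abs-ε k)) (ℕₚ.*-identityˡ _))
      v₂ : ∣ V₂ a ∣ ℕ.≤ N ℕ.* w ℕ.^ k
      v₂ = ℕₚ.≤-trans (abs-h k (suc k) r a 1ℤ w ℕₚ.≤-refl 1≤) (ℕₚ.*-monoˡ-≤ (w ℕ.^ k) ≤₁)
      v₃ : ∣ V₃ a β ∣ ℕ.≤ N ℕ.* w ℕ.^ r
      v₃ = ℕₚ.≤-trans (ℕₚ.≤-reflexive (εN (h r' (suc k) (suc k) a β))) (ℕₚ.≤-trans (abs-h r' (suc k) (suc k) a β w ℕₚ.≤-refl β≤)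
        (ℕₚ.*-mono-≤ ≤₂ (ℕₚ.m≤n*m (w ℕ.^ r') w {{wnz}})))
      w₂ : ∣ W₂ a β ∣ ℕ.≤ N ℕ.* w ℕ.^ k
      w₂ = ℕₚ.≤-trans (ℕₚ.≤-reflexive (abs-* β (h k' (suc k) (suc r) a 1ℤ))) (ℕₚ.≤-trans (ℕₚ.*-mono-≤ β≤ (ℕₚ.≤-trans (abs-h k' (suc k) (suc r) a 1ℤ w ℕₚ.≤-refl 1≤) (ℕₚ.*-monoˡ-≤ (w ℕ.^ k') ≤₄)))
        (ℕₚ.≤-reflexive (l₃ w N (w ℕ.^ k'))))
        where
        l₃ : ∀ w N z → w ℕ.* (N ℕ.* z) ≡ N ℕ.* (w ℕ.* z)
        l₃ = ℕR.solve-∀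
      w₃ : ∣ W₃ a β ∣ ℕ.≤ N ℕ.* w ℕ.^ r
      w₃ = ℕₚ.≤-trans (ℕₚ.≤-reflexive (εN (h r (suc k) k a β))) (ℕₚ.≤-trans (abs-h r (suc k) k a β w ℕₚ.≤-refl β≤) (ℕₚ.*-monoˡ-≤ (w ℕ.^ r) ≤₅))
      l : ∀ am bm v₁ v₂ v₃ w₁ w₂ w₃ → am * v₁ - bm * v₂ - v₃ ≡ 0ℤ → am * w₁ - bm * w₂ - w₃ ≡ 0ℤ → am * (v₁ * w₂ - v₂ * w₁) ≡ v₃ * w₂ - v₂ * w₃
      l am bm v₁ v₂ v₃ w₁ w₂ w₃ e₁ e₂ = trans (l₁ am bm v₁ v₂ v₃ w₁ w₂ w₃) (trans (cong₂ (λ y z → v₃ * w₂ - v₂ * w₃ + y * w₂ - v₂ * z) e₁ e₂) (l₁' v₂ w₂ (v₃ * w₂ - v₂ * w₃)))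
        where
        l₁ : ∀ am bm v₁ v₂ v₃ w₁ w₂ w₃ → am * (v₁ * w₂ - v₂ * w₁) ≡ v₃ * w₂ - v₂ * w₃ + (am * v₁ - bm * v₂ - v₃) * w₂ - v₂ * (am * w₁ - bm * w₂ - w₃)
        l₁ = solve-∀
        l₁' : ∀ v w z → z + 0ℤ * w - v * 0ℤ ≡ z
        l₁' = solve-∀
      l₂ : ∀ N x y → N ℕ.* x ℕ.* (N ℕ.* y) ℕ.+ N ℕ.* y ℕ.* (N ℕ.* x) ≡ y ℕ.* x ℕ.* (2 ℕ.* (N ℕ.* N))
      l₂ = ℕR.solve-∀

    -- Δ is bounded on ℕ and congruent to κ modulo b.
    Δ-const : ∀ b → 2 ℕ.* (N ℕ.* N) ℕ.+ ∣ κ ∣ ℕ.< b → Δ (+ b + 1ℤ) (+ b) ≡ κ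
    Δ-const b lt = i-j≡0⇒i≡j (Δ a β) κ (∣-small {+ b} {Δ a β - κ} (divisible (V₁ β * H - proj₁ c₁ * W₁ β - V₂ 1ℤ * proj₁ c₂ , eq))
        (ℕₚ.≤-<-trans (∣i-j∣≤∣i∣+∣j∣ (Δ a β) κ) (ℕₚ.≤-<-trans (ℕₚ.+-monoˡ-≤ (∣ κ ∣) (Δ-bounded b)) lt)))
      where
      β a : ℤ
      β = + b
      a = + b + 1ℤ
      H = h k' (suc k) (suc r) a 1ℤ
      c₁ = h-cong k (suc k) r a 1ℤ 1ℤ
      c₂ = h-cong k k (suc r) β 0ℤ (- 1ℤ)
      l : ∀ v₁ β H v₂ v₂₀ w w₀ → v₁ * (β * H) - v₂ * w - - (v₂₀ * w₀) ≡ v₁ * (β * H) - (v₂ - v₂₀) * w - v₂₀ * (w - w₀)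
      l = solve-∀
      l' : ∀ v₁ β H k₁ w v k₂ → v₁ * (β * H) - (β + 1ℤ - 1ℤ) * k₁ * w - v * ((β - 0ℤ) * k₂) ≡ β * (v₁ * H - k₁ * w - v * k₂)
      l' = solve-∀
      eq : Δ a β - κ ≡ β * (V₁ β * H - proj₁ c₁ * W₁ β - V₂ 1ℤ * proj₁ c₂)
      eq = trans (l (V₁ β) β H (V₂ a) (V₂ 1ℤ) (W₁ β) (W₁ 0ℤ)) (trans (cong₂ (λ y z → V₁ β * (β * H) - y * W₁ β - V₂ 1ℤ * z) (proj₂ c₁) (proj₂ c₂)) (l' (V₁ β) β H (proj₁ c₁) (W₁ β) (V₂ 1ℤ) (proj₁ c₂)))

open PadéApproximants

-- Contractible elements obtained from approximants.

module Descent where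
  open import Data.Integer using (_+_; _*_; _-_; -_; _^_)
  open import Data.Integer.Properties
  open HomogeneousSums

  Trivial : Modulus → Set
  Trivial M = ¬ ¬ Modulus.I M (λ _ → 1ℤ)

  -- This replaces the primality of a modulus: a nilpotent L may be assumed to be zero.
  nilpotent : (Hyp : Modulus → Set) → (∀ M L pL → Hyp M → Hyp (refine M L pL)) →
    ∀ L → Poly L → (∀ M → Hyp M → Modulus.I M L → Trivial M) →
    ∀ j M → Hyp M → Modulus.I M (λ t → L t ^ j) → Trivial M
  nilpotent Hyp stable L pL concl zero    M hyp i n = n i
  nilpotent Hyp stable L pL concl (suc j) M hyp i n =
    concl (refine M (λ t → L t ^ j) (Poly-^ j pL)) (stable M _ (Poly-^ j pL) hyp) (ext≡ (λ t → *-comm (L t) (L t ^ j)) i)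
      λ i' → nilpotent Hyp stable L pL concl j M hyp (ext≡ (λ t → *-identityʳ (L t ^ j)) i') n
    where open Modulus M

  Form⇒Poly : ∀ {n b A} → Form n b A → Poly A
  Form⇒Poly f = _ , _ , Form⇒P f

  Form-neg : ∀ {n b A} → Form n b A → Form n b (λ t → - A t)
  Form-neg {n} {b} {A} f = cast (ℕₚ.≤-reflexive (ℕₚ.+-identityʳ b)) (λ t → -1*i≡-i (A t)) (scl -[1+ 0 ] f)

  Form-- : ∀ {n b c A B} → Form n b A → Form n c B → Form n (b ℕ.+ c) (λ t → A t - B t)
  Form-- f g = add f (Form-neg g)

  Form-X* : ∀ {n b A} m → Form n b A → Form (m ℕ.+ n) b (λ t → X t ^ m * A t)
  Form-X* {n} {b} m f = cast (ℕₚ.≤-reflexive (ℕₚ.+-identityʳ b)) (λ _ → refl) (Form-* (Form-X m) f)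

  Form-Y* : ∀ {n b A} m → Form n b A → Form (m ℕ.+ n) b (λ t → Y t ^ m * A t)
  Form-Y* {n} {b} m f = cast (ℕₚ.≤-reflexive (ℕₚ.+-identityʳ b)) (λ _ → refl) (Form-* (Form-Y m) f)

  Form-lift : ∀ {n b A} m → Form n b A → Form (m ℕ.+ n) b A
  Form-lift {n} m = Form-weaken (ℕₚ.m≤n+m n m)

  -- The point is that `d` is much smaller than `μ`: for the Padé approximants below `d` is `k s`,
  -- while `μ` is `s` times the sum of both degree parameters.
  record Approximant (M : Modulus) (μ d N : ℕ) (V₁ V₂ V₃ : Fn) : Set where
    field
      form₁ : Form d N V₁
      form₂ : Form d N V₂
      form₃ : Form d N V₃
      rel   : Modulus.I M (λ t → X t ^ μ * V₁ t - Y t ^ μ * V₂ t - V₃ t)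

  module _ (M : Modulus) where
    open Modulus M

    F-I : ∀ n → I (F n) → I (λ t → X t ^ n - Y t ^ n - 1ℤ)
    F-I n = ext≡ (F-def n)

    -- Cramer's rule for the unknowns X^μ and Y^μ in the equations X^m X^μ - Y^m Y^μ = 1 and V₁ X^μ
    -- - V₂ Y^μ = V₃; up to sign `L` is the determinant.
    descends⁺ : ∀ {μ d N V₁ V₂ V₃} m → Approximant M μ d N V₁ V₂ V₃ → I (F (m ℕ.+ μ)) →
      Descends M (λ t → X t ^ m * V₂ t - Y t ^ m * V₁ t) μ (m ℕ.+ d) (N ℕ.+ N)
    descends⁺ {μ} {d} {N} {V₁} {V₂} {V₃} m a i = record
      { LX = λ t → V₂ t - Y t ^ m * V₃ t ; LY = λ t → V₁ t - X t ^ m * V₃ t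
      ; form = Form-- (Form-X* m form₂) (Form-Y* m form₁)
      ; formX = Form-- (Form-lift m form₂) (Form-Y* m form₃)
      ; formY = Form-- (Form-lift m form₁) (Form-X* m form₃)
      ; relX = ext≡ (λ t → lX (X t ^ m) (Y t ^ m) (X t ^ μ) (Y t ^ μ) (V₁ t) (V₂ t) (V₃ t)) (I-- (I-* V₂ i') (I-* (λ t → Y t ^ m) rel))
      ; relY = ext≡ (λ t → lY (X t ^ m) (Y t ^ m) (X t ^ μ) (Y t ^ μ) (V₁ t) (V₂ t) (V₃ t)) (I-- (I-* V₁ i') (I-* (λ t → X t ^ m) rel)) }
      where
      open Approximant a
      i' : I (λ t → X t ^ m * X t ^ μ - Y t ^ m * Y t ^ μ - 1ℤ)
      i' = ext≡ (λ t → cong₂ (λ u v → u - v - 1ℤ) (^-distribˡ-+-* (X t) m μ) (^-distribˡ-+-* (Y t) m μ)) (F-I (m ℕ.+ μ) i)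
      lX : ∀ x y a b v₁ v₂ v₃ → v₂ * (x * a - y * b - 1ℤ) - y * (a * v₁ - b * v₂ - v₃) ≡ (x * v₂ - y * v₁) * a - (v₂ - y * v₃)
      lX = solve-∀
      lY : ∀ x y a b v₁ v₂ v₃ → v₁ * (x * a - y * b - 1ℤ) - x * (a * v₁ - b * v₂ - v₃) ≡ (x * v₂ - y * v₁) * b - (v₁ - x * v₃)
      lY = solve-∀

    -- Cramer's rule again, now for an `r` below the exponent `r + m` of the approximant: the
    -- unknowns are X^r and Y^r, and X^m, Y^m move into the coefficients of the second equation.
    descends⁻ : ∀ {d N V₁ V₂ V₃} r m → Approximant M (r ℕ.+ m) d N V₁ V₂ V₃ → I (F r) →
      Descends M (λ t → Y t ^ m * V₂ t - X t ^ m * V₁ t) r (m ℕ.+ d) (N ℕ.+ N)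
    descends⁻ {d} {N} {V₁} {V₂} {V₃} r m a i = record
      { LX = λ t → Y t ^ m * V₂ t - V₃ t ; LY = λ t → X t ^ m * V₁ t - V₃ t
      ; form = Form-- (Form-Y* m form₂) (Form-X* m form₁)
      ; formX = Form-- (Form-Y* m form₂) (Form-lift m form₃)
      ; formY = Form-- (Form-X* m form₁) (Form-lift m form₃)
      ; relX = ext≡ (λ t → lX (X t ^ m) (Y t ^ m) (X t ^ r) (Y t ^ r) (V₁ t) (V₂ t) (V₃ t)) (I-- (I-* (λ t → Y t ^ m * V₂ t) (F-I r i)) rel')
      ; relY = ext≡ (λ t → lY (X t ^ m) (Y t ^ m) (X t ^ r) (Y t ^ r) (V₁ t) (V₂ t) (V₃ t)) (I-- (I-* (λ t → X t ^ m * V₁ t) (F-I r i)) rel') }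
      where
      open Approximant a
      rel' : I (λ t → X t ^ r * X t ^ m * V₁ t - Y t ^ r * Y t ^ m * V₂ t - V₃ t)
      rel' = ext≡ (λ t → cong₂ (λ u v → u * V₁ t - v * V₂ t - V₃ t) (^-distribˡ-+-* (X t) r m) (^-distribˡ-+-* (Y t) r m)) rel
      lX : ∀ x y a b v₁ v₂ v₃ → y * v₂ * (a - b - 1ℤ) - (a * x * v₁ - b * y * v₂ - v₃) ≡ (y * v₂ - x * v₁) * a - (y * v₂ - v₃)
      lX = solve-∀
      lY : ∀ x y a b v₁ v₂ v₃ → x * v₁ * (a - b - 1ℤ) - (a * x * v₁ - b * y * v₂ - v₃) ≡ (y * v₂ - x * v₁) * b - (x * v₁ - v₃)
      lY = solve-∀

    descended : ∀ {L μ E B} (d : Descends M L μ E B) → I L → I (Descends.LX d) × I (Descends.LY d)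
    descended {L} {μ} d i = ext≡ (λ t → l (L t) (X t ^ μ) (LX t)) (I-- (I-* (λ t → X t ^ μ) i) relX) ,
                        ext≡ (λ t → l (L t) (Y t ^ μ) (LY t)) (I-- (I-* (λ t → Y t ^ μ) i) relY)
      where
      open Descends d
      l : ∀ a b c → b * a - (a * b - c) ≡ c
      l = solve-∀

    cancelX : ∀ m {A} → I (λ t → X t ^ m * A t) → I A
    cancelX zero    {A} i = ext≡ (λ t → *-identityˡ (A t)) i
    cancelX (suc m) {A} i = cancelX m (cancelQ (ext≡ (λ t → l (X t) (Y t) (q t) (X t ^ m) (A t)) (I-* (λ t → Y t * q t) i)))
      where
      l : ∀ x y q w a → y * q * (x * w * a) ≡ x * y * q * (w * a)
      l = solve-∀

    cancelY : ∀ m {A} → I (λ t → Y t ^ m * A t) → I A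
    cancelY zero    {A} i = ext≡ (λ t → *-identityˡ (A t)) i
    cancelY (suc m) {A} i = cancelY m (cancelQ (ext≡ (λ t → l (X t) (Y t) (q t) (Y t ^ m) (A t)) (I-* (λ t → X t * q t) i)))
      where
      l : ∀ x y q w a → x * q * (y * w * a) ≡ x * y * q * (w * a)
      l = solve-∀

    -- The hypotheses make (V₁ , V₂) and (W₁ , W₂) multiples of the same vector (X^m , Y^m). In
    -- `determinant⁻` the common direction is (Y^m , X^m), visible after multiplication by X^m Y^m.
    determinant⁺ : ∀ m {V₁ V₂ V₃ W₁ W₂ W₃ : Fn} → I (λ t → V₂ t - Y t ^ m * V₃ t) → I (λ t → V₁ t - X t ^ m * V₃ t) →
      I (λ t → W₂ t - Y t ^ m * W₃ t) → I (λ t → W₁ t - X t ^ m * W₃ t) → I (λ t → V₁ t * W₂ t - V₂ t * W₁ t)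
    determinant⁺ m {V₁} {V₂} {V₃} {W₁} {W₂} {W₃} v₂ v₁ w₂ w₁ =
      ext≡ (λ t → l (X t ^ m) (Y t ^ m) (V₁ t) (V₂ t) (V₃ t) (W₁ t) (W₂ t) (W₃ t))
        (I-- (I-+ (I-* W₂ v₁) (I-* (λ t → X t ^ m * V₃ t) w₂)) (I-+ (I-* W₁ v₂) (I-* (λ t → Y t ^ m * V₃ t) w₁)))
      where
      l : ∀ x y v₁ v₂ v₃ w₁ w₂ w₃ → w₂ * (v₁ - x * v₃) + x * v₃ * (w₂ - y * w₃) - (w₁ * (v₂ - y * v₃) + y * v₃ * (w₁ - x * w₃)) ≡ v₁ * w₂ - v₂ * w₁
      l = solve-∀

    determinant⁻ : ∀ m {V₁ V₂ V₃ W₁ W₂ W₃ : Fn} → I (λ t → Y t ^ m * V₂ t - V₃ t) → I (λ t → X t ^ m * V₁ t - V₃ t) →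
      I (λ t → Y t ^ m * W₂ t - W₃ t) → I (λ t → X t ^ m * W₁ t - W₃ t) → I (λ t → V₁ t * W₂ t - V₂ t * W₁ t)
    determinant⁻ m {V₁} {V₂} {V₃} {W₁} {W₂} {W₃} v₂ v₁ w₂ w₁ = cancelX m {λ t → V₁ t * W₂ t - V₂ t * W₁ t} (cancelY m {λ t → X t ^ m * (V₁ t * W₂ t - V₂ t * W₁ t)}
      (ext≡ (λ t → l (X t ^ m) (Y t ^ m) (V₁ t) (V₂ t) (V₃ t) (W₁ t) (W₂ t) (W₃ t))
        (I-- (I-+ (I-* (λ t → Y t ^ m * W₂ t) v₁) (I-* V₃ w₂)) (I-+ (I-* (λ t → X t ^ m * W₁ t) v₂) (I-* V₃ w₁)))))
      where
      l : ∀ x y v₁ v₂ v₃ w₁ w₂ w₃ → y * w₂ * (x * v₁ - v₃) + v₃ * (y * w₂ - w₃) - (x * w₁ * (y * v₂ - v₃) + v₃ * (x * w₁ - w₃)) ≡ y * (x * (v₁ * w₂ - v₂ * w₁))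
      l = solve-∀

  record Hypotheses (s r ν a D : ℕ) (M : Modulus) : Set where
    field
      F-s : Modulus.I M (F s)
      F-r : Modulus.I M (F r)
      cert : Certificate M ν a D

  refine-hypotheses : ∀ {s r ν a D} M L pL → Hypotheses s r ν a D M → Hypotheses s r ν a D (refine M L pL)
  refine-hypotheses M L pL hyp = record { F-s = I-* L F-s ; F-r = I-* L F-r ; cert = refine-certificate L pL cert }
    where
    open Modulus M
    open Hypotheses hyp

  module _ {s r ν a D : ℕ} where
    private
      Hyp : Modulus → Set
      Hyp = Hypotheses s r ν a D

    -- Contraction makes `LV` nilpotent, and `nilpotent` allows it to be zero. `LW` is then
    -- contracted in a modulus in which `LV` is already zero, so that both vanish together and the
    -- determinant applies.
    two-approximants : ∀ {V₁ V₂ W₁ W₂ LV LW : Fn} {μ E B} G → E ℕ.+ G ℕ.≤ μ → B ℕ.^ ν ℕ.* a ℕ.^ G ℕ.< D ℕ.^ G →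
      Poly LV → Poly LW → (∀ M → Hyp M → Descends M LV μ E B) → (∀ M → Hyp M → Descends M LW μ E B) →
      (∀ M → Hyp M → Modulus.I M LV → Modulus.I M LW → Modulus.I M (λ t → V₁ t * W₂ t - V₂ t * W₁ t)) →
      (∀ M → Hyp M → Modulus.I M (λ t → V₁ t * W₂ t - V₂ t * W₁ t) → Modulus.I M (λ _ → 1ℤ)) →
      ∀ M → Hyp M → Trivial M
    two-approximants {LV = LV} {LW} G le lt pV pW dV dW det concl M hyp =
      nilpotent Hyp refine-hypotheses LV pV
        (λ M hyp iV → nilpotent (λ M → Hyp M × Modulus.I M LV) (λ M L pL (hyp , i) → refine-hypotheses M L pL hyp , Modulus.I-* M L i) LW pW
          (λ M (hyp , iV) iW n → n (concl M hyp (det M hyp iV iW)))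
          (proj₁ (cW M hyp)) M (hyp , iV) (proj₂ (cW M hyp)))
        (proj₁ (cV M hyp)) M hyp (proj₂ (cV M hyp))
      where
      cV : ∀ M → Hyp M → ∃ λ j → Modulus.I M (λ t → LV t ^ j)
      cV M hyp = Contraction.contract M (Hypotheses.cert hyp) (dV M hyp) G le lt
      cW : ∀ M → Hyp M → ∃ λ j → Modulus.I M (λ t → LW t ^ j)
      cW M hyp = Contraction.contract M (Hypotheses.cert hyp) (dW M hyp) G le lt

    -- For `r` well below `2 s` the equation for `s` is itself the approximant, with V₁ = V₂ = V₃ =
    -- 1. If `L` vanishes, then X^m and Y^m are congruent to 1, so X and Y have absolute value 1
    -- everywhere. Now the element 1 itself can be contracted, because `a < D`.
    first-gap : ∀ m G → r ≡ m ℕ.+ s → 0 ℕ.< m → m ℕ.+ G ℕ.≤ s → a ℕ.< D → 2 ℕ.^ ν ℕ.* a ℕ.^ G ℕ.< D ℕ.^ G → ∀ M → Hyp M → Trivial M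
    first-gap m G refl 0<m le a<D lt M hyp =
      nilpotent Hyp refine-hypotheses L (Form⇒Poly {m ℕ.+ 0} formL) concl (proj₁ (c M hyp)) M hyp (proj₂ (c M hyp))
      where
      L : Fn
      L t = X t ^ m * 1ℤ - Y t ^ m * 1ℤ
      formL : Form (m ℕ.+ 0) 2 L
      formL = Form-- (Form-X* m Form-one) (Form-Y* m Form-one)
      approx : ∀ M → Hyp M → Approximant M s 0 1 (λ _ → 1ℤ) (λ _ → 1ℤ) (λ _ → 1ℤ)
      approx M hyp = record { form₁ = Form-one ; form₂ = Form-one ; form₃ = Form-one
                            ; rel = Modulus.ext≡ M (λ t → l (X t ^ s) (Y t ^ s)) (F-I M s (Hypotheses.F-s hyp)) }
        where
        l : ∀ x y → x - y - 1ℤ ≡ x * 1ℤ - y * 1ℤ - 1ℤ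
        l = solve-∀
      d : ∀ M → Hyp M → Descends M L s (m ℕ.+ 0) 2
      d M hyp = descends⁺ M m (approx M hyp) (Hypotheses.F-r hyp)
      c : ∀ M → Hyp M → ∃ λ j → Modulus.I M (λ t → L t ^ j)
      c M hyp = Contraction.contract M (Hypotheses.cert hyp) (d M hyp) G (subst (λ z → z ℕ.+ G ℕ.≤ s) (sym (ℕₚ.+-identityʳ m)) le) lt
      concl : ∀ M → Hyp M → Modulus.I M L → Trivial M
      concl M hyp iL n = n (ext≡ (λ t → ^-zeroˡ (proj₁ c₁)) (proj₂ c₁))
        where
        open Modulus M
        ds = descended M (d M hyp) iL
        unit : Descends M (λ _ → 1ℤ) m 0 1
        unit = record { LX = λ _ → 1ℤ ; LY = λ _ → 1ℤ ; form = Form-one ; formX = Form-one ; formY = Form-one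
                      ; relX = ext≡ (λ t → l (X t ^ m)) (I-* (λ _ → - 1ℤ) (proj₂ ds)) ; relY = ext≡ (λ t → l (Y t ^ m)) (I-* (λ _ → - 1ℤ) (proj₁ ds)) }
          where
          l : ∀ x → - 1ℤ * (1ℤ - x * 1ℤ) ≡ 1ℤ * x - 1ℤ
          l = solve-∀
        c₁ = Contraction.contract M (Hypotheses.cert hyp) unit m ℕₚ.≤-refl
          (subst (ℕ._< D ℕ.^ m) (sym (trans (cong (ℕ._* a ℕ.^ m) (ℕₚ.^-zeroˡ ν)) (ℕₚ.*-identityˡ _))) (ℕₚ.^-monoˡ-< m {{ℕ.>-nonZero 0<m}} a<D))

    module _ (k' r' N : ℕ) (s≥1 : 1 ℕ.≤ s) (r'≤k' : r' ℕ.≤ k') where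
      private
        module Pa = Padé k' r'
      open Padé k' r' using (k; κ)

      record Bounds : Set where
        field
          n₁ : Nh k (suc k) (suc r') ℕ.≤ N
          n₂ : Nh r' (suc k) (suc k) ℕ.≤ N
          n₃ : Nh k k (suc (suc r')) ℕ.≤ N
          n₄ : Nh k' (suc k) (suc (suc r')) ℕ.≤ N
          n₅ : Nh (suc r') (suc k) k ℕ.≤ N

      module _ (bounds : Bounds) where
        open Bounds bounds
        private
          A B V₁ V₂ V₃ W₁ W₂ W₃ : Fn
          A t = X t ^ s
          B t = Y t ^ s
          V₁ t = Pa.V₁ (B t)
          V₂ t = Pa.V₂ (A t)
          V₃ t = Pa.V₃ (A t) (B t)
          W₁ t = Pa.W₁ (B t)
          W₂ t = Pa.W₂ (A t) (B t)
          W₃ t = Pa.W₃ (A t) (B t)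
          fA : Form s 1 A
          fA = Form-X s
          fB : Form s 1 B
          fB = Form-Y s
          f1 : Form s 1 (λ _ → 1ℤ)
          f1 = Form-one
          f-1 : Form s 1 (λ _ → - 1ℤ)
          f-1 = Form-neg Form-one
          fε : ∀ {d b C} → Form d b C → b ℕ.≤ N → d ℕ.≤ k ℕ.* s → Form (k ℕ.* s) N (λ t → ε k * C t)
          fε {d} {b} f le ld = Form-weaken ld (cast (ℕₚ.≤-trans (ℕₚ.≤-reflexive (trans (cong (ℕ._* b) (abs-ε k)) (ℕₚ.*-identityˡ b))) le) (λ _ → refl) (scl (ε k) f))
          to : ∀ {d b C} → Form d b C → b ℕ.≤ N → Form d N C
          to f le = cast le (λ _ → refl) f
          I-F : ∀ M → Hyp M → Modulus.I M (λ t → A t - (B t + 1ℤ))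
          I-F M hyp = Modulus.ext≡ M (λ t → l (A t) (B t)) (F-I M s (Hypotheses.F-s hyp))
            where
            l : ∀ a b → a - b - 1ℤ ≡ a - (b + 1ℤ)
            l = solve-∀
          up : ∀ x → (x ^ s) ^ Pa.M ≡ x ^ (s ℕ.* Pa.M)
          up x = ^-*-assoc x s Pa.M
          aV : ∀ M → Hyp M → Approximant M (s ℕ.* Pa.M) (k ℕ.* s) N V₁ V₂ V₃
          aV M hyp = record
            { form₁ = to (Form-h k (suc k) (suc r') s fB f-1) n₁
            ; form₂ = to (Form-h k (suc k) (suc r') s fA f1) n₁
            ; form₃ = fε (Form-h r' (suc k) (suc k) s fA fB) n₂ (ℕₚ.*-monoˡ-≤ s (ℕₚ.≤-trans r'≤k' (ℕₚ.n≤1+n k')))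
            ; rel = ext≡ (λ t → trans (sym (proj₂ (Pa.rel-V (A t) (B t)))) (cong₂ (λ u v → u * V₁ t - v * V₂ t - V₃ t) (up (X t)) (up (Y t))))
                      (I-* (λ t → proj₁ (Pa.rel-V (A t) (B t))) (I-F M hyp)) }
            where open Modulus M
          aW : ∀ M → Hyp M → Approximant M (s ℕ.* Pa.M) (k ℕ.* s) N W₁ W₂ W₃
          aW M hyp = record
            { form₁ = to (Form-h k k (suc (suc r')) s fB f-1) n₃
            ; form₂ = to (cast (ℕₚ.≤-reflexive (ℕₚ.+-identityʳ _)) (λ _ → refl) (Form-* fB (Form-h k' (suc k) (suc (suc r')) s fA f1))) n₄
            ; form₃ = fε (Form-h (suc r') (suc k) k s fA fB) n₅ (ℕₚ.*-monoˡ-≤ s (s≤s r'≤k'))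
            ; rel = ext≡ (λ t → trans (sym (proj₂ (Pa.rel-W (A t) (B t)))) (cong₂ (λ u v → u * W₁ t - v * W₂ t - W₃ t) (up (X t)) (up (Y t))))
                      (I-* (λ t → proj₁ (Pa.rel-W (A t) (B t))) (I-F M hyp)) }
            where open Modulus M
          pV₁ : Poly V₁
          pV₁ = Form⇒Poly (Form-h k (suc k) (suc r') s fB f-1)
          pV₂ : Poly V₂
          pV₂ = Form⇒Poly (Form-h k (suc k) (suc r') s fA f1)
          pW₁ : Poly W₁
          pW₁ = Form⇒Poly (Form-h k k (suc (suc r')) s fB f-1)
          pW₂ : Poly W₂
          pW₂ = Form⇒Poly (Form-* fB (Form-h k' (suc k) (suc (suc r')) s fA f1))
          pX : ∀ m → Poly (λ t → X t ^ m)
          pX m = Form⇒Poly (Form-X m)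
          pY : ∀ m → Poly (λ t → Y t ^ m)
          pY m = Form⇒Poly (Form-Y m)
          t≤t^s : ∀ t s → 1 ℕ.≤ s → t ℕ.≤ t ℕ.^ s
          t≤t^s zero    s       _ = z≤n
          t≤t^s (suc t) (suc s) _ = ℕₚ.m≤m*n (suc t) (suc t ℕ.^ s) {{ℕₚ.m^n≢0 (suc t) s}}
          concl : ∀ M → Hyp M → Modulus.I M (λ t → V₁ t * W₂ t - V₂ t * W₁ t) → Modulus.I M (λ _ → 1ℤ)
          concl M hyp i = cancelℤ (∣ κ ∣) Pa.κ≢0 (ext≡ (λ t → sym (*-identityʳ _)) I-∣κ∣)
            where
            open Modulus M
            bound = 2 ℕ.* (Pa.N ℕ.* Pa.N) ℕ.+ ∣ κ ∣
            l : ∀ d d' → d - (d - d') ≡ d'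
            l = solve-∀
            I-Δ : I (λ t → Pa.Δ (B t + 1ℤ) (B t))
            I-Δ = ext≡ (λ t → l (Pa.Δ (A t) (B t)) (Pa.Δ (B t + 1ℤ) (B t)))
              (I-- i (ext≡ (λ t → sym (proj₂ (Pa.rel-Δ (A t) (B t)))) (I-* (λ t → proj₁ (Pa.rel-Δ (A t) (B t))) (I-F M hyp))))
            I-κ : I (λ _ → κ)
            -- `Δ` is known to equal `κ` only at large arguments, which is all that `ext` asks for;
            -- `s ≥ 1` makes `t ^ s` large together with `t`.
            I-κ = ext (suc bound , λ t lt → trans (cong (λ z → Pa.Δ (z + 1ℤ) z) (sym (pos-^ t s))) (Pa.Δ-const (t ℕ.^ s) (ℕₚ.<-≤-trans lt (t≤t^s t s s≥1)))) I-Δ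
            I-∣κ∣ : I (λ _ → + ∣ κ ∣)
            I-∣κ∣ with +∣i∣≡i⊎+∣i∣≡-i κ
            ... | inj₁ e = ext≡ (λ _ → sym e) I-κ
            ... | inj₂ e = ext≡ (λ _ → trans (-1*i≡-i κ) (sym e)) (I-* (λ _ → -[1+ 0 ]) I-κ)

        padé⁺ : ∀ m G → r ≡ m ℕ.+ s ℕ.* Pa.M → m ℕ.+ k ℕ.* s ℕ.+ G ℕ.≤ s ℕ.* Pa.M → (N ℕ.+ N) ℕ.^ ν ℕ.* a ℕ.^ G ℕ.< D ℕ.^ G →
          ∀ M → Hyp M → Trivial M
        padé⁺ m G refl le lt = two-approximants {V₁} {V₂} {W₁} {W₂} G le lt
          (Poly-+ (Poly-* (pX m) pV₂) (Poly-neg (Poly-* (pY m) pV₁))) (Poly-+ (Poly-* (pX m) pW₂) (Poly-neg (Poly-* (pY m) pW₁)))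
          dV dW
          (λ M hyp iV iW → let xV , yV = descended M (dV M hyp) iV ; xW , yW = descended M (dW M hyp) iW in
            determinant⁺ M m {V₁} {V₂} {V₃} {W₁} {W₂} {W₃} xV yV xW yW) concl
          where
          dV : ∀ M → Hyp M → Descends M (λ t → X t ^ m * V₂ t - Y t ^ m * V₁ t) (s ℕ.* Pa.M) (m ℕ.+ k ℕ.* s) (N ℕ.+ N)
          dV M hyp = descends⁺ M m (aV M hyp) (Hypotheses.F-r hyp)
          dW : ∀ M → Hyp M → Descends M (λ t → X t ^ m * W₂ t - Y t ^ m * W₁ t) (s ℕ.* Pa.M) (m ℕ.+ k ℕ.* s) (N ℕ.+ N)
          dW M hyp = descends⁺ M m (aW M hyp) (Hypotheses.F-r hyp)

        padé⁻ : ∀ m G → r ℕ.+ m ≡ s ℕ.* Pa.M → m ℕ.+ k ℕ.* s ℕ.+ G ℕ.≤ r → (N ℕ.+ N) ℕ.^ ν ℕ.* a ℕ.^ G ℕ.< D ℕ.^ G →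
          ∀ M → Hyp M → Trivial M
        padé⁻ m G e le lt = two-approximants {V₁} {V₂} {W₁} {W₂} G le lt
          (Poly-+ (Poly-* (pY m) pV₂) (Poly-neg (Poly-* (pX m) pV₁))) (Poly-+ (Poly-* (pY m) pW₂) (Poly-neg (Poly-* (pX m) pW₁)))
          dV dW
          (λ M hyp iV iW → let xV , yV = descended M (dV M hyp) iV ; xW , yW = descended M (dW M hyp) iW in
            determinant⁻ M m {V₁} {V₂} {V₃} {W₁} {W₂} {W₃} xV yV xW yW) concl
          where
          dV : ∀ M → Hyp M → Descends M (λ t → Y t ^ m * V₂ t - X t ^ m * V₁ t) r (m ℕ.+ k ℕ.* s) (N ℕ.+ N)
          dV M hyp = descends⁻ M r m (subst (λ z → Approximant M z (k ℕ.* s) N V₁ V₂ V₃) (sym e) (aV M hyp)) (Hypotheses.F-r hyp)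
          dW : ∀ M → Hyp M → Descends M (λ t → Y t ^ m * W₂ t - X t ^ m * W₁ t) r (m ℕ.+ k ℕ.* s) (N ℕ.+ N)
          dW M hyp = descends⁻ M r m (subst (λ z → Approximant M z (k ℕ.* s) N W₁ W₂ W₃) (sym e) (aW M hyp)) (Hypotheses.F-r hyp)

open Descent

-- Certificates of smallness that are checked by computation.

module Certificates where
  open import Data.Integer using (_+_; _*_; _-_; -_; _^_)
  open import Data.Integer.Properties

  -- Coefficient lists, lowest degree first.

  evL : List ℤ → Fn
  evL []       t = 0ℤ
  evL (a ∷ as) t = a + + t * evL as t

  addL : List ℤ → List ℤ → List ℤ
  addL []       bs       = bs
  addL (a ∷ as) []       = a ∷ as
  addL (a ∷ as) (b ∷ bs) = (a + b) ∷ addL as bs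

  scaleL : ℤ → List ℤ → List ℤ
  scaleL k = map (k *_)

  mulL : List ℤ → List ℤ → List ℤ
  mulL []       bs = []
  mulL (a ∷ as) bs = addL (scaleL a bs) (0ℤ ∷ mulL as bs)

  powL : List ℤ → ℕ → List ℤ
  powL as zero    = 1ℤ ∷ []
  powL as (suc n) = mulL as (powL as n)

  X^L : ℕ → List ℤ
  X^L zero    = 1ℤ ∷ []
  X^L (suc n) = double (X^L n)
    where
    double : List ℤ → List ℤ
    double as = addL as (0ℤ ∷ as)

  shiftL : ℕ → List ℤ → List ℤ
  shiftL zero    as = as
  shiftL (suc n) as = 0ℤ ∷ shiftL n as

  evL-add : ∀ as bs t → evL (addL as bs) t ≡ evL as t + evL bs t
  evL-add []       bs       t = sym (+-identityˡ _)
  evL-add (a ∷ as) []       t = sym (+-identityʳ _)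
  evL-add (a ∷ as) (b ∷ bs) t = trans (cong (λ z → a + b + + t * z) (evL-add as bs t)) (l a b (+ t) (evL as t) (evL bs t))
    where
    l : ∀ a b t u v → a + b + t * (u + v) ≡ a + t * u + (b + t * v)
    l = solve-∀

  evL-scale : ∀ k as t → evL (scaleL k as) t ≡ k * evL as t
  evL-scale k []       t = sym (*-zeroʳ k)
  evL-scale k (a ∷ as) t = trans (cong (λ z → k * a + + t * z) (evL-scale k as t)) (l k a (+ t) (evL as t))
    where
    l : ∀ k a t u → k * a + t * (k * u) ≡ k * (a + t * u)
    l = solve-∀

  evL-mul : ∀ as bs t → evL (mulL as bs) t ≡ evL as t * evL bs t
  evL-mul []       bs t = sym (*-zeroˡ (evL bs t))
  evL-mul (a ∷ as) bs t = trans (evL-add (scaleL a bs) (0ℤ ∷ mulL as bs) t)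
    (trans (cong₂ (λ y z → y + (0ℤ + + t * z)) (evL-scale a bs t) (evL-mul as bs t)) (l a (+ t) (evL as t) (evL bs t)))
    where
    l : ∀ a t u v → a * v + (0ℤ + t * (u * v)) ≡ (a + t * u) * v
    l = solve-∀

  evL-pow : ∀ as n t → evL (powL as n) t ≡ evL as t ^ n
  evL-pow as zero    t = l (+ t)
    where
    l : ∀ t → 1ℤ + t * 0ℤ ≡ 1ℤ
    l = solve-∀
  evL-pow as (suc n) t = trans (evL-mul as (powL as n) t) (cong (evL as t *_) (evL-pow as n t))

  evL-X^ : ∀ n t → evL (X^L n) t ≡ X t ^ n
  evL-X^ zero    t = l (+ t)
    where
    l : ∀ t → 1ℤ + t * 0ℤ ≡ 1ℤ
    l = solve-∀
  evL-X^ (suc n) t = trans (evL-add (X^L n) (0ℤ ∷ X^L n) t) (trans (cong (λ z → z + (0ℤ + + t * z)) (evL-X^ n t)) (l (+ t) (X t ^ n)))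
    where
    l : ∀ t u → u + (0ℤ + t * u) ≡ (t + 1ℤ) * u
    l = solve-∀

  evL-shift : ∀ n as t → evL (shiftL n as) t ≡ Y t ^ n * evL as t
  evL-shift zero    as t = sym (*-identityˡ _)
  evL-shift (suc n) as t = trans (cong (λ z → 0ℤ + + t * z) (evL-shift n as t)) (l (+ t) (Y t ^ n) (evL as t))
    where
    l : ∀ t u v → 0ℤ + t * (u * v) ≡ t * u * v
    l = solve-∀

  isZero : ℤ → Bool
  isZero z = ∣ z ∣ ℕ.≡ᵇ 0

  isZero-sound : ∀ z → T (isZero z) → z ≡ 0ℤ
  isZero-sound z h = ∣i∣≡0⇒i≡0 (ℕₚ.≡ᵇ⇒≡ (∣ z ∣) 0 h)

  ∧-split : ∀ a b → T (a ∧ b) → T a × T b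
  ∧-split true true h = tt , tt

  zeroL : List ℤ → Bool
  zeroL []       = true
  zeroL (a ∷ as) = isZero a ∧ zeroL as

  zeroL-sound : ∀ as → T (zeroL as) → ∀ t → evL as t ≡ 0ℤ
  zeroL-sound []       h t = refl
  zeroL-sound (a ∷ as) h t = let ha , has = ∧-split (isZero a) (zeroL as) h in
    trans (cong₂ (λ y z → y + + t * z) (isZero-sound a ha) (zeroL-sound as has t)) (l (+ t))
    where
    l : ∀ t → 0ℤ + t * 0ℤ ≡ 0ℤ
    l = solve-∀

  eqL : List ℤ → List ℤ → Bool
  eqL as bs = zeroL (addL as (scaleL -[1+ 0 ] bs))

  eqL-sound : ∀ as bs → T (eqL as bs) → ∀ t → evL as t ≡ evL bs t
  eqL-sound as bs h t = i-j≡0⇒i≡j (evL as t) (evL bs t) (trans (cong (_+_ (evL as t)) (sym (trans (evL-scale -[1+ 0 ] bs t) (-1*i≡-i (evL bs t)))))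
    (trans (sym (evL-add as (scaleL -[1+ 0 ] bs) t)) (zeroL-sound (addL as (scaleL -[1+ 0 ] bs)) h t)))

  Poly-evL : ∀ as → Poly (evL as)
  Poly-evL []       = Poly-const 0ℤ
  Poly-evL (a ∷ as) = Poly-+ (Poly-const a) (Poly-* Poly-t (Poly-evL as))

  FL : ℕ → List ℤ
  FL n = addL (X^L n) (addL (scaleL -[1+ 0 ] (shiftL n (1ℤ ∷ []))) (-[1+ 0 ] ∷ []))

  evL-F : ∀ n t → evL (FL n) t ≡ F n t
  evL-F n t = trans (evL-add (X^L n) _ t) (trans (cong₂ _+_ (evL-X^ n t)
      (trans (evL-add (scaleL -[1+ 0 ] (shiftL n (1ℤ ∷ []))) (-[1+ 0 ] ∷ []) t) (cong (_+ evL (-[1+ 0 ] ∷ []) t)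
        (trans (evL-scale -[1+ 0 ] (shiftL n (1ℤ ∷ [])) t) (cong (-[1+ 0 ] *_) (evL-shift n (1ℤ ∷ []) t))))))
    (trans (l (X t ^ n) (Y t ^ n) (+ t)) (sym (F-def n t))))
    where
    l : ∀ x y t → x + (- 1ℤ * (y * (1ℤ + t * 0ℤ)) + (- 1ℤ + t * 0ℤ)) ≡ x - y - 1ℤ
    l = solve-∀

  -- Integer combinations of monomials X^i Y^j, given by triples (coefficient , i , j).

  Terms : Set
  Terms = List (ℤ × ℕ × ℕ)

  termsF : Terms → Fn
  termsF []                 t = 0ℤ
  termsF ((c , i , j) ∷ ts) t = c * (X t ^ i * Y t ^ j) + termsF ts t

  termsL : Terms → List ℤ
  termsL []                 = []
  termsL ((c , i , j) ∷ ts) = addL (scaleL c (shiftL j (X^L i))) (termsL ts)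

  termsL-sound : ∀ ts t → evL (termsL ts) t ≡ termsF ts t
  termsL-sound []                 t = refl
  termsL-sound ((c , i , j) ∷ ts) t = trans (evL-add (scaleL c (shiftL j (X^L i))) (termsL ts) t)
    (cong₂ _+_ (trans (evL-scale c (shiftL j (X^L i)) t) (cong (c *_) (trans (evL-shift j (X^L i) t) (trans (cong (Y t ^ j *_) (evL-X^ i t)) (*-comm (Y t ^ j) (X t ^ i))))))
      (termsL-sound ts t))

  degrees : ℕ → Terms → Bool
  degrees ν []                 = true
  degrees ν ((c , i , j) ∷ ts) = (i ℕ.+ j ℕ.≤ᵇ ν) ∧ degrees ν ts

  total : Terms → ℕ
  total []                 = 0
  total ((c , i , j) ∷ ts) = ∣ c ∣ ℕ.+ total ts

  Form-terms : ∀ ν ts → T (degrees ν ts) → Form ν (total ts) (termsF ts)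
  Form-terms ν []                 h = zer
  Form-terms ν ((c , i , j) ∷ ts) h = let hi , hts = ∧-split (i ℕ.+ j ℕ.≤ᵇ ν) (degrees ν ts) h in
    add (cast (ℕₚ.≤-reflexive (ℕₚ.*-identityʳ _)) (λ _ → refl) (scl c (mono i j (ℕₚ.≤ᵇ⇒≤ (i ℕ.+ j) ν hi)))) (Form-terms ν ts hts)

  qq : List ℤ
  qq = 1ℤ ∷ 1ℤ ∷ 1ℤ ∷ []

  -- With `E = []` the relations are identities, good for every `s`. Otherwise `E` is what remains
  -- of one particular `F s` after its zeros at `Q` are removed. The relations then hold only at the
  -- zeros of `E`, which allows a smaller ratio of `total Φ` to `D` in comparison with `ν`.
  record CertificateData : Set where
    field
      ν D α β e₀  : ℕ
      E           : List ℤ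
      R Φ         : Terms
      K K'        : List ℤ

  -- e₀ R = (X Y)^α q^β + K E and D R = Φ + K' E.
  valid : CertificateData → Bool
  valid d = (1 ℕ.≤ᵇ e₀) ∧ (degrees ν R ∧ (degrees ν Φ ∧
      (eqL (scaleL (+ e₀) (termsL R)) (addL (shiftL α (mulL (X^L α) (powL qq β))) (mulL K E)) ∧
       eqL (scaleL (+ D) (termsL R)) (addL (termsL Φ) (mulL K' E)))))
    where open CertificateData d

  cancel-q : ∀ (M : Modulus) m {A} → Modulus.I M (λ t → q t ^ m * A t) → Modulus.I M A
  cancel-q M zero    {A} i = Modulus.ext≡ M (λ t → *-identityˡ (A t)) i
  cancel-q M (suc m) {A} i = cancel-q M m (cancelQ (ext≡ (λ t → l (X t) (Y t) (q t) (q t ^ m) (A t)) (I-* (λ t → X t * Y t) i)))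
    where
    open Modulus M
    l : ∀ x y q w a → x * y * (q * w * a) ≡ x * y * q * (w * a)
    l = solve-∀

  certify : (d : CertificateData) → T (valid d) → ∀ M → Modulus.I M (evL (CertificateData.E d)) →
    Certificate M (CertificateData.ν d) (total (CertificateData.Φ d)) (CertificateData.D d)
  certify d ok M iE = record
    { R = termsF R ; Φ = termsF Φ ; bR = total R
    ; formR = Form-terms ν R okR ; formΦ = Form-terms ν Φ okΦ
    ; relation = ext≡ (λ t → l (+ D * termsF R t) (termsF Φ t) (evL K' t) (evL E t) (e₂ t)) (I-* (evL K') iE)
    ; cancelR = λ {A} i → cancel-q M β {A} (cancelX M α {λ t → q t ^ β * A t} (cancelY M α {λ t → X t ^ α * (q t ^ β * A t)}
        (ext≡ (λ t → l' (+ e₀) (termsF R t) (Y t ^ α) (X t ^ α) (q t ^ β) (evL K t) (evL E t) (A t) (e₁ t))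
          (I-- (I-* (λ _ → + e₀) i) (I-* (λ t → evL K t * A t) iE))))) }
    where
    open Modulus M
    open CertificateData d
    s₁ = ∧-split (1 ℕ.≤ᵇ e₀) _ ok
    s₂ = ∧-split (degrees ν R) _ (proj₂ s₁)
    okR = proj₁ s₂
    s₃ = ∧-split (degrees ν Φ) _ (proj₂ s₂)
    okΦ = proj₁ s₃
    s₄ = ∧-split (eqL (scaleL (+ e₀) (termsL R)) (addL (shiftL α (mulL (X^L α) (powL qq β))) (mulL K E))) _ (proj₂ s₃)
    q-list : ∀ t → evL qq t ≡ q t
    q-list t = l₀ (+ t)
      where
      l₀ : ∀ t → 1ℤ + t * (1ℤ + t * (1ℤ + t * 0ℤ)) ≡ t * t + t + 1ℤ
      l₀ = solve-∀
    e₁ : ∀ t → + e₀ * termsF R t ≡ Y t ^ α * (X t ^ α * q t ^ β) + evL K t * evL E t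
    e₁ t = trans (cong (+ e₀ *_) (sym (termsL-sound R t))) (trans (sym (evL-scale (+ e₀) (termsL R) t)) (trans (eqL-sound (scaleL (+ e₀) (termsL R)) (addL (shiftL α (mulL (X^L α) (powL qq β))) (mulL K E)) (proj₁ s₄) t)
      (trans (evL-add (shiftL α (mulL (X^L α) (powL qq β))) (mulL K E) t) (cong₂ _+_
        (trans (evL-shift α (mulL (X^L α) (powL qq β)) t) (cong (Y t ^ α *_) (trans (evL-mul (X^L α) (powL qq β) t)
          (cong₂ _*_ (evL-X^ α t) (trans (evL-pow qq β t) (cong (_^ β) (q-list t)))))))
        (evL-mul K E t)))))
    e₂ : ∀ t → + D * termsF R t ≡ termsF Φ t + evL K' t * evL E t
    e₂ t = trans (cong (+ D *_) (sym (termsL-sound R t))) (trans (sym (evL-scale (+ D) (termsL R) t)) (trans (eqL-sound (scaleL (+ D) (termsL R)) (addL (termsL Φ) (mulL K' E)) (proj₂ s₄) t)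
      (trans (evL-add (termsL Φ) (mulL K' E) t) (cong₂ _+_ (termsL-sound Φ t) (evL-mul K' E t)))))
    l : ∀ dr φ k e → dr ≡ φ + k * e → k * e ≡ dr - φ
    l .(φ + k * e) φ k e refl = l₁ φ (k * e)
      where
      l₁ : ∀ φ u → u ≡ φ + u - φ
      l₁ = solve-∀
    l' : ∀ e₀ r y x q k e a → e₀ * r ≡ y * (x * q) + k * e → e₀ * (r * a) - k * a * e ≡ y * (x * (q * a))
    l' e₀ r y x q k e a eq = trans (l₁ e₀ r a (k * a * e)) (trans (cong (λ z → z * a - k * a * e) eq) (l₂ y x q k e a))
      where
      l₁ : ∀ e r a z → e * (r * a) - z ≡ e * r * a - z
      l₁ = solve-∀
      l₂ : ∀ y x q k e a → (y * (x * q) + k * e) * a - k * a * e ≡ y * (x * (q * a))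
      l₂ = solve-∀

  QQ : List ℤ
  QQ = 0ℤ ∷ 1ℤ ∷ + 2 ∷ + 2 ∷ 1ℤ ∷ []

  -- `T'` collects the zeros of `F s` at `Q`. They have order at most two, so `T'` divides
  -- `n Q ^ 2`, and `Q` can be cancelled modulo the ideal.
  factor : ∀ s n E T' T'' → 0 ℕ.< n → T (eqL (FL s) (mulL T' E)) → T (eqL (mulL T' T'') (scaleL (+ n) (powL QQ 2))) →
    ∀ M → Modulus.I M (F s) → Modulus.I M (evL E)
  factor s n E T' T'' 0<n h₁ h₂ M i = cancelℤ {evL E} n 0<n (cancelQ {λ t → + n * evL E t} (cancelQ {λ t → Q t * (+ n * evL E t)}
      (ext≡ (λ t → trans (cong (evL T'' t *_) (trans (sym (evL-F s t)) (trans (eqL-sound (FL s) (mulL T' E) h₁ t) (evL-mul T' E t))))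
          (trans (l₁ (evL T'' t) (evL T' t) (evL E t)) (trans (cong (_* evL E t) (trans (sym (evL-mul T' T'' t)) (trans (eqL-sound (mulL T' T'') (scaleL (+ n) (powL QQ 2)) h₂ t)
            (trans (evL-scale (+ n) (powL QQ 2) t) (cong (+ n *_) (trans (evL-pow QQ 2 t) (cong (_^ 2) (Q-list t))))))))
            (l₂ (+ n) (Q t) (evL E t)))))
        (I-* (evL T'') i))))
    where
    open Modulus M
    l₁ : ∀ a b c → a * (b * c) ≡ b * a * c
    l₁ = solve-∀
    l₂ : ∀ n q e → n * (q * (q * 1ℤ)) * e ≡ q * (q * (n * e))
    l₂ = solve-∀
    Q-list : ∀ t → evL QQ t ≡ Q t
    Q-list t = l₀ (+ t)
      where
      l₀ : ∀ t → 0ℤ + t * (1ℤ + t * (+ 2 + t * (+ 2 + t * (1ℤ + t * 0ℤ)))) ≡ (t + 1ℤ) * t * (t * t + t + 1ℤ)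
      l₀ = solve-∀

open Certificates

-- Coprimality modulo a prime, by computing in a quotient ring.

module DirectCheck where
  open import Data.Integer using (_+_; _*_; _-_; -_; _^_)
  open import Data.Integer.Properties

  ∨-split : ∀ a b → T (a ∨ b) → T a ⊎ T b
  ∨-split true  b h = inj₁ tt
  ∨-split false b h = inj₂ h

  -- Residues modulo μ of polynomials of degree less than n, highest coefficient first.

  evB : ∀ {n} → Vec ℕ n → Fn
  evB []             t = 0ℤ
  evB {suc n} (a ∷ v) t = + a * Y t ^ n + evB v t

  module Residues (μ : ℕ) .{{_ : ℕ.NonZero μ}} where

    -- Forces the evaluation of the head.
    cons : ∀ {n} → ℕ → Vec ℕ n → Vec ℕ (suc n)
    cons zero    v = zero ∷ v
    cons (suc a) v = suc a ∷ v

    cons-∷ : ∀ {n} a (v : Vec ℕ n) → cons a v ≡ a ∷ v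
    cons-∷ zero    v = refl
    cons-∷ (suc a) v = refl

    -- Computes `Y v + c e`. This is multiplication by `Y`: the leading coefficient `c` that
    -- overflows is put back by means of `Y ^ (n + 1) = e`.
    combine : ∀ {n} → ℕ → Vec ℕ n → Vec ℕ (suc n) → Vec ℕ (suc n)
    combine c []      (e ∷ []) = (c ℕ.* e) % μ ∷ []
    combine c (a ∷ v) (e ∷ w)  = cons ((a ℕ.+ c ℕ.* e) % μ) (combine c v w)

    addMul : ∀ {n} → ℕ → Vec ℕ n → Vec ℕ n → Vec ℕ n
    addMul c []      []      = []
    addMul c (a ∷ v) (b ∷ w) = cons ((a ℕ.+ c ℕ.* b) % μ) (addMul c v w)

    zeroV oneV : ∀ n → Vec ℕ n
    zeroV zero    = []
    zeroV (suc n) = 0 ∷ zeroV n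
    oneV zero          = []
    oneV (suc zero)    = 1 ∷ []
    oneV (suc (suc n)) = 0 ∷ oneV (suc n)

    module Quotient {n : ℕ} (e : Vec ℕ (suc n)) where
      V : Set
      V = Vec ℕ (suc n)

      mulY mulX : V → V
      mulY (c ∷ v) = combine c v e
      mulX v = addMul 1 (mulY v) v

      horner : ∀ {k} → V → V → Vec ℕ k → V
      horner w acc []      = acc
      horner w acc (a ∷ v) = horner w (addMul a (mulY acc) w) v

      mulV : V → V → V
      mulV v w = horner w (zeroV (suc n)) v

      iterate : (V → V) → ℕ → V → V
      iterate f zero    v = v
      iterate f (suc k) v = iterate f k (f v)

      -- The element `x - y - 1`, which is `F r` when x and y hold the powers X^r and Y^r; `pred μ`
      -- stands for - 1.
      value : V → V → V
      value x y = addMul (ℕ.pred μ) (addMul (ℕ.pred μ) x y) (oneV (suc n))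

      run advance : List ℕ → ℕ → V → V → V → V
      run []        r x y p = p
      run (r' ∷ rs) r x y p = advance rs r' (iterate mulX (r' ℕ.∸ r) x) (iterate mulY (r' ℕ.∸ r) y) p
      advance rs r x y p = run rs r x y (mulV p (value x y))

      -- The product of the F r, for r in the given increasing list; x and y are the powers of X and Y reached so far.
      product : List ℕ → V
      product rs = run rs 0 (oneV (suc n)) (oneV (suc n)) (oneV (suc n))

    increasing : ℕ → List ℕ → Bool
    increasing r []        = true
    increasing r (r' ∷ rs) = (r ℕ.≤ᵇ r') ∧ increasing r' rs

    elem : ℕ → List ℕ → Bool
    elem r []        = false
    elem r (r' ∷ rs) = (r ℕ.≡ᵇ r') ∨ elem r rs

    eqV : ∀ {n} → Vec ℕ n → Vec ℕ n → Bool
    eqV []      []      = true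
    eqV (a ∷ v) (b ∷ w) = (a ℕ.≡ᵇ b) ∧ eqV v w

    eqV-sound : ∀ {n} (v w : Vec ℕ n) → T (eqV v w) → ∀ t → evB v t ≡ evB w t
    eqV-sound []      []      h t = refl
    eqV-sound {suc n} (a ∷ v) (b ∷ w) h t = let ha , hv = ∧-split (a ℕ.≡ᵇ b) (eqV v w) h in
      cong₂ (λ y z → + y * Y t ^ n + z) (ℕₚ.≡ᵇ⇒≡ a b ha) (eqV-sound v w hv t)

    private
      rest : ∀ a → + (a % μ) ≡ + a - + μ * + (a / μ)
      rest a = trans (l (+ (a % μ)) (+ μ * + (a / μ))) (cong (_- + μ * + (a / μ)) (trans (cong (_+_ (+ (a % μ))) (trans (sym (pos-* μ (a / μ))) (cong +_ (ℕₚ.*-comm μ (a / μ)))))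
        (trans (sym (pos-+ (a % μ) (a / μ ℕ.* μ))) (cong +_ (sym (m≡m%n+[m/n]*n a μ))))))
        where
        l : ∀ r z → r ≡ r + z - z
        l = solve-∀

      pos-muladd : ∀ a c e → + (a ℕ.+ c ℕ.* e) ≡ + a + + c * + e
      pos-muladd a c e = trans (pos-+ a (c ℕ.* e)) (cong (_+_ (+ a)) (pos-* c e))

    combine-sound : ∀ {n} c (v : Vec ℕ n) w → ∃ λ (C : Fn) → Poly C × ∀ t → evB (combine c v w) t ≡ Y t * evB v t + + c * evB w t - + μ * C t
    combine-sound c [] (e ∷ []) = (λ _ → + (c ℕ.* e / μ)) , Poly-const _ , λ t →
      trans (cong (λ z → z * 1ℤ + 0ℤ) (trans (rest (c ℕ.* e)) (cong (_- + μ * + (c ℕ.* e / μ)) (pos-* c e)))) (l (Y t) (+ c) (+ e) (+ μ * + (c ℕ.* e / μ)))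
      where
      l : ∀ y c e z → (c * e - z) * 1ℤ + 0ℤ ≡ y * 0ℤ + c * (e * 1ℤ + 0ℤ) - z
      l = solve-∀
    combine-sound {suc n} c (a ∷ v) (e ∷ w) = (λ t → + k * Y t ^ suc n + C t) ,
        Poly-+ (Poly-* (Poly-const (+ k)) (Poly-^ (suc n) Poly-t)) (proj₁ (proj₂ ih)) , λ t →
        trans (cong (λ z → evB z t) (cons-∷ ((a ℕ.+ c ℕ.* e) % μ) (combine c v w))) (trans (cong₂ (λ y z → y * Y t ^ suc n + z) (trans (rest (a ℕ.+ c ℕ.* e)) (cong (_- + μ * + k) (pos-muladd a c e))) (proj₂ (proj₂ ih) t))
          (l (Y t) (Y t ^ n) (+ a) (+ c) (+ e) (+ μ) (+ k) (evB v t) (evB w t) (C t)))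
      where
      k = (a ℕ.+ c ℕ.* e) / μ
      ih = combine-sound c v w
      C = proj₁ ih
      l : ∀ y u a c e μ k v w C → (a + c * e - μ * k) * (y * u) + (y * v + c * w - μ * C) ≡ y * (a * u + v) + c * (e * (y * u) + w) - μ * (k * (y * u) + C)
      l = solve-∀

    addMul-sound : ∀ {n} c (v w : Vec ℕ n) → ∃ λ (C : Fn) → Poly C × ∀ t → evB (addMul c v w) t ≡ evB v t + + c * evB w t - + μ * C t
    addMul-sound c [] [] = (λ _ → 0ℤ) , Poly-const 0ℤ , λ t → l (+ c) (+ μ)
      where
      l : ∀ c μ → 0ℤ ≡ 0ℤ + c * 0ℤ - μ * 0ℤ
      l = solve-∀
    addMul-sound {suc n} c (a ∷ v) (b ∷ w) = (λ t → + k * Y t ^ n + C t) , Poly-+ (Poly-* (Poly-const (+ k)) (Poly-^ n Poly-t)) (proj₁ (proj₂ ih)) , λ t →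
        trans (cong (λ z → evB z t) (cons-∷ ((a ℕ.+ c ℕ.* b) % μ) (addMul c v w))) (trans (cong₂ (λ y z → y * Y t ^ n + z) (trans (rest (a ℕ.+ c ℕ.* b)) (cong (_- + μ * + k) (pos-muladd a c b))) (proj₂ (proj₂ ih) t))
          (l (Y t ^ n) (+ a) (+ c) (+ b) (+ μ) (+ k) (evB v t) (evB w t) (C t)))
      where
      k = (a ℕ.+ c ℕ.* b) / μ
      ih = addMul-sound c v w
      C = proj₁ ih
      l : ∀ u a c b μ k v w C → (a + c * b - μ * k) * u + (v + c * w - μ * C) ≡ a * u + v + c * (b * u + w) - μ * (k * u + C)
      l = solve-∀

    zeroV-sound : ∀ n t → evB (zeroV n) t ≡ 0ℤ
    zeroV-sound zero    t = refl
    zeroV-sound (suc n) t = trans (cong₂ _+_ (*-zeroˡ (Y t ^ n)) (zeroV-sound n t)) refl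

    oneV-sound : ∀ n t → evB (oneV (suc n)) t ≡ 1ℤ
    oneV-sound zero    t = refl
    oneV-sound (suc n) t = trans (cong₂ _+_ (*-zeroˡ (Y t ^ suc n)) (oneV-sound n t)) refl

    Poly-evB : ∀ {n} (v : Vec ℕ n) → Poly (evB v)
    Poly-evB []              = Poly-const 0ℤ
    Poly-evB {suc n} (a ∷ v) = Poly-+ (Poly-* (Poly-const (+ a)) (Poly-^ n Poly-t)) (Poly-evB v)

    toL : ∀ {n} → Vec ℕ n → List ℤ → List ℤ
    toL []      acc = acc
    toL (a ∷ v) acc = toL v (+ a ∷ acc)

    toL-sound : ∀ {n} (v : Vec ℕ n) acc t → evL (toL v acc) t ≡ evB v t + Y t ^ n * evL acc t
    toL-sound []              acc t = l (evL acc t)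
      where
      l : ∀ a → a ≡ 0ℤ + 1ℤ * a
      l = solve-∀
    toL-sound {suc n} (a ∷ v) acc t = trans (toL-sound v (+ a ∷ acc) t) (l (evB v t) (Y t ^ n) (+ a) (Y t) (evL acc t))
      where
      l : ∀ v u a y w → v + u * (a + y * w) ≡ a * u + v + y * u * w
      l = solve-∀

    module Sound (M : Modulus) {n : ℕ} (e : Vec ℕ (suc n)) where
      open Modulus M
      open Quotient e

      -- The ideal I + (μ). The cofactor has to be a polynomial because its powers are later reduced
      -- modulo an `F s`, to the bounded degree that `adic` requires.
      record J (A : Fn) : Set where
        constructor inJ
        field
          C  : Fn
          pC : Poly C
          iC : I (λ t → A t - + μ * C t)

      infix 4 _~_
      _~_ : Fn → Fn → Set
      A ~ B = J (λ t → A t - B t)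

      J-ext : ∀ {A B} → (∀ t → A t ≡ B t) → J A → J B
      J-ext {A} {B} h (inJ C pC i) = inJ C pC (ext≡ (λ t → cong (_- + μ * C t) (h t)) i)

      J-I : ∀ {A} → I A → J A
      J-I {A} i = inJ (λ _ → 0ℤ) (Poly-const 0ℤ) (ext≡ (λ t → l (A t) (+ μ)) i)
        where
        l : ∀ a m → a ≡ a - m * 0ℤ
        l = solve-∀

      J-+ : ∀ {A B} → J A → J B → J (λ t → A t + B t)
      J-+ {A} {B} (inJ C pC i) (inJ C' pC' i') = inJ (λ t → C t + C' t) (Poly-+ pC pC') (ext≡ (λ t → l (A t) (B t) (+ μ) (C t) (C' t)) (I-+ i i'))
        where
        l : ∀ a b m c c' → a - m * c + (b - m * c') ≡ a + b - m * (c + c')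
        l = solve-∀

      J-* : ∀ {A} (B : Fn) → Poly B → J A → J (λ t → B t * A t)
      J-* {A} B pB (inJ C pC i) = inJ (λ t → B t * C t) (Poly-* pB pC) (ext≡ (λ t → l (A t) (B t) (+ μ) (C t)) (I-* B i))
        where
        l : ∀ a b m c → b * (a - m * c) ≡ b * a - m * (b * c)
        l = solve-∀

      J-exact : ∀ {A B : Fn} (C : Fn) → Poly C → (∀ t → A t ≡ B t - + μ * C t) → A ~ B
      J-exact {A} {B} C pC h = inJ (λ t → - C t) (Poly-neg pC) (ext≡ (λ t → sym (trans (cong (λ z → z - B t - + μ * - C t) (h t)) (l (B t) (+ μ) (C t)))) I-0)
        where
        l : ∀ b m c → b - m * c - b - m * - c ≡ 0ℤ
        l = solve-∀

      ~-trans : ∀ {A B C} → A ~ B → B ~ C → A ~ C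
      ~-trans {A} {B} {C} p r = J-ext {λ t → (A t - B t) + (B t - C t)} (λ t → l (A t) (B t) (C t)) (J-+ p r)
        where
        l : ∀ a b c → a - b + (b - c) ≡ a - c
        l = solve-∀

      ~-resp : ∀ {A B} → A ~ B → J B → J A
      ~-resp {A} {B} p b = J-ext {λ t → (A t - B t) + B t} (λ t → l (A t) (B t)) (J-+ p b)
        where
        l : ∀ a b → a - b + b ≡ a
        l = solve-∀

      module _ (rel : (λ t → Y t ^ suc n) ~ evB e) where

        mulY-sound : ∀ v → evB (mulY v) ~ (λ t → Y t * evB v t)
        mulY-sound (c ∷ v) = J-ext {λ t → (evB (combine c v e) t - (Y t * evB v t + + c * evB e t)) + - + c * (Y t ^ suc n - evB e t)}
            (λ t → l (evB (combine c v e) t) (Y t) (evB v t) (+ c) (evB e t) (Y t ^ n))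
            (J-+ (J-exact {evB (combine c v e)} {λ t → Y t * evB v t + + c * evB e t} (proj₁ s) (proj₁ (proj₂ s)) (proj₂ (proj₂ s)))
              (J-* (λ _ → - + c) (Poly-const (- + c)) rel))
          where
          s = combine-sound c v e
          l : ∀ r y v c e u → (r - (y * v + c * e)) + - c * (y * u - e) ≡ r - y * (c * u + v)
          l = solve-∀

        addMul-~ : ∀ c (v w : V) {A B : Fn} → evB v ~ A → evB w ~ B → evB (addMul c v w) ~ (λ t → A t + + c * B t)
        addMul-~ c v w {A} {B} p r = ~-trans {evB (addMul c v w)} {λ t → evB v t + + c * evB w t} {λ t → A t + + c * B t}
          (J-exact {evB (addMul c v w)} {λ t → evB v t + + c * evB w t} (proj₁ s) (proj₁ (proj₂ s)) (proj₂ (proj₂ s)))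
          (J-ext {λ t → (evB v t - A t) + + c * (evB w t - B t)} (λ t → l (evB v t) (A t) (+ c) (evB w t) (B t)) (J-+ p (J-* (λ _ → + c) (Poly-const (+ c)) r)))
          where
          s = addMul-sound c v w
          l : ∀ v a c w b → v - a + c * (w - b) ≡ v + c * w - (a + c * b)
          l = solve-∀

        ~-refl : ∀ {A B : Fn} → (∀ t → A t ≡ B t) → A ~ B
        ~-refl {A} {B} h = J-I (ext≡ (λ t → sym (i≡j⇒i-j≡0 (h t))) I-0)

        mulY-~ : ∀ v {A} → evB v ~ A → evB (mulY v) ~ (λ t → Y t * A t)
        mulY-~ v {A} p = ~-trans {evB (mulY v)} {λ t → Y t * evB v t} {λ t → Y t * A t} (mulY-sound v)
          (J-ext {λ t → Y t * (evB v t - A t)} (λ t → l (Y t) (evB v t) (A t)) (J-* Y Poly-t p))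
          where
          l : ∀ y v a → y * (v - a) ≡ y * v - y * a
          l = solve-∀

        mulX-~ : ∀ v {A} → evB v ~ A → evB (mulX v) ~ (λ t → X t * A t)
        mulX-~ v {A} p = ~-trans {evB (mulX v)} {λ t → Y t * A t + + 1 * A t} {λ t → X t * A t} (addMul-~ 1 (mulY v) v {λ t → Y t * A t} {A} (mulY-~ v {A} p) p)
          (~-refl {λ t → Y t * A t + + 1 * A t} {λ t → X t * A t} (λ t → l (Y t) (A t)))
          where
          l : ∀ y a → y * a + + 1 * a ≡ (y + 1ℤ) * a
          l = solve-∀

        horner-~ : ∀ {k} w acc (v : Vec ℕ k) → evB (horner w acc v) ~ (λ t → Y t ^ k * evB acc t + evB v t * evB w t)
        horner-~ w acc [] = ~-refl {evB acc} {λ t → Y t ^ 0 * evB acc t + 0ℤ * evB w t} (λ t → l (evB acc t) (evB w t))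
          where
          l : ∀ a w → a ≡ 1ℤ * a + 0ℤ * w
          l = solve-∀
        horner-~ {suc k} w acc (a ∷ v) = ~-trans {evB (horner w acc' v)} {λ t → Y t ^ k * evB acc' t + evB v t * evB w t} {G} (horner-~ w acc' v)
            (J-ext {λ t → Y t ^ k * (evB acc' t - (Y t * evB acc t + + a * evB w t))} (λ t → l (Y t ^ k) (evB acc' t) (Y t) (evB acc t) (+ a) (evB w t) (evB v t))
              (J-* (λ t → Y t ^ k) (Poly-^ k Poly-t) (addMul-~ a (mulY acc) w {λ t → Y t * evB acc t} {evB w} (mulY-sound acc) (~-refl {evB w} {evB w} (λ _ → refl)))))
          where
          acc' = addMul a (mulY acc) w
          G : Fn
          G t = Y t ^ suc k * evB acc t + (+ a * Y t ^ k + evB v t) * evB w t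
          l : ∀ u c y b a w v → u * (c - (y * b + a * w)) ≡ u * c + v * w - (y * u * b + (a * u + v) * w)
          l = solve-∀

        mulV-~ : ∀ v w → evB (mulV v w) ~ (λ t → evB v t * evB w t)
        mulV-~ v w = ~-trans {evB (mulV v w)} {λ t → Y t ^ suc n * evB (zeroV (suc n)) t + evB v t * evB w t} {λ t → evB v t * evB w t} (horner-~ w (zeroV (suc n)) v)
          (~-refl {λ t → Y t ^ suc n * evB (zeroV (suc n)) t + evB v t * evB w t} {λ t → evB v t * evB w t}
            (λ t → trans (cong (λ z → Y t ^ suc n * z + evB v t * evB w t) (zeroV-sound (suc n) t)) (l (Y t ^ suc n) (evB v t * evB w t))))
          where
          l : ∀ u w → u * 0ℤ + w ≡ w
          l = solve-∀

        mulV-J : ∀ v w → J (evB v) ⊎ J (evB w) → J (evB (mulV v w))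
        mulV-J v w (inj₁ j) = ~-resp {evB (mulV v w)} {λ t → evB v t * evB w t} (mulV-~ v w)
          (J-ext {λ t → evB w t * evB v t} (λ t → *-comm (evB w t) (evB v t)) (J-* (evB w) (Poly-evB w) j))
        mulV-J v w (inj₂ j) = ~-resp {evB (mulV v w)} {λ t → evB v t * evB w t} (mulV-~ v w) (J-* (evB v) (Poly-evB v) j)

        value-~ : ∀ x y {A B : Fn} → Poly B → evB x ~ A → evB y ~ B → evB (value x y) ~ (λ t → A t - B t - 1ℤ)
        value-~ x y {A} {B} pB p r = ~-trans {evB (value x y)} {λ t → A t + + μ' * B t + + μ' * 1ℤ} {λ t → A t - B t - 1ℤ}
            (addMul-~ μ' (addMul μ' x y) (oneV (suc n)) {λ t → A t + + μ' * B t} {λ _ → 1ℤ} (addMul-~ μ' x y {A} {B} p r) (~-refl {evB (oneV (suc n))} {λ _ → 1ℤ} (oneV-sound n)))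
            (inJ (λ t → B t + 1ℤ) (Poly-+ pB (Poly-const 1ℤ)) (ext≡ (λ t → sym (trans (cong (λ z → A t + z * B t + z * 1ℤ - (A t - B t - 1ℤ) - + μ * (B t + 1ℤ)) μ'≡) (l (A t) (B t) (+ μ)))) I-0))
          where
          μ' = ℕ.pred μ
          μ'≡ : + μ' ≡ + μ - 1ℤ
          μ'≡ = trans (l₀ (+ μ')) (cong (_- 1ℤ) (trans (sym (pos-+ 1 μ')) (cong +_ (ℕₚ.suc-pred μ))))
            where
            l₀ : ∀ a → a ≡ 1ℤ + a - 1ℤ
            l₀ = solve-∀
          l : ∀ a b m → a + (m - 1ℤ) * b + (m - 1ℤ) * 1ℤ - (a - b - 1ℤ) - m * (b + 1ℤ) ≡ 0ℤ
          l = solve-∀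

        iterate-X : ∀ k r v → evB v ~ (λ t → X t ^ r) → evB (iterate mulX k v) ~ (λ t → X t ^ (k ℕ.+ r))
        iterate-X zero    r v p = p
        iterate-X (suc k) r v p = subst (λ z → evB (iterate mulX k (mulX v)) ~ (λ t → X t ^ z)) (ℕₚ.+-suc k r) (iterate-X k (suc r) (mulX v) (mulX-~ v {λ t → X t ^ r} p))

        iterate-Y : ∀ k r v → evB v ~ (λ t → Y t ^ r) → evB (iterate mulY k v) ~ (λ t → Y t ^ (k ℕ.+ r))
        iterate-Y zero    r v p = p
        iterate-Y (suc k) r v p = subst (λ z → evB (iterate mulY k (mulY v)) ~ (λ t → Y t ^ z)) (ℕₚ.+-suc k r) (iterate-Y k (suc r) (mulY v) (mulY-~ v {λ t → Y t ^ r} p))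

        run-keep : ∀ rs r x y p → J (evB p) → J (evB (run rs r x y p))
        run-keep []        r x y p j = j
        run-keep (r' ∷ rs) r x y p j = run-keep rs r' _ _ _ (mulV-J p (value (iterate mulX (r' ℕ.∸ r) x) (iterate mulY (r' ℕ.∸ r) y)) (inj₁ j))

        run-hit : ∀ rs r x y p r₀ → T (increasing r rs) → T (elem r₀ rs) → evB x ~ (λ t → X t ^ r) → evB y ~ (λ t → Y t ^ r) → I (F r₀) → J (evB (run rs r x y p))
        run-hit (r' ∷ rs) r x y p r₀ inc el ex ey iF = go (∨-split (r₀ ℕ.≡ᵇ r') (elem r₀ rs) el)
          where
          r≤r' = ℕₚ.≤ᵇ⇒≤ r r' (proj₁ (∧-split (r ℕ.≤ᵇ r') (increasing r' rs) inc))
          x' = iterate mulX (r' ℕ.∸ r) x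
          y' = iterate mulY (r' ℕ.∸ r) y
          ex' : evB x' ~ (λ t → X t ^ r')
          ex' = subst (λ z → evB x' ~ (λ t → X t ^ z)) (ℕₚ.m∸n+n≡m r≤r') (iterate-X (r' ℕ.∸ r) r x ex)
          ey' : evB y' ~ (λ t → Y t ^ r')
          ey' = subst (λ z → evB y' ~ (λ t → Y t ^ z)) (ℕₚ.m∸n+n≡m r≤r') (iterate-Y (r' ℕ.∸ r) r y ey)
          go : T (r₀ ℕ.≡ᵇ r') ⊎ T (elem r₀ rs) → J (evB (run (r' ∷ rs) r x y p))
          go (inj₁ h) = run-keep rs r' x' y' (mulV p (value x' y')) (mulV-J p (value x' y') (inj₂
            (~-resp {evB (value x' y')} {λ t → X t ^ r' - Y t ^ r' - 1ℤ}
              (value-~ x' y' {λ t → X t ^ r'} {λ t → Y t ^ r'} (Poly-^ r' Poly-t) ex' ey')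
              (J-I (F-I M r' (subst (λ z → I (F z)) (ℕₚ.≡ᵇ⇒≡ r₀ r' h) iF))))))
          go (inj₂ h) = run-hit rs r' x' y' (mulV p (value x' y')) r₀ (proj₂ (∧-split (r ℕ.≤ᵇ r') (increasing r' rs) inc)) h ex' ey' iF

        J-one : ∀ rs r inv → T (increasing 0 rs) → T (elem r rs) → I (F r) → T (eqV (mulV (product rs) inv) (oneV (suc n))) → J (λ _ → 1ℤ)
        J-one rs r inv inc el iF ok = J-ext {evB (mulV (product rs) inv)} (λ t → trans (eqV-sound (mulV (product rs) inv) (oneV (suc n)) ok t) (oneV-sound n t))
          (mulV-J (product rs) inv (inj₁ (run-hit rs 0 (oneV (suc n)) (oneV (suc n)) (oneV (suc n)) r inc el one one iF)))
          where
          one : evB (oneV (suc n)) ~ (λ _ → 1ℤ)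
          one = ~-refl {evB (oneV (suc n))} {λ _ → 1ℤ} (oneV-sound n)

      -- If 1 lies in I + (μ), it lies in I + (μ^j) for all j.
      J⇒I : ∀ m → 1 ℕ.< μ → Coprime μ (suc (suc m)) → I (F (suc (suc m))) → J (λ _ → 1ℤ) → I (λ _ → 1ℤ)
      J⇒I m 1<μ cop iF (inJ C pC i) = adic (suc m) μ (suc (suc m)) 1<μ cop (P-pad (s≤s z≤n) (P-const 1ℤ)) λ j →
        let nj , bj , pj = Poly-^ j pC
            Rj , pRj , Kj , ej = pseudo-rem m nj (P-pad (ℕₚ.m≤m+n nj (suc m)) pj)
        in nj , Rj , _ , pRj , ext≡ (λ t → l ((+ suc (suc m)) ^ nj) ((+ μ) ^ j) (C t ^ j) (Kj t) (F (suc (suc m)) t) (Rj t) (ej t))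
             (I-+ (I-* (λ _ → (+ suc (suc m)) ^ nj) (power j)) (I-* (λ t → (+ μ) ^ j * Kj t) iF))
        where
        power : ∀ j → I (λ t → 1ℤ - (+ μ) ^ j * C t ^ j)
        power zero    = ext≡ (λ t → refl) I-0
        power (suc j) = ext≡ (λ t → l₁ (+ μ) (C t) ((+ μ) ^ j) (C t ^ j)) (I-+ i (I-* (λ t → + μ * C t) (power j)))
          where
          l₁ : ∀ m c u v → 1ℤ - m * c + m * c * (1ℤ - u * v) ≡ 1ℤ - m * u * (c * v)
          l₁ = solve-∀
        l : ∀ s m c k f r → s * c ≡ k * f + r → s * (1ℤ - m * c) + m * k * f ≡ s * 1ℤ - m * r
        l s m c k f r e = trans (l₁ s m c k f) (trans (cong (λ z → s * 1ℤ - m * (z - k * f)) e) (l₂ s m k f r))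
          where
          l₁ : ∀ s m c k f → s * (1ℤ - m * c) + m * k * f ≡ s * 1ℤ - m * (s * c - k * f)
          l₁ = solve-∀
          l₂ : ∀ s m k f r → s * 1ℤ - m * (k * f + r - k * f) ≡ s * 1ℤ - m * r
          l₂ = solve-∀

    module _ (M : Modulus) {n : ℕ} (e : Vec ℕ (suc n)) where
      open Modulus M
      open Sound M e

      -- u E = Y^(n+1) - e + μ C
      quotient-relation : ∀ u (E C : List ℤ) → T (eqL (scaleL u E) (addL (shiftL (suc n) (1ℤ ∷ [])) (addL (scaleL -[1+ 0 ] (toL e [])) (scaleL (+ μ) C)))) →
        I (evL E) → (λ t → Y t ^ suc n) ~ evB e
      quotient-relation u E C ok iE = inJ (λ t → - evL C t) (Poly-neg (Poly-evL C))
        (ext≡ (λ t → trans (cong (λ z → z) (eq t)) (l (Y t ^ suc n) (evB e t) (+ μ) (evL C t) (+ t))) (I-* (λ _ → u) iE))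
        where
        eq : ∀ t → u * evL E t ≡ Y t ^ suc n * (1ℤ + + t * 0ℤ) + (-[1+ 0 ] * (evB e t + Y t ^ suc n * 0ℤ) + + μ * evL C t)
        eq t = trans (sym (evL-scale u E t)) (trans (eqL-sound (scaleL u E) (addL (shiftL (suc n) (1ℤ ∷ [])) (addL (scaleL -[1+ 0 ] (toL e [])) (scaleL (+ μ) C))) ok t)
          (trans (evL-add (shiftL (suc n) (1ℤ ∷ [])) (addL (scaleL -[1+ 0 ] (toL e [])) (scaleL (+ μ) C)) t) (cong₂ _+_ (evL-shift (suc n) (1ℤ ∷ []) t)
            (trans (evL-add (scaleL -[1+ 0 ] (toL e [])) (scaleL (+ μ) C) t) (cong₂ _+_ (trans (evL-scale -[1+ 0 ] (toL e []) t) (cong (-[1+ 0 ] *_) (toL-sound e [] t))) (evL-scale (+ μ) C t))))))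
        l : ∀ y e m c t → y * (1ℤ + t * 0ℤ) + (- 1ℤ * (e + y * 0ℤ) + m * c) ≡ y - e - m * - c
        l = solve-∀

open DirectCheck

-- The exponents settled by each approximant.

module Coverage where
  open HomogeneousSums using (Nh; Nh-bound)

  *-^ : ∀ x y n → (x ℕ.* y) ℕ.^ n ≡ x ℕ.^ n ℕ.* y ℕ.^ n
  *-^ x y zero    = refl
  *-^ x y (suc n) = trans (cong (x ℕ.* y ℕ.*_) (*-^ x y n)) (l x y (x ℕ.^ n) (y ℕ.^ n))
    where
    l : ∀ a b c d → a ℕ.* b ℕ.* (c ℕ.* d) ≡ a ℕ.* c ℕ.* (b ℕ.* d)
    l = ℕR.solve-∀

  gain-mono : ∀ c a D {G₀ G} → 0 ℕ.< D → a ℕ.≤ D → G₀ ℕ.≤ G → c ℕ.* a ℕ.^ G₀ ℕ.< D ℕ.^ G₀ → c ℕ.* a ℕ.^ G ℕ.< D ℕ.^ G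
  gain-mono c a D {G₀} {G} 0<D a≤D G₀≤G lt = subst (λ z → c ℕ.* a ℕ.^ z ℕ.< D ℕ.^ z) (ℕₚ.m+[n∸m]≡n G₀≤G) (begin-strict
    c ℕ.* a ℕ.^ (G₀ ℕ.+ g)        ≡⟨ trans (cong (c ℕ.*_) (ℕₚ.^-distribˡ-+-* a G₀ g)) (sym (ℕₚ.*-assoc c (a ℕ.^ G₀) (a ℕ.^ g))) ⟩
    c ℕ.* a ℕ.^ G₀ ℕ.* a ℕ.^ g    ≤⟨ ℕₚ.*-monoʳ-≤ (c ℕ.* a ℕ.^ G₀) (ℕₚ.^-monoˡ-≤ g a≤D) ⟩
    c ℕ.* a ℕ.^ G₀ ℕ.* D ℕ.^ g    <⟨ ℕₚ.*-monoˡ-< (D ℕ.^ g) {{ℕₚ.m^n≢0 D g {{ℕ.>-nonZero 0<D}}}} lt ⟩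
    D ℕ.^ G₀ ℕ.* D ℕ.^ g          ≡⟨ sym (ℕₚ.^-distribˡ-+-* D G₀ g) ⟩
    D ℕ.^ (G₀ ℕ.+ g) ∎)
    where
    open ℕₚ.≤-Reasoning
    g = G ℕ.∸ G₀

  -- The degree parameters of a Padé approximant, a bound `N` for its coefficient sums, and a gain
  -- `G` in degree that is large enough for contraction.
  record Entry : Set where
    constructor entry
    field
      k' r' N G : ℕ

  valid-entry : ℕ → ℕ → ℕ → Entry → Bool
  valid-entry ν a D (entry k' r' N G) = (r' ℕ.≤ᵇ k') ∧ ((Nh k (suc k) (suc r') ℕ.≤ᵇ N) ∧ ((Nh r' (suc k) (suc k) ℕ.≤ᵇ N) ∧
    ((Nh k k (suc (suc r')) ℕ.≤ᵇ N) ∧ ((Nh k' (suc k) (suc (suc r')) ℕ.≤ᵇ N) ∧ ((Nh (suc r') (suc k) k ℕ.≤ᵇ N) ∧ ((N ℕ.+ N) ℕ.^ ν ℕ.* a ℕ.^ G ℕ.<ᵇ D ℕ.^ G))))))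
    where k = suc k'

  covers⁺ covers⁻ covers : ℕ → ℕ → Entry → Bool
  covers⁺ s r (entry k' r' N G) = let μ = s ℕ.* (suc k' ℕ.+ suc r') in (μ ℕ.≤ᵇ r) ∧ (r ℕ.∸ μ ℕ.+ suc k' ℕ.* s ℕ.+ G ℕ.≤ᵇ μ)
  covers⁻ s r (entry k' r' N G) = let μ = s ℕ.* (suc k' ℕ.+ suc r') in (r ℕ.≤ᵇ μ) ∧ (μ ℕ.∸ r ℕ.+ suc k' ℕ.* s ℕ.+ G ℕ.≤ᵇ r)
  covers s r e = covers⁺ s r e ∨ covers⁻ s r e

  covers-sound : ∀ ν a D e → T (valid-entry ν a D e) → ∀ s r → 1 ℕ.≤ s → T (covers s r e) → ∀ M → Hypotheses s r ν a D M → Trivial M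
  covers-sound ν a D e@(entry k' r' N G) ok s r 1≤s c = pick (∨-split (covers⁺ s r e) (covers⁻ s r e) c)
    where
    k = suc k'
    μ = s ℕ.* (suc k' ℕ.+ suc r')
    s₁ = ∧-split (r' ℕ.≤ᵇ k') _ ok
    s₂ = ∧-split (Nh k (suc k) (suc r') ℕ.≤ᵇ N) _ (proj₂ s₁)
    s₃ = ∧-split (Nh r' (suc k) (suc k) ℕ.≤ᵇ N) _ (proj₂ s₂)
    s₄ = ∧-split (Nh k k (suc (suc r')) ℕ.≤ᵇ N) _ (proj₂ s₃)
    s₅ = ∧-split (Nh k' (suc k) (suc (suc r')) ℕ.≤ᵇ N) _ (proj₂ s₄)
    s₆ = ∧-split (Nh (suc r') (suc k) k ℕ.≤ᵇ N) _ (proj₂ s₅)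
    r'≤k' = ℕₚ.≤ᵇ⇒≤ r' k' (proj₁ s₁)
    lt = ℕₚ.<ᵇ⇒< ((N ℕ.+ N) ℕ.^ ν ℕ.* a ℕ.^ G) (D ℕ.^ G) (proj₂ s₆)
    bounds : Bounds {s} {r} {ν} {a} {D} k' r' N 1≤s r'≤k'
    bounds = record { n₁ = ℕₚ.≤ᵇ⇒≤ _ N (proj₁ s₂) ; n₂ = ℕₚ.≤ᵇ⇒≤ _ N (proj₁ s₃) ; n₃ = ℕₚ.≤ᵇ⇒≤ _ N (proj₁ s₄)
                    ; n₄ = ℕₚ.≤ᵇ⇒≤ _ N (proj₁ s₅) ; n₅ = ℕₚ.≤ᵇ⇒≤ _ N (proj₁ s₆) }
    pick : T (covers⁺ s r e) ⊎ T (covers⁻ s r e) → ∀ M → Hypotheses s r ν a D M → Trivial M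
    pick (inj₁ h) = let h₁ , h₂ = ∧-split (μ ℕ.≤ᵇ r) _ h in
      padé⁺ k' r' N 1≤s r'≤k' bounds (r ℕ.∸ μ) G (sym (ℕₚ.m∸n+n≡m (ℕₚ.≤ᵇ⇒≤ μ r h₁))) (ℕₚ.≤ᵇ⇒≤ _ μ h₂) lt
    pick (inj₂ h) = let h₁ , h₂ = ∧-split (r ℕ.≤ᵇ μ) _ h in
      padé⁻ k' r' N 1≤s r'≤k' bounds (μ ℕ.∸ r) G (ℕₚ.m+[n∸m]≡n (ℕₚ.≤ᵇ⇒≤ r μ h₁)) (ℕₚ.≤ᵇ⇒≤ _ r h₂) lt

  all-valid : ℕ → ℕ → ℕ → List Entry → Bool
  all-valid ν a D []       = true
  all-valid ν a D (e ∷ es) = valid-entry ν a D e ∧ all-valid ν a D es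

  any-covers : ℕ → ℕ → List Entry → Bool
  any-covers s r []       = false
  any-covers s r (e ∷ es) = covers s r e ∨ any-covers s r es

  any-covers-sound : ∀ ν a D es → T (all-valid ν a D es) → ∀ s r → 1 ℕ.≤ s → T (any-covers s r es) → ∀ M → Hypotheses s r ν a D M → Trivial M
  any-covers-sound ν a D (e ∷ es) ok s r 1≤s c = pick (∨-split (covers s r e) (any-covers s r es) c)
    where
    sp = ∧-split (valid-entry ν a D e) (all-valid ν a D es) ok
    pick : T (covers s r e) ⊎ T (any-covers s r es) → ∀ M → Hypotheses s r ν a D M → Trivial M
    pick (inj₁ h) = covers-sound ν a D e (proj₁ sp) s r 1≤s h
    pick (inj₂ h) = any-covers-sound ν a D es (proj₂ sp) s r 1≤s h

  valid-first : ℕ → ℕ → ℕ → ℕ → Bool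
  valid-first ν a D G = (a ℕ.<ᵇ D) ∧ (2 ℕ.^ ν ℕ.* a ℕ.^ G ℕ.<ᵇ D ℕ.^ G)

  first-sound : ∀ ν a D G → T (valid-first ν a D G) → ∀ s r → s ℕ.< r → r ℕ.∸ s ℕ.+ G ℕ.≤ s → ∀ M → Hypotheses s r ν a D M → Trivial M
  first-sound ν a D G ok s r s<r le = first-gap (r ℕ.∸ s) G (sym (ℕₚ.m∸n+n≡m (ℕₚ.<⇒≤ s<r))) (ℕₚ.m<n⇒0<n∸m s<r) le
      (ℕₚ.<ᵇ⇒< a D (proj₁ sp)) (ℕₚ.<ᵇ⇒< _ (D ℕ.^ G) (proj₂ sp))
    where
    sp = ∧-split (a ℕ.<ᵇ D) _ ok

  -- For r ≥ 2 k₁ s the diagonal approximants of degree ⌊ r / 2s ⌋ or one more suffice.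

  tail-base tail-step : ℕ → ℕ → ℕ → ℕ → ℕ → Bool
  tail-base ν a D s j = (3 ℕ.* 27 ℕ.^ (2 ℕ.+ j)) ℕ.^ ν ℕ.* a ℕ.^ (j ℕ.* s) ℕ.<ᵇ (4 ℕ.^ (2 ℕ.+ j)) ℕ.^ ν ℕ.* D ℕ.^ (j ℕ.* s)
  tail-step ν a D s j = (27 ℕ.^ ν ℕ.* a ℕ.^ s ℕ.≤ᵇ 4 ℕ.^ ν ℕ.* D ℕ.^ s) ∧ (a ℕ.<ᵇ D)

  module _ (ν a D s₀ j₀ : ℕ) (base : T (tail-base ν a D s₀ j₀)) (step : T (tail-step ν a D s₀ j₀)) where
    private
      a<D = ℕₚ.<ᵇ⇒< a D (proj₂ (∧-split (27 ℕ.^ ν ℕ.* a ℕ.^ s₀ ℕ.≤ᵇ 4 ℕ.^ ν ℕ.* D ℕ.^ s₀) _ step))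
      0<D : 0 ℕ.< D
      0<D = ℕₚ.≤-<-trans z≤n a<D
      ratio = ℕₚ.≤ᵇ⇒≤ (27 ℕ.^ ν ℕ.* a ℕ.^ s₀) (4 ℕ.^ ν ℕ.* D ℕ.^ s₀) (proj₁ (∧-split (27 ℕ.^ ν ℕ.* a ℕ.^ s₀ ℕ.≤ᵇ 4 ℕ.^ ν ℕ.* D ℕ.^ s₀) _ step))

      -- The inequality of `contract` for the gain `j s₀`, with the coefficient bound `2 N` replaced
      -- by 3 (27/4)^(2 + j) and the denominators moved to the right.
      Ineq : ℕ → Set
      Ineq j = (3 ℕ.* 27 ℕ.^ (2 ℕ.+ j)) ℕ.^ ν ℕ.* a ℕ.^ (j ℕ.* s₀) ℕ.< (4 ℕ.^ (2 ℕ.+ j)) ℕ.^ ν ℕ.* D ℕ.^ (j ℕ.* s₀)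

      -- Passing from j to j + 1 multiplies the quotient of the two sides by (27/4)^ν (a/D)^s₀,
      -- which is at most 1 by `ratio`.
      next : ∀ j → Ineq j → Ineq (suc j)
      next j h = begin-strict
        (3 ℕ.* 27 ℕ.^ (3 ℕ.+ j)) ℕ.^ ν ℕ.* a ℕ.^ (s₀ ℕ.+ j ℕ.* s₀)
          ≡⟨ cong₂ ℕ._*_ (trans (cong (ℕ._^ ν) (l₁ 27 (27 ℕ.^ (2 ℕ.+ j)))) (*-^ 27 (3 ℕ.* 27 ℕ.^ (2 ℕ.+ j)) ν)) (ℕₚ.^-distribˡ-+-* a s₀ (j ℕ.* s₀)) ⟩
        27 ℕ.^ ν ℕ.* u ℕ.* (a ℕ.^ s₀ ℕ.* a ℕ.^ (j ℕ.* s₀)) ≡⟨ l₂ (27 ℕ.^ ν) u (a ℕ.^ s₀) (a ℕ.^ (j ℕ.* s₀)) ⟩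
        27 ℕ.^ ν ℕ.* a ℕ.^ s₀ ℕ.* (u ℕ.* a ℕ.^ (j ℕ.* s₀)) ≤⟨ ℕₚ.*-monoˡ-≤ (u ℕ.* a ℕ.^ (j ℕ.* s₀)) ratio ⟩
        4 ℕ.^ ν ℕ.* D ℕ.^ s₀ ℕ.* (u ℕ.* a ℕ.^ (j ℕ.* s₀)) <⟨ ℕₚ.*-monoʳ-< (4 ℕ.^ ν ℕ.* D ℕ.^ s₀) {{nz}} h ⟩
        4 ℕ.^ ν ℕ.* D ℕ.^ s₀ ℕ.* (v ℕ.* D ℕ.^ (j ℕ.* s₀)) ≡⟨ sym (l₂ (4 ℕ.^ ν) v (D ℕ.^ s₀) (D ℕ.^ (j ℕ.* s₀))) ⟩
        4 ℕ.^ ν ℕ.* v ℕ.* (D ℕ.^ s₀ ℕ.* D ℕ.^ (j ℕ.* s₀))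
          ≡⟨ sym (cong₂ ℕ._*_ (*-^ 4 (4 ℕ.^ (2 ℕ.+ j)) ν) (ℕₚ.^-distribˡ-+-* D s₀ (j ℕ.* s₀))) ⟩
        (4 ℕ.^ (3 ℕ.+ j)) ℕ.^ ν ℕ.* D ℕ.^ (s₀ ℕ.+ j ℕ.* s₀) ∎
        where
        open ℕₚ.≤-Reasoning
        u = (3 ℕ.* 27 ℕ.^ (2 ℕ.+ j)) ℕ.^ ν
        v = (4 ℕ.^ (2 ℕ.+ j)) ℕ.^ ν
        nz : ℕ.NonZero (4 ℕ.^ ν ℕ.* D ℕ.^ s₀)
        nz = ℕ.>-nonZero (ℕₚ.*-mono-≤ {1} {4 ℕ.^ ν} (ℕₚ.m^n>0 4 ν) (ℕₚ.m^n>0 D {{ℕ.>-nonZero 0<D}} s₀))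
        l₁ : ∀ x w → 3 ℕ.* (x ℕ.* w) ≡ x ℕ.* (3 ℕ.* w)
        l₁ = ℕR.solve-∀
        l₂ : ∀ x u y w → x ℕ.* u ℕ.* (y ℕ.* w) ≡ x ℕ.* y ℕ.* (u ℕ.* w)
        l₂ = ℕR.solve-∀

      ineq : ∀ i → Ineq (i ℕ.+ j₀)
      ineq zero    = ℕₚ.<ᵇ⇒< _ ((4 ℕ.^ (2 ℕ.+ j₀)) ℕ.^ ν ℕ.* D ℕ.^ (j₀ ℕ.* s₀)) base
      ineq (suc i) = next (i ℕ.+ j₀) (ineq i)

      N : ℕ → ℕ
      N κ' = let κ = suc κ' in Nh κ (suc κ) κ ℕ.⊔ (Nh κ' (suc κ) (suc κ) ℕ.⊔ (Nh κ κ (suc κ) ℕ.⊔ (Nh κ' (suc κ) (suc κ) ℕ.⊔ Nh κ (suc κ) κ)))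

      Bound : ℕ → ℕ → Set
      Bound κ x = 2 ℕ.* 4 ℕ.^ κ ℕ.* x ℕ.≤ 3 ℕ.* 27 ℕ.^ κ

      -- This is the origin of the rate 27/4 = 3^3 / 2^2: in all five sums for a diagonal
      -- approximant the degree and the number of variables add up to 3 κ + 1, and at least 2 κ + 1
      -- of this are variables.
      bound : ∀ κ m i j → m ℕ.+ (i ℕ.+ j) ≡ suc (3 ℕ.* κ) → suc (2 ℕ.* κ) ℕ.≤ i ℕ.+ j → Bound κ (Nh m i j)
      bound κ m i j e le = begin
        2 ℕ.* 4 ℕ.^ κ ℕ.* Nh m i j ≡⟨ cong (λ z → 2 ℕ.* z ℕ.* Nh m i j) (ℕₚ.^-*-assoc 2 2 κ) ⟩
        2 ℕ.^ suc (2 ℕ.* κ) ℕ.* Nh m i j ≤⟨ ℕₚ.*-monoˡ-≤ (Nh m i j) (ℕₚ.^-monoʳ-≤ 2 le) ⟩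
        2 ℕ.^ (i ℕ.+ j) ℕ.* Nh m i j ≤⟨ Nh-bound m i j ⟩
        3 ℕ.^ (m ℕ.+ (i ℕ.+ j)) ≡⟨ cong (3 ℕ.^_) e ⟩
        3 ℕ.* 3 ℕ.^ (3 ℕ.* κ) ≡⟨ cong (3 ℕ.*_) (sym (ℕₚ.^-*-assoc 3 3 κ)) ⟩
        3 ℕ.* 27 ℕ.^ κ ∎
        where open ℕₚ.≤-Reasoning

      ⊔-bound : ∀ κ x y → Bound κ x → Bound κ y → Bound κ (x ℕ.⊔ y)
      ⊔-bound κ x y bx by with ℕₚ.⊔-sel x y
      ... | inj₁ e = subst (Bound κ) (sym e) bx
      ... | inj₂ e = subst (Bound κ) (sym e) by

      N-bound : ∀ κ' → Bound (suc κ') (N κ')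
      N-bound κ' = ⊔-bound κ _ _ b₁ (⊔-bound κ _ _ b₂ (⊔-bound κ _ _ b₃ (⊔-bound κ _ _ b₂ b₁)))
        where
        κ = suc κ'
        e₁ : ∀ κ → κ ℕ.+ (1 ℕ.+ κ ℕ.+ κ) ≡ 1 ℕ.+ 3 ℕ.* κ
        e₁ = ℕR.solve-∀
        e₂ : ∀ κ → κ ℕ.+ ((2 ℕ.+ κ) ℕ.+ (2 ℕ.+ κ)) ≡ 1 ℕ.+ 3 ℕ.* (1 ℕ.+ κ)
        e₂ = ℕR.solve-∀
        e₃ : ∀ κ → κ ℕ.+ (κ ℕ.+ (1 ℕ.+ κ)) ≡ 1 ℕ.+ 3 ℕ.* κ
        e₃ = ℕR.solve-∀
        f₁ : ∀ κ → 1 ℕ.+ 2 ℕ.* κ ≡ 1 ℕ.+ κ ℕ.+ κ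
        f₁ = ℕR.solve-∀
        f₂ : ∀ κ → 1 ℕ.+ (1 ℕ.+ 2 ℕ.* (1 ℕ.+ κ)) ≡ (2 ℕ.+ κ) ℕ.+ (2 ℕ.+ κ)
        f₂ = ℕR.solve-∀
        f₃ : ∀ κ → 1 ℕ.+ 2 ℕ.* κ ≡ κ ℕ.+ (1 ℕ.+ κ)
        f₃ = ℕR.solve-∀
        b₁ = bound κ κ (suc κ) κ (e₁ κ) (ℕₚ.≤-reflexive (f₁ κ))
        b₂ = bound κ κ' (suc κ) (suc κ) (e₂ κ') (ℕₚ.≤-trans (ℕₚ.n≤1+n _) (ℕₚ.≤-reflexive (f₂ κ')))
        b₃ = bound κ κ κ (suc κ) (e₃ κ) (ℕₚ.≤-reflexive (f₃ κ))

      gain : ∀ i κ' x → (κ' ≡ i ℕ.+ j₀ ⊎ κ' ≡ suc (i ℕ.+ j₀)) → Bound (suc κ') x → (x ℕ.+ x) ℕ.^ ν ℕ.* a ℕ.^ ((i ℕ.+ j₀) ℕ.* s₀) ℕ.< D ℕ.^ ((i ℕ.+ j₀) ℕ.* s₀)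
      gain i κ' x κ≡ bx = ℕₚ.*-cancelˡ-< ((4 ℕ.^ (2 ℕ.+ j)) ℕ.^ ν) _ _ (begin-strict
          (4 ℕ.^ (2 ℕ.+ j)) ℕ.^ ν ℕ.* ((x ℕ.+ x) ℕ.^ ν ℕ.* a ℕ.^ (j ℕ.* s₀)) ≡⟨ sym (ℕₚ.*-assoc ((4 ℕ.^ (2 ℕ.+ j)) ℕ.^ ν) ((x ℕ.+ x) ℕ.^ ν) (a ℕ.^ (j ℕ.* s₀))) ⟩
          (4 ℕ.^ (2 ℕ.+ j)) ℕ.^ ν ℕ.* (x ℕ.+ x) ℕ.^ ν ℕ.* a ℕ.^ (j ℕ.* s₀) ≡⟨ cong (ℕ._* a ℕ.^ (j ℕ.* s₀)) (sym (*-^ (4 ℕ.^ (2 ℕ.+ j)) (x ℕ.+ x) ν)) ⟩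
          (4 ℕ.^ (2 ℕ.+ j) ℕ.* (x ℕ.+ x)) ℕ.^ ν ℕ.* a ℕ.^ (j ℕ.* s₀) ≤⟨ ℕₚ.*-monoˡ-≤ (a ℕ.^ (j ℕ.* s₀)) (ℕₚ.^-monoˡ-≤ ν (le κ≡)) ⟩
          (3 ℕ.* 27 ℕ.^ (2 ℕ.+ j)) ℕ.^ ν ℕ.* a ℕ.^ (j ℕ.* s₀) <⟨ ineq i ⟩
          (4 ℕ.^ (2 ℕ.+ j)) ℕ.^ ν ℕ.* D ℕ.^ (j ℕ.* s₀) ∎)
        where
        open ℕₚ.≤-Reasoning
        j = i ℕ.+ j₀
        l : ∀ w x → w ℕ.* (x ℕ.+ x) ≡ 2 ℕ.* w ℕ.* x
        l = ℕR.solve-∀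
        l' : ∀ w x → 4 ℕ.* w ℕ.* (x ℕ.+ x) ≡ 4 ℕ.* (2 ℕ.* w ℕ.* x)
        l' = ℕR.solve-∀
        l'' : ∀ w → 3 ℕ.* (27 ℕ.* w) ≡ 27 ℕ.* (3 ℕ.* w)
        l'' = ℕR.solve-∀
        le : (κ' ≡ j ⊎ κ' ≡ suc j) → 4 ℕ.^ (2 ℕ.+ j) ℕ.* (x ℕ.+ x) ℕ.≤ 3 ℕ.* 27 ℕ.^ (2 ℕ.+ j)
        le (inj₂ refl) = ℕₚ.≤-trans (ℕₚ.≤-reflexive (l (4 ℕ.^ (2 ℕ.+ j)) x)) bx
        le (inj₁ refl) = ℕₚ.≤-trans (ℕₚ.≤-reflexive (l' (4 ℕ.^ suc j) x)) (ℕₚ.≤-trans (ℕₚ.*-mono-≤ {4} {27} (ℕₚ.≤ᵇ⇒≤ 4 27 _) bx) (ℕₚ.≤-reflexive (sym (l'' (27 ℕ.^ suc j)))))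

      bounds : ∀ {s r} (1≤s : 1 ℕ.≤ s) κ' (h : κ' ℕ.≤ κ') → Bounds {s} {r} {ν} {a} {D} κ' κ' (N κ') 1≤s h
      bounds 1≤s κ' h = record
        { n₁ = ℕₚ.m≤m⊔n _ _ ; n₂ = ℕₚ.≤-trans (ℕₚ.m≤m⊔n _ _) (ℕₚ.m≤n⊔m (Nh (suc κ') (suc (suc κ')) (suc κ')) _)
        ; n₃ = ℕₚ.≤-trans (ℕₚ.≤-trans (ℕₚ.m≤m⊔n _ _) (ℕₚ.m≤n⊔m (Nh κ' (suc (suc κ')) (suc (suc κ'))) _)) (ℕₚ.m≤n⊔m (Nh (suc κ') (suc (suc κ')) (suc κ')) _)
        ; n₄ = ℕₚ.≤-trans (ℕₚ.m≤m⊔n _ _) (ℕₚ.m≤n⊔m (Nh (suc κ') (suc (suc κ')) (suc κ')) _)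
        ; n₅ = ℕₚ.m≤m⊔n _ _ }

      gain-up : ∀ {s} i N → s₀ ℕ.≤ s → N ℕ.^ ν ℕ.* a ℕ.^ ((i ℕ.+ j₀) ℕ.* s₀) ℕ.< D ℕ.^ ((i ℕ.+ j₀) ℕ.* s₀) → N ℕ.^ ν ℕ.* a ℕ.^ ((i ℕ.+ j₀) ℕ.* s) ℕ.< D ℕ.^ ((i ℕ.+ j₀) ℕ.* s)
      gain-up i N s₀≤s = gain-mono (N ℕ.^ ν) a D 0<D (ℕₚ.<⇒≤ a<D) (ℕₚ.*-monoʳ-≤ (i ℕ.+ j₀) s₀≤s)

    -- r = m + k (2s) with k = 1 + i + j₀
    tail-sound : ∀ s r i m → 1 ℕ.≤ s → s₀ ℕ.≤ s → r ≡ m ℕ.+ suc (i ℕ.+ j₀) ℕ.* (2 ℕ.* s) → m ℕ.< 2 ℕ.* s → ∀ M → Hypotheses s r ν a D M → Trivial M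
    tail-sound s r i m 1≤s s₀≤s r≡ m< with m ℕ.≤? s
    ... | yes m≤s = padé⁺ j j (N j) 1≤s ℕₚ.≤-refl (bounds 1≤s j ℕₚ.≤-refl) m (j ℕ.* s) (trans r≡ (cong (m ℕ.+_) (e j s)))
            (ℕₚ.≤-trans (ℕₚ.≤-reflexive (f m j s)) (ℕₚ.≤-trans (ℕₚ.+-monoˡ-≤ (j ℕ.* s ℕ.+ suc j ℕ.* s) m≤s) (ℕₚ.≤-reflexive (g j s))))
            (gain-up i (N j ℕ.+ N j) s₀≤s (gain i j (N j) (inj₁ refl) (N-bound j)))
      where
      j = i ℕ.+ j₀
      e : ∀ j s → suc j ℕ.* (2 ℕ.* s) ≡ s ℕ.* (suc j ℕ.+ suc j)
      e j s = e' (suc j) s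
        where
        e' : ∀ k s → k ℕ.* (2 ℕ.* s) ≡ s ℕ.* (k ℕ.+ k)
        e' = ℕR.solve-∀
      f : ∀ m j s → m ℕ.+ suc j ℕ.* s ℕ.+ j ℕ.* s ≡ m ℕ.+ (j ℕ.* s ℕ.+ suc j ℕ.* s)
      f m j s = trans (ℕₚ.+-assoc m (suc j ℕ.* s) (j ℕ.* s)) (cong (m ℕ.+_) (ℕₚ.+-comm (suc j ℕ.* s) (j ℕ.* s)))
      g : ∀ j s → s ℕ.+ (j ℕ.* s ℕ.+ (1 ℕ.+ j) ℕ.* s) ≡ s ℕ.* ((1 ℕ.+ j) ℕ.+ (1 ℕ.+ j))
      g = ℕR.solve-∀
    -- Now `r` is closer to the next multiple of `2 s`. The approximant of one degree more is used
    -- from above, with a deficit `m'` of at most `s`, and the gain is `j s` again.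
    ... | no m≰s = padé⁻ (suc j) (suc j) (N (suc j)) 1≤s ℕₚ.≤-refl (bounds 1≤s (suc j) ℕₚ.≤-refl) m' (j ℕ.* s) (trans (cong (ℕ._+ m') r≡) total')
            (ℕₚ.+-cancelʳ-≤ m' _ r (ℕₚ.≤-trans (ℕₚ.≤-reflexive (f m' j s)) (ℕₚ.≤-trans (ℕₚ.+-monoˡ-≤ ((2 ℕ.+ j) ℕ.* s ℕ.+ j ℕ.* s) (ℕₚ.+-mono-≤ m'≤s m'≤s))
              (ℕₚ.≤-trans (ℕₚ.≤-reflexive (g j s)) (ℕₚ.≤-reflexive (sym (trans (cong (ℕ._+ m') r≡) total')))))))
            (gain-up i (N (suc j) ℕ.+ N (suc j)) s₀≤s (gain i (suc j) (N (suc j)) (inj₂ refl) (N-bound (suc j))))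
      where
      j = i ℕ.+ j₀
      m' = 2 ℕ.* s ℕ.∸ m
      m'≤s : m' ℕ.≤ s
      m'≤s = ℕₚ.≤-trans (ℕₚ.∸-monoʳ-≤ (2 ℕ.* s) (ℕₚ.<⇒≤ (ℕₚ.≰⇒> m≰s))) (ℕₚ.≤-reflexive (trans (cong (ℕ._∸ s) (cong (s ℕ.+_) (ℕₚ.+-identityʳ s))) (ℕₚ.m+n∸n≡m s s)))
      total' : m ℕ.+ suc j ℕ.* (2 ℕ.* s) ℕ.+ m' ≡ s ℕ.* (suc (suc j) ℕ.+ suc (suc j))
      total' = trans (sw m (suc j ℕ.* (2 ℕ.* s)) m') (trans (cong (ℕ._+ suc j ℕ.* (2 ℕ.* s)) (ℕₚ.m+[n∸m]≡n (ℕₚ.<⇒≤ m<))) (e (suc j) s))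
        where
        sw : ∀ m k n → m ℕ.+ k ℕ.+ n ≡ m ℕ.+ n ℕ.+ k
        sw = ℕR.solve-∀
        e : ∀ j s → 2 ℕ.* s ℕ.+ j ℕ.* (2 ℕ.* s) ≡ s ℕ.* ((1 ℕ.+ j) ℕ.+ (1 ℕ.+ j))
        e = ℕR.solve-∀
      f : ∀ m j s → m ℕ.+ (2 ℕ.+ j) ℕ.* s ℕ.+ j ℕ.* s ℕ.+ m ≡ m ℕ.+ m ℕ.+ ((2 ℕ.+ j) ℕ.* s ℕ.+ j ℕ.* s)
      f = ℕR.solve-∀
      g : ∀ j s → s ℕ.+ s ℕ.+ ((2 ℕ.+ j) ℕ.* s ℕ.+ j ℕ.* s) ≡ s ℕ.* ((2 ℕ.+ j) ℕ.+ (2 ℕ.+ j))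
      g = ℕR.solve-∀

open Coverage

-- Exhaustion of the pairs (r, s).

module CaseAnalysis where
  -- Any prime not dividing the resultants involved would do.
  μ : ℕ
  μ = 1000003

  -- F s = T' E with T' = c Y X^x q^y.  The data show that the F r, for r among the targets, are coprime
  -- to E modulo μ.
  record DirectData : Set where
    field
      s-2 c x y n u : ℕ
      targets       : List ℕ
      E C           : List ℤ
      e inv         : Vec ℕ (suc n)

    s : ℕ
    s = suc (suc s-2)

    T' T'' : List ℤ
    T'  = scaleL (+ c) (shiftL 1 (mulL (X^L x) (powL qq y)))
    T'' = shiftL 1 (mulL (X^L (2 ℕ.∸ x)) (powL qq (2 ℕ.∸ y)))

    valid-E : Bool
    valid-E = (1 ℕ.≤ᵇ c) ∧ (eqL (FL s) (mulL T' E) ∧ eqL (mulL T' T'') (scaleL (+ c) (powL QQ 2)))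

    open Residues μ
    open Quotient e

    E-relation : Bool
    E-relation = eqL (scaleL (+ u) E) (addL (shiftL (suc n) (1ℤ ∷ [])) (addL (scaleL -[1+ 0 ] (toL e [])) (scaleL (+ μ) C)))

    valid-product : Bool
    valid-product = (gcd μ s ℕ.≡ᵇ 1) ∧ (E-relation ∧ (increasing 0 targets ∧ eqV (mulV (product targets) inv) (oneV (suc n))))

  module _ (d : DirectData) where
    open DirectData d

    I-E : T valid-E → ∀ M → Modulus.I M (F s) → Modulus.I M (evL E)
    I-E ok = let ok₁ , ok' = ∧-split (1 ℕ.≤ᵇ c) _ ok
                 ok₂ , ok₃ = ∧-split (eqL (FL s) (mulL T' E)) _ ok'
             in factor s c E T' T'' (ℕₚ.≤ᵇ⇒≤ 1 c ok₁) ok₂ ok₃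

    direct : T valid-E → T valid-product → ∀ r → T (Residues.elem μ r targets) →
      ∀ M → Modulus.I M (F s) → Modulus.I M (F r) → Modulus.I M (λ _ → 1ℤ)
    direct okE ok r el M iS iR = J⇒I s-2 (s≤s (s≤s z≤n)) (gcd≡1⇒coprime (ℕₚ.≡ᵇ⇒≡ (gcd μ s) 1 (proj₁ s₁))) iS
        (J-one (Residues.quotient-relation μ M e (+ u) E C (proj₁ s₂) (I-E okE M iS)) targets r inv (proj₁ s₃) el iR (proj₂ s₃))
      where
      open Residues.Sound μ M e
      s₁ = ∧-split (gcd μ s ℕ.≡ᵇ 1) _ ok
      s₂ = ∧-split E-relation _ (proj₂ s₁)
      s₃ = ∧-split (Residues.increasing μ 0 targets) _ (proj₂ s₂)

  allFrom : ℕ → ℕ → (ℕ → Bool) → Bool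
  allFrom a zero    p = true
  allFrom a (suc n) p = p a ∧ allFrom (suc a) n p

  allFrom-sound : ∀ a n p → T (allFrom a n p) → ∀ r → a ℕ.≤ r → r ℕ.< n ℕ.+ a → T (p r)
  allFrom-sound a zero    p h r a≤r r< = ⊥-elim (ℕₚ.<⇒≱ r< a≤r)
  allFrom-sound a (suc n) p h r a≤r r< with ℕₚ.m≤n⇒m<n∨m≡n a≤r
  ... | inj₂ refl = proj₁ (∧-split (p a) _ h)
  ... | inj₁ a<r  = allFrom-sound (suc a) n p (proj₂ (∧-split (p a) _ h)) r a<r (subst (r ℕ.<_) (sym (ℕₚ.+-suc n a)) r<)

  hypotheses : ∀ {s r} (c : CertificateData) → T (valid c) → ∀ M → Modulus.I M (F s) → Modulus.I M (F r) → Modulus.I M (evL (CertificateData.E c)) →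
    Hypotheses s r (CertificateData.ν c) (total (CertificateData.Φ c)) (CertificateData.D c) M
  hypotheses c ok M iS iR iE = record { F-s = iS ; F-r = iR ; cert = certify c ok M iE }

  tail : ∀ ν a D s₀ j₀ → T (tail-base ν a D s₀ j₀) → T (tail-step ν a D s₀ j₀) → ∀ s r → 1 ℕ.≤ s → s₀ ℕ.≤ s → suc j₀ ℕ.* (2 ℕ.* s) ℕ.≤ r →
    ∀ M → Hypotheses s r ν a D M → Trivial M
  tail ν a D s₀ j₀ base step s@(suc _) r 1≤s s₀≤s le =
      tail-sound ν a D s₀ j₀ base step s r (k ℕ.∸ suc j₀) (r % (2 ℕ.* s)) 1≤s s₀≤s
        (trans (m≡m%n+[m/n]*n r (2 ℕ.* s)) (cong (λ z → r % (2 ℕ.* s) ℕ.+ z ℕ.* (2 ℕ.* s)) (sym (trans (sym (ℕₚ.+-suc _ j₀)) (ℕₚ.m∸n+n≡m k≥)))))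
        (m%n<n r (2 ℕ.* s))
    where
    k = r / (2 ℕ.* s)
    k≥ : suc j₀ ℕ.≤ k
    k≥ = ℕₚ.≤-trans (ℕₚ.≤-reflexive (sym (m*n/n≡m (suc j₀) (2 ℕ.* s)))) (/-monoˡ-≤ (2 ℕ.* s) le)

  covered : ℕ → List Entry → ℕ → List ℕ → ℕ → Bool
  covered s table G₀ targets r = (r ℕ.∸ s ℕ.+ G₀ ℕ.≤ᵇ s) ∨ (any-covers s r table ∨ Residues.elem μ r targets)

  uncovered : ℕ → List Entry → ℕ → ℕ → ℕ → List ℕ
  uncovered s table G₀ a zero    = []
  uncovered s table G₀ a (suc n) = if covered s table G₀ [] a then uncovered s table G₀ (suc a) n else a ∷ uncovered s table G₀ (suc a) n

  coverage : ℕ → ℕ → List Entry → ℕ → List ℕ → Bool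
  coverage j₀ s table G₀ targets = allFrom (suc s) (suc j₀ ℕ.* (2 ℕ.* s) ℕ.∸ suc s) (covered s table G₀ targets)

  module _ (d : DirectData) (cd : CertificateData) (table : List Entry) (G₀ j₀ : ℕ) where
    open DirectData d using (s; E; targets; valid-E; valid-product)
    open CertificateData cd using (ν; Φ; D) renaming (E to E')
    private
      a = total Φ

    -- From `2 (1 + j₀) s` on, the diagonal approximants apply uniformly; the finitely many smaller
    -- `r` are tested one by one by `coverage`.
    small-s : T valid-E → T valid-product → T (valid cd) → T (zeroL E' ∨ eqL E' E) → T (all-valid ν a D table) → T (valid-first ν a D G₀) →
      T (tail-base ν a D s j₀) → T (tail-step ν a D s j₀) → T (coverage j₀ s table G₀ targets) →
      ∀ r → s ℕ.< r → ∀ M → Modulus.I M (F s) → Modulus.I M (F r) → Trivial M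
    small-s okE okP okC okE' okT okF okB okS okV r s<r M iS iR = decide (top ℕ.≤? r)
      where
      iE : T (zeroL E') ⊎ T (eqL E' E) → Modulus.I M (evL E')
      iE (inj₁ z) = Modulus.ext≡ M (λ t → sym (zeroL-sound E' z t)) (Modulus.I-0 M)
      iE (inj₂ z) = Modulus.ext≡ M (λ t → sym (eqL-sound E' E z t)) (I-E d okE M iS)
      hyp : Hypotheses s r ν a D M
      hyp = hypotheses {s} {r} cd okC M iS iR (iE (∨-split (zeroL E') (eqL E' E) okE'))
      top = suc j₀ ℕ.* (2 ℕ.* s)
      pick₂ : T (any-covers s r table) ⊎ T (Residues.elem μ r targets) → Trivial M
      pick₂ (inj₁ w) = any-covers-sound ν a D table okT s r (s≤s z≤n) w M hyp
      pick₂ (inj₂ w) = λ n → n (direct d okE okP r w M iS iR)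
      pick₁ : T (r ℕ.∸ s ℕ.+ G₀ ℕ.≤ᵇ s) ⊎ T (any-covers s r table ∨ Residues.elem μ r targets) → Trivial M
      pick₁ (inj₁ z) = first-sound ν a D G₀ okF s r s<r (ℕₚ.≤ᵇ⇒≤ _ s z) M hyp
      pick₁ (inj₂ z) = pick₂ (∨-split (any-covers s r table) (Residues.elem μ r targets) z)
      decide : Dec (top ℕ.≤ r) → Trivial M
      decide (yes h) = tail ν a D s j₀ okB okS s r (s≤s z≤n) ℕₚ.≤-refl h M hyp
      decide (no h)  = pick₁ (∨-split (r ℕ.∸ s ℕ.+ G₀ ℕ.≤ᵇ s) (any-covers s r table ∨ Residues.elem μ r targets)
          (allFrom-sound (suc s) (top ℕ.∸ suc s) (covered s table G₀ targets) okV r s<r r<))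
        where
        r< : r ℕ.< top ℕ.∸ suc s ℕ.+ suc s
        r< = ℕₚ.<-≤-trans (ℕₚ.≰⇒> h) (ℕₚ.≤-trans (ℕₚ.m≤n+m∸n top (suc s)) (ℕₚ.≤-reflexive (ℕₚ.+-comm (suc s) (top ℕ.∸ suc s))))

  ∧-intro : ∀ {a b} → T a → T b → T (a ∧ b)
  ∧-intro {true} {true} _ _ = tt

  ∨-introˡ : ∀ {a b} → T a → T (a ∨ b)
  ∨-introˡ {true} _ = tt

  ∨-introʳ : ∀ {a b} → T b → T (a ∨ b)
  ∨-introʳ {true}  _ = tt
  ∨-introʳ {false} h = h

  module LargeS (c : CertificateData) where
    open CertificateData c using (ν; Φ; D; E)
    a = total Φ

    -- Each gain is the least `G` with (2 N)^ν a^G < D^G for the universal certificate, where ν =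
    -- 60. The gain 5 of the first gap is likewise the least one for 2 in place of 2 N.
    e₁ e₂ e₃ : Entry
    e₁ = entry 0 0 3 11
    e₂ = entry 1 0 10 18
    e₃ = entry 1 1 15 20

    module _ (okC : T (valid c)) (okZ : T (zeroL E)) (ok₁ : T (valid-entry ν a D e₁)) (ok₂ : T (valid-entry ν a D e₂)) (ok₃ : T (valid-entry ν a D e₃))
      (okF : T (valid-first ν a D 5)) (okB : T (tail-base ν a D 40 1)) (okS : T (tail-step ν a D 40 1)) where

      after : ∀ s r k' r' N G → let w = s ℕ.* (suc k' ℕ.+ suc r') in w ℕ.≤ r → r ℕ.+ (suc k' ℕ.* s ℕ.+ G) ℕ.≤ w ℕ.+ w → T (covers s r (entry k' r' N G))
      after s r k' r' N G h le = ∨-introˡ (∧-intro {w ℕ.≤ᵇ r} (ℕₚ.≤⇒≤ᵇ h) (ℕₚ.≤⇒≤ᵇ (ℕₚ.+-cancelʳ-≤ w _ w (ℕₚ.≤-trans (ℕₚ.≤-reflexive eq) le))))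
        where
        w = s ℕ.* (suc k' ℕ.+ suc r')
        l : ∀ d k g w → d ℕ.+ k ℕ.+ g ℕ.+ w ≡ d ℕ.+ w ℕ.+ (k ℕ.+ g)
        l = ℕR.solve-∀
        eq : r ℕ.∸ w ℕ.+ suc k' ℕ.* s ℕ.+ G ℕ.+ w ≡ r ℕ.+ (suc k' ℕ.* s ℕ.+ G)
        eq = trans (l (r ℕ.∸ w) (suc k' ℕ.* s) G w) (cong (ℕ._+ (suc k' ℕ.* s ℕ.+ G)) (ℕₚ.m∸n+n≡m h))

      before : ∀ s r k' r' N G b → let w = s ℕ.* (suc k' ℕ.+ suc r') in r ℕ.≤ w → w ℕ.≤ r ℕ.+ b → suc k' ℕ.* s ℕ.+ G ℕ.+ (b ℕ.+ b) ℕ.≤ w → T (covers s r (entry k' r' N G))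
      before s r k' r' N G b h h' le = ∨-introʳ {covers⁺ s r (entry k' r' N G)} (∧-intro {r ℕ.≤ᵇ w} (ℕₚ.≤⇒≤ᵇ h) (ℕₚ.≤⇒≤ᵇ (ℕₚ.+-cancelʳ-≤ b _ r (begin
          w ℕ.∸ r ℕ.+ suc k' ℕ.* s ℕ.+ G ℕ.+ b ≤⟨ ℕₚ.+-monoˡ-≤ b (ℕₚ.+-monoˡ-≤ G (ℕₚ.+-monoˡ-≤ (suc k' ℕ.* s) (ℕₚ.m≤n+o⇒m∸n≤o w r h'))) ⟩
          b ℕ.+ suc k' ℕ.* s ℕ.+ G ℕ.+ b ≡⟨ l b (suc k' ℕ.* s) G ⟩
          suc k' ℕ.* s ℕ.+ G ℕ.+ (b ℕ.+ b) ≤⟨ le ⟩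
          w ≤⟨ h' ⟩
          r ℕ.+ b ∎))))
        where
        open ℕₚ.≤-Reasoning
        w = s ℕ.* (suc k' ℕ.+ suc r')
        l : ∀ b k g → b ℕ.+ k ℕ.+ g ℕ.+ b ≡ k ℕ.+ g ℕ.+ (b ℕ.+ b)
        l = ℕR.solve-∀

      -- The first gap reaches up to 2 s - 5, `e₁` up to 3 s - 11, `e₂` up to 4 s - 18, `e₃` up to 4
      -- s, and the diagonal approximants take over from there. An approximant of exponent w also
      -- works slightly below w, and this bridges the hole that its predecessor leaves.
      large-s : ∀ s r → 40 ℕ.≤ s → s ℕ.< r → ∀ M → Modulus.I M (F s) → Modulus.I M (F r) → Trivial M
      large-s s r 40≤s s<r M iS iR = go₁ (r ℕ.+ 5 ℕ.≤? s ℕ.* 2)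
        where
        1≤s : 1 ℕ.≤ s
        1≤s = ℕₚ.≤-trans (s≤s z≤n) 40≤s
        v = s ℕ.∸ 40
        s≡ : 40 ℕ.+ v ≡ s
        s≡ = ℕₚ.m+[n∸m]≡n 40≤s
        hyp : Hypotheses s r ν a D M
        hyp = hypotheses {s} {r} c okC M iS iR (Modulus.ext≡ M (λ t → sym (zeroL-sound E okZ t)) (Modulus.I-0 M))
        neg : ∀ {m n} c → ¬ m ℕ.+ c ℕ.≤ n → n ℕ.≤ m ℕ.+ c
        neg c h = ℕₚ.<⇒≤ (ℕₚ.≰⇒> h)
        le : ∀ {x y} z → x ℕ.+ z ≡ y → x ℕ.≤ y
        le {x} z refl = ℕₚ.m≤m+n x z
        a₁ : ∀ v → 1 ℕ.* (40 ℕ.+ v) ℕ.+ 11 ℕ.+ 10 ℕ.+ (19 ℕ.+ v) ≡ (40 ℕ.+ v) ℕ.* 2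
        a₁ = ℕR.solve-∀
        -- An equality without slack at v = 0: only from s = 40 on does `e₂` reach down from 3 s to
        -- 3 s - 11. The tail inequality with `j₀ = 1` needs `s₀ = 40` as well; these are the two
        -- origins of the bound 40.
        a₂ : ∀ v → 2 ℕ.* (40 ℕ.+ v) ℕ.+ 18 ℕ.+ 22 ℕ.+ v ≡ (40 ℕ.+ v) ℕ.* 3
        a₂ = ℕR.solve-∀
        a₃ : ∀ v → 2 ℕ.* (40 ℕ.+ v) ℕ.+ 20 ℕ.+ 36 ℕ.+ (24 ℕ.+ 2 ℕ.* v) ≡ (40 ℕ.+ v) ℕ.* 4
        a₃ = ℕR.solve-∀
        b₁ : ∀ r s → r ℕ.+ (1 ℕ.* s ℕ.+ 11) ≡ r ℕ.+ 11 ℕ.+ s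
        b₁ = ℕR.solve-∀
        b₁' : ∀ s → s ℕ.* 3 ℕ.+ s ≡ s ℕ.* 2 ℕ.+ s ℕ.* 2
        b₁' = ℕR.solve-∀
        b₂ : ∀ r s → r ℕ.+ (2 ℕ.* s ℕ.+ 18) ≡ r ℕ.+ 18 ℕ.+ 2 ℕ.* s
        b₂ = ℕR.solve-∀
        b₂' : ∀ s → s ℕ.* 4 ℕ.+ 2 ℕ.* s ≡ s ℕ.* 3 ℕ.+ s ℕ.* 3
        b₂' = ℕR.solve-∀
        c₁ : ∀ s → s ℕ.* 2 ≡ s ℕ.+ s
        c₁ = ℕR.solve-∀
        c₂ : ∀ s → s ℕ.* 4 ≡ 2 ℕ.* (2 ℕ.* s)
        c₂ = ℕR.solve-∀
        l₅ : ∀ d s → d ℕ.+ 5 ℕ.+ s ≡ d ℕ.+ s ℕ.+ 5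
        l₅ = ℕR.solve-∀
        go₆ : Dec (r ℕ.≤ s ℕ.* 4) → s ℕ.* 4 ℕ.≤ r ℕ.+ 18 → Trivial M
        go₆ (yes h) h₅ = covers-sound ν a D e₃ ok₃ s r 1≤s (before s r 1 1 15 20 18 h h₅ (subst (λ z → 2 ℕ.* z ℕ.+ 20 ℕ.+ 36 ℕ.≤ z ℕ.* 4) s≡ (le (24 ℕ.+ 2 ℕ.* v) (a₃ v)))) M hyp
        go₆ (no h₆) _  = tail ν a D 40 1 okB okS s r 1≤s 40≤s (ℕₚ.≤-trans (ℕₚ.≤-reflexive (sym (c₂ s))) (ℕₚ.<⇒≤ (ℕₚ.≰⇒> h₆))) M hyp
        go₅ : Dec (r ℕ.+ 18 ℕ.≤ s ℕ.* 4) → s ℕ.* 3 ℕ.≤ r → Trivial M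
        go₅ (yes h) h₄ = covers-sound ν a D e₂ ok₂ s r 1≤s (after s r 1 0 10 18 h₄ (ℕₚ.≤-trans (ℕₚ.≤-reflexive (b₂ r s)) (ℕₚ.≤-trans (ℕₚ.+-monoˡ-≤ (2 ℕ.* s) h) (ℕₚ.≤-reflexive (b₂' s))))) M hyp
        go₅ (no h₅) _  = go₆ (r ℕ.≤? s ℕ.* 4) (neg 18 h₅)
        go₄ : Dec (r ℕ.≤ s ℕ.* 3) → s ℕ.* 3 ℕ.≤ r ℕ.+ 11 → Trivial M
        go₄ (yes h) h₃ = covers-sound ν a D e₂ ok₂ s r 1≤s (before s r 1 0 10 18 11 h h₃ (subst (λ z → 2 ℕ.* z ℕ.+ 18 ℕ.+ 22 ℕ.≤ z ℕ.* 3) s≡ (le v (a₂ v)))) M hyp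
        go₄ (no h₄) _  = go₅ (r ℕ.+ 18 ℕ.≤? s ℕ.* 4) (ℕₚ.<⇒≤ (ℕₚ.≰⇒> h₄))
        go₃ : Dec (r ℕ.+ 11 ℕ.≤ s ℕ.* 3) → s ℕ.* 2 ℕ.≤ r → Trivial M
        go₃ (yes h) h₂ = covers-sound ν a D e₁ ok₁ s r 1≤s (after s r 0 0 3 11 h₂ (ℕₚ.≤-trans (ℕₚ.≤-reflexive (b₁ r s)) (ℕₚ.≤-trans (ℕₚ.+-monoˡ-≤ s h) (ℕₚ.≤-reflexive (b₁' s))))) M hyp
        go₃ (no h₃) _  = go₄ (r ℕ.≤? s ℕ.* 3) (neg 11 h₃)
        go₂ : Dec (r ℕ.≤ s ℕ.* 2) → s ℕ.* 2 ℕ.≤ r ℕ.+ 5 → Trivial M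
        go₂ (yes h) h₁ = covers-sound ν a D e₁ ok₁ s r 1≤s (before s r 0 0 3 11 5 h h₁ (subst (λ z → 1 ℕ.* z ℕ.+ 11 ℕ.+ 10 ℕ.≤ z ℕ.* 2) s≡ (le (19 ℕ.+ v) (a₁ v)))) M hyp
        go₂ (no h₂) _  = go₃ (r ℕ.+ 11 ℕ.≤? s ℕ.* 3) (ℕₚ.<⇒≤ (ℕₚ.≰⇒> h₂))
        go₁ : Dec (r ℕ.+ 5 ℕ.≤ s ℕ.* 2) → Trivial M
        go₁ (yes h) = first-sound ν a D 5 okF s r s<r (ℕₚ.+-cancelʳ-≤ s _ s (ℕₚ.≤-trans (ℕₚ.≤-reflexive (l₅ (r ℕ.∸ s) s))
          (ℕₚ.≤-trans (ℕₚ.≤-reflexive (cong (ℕ._+ 5) (ℕₚ.m∸n+n≡m (ℕₚ.<⇒≤ s<r)))) (ℕₚ.≤-trans h (ℕₚ.≤-reflexive (c₁ s)))))) M hyp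
        go₁ (no h₁) = go₂ (r ℕ.≤? s ℕ.* 2) (neg 5 h₁)

open CaseAnalysis

-- Numerical data, and Beukers' theorem for s at least 8.

module CertificateTables where
  -- Here R = (X Y q)^12; the coefficients of Φ come from a linear programme that makes their sum of absolute
  -- values small in comparison with D.
  universal : CertificateData
  universal = record
    { ν = 60 ; D = 610598316764517846835027286632281949848150 ; α = 12 ; β = 12 ; e₀ = 1
    ; E = []
    ; R = (+ 1 , 0 , 12) ∷ (+ 24 , 0 , 13) ∷ (+ 288 , 0 , 14) ∷ (+ 2300 , 0 , 15) ∷ (+ 13728 , 0 , 16) ∷ (+ 65208 , 0 , 17) ∷ (+ 256322 , 0 , 18) ∷ (+
      856152 , 0 , 19) ∷ (+ 2476320 , 0 , 20) ∷ (+ 6289932 , 0 , 21) ∷ (+ 14181024 , 0 , 22) ∷ (+ 28614456 , 0 , 23) ∷ (+ 52010479 , 0 , 24) ∷ (+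
      85590960 , 0 , 25) ∷ (+ 128030784 , 0 , 26) ∷ (+ 174608632 , 0 , 27) ∷ (+ 217597248 , 0 , 28) ∷ (+ 248167920 , 0 , 29) ∷ (+ 259258780 , 0 , 30) ∷
      (+ 248167920 , 0 , 31) ∷ (+ 217597248 , 0 , 32) ∷ (+ 174608632 , 0 , 33) ∷ (+ 128030784 , 0 , 34) ∷ (+ 85590960 , 0 , 35) ∷ (+ 52010479 , 0 , 36)
      ∷ (+ 28614456 , 0 , 37) ∷ (+ 14181024 , 0 , 38) ∷ (+ 6289932 , 0 , 39) ∷ (+ 2476320 , 0 , 40) ∷ (+ 856152 , 0 , 41) ∷ (+ 256322 , 0 , 42) ∷ (+
      65208 , 0 , 43) ∷ (+ 13728 , 0 , 44) ∷ (+ 2300 , 0 , 45) ∷ (+ 288 , 0 , 46) ∷ (+ 24 , 0 , 47) ∷ (+ 1 , 0 , 48) ∷ []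
    ; Φ = (+ 9406948406937776771800259434601263 , 0 , 0) ∷ (+ 35376893178427896097298099138220600 , 0 , 3) ∷ (+ 22134342678970098414220832178647775 , 0
      , 8) ∷ (-[1+ 120586495675495792629151807954468999 ] , 0 , 9) ∷ (+ 65678378381705627500914453372897600 , 0 , 13) ∷ (-[1+
      330721865373976787290278852530804699 ] , 0 , 14) ∷ (-[1+ 577226439994608878177938799062297799 ] , 0 , 19) ∷ (+
      242788815951174689227050013184310120 , 0 , 20) ∷ (-[1+ 567657342796777192890508237831776149 ] , 0 , 24) ∷ (+ 664397299776616614629215418885454648
      , 0 , 25) ∷ (+ 1383377473600633766376106699889655480 , 0 , 30) ∷ (+ 664397299776616614629215418885454648 , 0 , 35) ∷ (-[1+
      567657342796777192890508237831776149 ] , 0 , 36) ∷ (+ 242788815951174689227050013184310120 , 0 , 40) ∷ (-[1+ 577226439994608878177938799062297799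
      ] , 0 , 41) ∷ (-[1+ 330721865373976787290278852530804699 ] , 0 , 46) ∷ (+ 65678378381705627500914453372897600 , 0 , 47) ∷ (-[1+
      120586495675495792629151807954468999 ] , 0 , 51) ∷ (+ 22134342678970098414220832178647775 , 0 , 52) ∷ (+ 35376893178427896097298099138220600 , 0 ,
      57) ∷ (+ 9406948406937776771800259434601263 , 0 , 60) ∷ (-[1+ 35376893178427896097298099138220599 ] , 3 , 0) ∷ (-[1+
      35376893178427896097298099138220599 ] , 3 , 57) ∷ (+ 22134342678970098414220832178647775 , 8 , 0) ∷ (+ 22134342678970098414220832178647775 , 8 ,
      52) ∷ (+ 120586495675495792629151807954469000 , 9 , 0) ∷ (+ 120586495675495792629151807954469000 , 9 , 51) ∷ (-[1+
      65678378381705627500914453372897599 ] , 13 , 0) ∷ (-[1+ 65678378381705627500914453372897599 ] , 13 , 47) ∷ (-[1+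
      330721865373976787290278852530804699 ] , 14 , 0) ∷ (-[1+ 330721865373976787290278852530804699 ] , 14 , 46) ∷ (+
      577226439994608878177938799062297800 , 19 , 0) ∷ (+ 577226439994608878177938799062297800 , 19 , 41) ∷ (+ 242788815951174689227050013184310120 , 20
      , 0) ∷ (+ 242788815951174689227050013184310120 , 20 , 40) ∷ (-[1+ 567657342796777192890508237831776149 ] , 24 , 0) ∷ (-[1+
      567657342796777192890508237831776149 ] , 24 , 36) ∷ (-[1+ 664397299776616614629215418885454647 ] , 25 , 0) ∷ (-[1+
      664397299776616614629215418885454647 ] , 25 , 35) ∷ (+ 1383377473600633766376106699889655480 , 30 , 0) ∷ (+ 1383377473600633766376106699889655480
      , 30 , 30) ∷ (-[1+ 664397299776616614629215418885454647 ] , 35 , 0) ∷ (-[1+ 664397299776616614629215418885454647 ] , 35 , 25) ∷ (-[1+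
      567657342796777192890508237831776149 ] , 36 , 0) ∷ (-[1+ 567657342796777192890508237831776149 ] , 36 , 24) ∷ (+
      242788815951174689227050013184310120 , 40 , 0) ∷ (+ 242788815951174689227050013184310120 , 40 , 20) ∷ (+ 577226439994608878177938799062297800 , 41
      , 0) ∷ (+ 577226439994608878177938799062297800 , 41 , 19) ∷ (-[1+ 330721865373976787290278852530804699 ] , 46 , 0) ∷ (-[1+
      330721865373976787290278852530804699 ] , 46 , 14) ∷ (-[1+ 65678378381705627500914453372897599 ] , 47 , 0) ∷ (-[1+
      65678378381705627500914453372897599 ] , 47 , 13) ∷ (+ 120586495675495792629151807954469000 , 51 , 0) ∷ (+ 120586495675495792629151807954469000 ,
      51 , 9) ∷ (+ 22134342678970098414220832178647775 , 52 , 0) ∷ (+ 22134342678970098414220832178647775 , 52 , 8) ∷ (-[1+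
      35376893178427896097298099138220599 ] , 57 , 0) ∷ (-[1+ 35376893178427896097298099138220599 ] , 57 , 3) ∷ (+ 9406948406937776771800259434601263 ,
      60 , 0) ∷ []
    ; K = []
    ; K' = [] }

  approximants : List Entry
  approximants = entry 0 0 3 11 ∷ entry 1 0 10 18 ∷ entry 1 1 15 20 ∷ entry 2 1 56 28 ∷ entry 2 2 84 30 ∷ entry 3 2 330 38 ∷ entry 3 3 495 41 ∷ []

  universal-valid : T (valid universal)
  universal-valid = tt

  approximants-valid : T (all-valid (CertificateData.ν universal) (total (CertificateData.Φ universal)) (CertificateData.D universal) approximants)
  approximants-valid = tt

  certificate-8 : CertificateData
  certificate-8 = record
    { ν = 48 ; D = 4753888029058689024 ; α = 10 ; β = 9 ; e₀ = 16
    ; E = + 4 ∷ + 14 ∷ + 28 ∷ + 35 ∷ + 28 ∷ + 14 ∷ + 4 ∷ []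
    ; R = (+ 2 , 0 , 1) ∷ (+ 9 , 0 , 2) ∷ (+ 22 , 0 , 3) ∷ (+ 37 , 0 , 4) ∷ (+ 48 , 0 , 5) ∷ (+ 55 , 0 , 6) ∷ (+ 62 , 0 , 7) ∷ (+ 69 , 0 , 8) ∷ (+ 73 ,
      0 , 9) ∷ (+ 71 , 0 , 10) ∷ (+ 65 , 0 , 11) ∷ (+ 65 , 0 , 12) ∷ (+ 118 , 0 , 13) ∷ (+ 380 , 0 , 14) ∷ (+ 1285 , 0 , 15) ∷ (+ 3805 , 0 , 16) ∷ (+
      9671 , 0 , 17) ∷ (+ 21248 , 0 , 18) ∷ (+ 40736 , 0 , 19) ∷ (+ 68691 , 0 , 20) ∷ (+ 102515 , 0 , 21) ∷ (+ 136032 , 0 , 22) ∷ (+ 160998 , 0 , 23) ∷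
      (+ 170265 , 0 , 24) ∷ (+ 160998 , 0 , 25) ∷ (+ 136032 , 0 , 26) ∷ (+ 102515 , 0 , 27) ∷ (+ 68691 , 0 , 28) ∷ (+ 40736 , 0 , 29) ∷ (+ 21248 , 0 ,
      30) ∷ (+ 9671 , 0 , 31) ∷ (+ 3805 , 0 , 32) ∷ (+ 1285 , 0 , 33) ∷ (+ 380 , 0 , 34) ∷ (+ 118 , 0 , 35) ∷ (+ 65 , 0 , 36) ∷ (+ 65 , 0 , 37) ∷ (+ 71
      , 0 , 38) ∷ (+ 73 , 0 , 39) ∷ (+ 69 , 0 , 40) ∷ (+ 62 , 0 , 41) ∷ (+ 55 , 0 , 42) ∷ (+ 48 , 0 , 43) ∷ (+ 37 , 0 , 44) ∷ (+ 22 , 0 , 45) ∷ (+ 9 , 0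
      , 46) ∷ (+ 2 , 0 , 47) ∷ []
    ; Φ = (+ 1899393556480 , 3 , 45) ∷ (-[1+ 5615210411212 ] , 0 , 24) ∷ (+ 1899393556480 , 3 , 0) ∷ (-[1+ 7914452967423 ] , 48 , 0) ∷ []
    ; K = + 0 ∷ + 8 ∷ + 8 ∷ + 4 ∷ + 8 ∷ + 10 ∷ + 10 ∷ + 9 ∷ + 9 ∷ + 8 ∷ + 1 ∷ + 9 ∷ + 2 ∷ + 14 ∷ + 12 ∷ + 12 ∷ + 12 ∷ + 8 ∷ + 4 ∷ + 6 ∷ + 14 ∷ + 0 ∷ +
      14 ∷ + 6 ∷ + 4 ∷ + 8 ∷ + 12 ∷ + 12 ∷ + 12 ∷ + 14 ∷ + 2 ∷ + 9 ∷ + 1 ∷ + 8 ∷ + 9 ∷ + 9 ∷ + 10 ∷ + 10 ∷ + 8 ∷ + 4 ∷ + 8 ∷ + 8 ∷ []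
    ; K' = + 1503764852736 ∷ + 2377032300242801664 ∷ + 2378854939369921536 ∷ + 1215374232168743424 ∷ + 2653625291734677504 ∷ + 5185123486571279616 ∷ +
      17317103633528944896 ∷ + 80033128655931093888 ∷ + 356718736798639272960 ∷ + 1398032799099572146112 ∷ + 4793471482451612209088 ∷ +
      14473717714925386262688 ∷ + 38684771936517003643520 ∷ + 92100248927131344066896 ∷ + 196184152608679063005456 ∷ + 375336818254936896086520 ∷ +
      646906057608471220383424 ∷ + 1006849839332997406793404 ∷ + 1417754227305968790970732 ∷ + 1808647493333018648589314 ∷ + 2092386969941250025691620 ∷
      + 2196392270251855019697703 ∷ + 2092386969941250025691620 ∷ + 1808647493333018648589314 ∷ + 1417754227305968790970732 ∷ +
      1006849839332997406793404 ∷ + 646906057608471220383424 ∷ + 375336818254936896086520 ∷ + 196184152608679063005456 ∷ + 92100248927131344066896 ∷ +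
      38684771936517003643520 ∷ + 14473717714925386262688 ∷ + 4793471482451612209088 ∷ + 1398032799099572146112 ∷ + 356718736798639272960 ∷ +
      80033128655931093888 ∷ + 17317103633528944896 ∷ + 5185123486571279616 ∷ + 2653625291734677504 ∷ + 1215374232168743424 ∷ + 2378854939369921536 ∷ +
      2377032300242801664 ∷ + 1503764852736 ∷ [] }

  direct-8 : DirectData
  direct-8 = record
    -- `u` inverts the leading coefficient 4 of `E` modulo `μ`. The targets are taken from the 455
    -- exponents 9, ..., 463, which end where the tail with `j₀ = 28` begins, at 29 * 16 = 464.
    { s-2 = 6 ; c = 2 ; x = 0 ; y = 0 ; n = 5 ; u = 250001 ; targets = uncovered 8 [] 3 9 455
    ; E = + 4 ∷ + 14 ∷ + 28 ∷ + 35 ∷ + 28 ∷ + 14 ∷ + 4 ∷ []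
    ; C = + 2 ∷ + 4 ∷ + 8 ∷ + 9 ∷ + 8 ∷ + 4 ∷ + 1 ∷ []
    ; e = 499998 ∷ 999996 ∷ 249992 ∷ 999996 ∷ 499998 ∷ 1000002 ∷ []
    ; inv = 335915 ∷ 415999 ∷ 795202 ∷ 394337 ∷ 370818 ∷ 684834 ∷ [] }

  -- Here `E = 3 q ^ 3 + (X Y) ^ 2`. The numbers X, - Y, - 1 have sum 0, second elementary symmetric
  -- function - q and product X Y, so X^18 + Y^18 + 1 is a combination of terms q^(9 - 3 i) (X Y)^(2
  -- i). At the zeros of `E` each of them is a multiple of q^9, and the total is 542 q^9.
  certificate-9 : CertificateData
  certificate-9 = record
    { ν = 18 ; D = 542 ; α = 0 ; β = 9 ; e₀ = 1
    ; E = + 3 ∷ + 9 ∷ + 19 ∷ + 23 ∷ + 19 ∷ + 9 ∷ + 3 ∷ []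
    ; R = (+ 1 , 0 , 0) ∷ (+ 9 , 0 , 1) ∷ (+ 45 , 0 , 2) ∷ (+ 156 , 0 , 3) ∷ (+ 414 , 0 , 4) ∷ (+ 882 , 0 , 5) ∷ (+ 1554 , 0 , 6) ∷ (+ 2304 , 0 , 7) ∷
      (+ 2907 , 0 , 8) ∷ (+ 3139 , 0 , 9) ∷ (+ 2907 , 0 , 10) ∷ (+ 2304 , 0 , 11) ∷ (+ 1554 , 0 , 12) ∷ (+ 882 , 0 , 13) ∷ (+ 414 , 0 , 14) ∷ (+ 156 , 0
      , 15) ∷ (+ 45 , 0 , 16) ∷ (+ 9 , 0 , 17) ∷ (+ 1 , 0 , 18) ∷ []
    ; Φ = (+ 1 , 18 , 0) ∷ (+ 1 , 0 , 18) ∷ (+ 1 , 0 , 0) ∷ []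
    ; K = []
    ; K' = + 180 ∷ + 1080 ∷ + 3699 ∷ + 8595 ∷ + 15144 ∷ + 20886 ∷ + 23256 ∷ + 20886 ∷ + 15144 ∷ + 8595 ∷ + 3699 ∷ + 1080 ∷ + 180 ∷ [] }

  direct-9 : DirectData
  direct-9 = record
    { s-2 = 7 ; c = 3 ; x = 1 ; y = 0 ; n = 5 ; u = 666669 ; targets = uncovered 9 [] 3 10 152
    ; E = + 3 ∷ + 9 ∷ + 19 ∷ + 23 ∷ + 19 ∷ + 9 ∷ + 3 ∷ []
    ; C = + 3 ∷ + 7 ∷ + 13 ∷ + 16 ∷ + 13 ∷ + 7 ∷ + 2 ∷ []
    ; e = 1000000 ∷ 333328 ∷ 666661 ∷ 333328 ∷ 1000000 ∷ 1000002 ∷ []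
    ; inv = 740952 ∷ 694020 ∷ 808628 ∷ 211261 ∷ 149097 ∷ 644386 ∷ [] }

  certificate-10 : CertificateData
  certificate-10 = record
    { ν = 20 ; D = 18110795175 ; α = 4 ; β = 4 ; e₀ = 5
    ; E = + 10 ∷ + 45 ∷ + 120 ∷ + 210 ∷ + 252 ∷ + 210 ∷ + 120 ∷ + 45 ∷ + 10 ∷ []
    ; R = (+ 4 , 0 , 0) ∷ (+ 20 , 0 , 1) ∷ (+ 65 , 0 , 2) ∷ (+ 150 , 0 , 3) ∷ (+ 266 , 0 , 4) ∷ (+ 384 , 0 , 5) ∷ (+ 468 , 0 , 6) ∷ (+ 518 , 0 , 7) ∷ (+
      567 , 0 , 8) ∷ (+ 628 , 0 , 9) ∷ (+ 660 , 0 , 10) ∷ (+ 628 , 0 , 11) ∷ (+ 567 , 0 , 12) ∷ (+ 518 , 0 , 13) ∷ (+ 468 , 0 , 14) ∷ (+ 384 , 0 , 15) ∷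
      (+ 266 , 0 , 16) ∷ (+ 150 , 0 , 17) ∷ (+ 65 , 0 , 18) ∷ (+ 20 , 0 , 19) ∷ (+ 4 , 0 , 20) ∷ []
    ; Φ = (+ 12010924 , 0 , 10) ∷ (-[1+ 3373599 ] , 0 , 2) ∷ (+ 74473200 , 20 , 0) ∷ (+ 4692600 , 0 , 3) ∷ (+ 4692600 , 0 , 17) ∷ (-[1+ 3373599 ] , 0 ,
      18) ∷ []
    ; K = + 2 ∷ + 1 ∷ + 4 ∷ + 3 ∷ + 0 ∷ + 4 ∷ + 4 ∷ + 4 ∷ + 0 ∷ + 3 ∷ + 4 ∷ + 1 ∷ + 2 ∷ []
    ; K' = + 7236870750 ∷ + 3506725575 ∷ + 13682801110 ∷ + 7543915920 ∷ -[1+ 8486728679 ] ∷ -[1+ 28020089 ] ∷ -[1+ 2818582811 ] ∷ -[1+ 28020089 ] ∷ -[1+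
      8486728679 ] ∷ + 7543915920 ∷ + 13682801110 ∷ + 3506725575 ∷ + 7236870750 ∷ [] }

  direct-10 : DirectData
  direct-10 = record
    { s-2 = 8 ; c = 1 ; x = 0 ; y = 0 ; n = 7 ; u = 300001 ; targets = uncovered 10 [] 3 11 169
    ; E = + 10 ∷ + 45 ∷ + 120 ∷ + 210 ∷ + 252 ∷ + 210 ∷ + 120 ∷ + 45 ∷ + 10 ∷ []
    ; C = + 4 ∷ + 14 ∷ + 37 ∷ + 64 ∷ + 76 ∷ + 64 ∷ + 37 ∷ + 14 ∷ + 3 ∷ []
    ; e = 499997 ∷ 999991 ∷ 999982 ∷ 399976 ∷ 999982 ∷ 999991 ∷ 499997 ∷ 1000002 ∷ []
    ; inv = 627413 ∷ 591662 ∷ 816442 ∷ 235437 ∷ 666924 ∷ 489929 ∷ 997611 ∷ 805284 ∷ [] }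

  -- As for s = 9, now with `E = q ^ 3 + (X Y) ^ 2`: at its zeros X^66 + Y^66 + 1 equals 601523
  -- q^33.
  certificate-11 : CertificateData
  certificate-11 = record
    { ν = 66 ; D = 601523 ; α = 0 ; β = 33 ; e₀ = 1
    ; E = + 1 ∷ + 3 ∷ + 7 ∷ + 9 ∷ + 7 ∷ + 3 ∷ + 1 ∷ []
    ; R = (+ 1 , 0 , 0) ∷ (+ 33 , 0 , 1) ∷ (+ 561 , 0 , 2) ∷ (+ 6512 , 0 , 3) ∷ (+ 57816 , 0 , 4) ∷ (+ 417384 , 0 , 5) ∷ (+ 2545224 , 0 , 6) ∷ (+
      13454496 , 0 , 7) ∷ (+ 62816292 , 0 , 8) ∷ (+ 262691396 , 0 , 9) ∷ (+ 994793844 , 0 , 10) ∷ (+ 3441242544 , 0 , 11) ∷ (+ 10951315936 , 0 , 12) ∷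
      (+ 32249690352 , 0 , 13) ∷ (+ 88311776256 , 0 , 14) ∷ (+ 225810489168 , 0 , 15) ∷ (+ 541050073146 , 0 , 16) ∷ (+ 1218481540650 , 0 , 17) ∷ (+
      2586011572650 , 0 , 18) ∷ (+ 5183987846400 , 0 , 19) ∷ (+ 9835219266840 , 0 , 20) ∷ (+ 17690727583320 , 0 , 21) ∷ (+ 30214037148840 , 0 , 22) ∷ (+
      49062484777680 , 0 , 23) ∷ (+ 75835103430240 , 0 , 24) ∷ (+ 111688111052496 , 0 , 25) ∷ (+ 156868432018848 , 0 , 26) ∷ (+ 210270058417936 , 0 ,
      27) ∷ (+ 269155629687912 , 0 , 28) ∷ (+ 329183118163416 , 0 , 29) ∷ (+ 384821546693144 , 0 , 30) ∷ (+ 430136774584704 , 0 , 31) ∷ (+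
      459807788441331 , 0 , 32) ∷ (+ 470139239360787 , 0 , 33) ∷ (+ 459807788441331 , 0 , 34) ∷ (+ 430136774584704 , 0 , 35) ∷ (+ 384821546693144 , 0 ,
      36) ∷ (+ 329183118163416 , 0 , 37) ∷ (+ 269155629687912 , 0 , 38) ∷ (+ 210270058417936 , 0 , 39) ∷ (+ 156868432018848 , 0 , 40) ∷ (+
      111688111052496 , 0 , 41) ∷ (+ 75835103430240 , 0 , 42) ∷ (+ 49062484777680 , 0 , 43) ∷ (+ 30214037148840 , 0 , 44) ∷ (+ 17690727583320 , 0 , 45)
      ∷ (+ 9835219266840 , 0 , 46) ∷ (+ 5183987846400 , 0 , 47) ∷ (+ 2586011572650 , 0 , 48) ∷ (+ 1218481540650 , 0 , 49) ∷ (+ 541050073146 , 0 , 50) ∷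
      (+ 225810489168 , 0 , 51) ∷ (+ 88311776256 , 0 , 52) ∷ (+ 32249690352 , 0 , 53) ∷ (+ 10951315936 , 0 , 54) ∷ (+ 3441242544 , 0 , 55) ∷ (+
      994793844 , 0 , 56) ∷ (+ 262691396 , 0 , 57) ∷ (+ 62816292 , 0 , 58) ∷ (+ 13454496 , 0 , 59) ∷ (+ 2545224 , 0 , 60) ∷ (+ 417384 , 0 , 61) ∷ (+
      57816 , 0 , 62) ∷ (+ 6512 , 0 , 63) ∷ (+ 561 , 0 , 64) ∷ (+ 33 , 0 , 65) ∷ (+ 1 , 0 , 66) ∷ []
    ; Φ = (+ 1 , 66 , 0) ∷ (+ 1 , 0 , 66) ∷ (+ 1 , 0 , 0) ∷ []
    ; K = []
    ; K' = + 601521 ∷ + 18045630 ∷ + 279104721 ∷ + 2948024754 ∷ + 23812504422 ∷ + 156343385898 ∷ + 866661534492 ∷ + 4162217630337 ∷ + 17643516025122 ∷ +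
      66943087927209 ∷ + 229827088841130 ∷ + 720146078356860 ∷ + 2073971961384280 ∷ + 5521404992188740 ∷ + 13653555143388989 ∷ + 31488140686315002 ∷ +
      67958620466269263 ∷ + 137661989325759966 ∷ + 262393832776808070 ∷ + 471643232413396740 ∷ + 800976677146577440 ∷ + 1287337120842311037 ∷ +
      1960916487745171418 ∷ + 2834443191567145611 ∷ + 3892180165029875658 ∷ + 5082085081832258364 ∷ + 6314777158473783438 ∷ + 7471747637687052336 ∷ +
      8422743757175113849 ∷ + 9049182506745048354 ∷ + 9267958259016327571 ∷ + 9049182506745048354 ∷ + 8422743757175113849 ∷ + 7471747637687052336 ∷ +
      6314777158473783438 ∷ + 5082085081832258364 ∷ + 3892180165029875658 ∷ + 2834443191567145611 ∷ + 1960916487745171418 ∷ + 1287337120842311037 ∷ +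
      800976677146577440 ∷ + 471643232413396740 ∷ + 262393832776808070 ∷ + 137661989325759966 ∷ + 67958620466269263 ∷ + 31488140686315002 ∷ +
      13653555143388989 ∷ + 5521404992188740 ∷ + 2073971961384280 ∷ + 720146078356860 ∷ + 229827088841130 ∷ + 66943087927209 ∷ + 17643516025122 ∷ +
      4162217630337 ∷ + 866661534492 ∷ + 156343385898 ∷ + 23812504422 ∷ + 2948024754 ∷ + 279104721 ∷ + 18045630 ∷ + 601521 ∷ [] }

  direct-11 : DirectData
  direct-11 = record
    { s-2 = 9 ; c = 11 ; x = 1 ; y = 1 ; n = 5 ; u = 1 ; targets = uncovered 11 [] 4 12 890
    ; E = + 1 ∷ + 3 ∷ + 7 ∷ + 9 ∷ + 7 ∷ + 3 ∷ + 1 ∷ []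
    ; C = + 1 ∷ + 1 ∷ + 1 ∷ + 1 ∷ + 1 ∷ + 1 ∷ + 0 ∷ []
    ; e = 1000000 ∷ 999996 ∷ 999994 ∷ 999996 ∷ 1000000 ∷ 1000002 ∷ []
    ; inv = 992514 ∷ 132180 ∷ 390287 ∷ 911820 ∷ 402479 ∷ 400497 ∷ [] }

  direct-12 : DirectData
  direct-12 = record
    { s-2 = 10 ; c = 1 ; x = 0 ; y = 0 ; n = 9 ; u = 416668 ; targets = uncovered 12 approximants 5 13 779
    ; E = + 12 ∷ + 66 ∷ + 220 ∷ + 495 ∷ + 792 ∷ + 924 ∷ + 792 ∷ + 495 ∷ + 220 ∷ + 66 ∷ + 12 ∷ []
    ; C = + 6 ∷ + 28 ∷ + 92 ∷ + 207 ∷ + 331 ∷ + 386 ∷ + 331 ∷ + 207 ∷ + 92 ∷ + 28 ∷ + 5 ∷ []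
    ; e = 499996 ∷ 333316 ∷ 749961 ∷ 999937 ∷ 999926 ∷ 999937 ∷ 749961 ∷ 333316 ∷ 499996 ∷ 1000002 ∷ []
    ; inv = 164606 ∷ 45078 ∷ 198137 ∷ 439629 ∷ 412166 ∷ 275912 ∷ 530976 ∷ 762987 ∷ 644712 ∷ 394914 ∷ [] }

  direct-13 : DirectData
  direct-13 = record
    { s-2 = 11 ; c = 13 ; x = 1 ; y = 2 ; n = 5 ; u = 1 ; targets = uncovered 13 approximants 5 14 402
    ; E = + 1 ∷ + 3 ∷ + 8 ∷ + 11 ∷ + 8 ∷ + 3 ∷ + 1 ∷ []
    ; C = + 1 ∷ + 1 ∷ + 1 ∷ + 1 ∷ + 1 ∷ + 1 ∷ + 0 ∷ []
    ; e = 1000000 ∷ 999995 ∷ 999992 ∷ 999995 ∷ 1000000 ∷ 1000002 ∷ []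
    ; inv = 181126 ∷ 24852 ∷ 220255 ∷ 192270 ∷ 895869 ∷ 809306 ∷ [] }

  direct-14 : DirectData
  direct-14 = record
    { s-2 = 12 ; c = 1 ; x = 0 ; y = 0 ; n = 11 ; u = 357144 ; targets = uncovered 14 approximants 5 15 293
    ; E = + 14 ∷ + 91 ∷ + 364 ∷ + 1001 ∷ + 2002 ∷ + 3003 ∷ + 3432 ∷ + 3003 ∷ + 2002 ∷ + 1001 ∷ + 364 ∷ + 91 ∷ + 14 ∷ []
    ; C = + 6 ∷ + 33 ∷ + 131 ∷ + 358 ∷ + 716 ∷ + 1073 ∷ + 1226 ∷ + 1073 ∷ + 716 ∷ + 358 ∷ + 131 ∷ + 33 ∷ + 5 ∷ []
    ; e = 499995 ∷ 999977 ∷ 499930 ∷ 999860 ∷ 499787 ∷ 285470 ∷ 499787 ∷ 999860 ∷ 499930 ∷ 999977 ∷ 499995 ∷ 1000002 ∷ []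
    ; inv = 880628 ∷ 999957 ∷ 706681 ∷ 185628 ∷ 679784 ∷ 184820 ∷ 493768 ∷ 327287 ∷ 682199 ∷ 296296 ∷ 660108 ∷ 592418 ∷ [] }

  direct-15 : DirectData
  direct-15 = record
    { s-2 = 13 ; c = 1 ; x = 1 ; y = 0 ; n = 11 ; u = 533335 ; targets = uncovered 15 approximants 5 16 254
    ; E = + 15 ∷ + 90 ∷ + 365 ∷ + 1000 ∷ + 2003 ∷ + 3002 ∷ + 3433 ∷ + 3002 ∷ + 2003 ∷ + 1000 ∷ + 365 ∷ + 90 ∷ + 15 ∷ []
    ; C = + 9 ∷ + 49 ∷ + 195 ∷ + 534 ∷ + 1069 ∷ + 1602 ∷ + 1831 ∷ + 1602 ∷ + 1069 ∷ + 534 ∷ + 195 ∷ + 49 ∷ + 8 ∷ []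
    ; e = 999997 ∷ 333310 ∷ 666602 ∷ 733202 ∷ 933136 ∷ 66438 ∷ 933136 ∷ 733202 ∷ 666602 ∷ 333310 ∷ 999997 ∷ 1000002 ∷ []
    ; inv = 318411 ∷ 503513 ∷ 97062 ∷ 671166 ∷ 276568 ∷ 228436 ∷ 4774 ∷ 467818 ∷ 776257 ∷ 38104 ∷ 129363 ∷ 49257 ∷ [] }

  direct-16 : DirectData
  direct-16 = record
    { s-2 = 14 ; c = 2 ; x = 0 ; y = 0 ; n = 13 ; u = 625002 ; targets = uncovered 16 approximants 5 17 207
    ; E = + 8 ∷ + 60 ∷ + 280 ∷ + 910 ∷ + 2184 ∷ + 4004 ∷ + 5720 ∷ + 6435 ∷ + 5720 ∷ + 4004 ∷ + 2184 ∷ + 910 ∷ + 280 ∷ + 60 ∷ + 8 ∷ []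
    ; C = + 6 ∷ + 38 ∷ + 176 ∷ + 569 ∷ + 1366 ∷ + 2503 ∷ + 3576 ∷ + 4022 ∷ + 3576 ∷ + 2503 ∷ + 1366 ∷ + 569 ∷ + 176 ∷ + 38 ∷ + 5 ∷ []
    ; e = 499994 ∷ 999968 ∷ 249887 ∷ 999730 ∷ 499501 ∷ 999288 ∷ 124196 ∷ 999288 ∷ 499501 ∷ 999730 ∷ 249887 ∷ 999968 ∷ 499994 ∷ 1000002 ∷ []
    ; inv = 487701 ∷ 212207 ∷ 212544 ∷ 874477 ∷ 974451 ∷ 512421 ∷ 707529 ∷ 640198 ∷ 102169 ∷ 716896 ∷ 218995 ∷ 139276 ∷ 367054 ∷ 596876 ∷ [] }

  direct-17 : DirectData
  direct-17 = record
    { s-2 = 15 ; c = 17 ; x = 1 ; y = 1 ; n = 11 ; u = 1 ; targets = uncovered 17 approximants 5 18 186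
    ; E = + 1 ∷ + 6 ∷ + 26 ∷ + 75 ∷ + 156 ∷ + 240 ∷ + 277 ∷ + 240 ∷ + 156 ∷ + 75 ∷ + 26 ∷ + 6 ∷ + 1 ∷ []
    ; C = + 1 ∷ + 1 ∷ + 1 ∷ + 1 ∷ + 1 ∷ + 1 ∷ + 1 ∷ + 1 ∷ + 1 ∷ + 1 ∷ + 1 ∷ + 1 ∷ + 0 ∷ []
    ; e = 999997 ∷ 999977 ∷ 999928 ∷ 999847 ∷ 999763 ∷ 999726 ∷ 999763 ∷ 999847 ∷ 999928 ∷ 999977 ∷ 999997 ∷ 1000002 ∷ []
    ; inv = 468656 ∷ 624548 ∷ 691798 ∷ 729702 ∷ 534358 ∷ 519198 ∷ 728428 ∷ 2331 ∷ 746358 ∷ 166060 ∷ 768252 ∷ 305128 ∷ [] }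

  direct-18 : DirectData
  direct-18 = record
    { s-2 = 16 ; c = 1 ; x = 0 ; y = 0 ; n = 15 ; u = 611113 ; targets = uncovered 18 approximants 5 19 197
    ; E = + 18 ∷ + 153 ∷ + 816 ∷ + 3060 ∷ + 8568 ∷ + 18564 ∷ + 31824 ∷ + 43758 ∷ + 48620 ∷ + 43758 ∷ + 31824 ∷ + 18564 ∷ + 8568 ∷ + 3060 ∷ + 816 ∷ + 153
      ∷ + 18 ∷ []
    ; C = + 12 ∷ + 94 ∷ + 499 ∷ + 1871 ∷ + 5237 ∷ + 11345 ∷ + 19449 ∷ + 26742 ∷ + 29713 ∷ + 26742 ∷ + 19449 ∷ + 11345 ∷ + 5237 ∷ + 1871 ∷ + 499 ∷ + 94 ∷
      + 11 ∷ []
    ; e = 499993 ∷ 333289 ∷ 999833 ∷ 999527 ∷ 332303 ∷ 998235 ∷ 997572 ∷ 775079 ∷ 997572 ∷ 998235 ∷ 332303 ∷ 999527 ∷ 999833 ∷ 333289 ∷ 499993 ∷ 1000002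
      ∷ []
    ; inv = 437598 ∷ 781821 ∷ 427230 ∷ 685651 ∷ 434884 ∷ 673714 ∷ 946996 ∷ 461356 ∷ 512838 ∷ 582779 ∷ 867337 ∷ 330825 ∷ 502740 ∷ 827091 ∷ 308636 ∷
      777684 ∷ [] }

  direct-19 : DirectData
  direct-19 = record
    { s-2 = 17 ; c = 19 ; x = 1 ; y = 2 ; n = 11 ; u = 1 ; targets = uncovered 19 approximants 5 20 170
    ; E = + 1 ∷ + 6 ∷ + 28 ∷ + 85 ∷ + 184 ∷ + 292 ∷ + 341 ∷ + 292 ∷ + 184 ∷ + 85 ∷ + 28 ∷ + 6 ∷ + 1 ∷ []
    ; C = + 1 ∷ + 1 ∷ + 1 ∷ + 1 ∷ + 1 ∷ + 1 ∷ + 1 ∷ + 1 ∷ + 1 ∷ + 1 ∷ + 1 ∷ + 1 ∷ + 0 ∷ []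
    ; e = 999997 ∷ 999975 ∷ 999918 ∷ 999819 ∷ 999711 ∷ 999662 ∷ 999711 ∷ 999819 ∷ 999918 ∷ 999975 ∷ 999997 ∷ 1000002 ∷ []
    ; inv = 519423 ∷ 390758 ∷ 18726 ∷ 976539 ∷ 661444 ∷ 770789 ∷ 987297 ∷ 583060 ∷ 706576 ∷ 930240 ∷ 967278 ∷ 269847 ∷ [] }

  direct-20 : DirectData
  direct-20 = record
    { s-2 = 18 ; c = 1 ; x = 0 ; y = 0 ; n = 17 ; u = 650002 ; targets = uncovered 20 approximants 5 21 179
    ; E = + 20 ∷ + 190 ∷ + 1140 ∷ + 4845 ∷ + 15504 ∷ + 38760 ∷ + 77520 ∷ + 125970 ∷ + 167960 ∷ + 184756 ∷ + 167960 ∷ + 125970 ∷ + 77520 ∷ + 38760 ∷ +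
      15504 ∷ + 4845 ∷ + 1140 ∷ + 190 ∷ + 20 ∷ []
    ; C = + 14 ∷ + 124 ∷ + 742 ∷ + 3150 ∷ + 10078 ∷ + 25195 ∷ + 50389 ∷ + 81881 ∷ + 109175 ∷ + 120092 ∷ + 109175 ∷ + 81881 ∷ + 50389 ∷ + 25195 ∷ + 10078
      ∷ + 3150 ∷ + 742 ∷ + 124 ∷ + 13 ∷ []
    ; e = 499992 ∷ 999946 ∷ 749760 ∷ 399226 ∷ 998065 ∷ 996127 ∷ 493703 ∷ 991605 ∷ 590764 ∷ 991605 ∷ 493703 ∷ 996127 ∷ 998065 ∷ 399226 ∷ 749760 ∷ 999946
      ∷ 499992 ∷ 1000002 ∷ []
    ; inv = 848087 ∷ 15993 ∷ 805251 ∷ 768074 ∷ 368542 ∷ 35519 ∷ 857453 ∷ 411123 ∷ 376341 ∷ 431406 ∷ 473680 ∷ 770744 ∷ 515110 ∷ 433700 ∷ 332188 ∷ 316067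
      ∷ 755841 ∷ 378884 ∷ [] }

  direct-21 : DirectData
  direct-21 = record
    { s-2 = 19 ; c = 1 ; x = 1 ; y = 0 ; n = 17 ; u = 238096 ; targets = uncovered 21 approximants 5 22 146
    ; E = + 21 ∷ + 189 ∷ + 1141 ∷ + 4844 ∷ + 15505 ∷ + 38759 ∷ + 77521 ∷ + 125969 ∷ + 167961 ∷ + 184755 ∷ + 167961 ∷ + 125969 ∷ + 77521 ∷ + 38759 ∷ +
      15505 ∷ + 4844 ∷ + 1141 ∷ + 189 ∷ + 21 ∷ []
    ; C = + 6 ∷ + 46 ∷ + 272 ∷ + 1154 ∷ + 3692 ∷ + 9229 ∷ + 18458 ∷ + 29993 ∷ + 39991 ∷ + 43990 ∷ + 39991 ∷ + 29993 ∷ + 18458 ∷ + 9229 ∷ + 3692 ∷ + 1154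
      ∷ + 272 ∷ + 46 ∷ + 5 ∷ []
    ; e = 999994 ∷ 333280 ∷ 666438 ∷ 332596 ∷ 664823 ∷ 615358 ∷ 374955 ∷ 277717 ∷ 705490 ∷ 277717 ∷ 374955 ∷ 615358 ∷ 664823 ∷ 332596 ∷ 666438 ∷ 333280
      ∷ 999994 ∷ 1000002 ∷ []
    ; inv = 480090 ∷ 805924 ∷ 133729 ∷ 192241 ∷ 916080 ∷ 774848 ∷ 898155 ∷ 119408 ∷ 161317 ∷ 383206 ∷ 234278 ∷ 249339 ∷ 436582 ∷ 954181 ∷ 648519 ∷
      610166 ∷ 331118 ∷ 218366 ∷ [] }

  direct-22 : DirectData
  direct-22 = record
    { s-2 = 20 ; c = 1 ; x = 0 ; y = 0 ; n = 19 ; u = 863639 ; targets = uncovered 22 approximants 5 23 153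
    ; E = + 22 ∷ + 231 ∷ + 1540 ∷ + 7315 ∷ + 26334 ∷ + 74613 ∷ + 170544 ∷ + 319770 ∷ + 497420 ∷ + 646646 ∷ + 705432 ∷ + 646646 ∷ + 497420 ∷ + 319770 ∷ +
      170544 ∷ + 74613 ∷ + 26334 ∷ + 7315 ∷ + 1540 ∷ + 231 ∷ + 22 ∷ []
    ; C = + 20 ∷ + 200 ∷ + 1331 ∷ + 6318 ∷ + 22744 ∷ + 64439 ∷ + 147289 ∷ + 276166 ∷ + 429591 ∷ + 558468 ∷ + 609237 ∷ + 558468 ∷ + 429591 ∷ + 276166 ∷ +
      147289 ∷ + 64439 ∷ + 22744 ∷ + 6318 ∷ + 1331 ∷ + 200 ∷ + 19 ∷ []
    ; e = 499991 ∷ 999933 ∷ 499669 ∷ 998806 ∷ 496610 ∷ 992251 ∷ 985468 ∷ 977393 ∷ 970610 ∷ 240663 ∷ 970610 ∷ 977393 ∷ 985468 ∷ 992251 ∷ 496610 ∷ 998806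
      ∷ 499669 ∷ 999933 ∷ 499991 ∷ 1000002 ∷ []
    ; inv = 542379 ∷ 962954 ∷ 261529 ∷ 249715 ∷ 870507 ∷ 96945 ∷ 249514 ∷ 329437 ∷ 916412 ∷ 866019 ∷ 933804 ∷ 96325 ∷ 561465 ∷ 613946 ∷ 155161 ∷ 201521
      ∷ 187037 ∷ 398083 ∷ 907554 ∷ 282794 ∷ [] }

  direct-23 : DirectData
  direct-23 = record
    { s-2 = 21 ; c = 23 ; x = 1 ; y = 1 ; n = 17 ; u = 1 ; targets = uncovered 23 approximants 5 24 160
    ; E = + 1 ∷ + 9 ∷ + 57 ∷ + 252 ∷ + 836 ∷ + 2156 ∷ + 4423 ∷ + 7324 ∷ + 9880 ∷ + 10911 ∷ + 9880 ∷ + 7324 ∷ + 4423 ∷ + 2156 ∷ + 836 ∷ + 252 ∷ + 57 ∷ +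
      9 ∷ + 1 ∷ []
    ; C = + 1 ∷ + 1 ∷ + 1 ∷ + 1 ∷ + 1 ∷ + 1 ∷ + 1 ∷ + 1 ∷ + 1 ∷ + 1 ∷ + 1 ∷ + 1 ∷ + 1 ∷ + 1 ∷ + 1 ∷ + 1 ∷ + 1 ∷ + 1 ∷ + 0 ∷ []
    ; e = 999994 ∷ 999946 ∷ 999751 ∷ 999167 ∷ 997847 ∷ 995580 ∷ 992679 ∷ 990123 ∷ 989092 ∷ 990123 ∷ 992679 ∷ 995580 ∷ 997847 ∷ 999167 ∷ 999751 ∷ 999946
      ∷ 999994 ∷ 1000002 ∷ []
    ; inv = 744548 ∷ 894607 ∷ 950821 ∷ 17728 ∷ 398962 ∷ 559174 ∷ 514085 ∷ 826082 ∷ 260188 ∷ 505313 ∷ 869280 ∷ 920029 ∷ 836548 ∷ 565581 ∷ 209997 ∷ 262127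
      ∷ 609629 ∷ 888245 ∷ [] }

  direct-24 : DirectData
  direct-24 = record
    { s-2 = 22 ; c = 1 ; x = 0 ; y = 0 ; n = 21 ; u = 208334 ; targets = uncovered 24 approximants 5 25 167
    ; E = + 24 ∷ + 276 ∷ + 2024 ∷ + 10626 ∷ + 42504 ∷ + 134596 ∷ + 346104 ∷ + 735471 ∷ + 1307504 ∷ + 1961256 ∷ + 2496144 ∷ + 2704156 ∷ + 2496144 ∷ +
      1961256 ∷ + 1307504 ∷ + 735471 ∷ + 346104 ∷ + 134596 ∷ + 42504 ∷ + 10626 ∷ + 2024 ∷ + 276 ∷ + 24 ∷ []
    ; C = + 6 ∷ + 58 ∷ + 422 ∷ + 2214 ∷ + 8856 ∷ + 28041 ∷ + 72106 ∷ + 153224 ∷ + 272397 ∷ + 408596 ∷ + 520031 ∷ + 563366 ∷ + 520031 ∷ + 408596 ∷ +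
      272397 ∷ + 153224 ∷ + 72106 ∷ + 28041 ∷ + 8856 ∷ + 2214 ∷ + 422 ∷ + 58 ∷ + 5 ∷ []
    ; e = 499990 ∷ 333250 ∷ 249558 ∷ 998232 ∷ 161059 ∷ 985582 ∷ 844358 ∷ 278855 ∷ 918284 ∷ 895997 ∷ 53994 ∷ 895997 ∷ 918284 ∷ 278855 ∷ 844358 ∷ 985582 ∷
      161059 ∷ 998232 ∷ 249558 ∷ 333250 ∷ 499990 ∷ 1000002 ∷ []
    ; inv = 557686 ∷ 649863 ∷ 725474 ∷ 395630 ∷ 194799 ∷ 230342 ∷ 516097 ∷ 672253 ∷ 306097 ∷ 325850 ∷ 612336 ∷ 891310 ∷ 565403 ∷ 815524 ∷ 895086 ∷
      543761 ∷ 903510 ∷ 690274 ∷ 7019 ∷ 768836 ∷ 453923 ∷ 786939 ∷ [] }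

  direct-25 : DirectData
  direct-25 = record
    { s-2 = 23 ; c = 5 ; x = 1 ; y = 2 ; n = 17 ; u = 600002 ; targets = uncovered 25 approximants 5 26 174
    ; E = + 5 ∷ + 45 ∷ + 300 ∷ + 1380 ∷ + 4746 ∷ + 12642 ∷ + 26639 ∷ + 45018 ∷ + 61518 ∷ + 68241 ∷ + 61518 ∷ + 45018 ∷ + 26639 ∷ + 12642 ∷ + 4746 ∷ +
      1380 ∷ + 300 ∷ + 45 ∷ + 5 ∷ []
    ; C = + 4 ∷ + 28 ∷ + 181 ∷ + 829 ∷ + 2848 ∷ + 7586 ∷ + 15984 ∷ + 27011 ∷ + 36911 ∷ + 40945 ∷ + 36911 ∷ + 27011 ∷ + 15984 ∷ + 7586 ∷ + 2848 ∷ + 829 ∷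
      + 181 ∷ + 28 ∷ + 3 ∷ []
    ; e = 999994 ∷ 999943 ∷ 999727 ∷ 399052 ∷ 797474 ∷ 594674 ∷ 190997 ∷ 187697 ∷ 386353 ∷ 187697 ∷ 190997 ∷ 594674 ∷ 797474 ∷ 399052 ∷ 999727 ∷ 999943
      ∷ 999994 ∷ 1000002 ∷ []
    ; inv = 157015 ∷ 923055 ∷ 446866 ∷ 493727 ∷ 595895 ∷ 157308 ∷ 205557 ∷ 842392 ∷ 513052 ∷ 692639 ∷ 631820 ∷ 539462 ∷ 187069 ∷ 758819 ∷ 823297 ∷
      617931 ∷ 257767 ∷ 990464 ∷ [] }

  direct-26 : DirectData
  direct-26 = record
    { s-2 = 24 ; c = 1 ; x = 0 ; y = 0 ; n = 23 ; u = 115385 ; targets = 68 ∷ 69 ∷ 70 ∷ 71 ∷ 72 ∷ 73 ∷ 87 ∷ []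
    ; E = + 26 ∷ + 325 ∷ + 2600 ∷ + 14950 ∷ + 65780 ∷ + 230230 ∷ + 657800 ∷ + 1562275 ∷ + 3124550 ∷ + 5311735 ∷ + 7726160 ∷ + 9657700 ∷ + 10400600 ∷ +
      9657700 ∷ + 7726160 ∷ + 5311735 ∷ + 3124550 ∷ + 1562275 ∷ + 657800 ∷ + 230230 ∷ + 65780 ∷ + 14950 ∷ + 2600 ∷ + 325 ∷ + 26 ∷ []
    ; C = + 4 ∷ + 38 ∷ + 301 ∷ + 1726 ∷ + 7591 ∷ + 26566 ∷ + 75901 ∷ + 180263 ∷ + 360526 ∷ + 612893 ∷ + 891481 ∷ + 1114351 ∷ + 1200070 ∷ + 1114351 ∷ +
      891481 ∷ + 612893 ∷ + 360526 ∷ + 180263 ∷ + 75901 ∷ + 26566 ∷ + 7591 ∷ + 1726 ∷ + 301 ∷ + 38 ∷ + 3 ∷ []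
    ; e = 499989 ∷ 999903 ∷ 999428 ∷ 997473 ∷ 991148 ∷ 974703 ∷ 439914 ∷ 879828 ∷ 295704 ∷ 702843 ∷ 628553 ∷ 369210 ∷ 628553 ∷ 702843 ∷ 295704 ∷ 879828
      ∷ 439914 ∷ 974703 ∷ 991148 ∷ 997473 ∷ 999428 ∷ 999903 ∷ 499989 ∷ 1000002 ∷ []
    ; inv = 674434 ∷ 334734 ∷ 650754 ∷ 555923 ∷ 267587 ∷ 706039 ∷ 973542 ∷ 230891 ∷ 331149 ∷ 151002 ∷ 492965 ∷ 412523 ∷ 152274 ∷ 204014 ∷ 433219 ∷ 54863
      ∷ 854076 ∷ 475704 ∷ 202784 ∷ 815109 ∷ 386085 ∷ 204604 ∷ 654845 ∷ 97628 ∷ [] }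

  direct-27 : DirectData
  direct-27 = record
    { s-2 = 25 ; c = 3 ; x = 1 ; y = 0 ; n = 23 ; u = 222223 ; targets = 71 ∷ 72 ∷ 73 ∷ 74 ∷ 75 ∷ 76 ∷ []
    ; E = + 9 ∷ + 108 ∷ + 867 ∷ + 4983 ∷ + 21927 ∷ + 76743 ∷ + 219267 ∷ + 520758 ∷ + 1041517 ∷ + 1770578 ∷ + 2575387 ∷ + 3219233 ∷ + 3466867 ∷ + 3219233
      ∷ + 2575387 ∷ + 1770578 ∷ + 1041517 ∷ + 520758 ∷ + 219267 ∷ + 76743 ∷ + 21927 ∷ + 4983 ∷ + 867 ∷ + 108 ∷ + 9 ∷ []
    ; C = + 3 ∷ + 25 ∷ + 193 ∷ + 1108 ∷ + 4873 ∷ + 17055 ∷ + 48727 ∷ + 115725 ∷ + 231449 ∷ + 393462 ∷ + 572309 ∷ + 715386 ∷ + 770416 ∷ + 715386 ∷ +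
      572309 ∷ + 393462 ∷ + 231449 ∷ + 115725 ∷ + 48727 ∷ + 17055 ∷ + 4873 ∷ + 1108 ∷ + 193 ∷ + 25 ∷ + 2 ∷ []
    ; e = 999991 ∷ 333238 ∷ 666115 ∷ 330898 ∷ 991476 ∷ 975640 ∷ 942141 ∷ 662056 ∷ 25492 ∷ 491626 ∷ 531199 ∷ 725907 ∷ 531199 ∷ 491626 ∷ 25492 ∷ 662056 ∷
      942141 ∷ 975640 ∷ 991476 ∷ 330898 ∷ 666115 ∷ 333238 ∷ 999991 ∷ 1000002 ∷ []
    ; inv = 35936 ∷ 552139 ∷ 357651 ∷ 252263 ∷ 695168 ∷ 954077 ∷ 111973 ∷ 986437 ∷ 806120 ∷ 119753 ∷ 221224 ∷ 600897 ∷ 329026 ∷ 302305 ∷ 490604 ∷ 254841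
      ∷ 312412 ∷ 565022 ∷ 348406 ∷ 578537 ∷ 933263 ∷ 768711 ∷ 173251 ∷ 732498 ∷ [] }

  direct-28 : DirectData
  direct-28 = record
    { s-2 = 26 ; c = 1 ; x = 0 ; y = 0 ; n = 25 ; u = 178572 ; targets = 74 ∷ 75 ∷ 76 ∷ 77 ∷ 78 ∷ []
    ; E = + 28 ∷ + 378 ∷ + 3276 ∷ + 20475 ∷ + 98280 ∷ + 376740 ∷ + 1184040 ∷ + 3108105 ∷ + 6906900 ∷ + 13123110 ∷ + 21474180 ∷ + 30421755 ∷ + 37442160 ∷
      + 40116600 ∷ + 37442160 ∷ + 30421755 ∷ + 21474180 ∷ + 13123110 ∷ + 6906900 ∷ + 3108105 ∷ + 1184040 ∷ + 376740 ∷ + 98280 ∷ + 20475 ∷ + 3276 ∷ + 378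
      ∷ + 28 ∷ []
    ; C = + 6 ∷ + 68 ∷ + 586 ∷ + 3657 ∷ + 17551 ∷ + 67276 ∷ + 211436 ∷ + 555019 ∷ + 1233376 ∷ + 2343413 ∷ + 3834676 ∷ + 5432458 ∷ + 6686102 ∷ + 7163681
      ∷ + 6686102 ∷ + 5432458 ∷ + 3834676 ∷ + 2343413 ∷ + 1233376 ∷ + 555019 ∷ + 211436 ∷ + 67276 ∷ + 17551 ∷ + 3657 ∷ + 586 ∷ + 68 ∷ + 5 ∷ []
    ; e = 499988 ∷ 999886 ∷ 749271 ∷ 996493 ∷ 986548 ∷ 243428 ∷ 138997 ∷ 753328 ∷ 31319 ∷ 233068 ∷ 663514 ∷ 662786 ∷ 995843 ∷ 662786 ∷ 663514 ∷ 233068 ∷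
      31319 ∷ 753328 ∷ 138997 ∷ 243428 ∷ 986548 ∷ 996493 ∷ 749271 ∷ 999886 ∷ 499988 ∷ 1000002 ∷ []
    ; inv = 225731 ∷ 233828 ∷ 559150 ∷ 977780 ∷ 132260 ∷ 167822 ∷ 689264 ∷ 161508 ∷ 998073 ∷ 126129 ∷ 870238 ∷ 652191 ∷ 670042 ∷ 756838 ∷ 272981 ∷
      696589 ∷ 736760 ∷ 510474 ∷ 510448 ∷ 444649 ∷ 159522 ∷ 384312 ∷ 162333 ∷ 741708 ∷ 976315 ∷ 844059 ∷ [] }

  direct-29 : DirectData
  direct-29 = record
    { s-2 = 27 ; c = 29 ; x = 1 ; y = 1 ; n = 23 ; u = 1 ; targets = 77 ∷ 78 ∷ 79 ∷ 80 ∷ 81 ∷ []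
    ; E = + 1 ∷ + 12 ∷ + 100 ∷ + 594 ∷ + 2695 ∷ + 9702 ∷ + 28432 ∷ + 69042 ∷ + 140695 ∷ + 242784 ∷ + 357010 ∷ + 449232 ∷ + 484867 ∷ + 449232 ∷ + 357010
      ∷ + 242784 ∷ + 140695 ∷ + 69042 ∷ + 28432 ∷ + 9702 ∷ + 2695 ∷ + 594 ∷ + 100 ∷ + 12 ∷ + 1 ∷ []
    ; C = + 1 ∷ + 1 ∷ + 1 ∷ + 1 ∷ + 1 ∷ + 1 ∷ + 1 ∷ + 1 ∷ + 1 ∷ + 1 ∷ + 1 ∷ + 1 ∷ + 1 ∷ + 1 ∷ + 1 ∷ + 1 ∷ + 1 ∷ + 1 ∷ + 1 ∷ + 1 ∷ + 1 ∷ + 1 ∷ + 1 ∷ + 1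
      ∷ + 0 ∷ []
    ; e = 999991 ∷ 999903 ∷ 999409 ∷ 997308 ∷ 990301 ∷ 971571 ∷ 930961 ∷ 859308 ∷ 757219 ∷ 642993 ∷ 550771 ∷ 515136 ∷ 550771 ∷ 642993 ∷ 757219 ∷ 859308
      ∷ 930961 ∷ 971571 ∷ 990301 ∷ 997308 ∷ 999409 ∷ 999903 ∷ 999991 ∷ 1000002 ∷ []
    ; inv = 983187 ∷ 152737 ∷ 132638 ∷ 215217 ∷ 276977 ∷ 667481 ∷ 408267 ∷ 521457 ∷ 978644 ∷ 276339 ∷ 573530 ∷ 693066 ∷ 229636 ∷ 953938 ∷ 428891 ∷
      891064 ∷ 86851 ∷ 339117 ∷ 149752 ∷ 542910 ∷ 511728 ∷ 685350 ∷ 695324 ∷ 814572 ∷ [] }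

  direct-30 : DirectData
  direct-30 = record
    { s-2 = 28 ; c = 1 ; x = 0 ; y = 0 ; n = 27 ; u = 766669 ; targets = 80 ∷ 81 ∷ 82 ∷ 83 ∷ []
    ; E = + 30 ∷ + 435 ∷ + 4060 ∷ + 27405 ∷ + 142506 ∷ + 593775 ∷ + 2035800 ∷ + 5852925 ∷ + 14307150 ∷ + 30045015 ∷ + 54627300 ∷ + 86493225 ∷ +
      119759850 ∷ + 145422675 ∷ + 155117520 ∷ + 145422675 ∷ + 119759850 ∷ + 86493225 ∷ + 54627300 ∷ + 30045015 ∷ + 14307150 ∷ + 5852925 ∷ + 2035800 ∷ +
      593775 ∷ + 142506 ∷ + 27405 ∷ + 4060 ∷ + 435 ∷ + 30 ∷ []
    ; C = + 24 ∷ + 334 ∷ + 3113 ∷ + 21011 ∷ + 109255 ∷ + 455228 ∷ + 1560781 ∷ + 4487243 ∷ + 10968816 ∷ + 23034513 ∷ + 41880932 ∷ + 66311476 ∷ + 91815889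
      ∷ + 111490723 ∷ + 118923438 ∷ + 111490723 ∷ + 91815889 ∷ + 66311476 ∷ + 41880932 ∷ + 23034513 ∷ + 10968816 ∷ + 4487243 ∷ + 1560781 ∷ + 455228 ∷ +
      109255 ∷ + 21011 ∷ + 3113 ∷ + 334 ∷ + 23 ∷ []
    ; e = 499987 ∷ 333199 ∷ 499088 ∷ 395251 ∷ 480209 ∷ 932143 ∷ 304904 ∷ 523098 ∷ 498504 ∷ 179096 ∷ 616903 ∷ 8017 ∷ 652594 ∷ 829434 ∷ 652594 ∷ 8017 ∷
      616903 ∷ 179096 ∷ 498504 ∷ 523098 ∷ 304904 ∷ 932143 ∷ 480209 ∷ 395251 ∷ 499088 ∷ 333199 ∷ 499987 ∷ 1000002 ∷ []
    ; inv = 621068 ∷ 367186 ∷ 467029 ∷ 980050 ∷ 705613 ∷ 422286 ∷ 712246 ∷ 496552 ∷ 989024 ∷ 716674 ∷ 432085 ∷ 216309 ∷ 555069 ∷ 24530 ∷ 671332 ∷ 169536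
      ∷ 390508 ∷ 419664 ∷ 559763 ∷ 922438 ∷ 851014 ∷ 974492 ∷ 888514 ∷ 608091 ∷ 855279 ∷ 379091 ∷ 575200 ∷ 226381 ∷ [] }

  direct-31 : DirectData
  direct-31 = record
    { s-2 = 29 ; c = 31 ; x = 1 ; y = 2 ; n = 23 ; u = 1 ; targets = 83 ∷ 84 ∷ 85 ∷ 86 ∷ []
    ; E = + 1 ∷ + 12 ∷ + 104 ∷ + 638 ∷ + 2984 ∷ + 11052 ∷ + 33235 ∷ + 82572 ∷ + 171584 ∷ + 300788 ∷ + 447464 ∷ + 567072 ∷ + 613525 ∷ + 567072 ∷ + 447464
      ∷ + 300788 ∷ + 171584 ∷ + 82572 ∷ + 33235 ∷ + 11052 ∷ + 2984 ∷ + 638 ∷ + 104 ∷ + 12 ∷ + 1 ∷ []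
    ; C = + 1 ∷ + 1 ∷ + 1 ∷ + 1 ∷ + 1 ∷ + 1 ∷ + 1 ∷ + 1 ∷ + 1 ∷ + 1 ∷ + 1 ∷ + 1 ∷ + 1 ∷ + 1 ∷ + 1 ∷ + 1 ∷ + 1 ∷ + 1 ∷ + 1 ∷ + 1 ∷ + 1 ∷ + 1 ∷ + 1 ∷ + 1
      ∷ + 0 ∷ []
    ; e = 999991 ∷ 999899 ∷ 999365 ∷ 997019 ∷ 988951 ∷ 966768 ∷ 917431 ∷ 828419 ∷ 699215 ∷ 552539 ∷ 432931 ∷ 386478 ∷ 432931 ∷ 552539 ∷ 699215 ∷ 828419
      ∷ 917431 ∷ 966768 ∷ 988951 ∷ 997019 ∷ 999365 ∷ 999899 ∷ 999991 ∷ 1000002 ∷ []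
    ; inv = 14109 ∷ 697661 ∷ 10311 ∷ 434797 ∷ 851353 ∷ 304125 ∷ 268977 ∷ 123301 ∷ 569986 ∷ 760579 ∷ 73451 ∷ 795190 ∷ 774562 ∷ 554163 ∷ 825279 ∷ 140464 ∷
      822932 ∷ 969586 ∷ 31612 ∷ 93655 ∷ 501098 ∷ 469077 ∷ 660888 ∷ 429006 ∷ [] }

  direct-32 : DirectData
  direct-32 = record
    { s-2 = 30 ; c = 2 ; x = 0 ; y = 0 ; n = 29 ; u = 312501 ; targets = 86 ∷ 87 ∷ 88 ∷ []
    ; E = + 16 ∷ + 248 ∷ + 2480 ∷ + 17980 ∷ + 100688 ∷ + 453096 ∷ + 1682928 ∷ + 5259150 ∷ + 14024400 ∷ + 32256120 ∷ + 64512240 ∷ + 112896420 ∷ +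
      173686800 ∷ + 235717800 ∷ + 282861360 ∷ + 300540195 ∷ + 282861360 ∷ + 235717800 ∷ + 173686800 ∷ + 112896420 ∷ + 64512240 ∷ + 32256120 ∷ + 14024400
      ∷ + 5259150 ∷ + 1682928 ∷ + 453096 ∷ + 100688 ∷ + 17980 ∷ + 2480 ∷ + 248 ∷ + 16 ∷ []
    ; C = + 6 ∷ + 78 ∷ + 776 ∷ + 5619 ∷ + 31466 ∷ + 141593 ∷ + 525916 ∷ + 1643485 ∷ + 4382626 ∷ + 10080040 ∷ + 20160080 ∷ + 35280139 ∷ + 54277136 ∷ +
      73661828 ∷ + 88394193 ∷ + 93918830 ∷ + 88394193 ∷ + 73661828 ∷ + 54277136 ∷ + 35280139 ∷ + 20160080 ∷ + 10080040 ∷ + 4382626 ∷ + 1643485 ∷ +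
      525916 ∷ + 141593 ∷ + 31466 ∷ + 5619 ∷ + 776 ∷ + 78 ∷ + 5 ∷ []
    ; e = 499986 ∷ 999848 ∷ 248877 ∷ 993710 ∷ 471683 ∷ 894820 ∷ 296305 ∷ 123478 ∷ 484000 ∷ 968000 ∷ 693997 ∷ 144608 ∷ 767684 ∷ 321219 ∷ 278795 ∷ 321219
      ∷ 767684 ∷ 144608 ∷ 693997 ∷ 968000 ∷ 484000 ∷ 123478 ∷ 296305 ∷ 894820 ∷ 471683 ∷ 993710 ∷ 248877 ∷ 999848 ∷ 499986 ∷ 1000002 ∷ []
    ; inv = 323422 ∷ 862881 ∷ 764015 ∷ 288422 ∷ 585030 ∷ 950994 ∷ 224957 ∷ 917208 ∷ 921502 ∷ 789210 ∷ 222723 ∷ 166793 ∷ 286534 ∷ 192454 ∷ 798168 ∷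
      786933 ∷ 156412 ∷ 445563 ∷ 827905 ∷ 328686 ∷ 897697 ∷ 563201 ∷ 54200 ∷ 699652 ∷ 317832 ∷ 910165 ∷ 549764 ∷ 473886 ∷ 726979 ∷ 915423 ∷ [] }

  direct-33 : DirectData
  direct-33 = record
    { s-2 = 31 ; c = 1 ; x = 1 ; y = 0 ; n = 29 ; u = 242425 ; targets = 89 ∷ 90 ∷ 91 ∷ []
    ; E = + 33 ∷ + 495 ∷ + 4961 ∷ + 35959 ∷ + 201377 ∷ + 906191 ∷ + 3365857 ∷ + 10518299 ∷ + 28048801 ∷ + 64512239 ∷ + 129024481 ∷ + 225792839 ∷ +
      347373601 ∷ + 471435599 ∷ + 565722721 ∷ + 601080389 ∷ + 565722721 ∷ + 471435599 ∷ + 347373601 ∷ + 225792839 ∷ + 129024481 ∷ + 64512239 ∷ +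
      28048801 ∷ + 10518299 ∷ + 3365857 ∷ + 906191 ∷ + 201377 ∷ + 35959 ∷ + 4961 ∷ + 495 ∷ + 33 ∷ []
    ; C = + 9 ∷ + 121 ∷ + 1203 ∷ + 8718 ∷ + 48819 ∷ + 219683 ∷ + 815966 ∷ + 2549891 ∷ + 6799711 ∷ + 15639333 ∷ + 31278666 ∷ + 54737665 ∷ + 84211793 ∷ +
      114287433 ∷ + 137144920 ∷ + 145716477 ∷ + 137144920 ∷ + 114287433 ∷ + 84211793 ∷ + 54737665 ∷ + 31278666 ∷ + 15639333 ∷ + 6799711 ∷ + 2549891 ∷ +
      815966 ∷ + 219683 ∷ + 48819 ∷ + 8718 ∷ + 1203 ∷ + 121 ∷ + 8 ∷ []
    ; e = 999988 ∷ 333184 ∷ 665579 ∷ 327232 ∷ 305874 ∷ 564673 ∷ 14598 ∷ 816708 ∷ 378424 ∷ 29573 ∷ 218420 ∷ 412954 ∷ 774724 ∷ 796335 ∷ 846106 ∷ 796335 ∷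
      774724 ∷ 412954 ∷ 218420 ∷ 29573 ∷ 378424 ∷ 816708 ∷ 14598 ∷ 564673 ∷ 305874 ∷ 327232 ∷ 665579 ∷ 333184 ∷ 999988 ∷ 1000002 ∷ []
    ; inv = 748757 ∷ 566313 ∷ 636405 ∷ 458775 ∷ 262361 ∷ 505353 ∷ 636311 ∷ 225625 ∷ 931292 ∷ 493741 ∷ 264500 ∷ 131984 ∷ 777080 ∷ 138548 ∷ 582786 ∷
      412082 ∷ 971974 ∷ 184275 ∷ 781571 ∷ 856686 ∷ 515663 ∷ 672826 ∷ 842836 ∷ 22325 ∷ 356328 ∷ 683122 ∷ 106081 ∷ 790047 ∷ 744797 ∷ 636383 ∷ [] }

  direct-34 : DirectData
  direct-34 = record
    { s-2 = 32 ; c = 1 ; x = 0 ; y = 0 ; n = 31 ; u = 205883 ; targets = 92 ∷ 93 ∷ []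
    ; E = + 34 ∷ + 561 ∷ + 5984 ∷ + 46376 ∷ + 278256 ∷ + 1344904 ∷ + 5379616 ∷ + 18156204 ∷ + 52451256 ∷ + 131128140 ∷ + 286097760 ∷ + 548354040 ∷ +
      927983760 ∷ + 1391975640 ∷ + 1855967520 ∷ + 2203961430 ∷ + 2333606220 ∷ + 2203961430 ∷ + 1855967520 ∷ + 1391975640 ∷ + 927983760 ∷ + 548354040 ∷ +
      286097760 ∷ + 131128140 ∷ + 52451256 ∷ + 18156204 ∷ + 5379616 ∷ + 1344904 ∷ + 278256 ∷ + 46376 ∷ + 5984 ∷ + 561 ∷ + 34 ∷ []
    ; C = + 8 ∷ + 116 ∷ + 1233 ∷ + 9549 ∷ + 57289 ∷ + 276893 ∷ + 1107569 ∷ + 3738043 ∷ + 10798790 ∷ + 26996974 ∷ + 58902489 ∷ + 112896437 ∷ + 191055508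
      ∷ + 286583261 ∷ + 382111015 ∷ + 453756830 ∷ + 480448409 ∷ + 453756830 ∷ + 382111015 ∷ + 286583261 ∷ + 191055508 ∷ + 112896437 ∷ + 58902489 ∷ +
      26996974 ∷ + 10798790 ∷ + 3738043 ∷ + 1107569 ∷ + 276893 ∷ + 57289 ∷ + 9549 ∷ + 1233 ∷ + 116 ∷ + 7 ∷ []
    ; e = 499985 ∷ 999827 ∷ 998639 ∷ 991819 ∷ 960447 ∷ 841779 ∷ 465997 ∷ 457322 ∷ 143302 ∷ 585387 ∷ 871991 ∷ 706444 ∷ 59663 ∷ 412885 ∷ 177800 ∷ 952967 ∷
      177800 ∷ 412885 ∷ 59663 ∷ 706444 ∷ 871991 ∷ 585387 ∷ 143302 ∷ 457322 ∷ 465997 ∷ 841779 ∷ 960447 ∷ 991819 ∷ 998639 ∷ 999827 ∷ 499985 ∷ 1000002 ∷ []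
    ; inv = 120784 ∷ 589568 ∷ 429727 ∷ 659742 ∷ 785633 ∷ 97708 ∷ 501111 ∷ 777514 ∷ 70482 ∷ 984943 ∷ 83796 ∷ 789335 ∷ 185119 ∷ 537413 ∷ 695440 ∷ 79066 ∷
      304937 ∷ 431233 ∷ 834062 ∷ 712392 ∷ 160770 ∷ 226020 ∷ 749401 ∷ 216262 ∷ 83240 ∷ 261814 ∷ 160008 ∷ 242609 ∷ 582648 ∷ 518207 ∷ 97556 ∷ 683238 ∷ [] }

  direct-35 : DirectData
  direct-35 = record
    { s-2 = 33 ; c = 1 ; x = 1 ; y = 1 ; n = 29 ; u = 942860 ; targets = 95 ∷ 96 ∷ []
    ; E = + 35 ∷ + 525 ∷ + 5425 ∷ + 40425 ∷ + 232407 ∷ + 1072071 ∷ + 4075139 ∷ + 13008993 ∷ + 35367125 ∷ + 82752021 ∷ + 167978615 ∷ + 297623403 ∷ +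
      462381743 ∷ + 631970493 ∷ + 761615285 ∷ + 810375651 ∷ + 761615285 ∷ + 631970493 ∷ + 462381743 ∷ + 297623403 ∷ + 167978615 ∷ + 82752021 ∷ +
      35367125 ∷ + 13008993 ∷ + 4075139 ∷ + 1072071 ∷ + 232407 ∷ + 40425 ∷ + 5425 ∷ + 525 ∷ + 35 ∷ []
    ; C = + 34 ∷ + 496 ∷ + 5116 ∷ + 38116 ∷ + 219127 ∷ + 1010810 ∷ + 3842275 ∷ + 12265623 ∷ + 33346148 ∷ + 78023337 ∷ + 158379842 ∷ + 280616360 ∷ +
      435959943 ∷ + 595857912 ∷ + 718094434 ∷ + 764068495 ∷ + 718094434 ∷ + 595857912 ∷ + 435959943 ∷ + 280616360 ∷ + 158379842 ∷ + 78023337 ∷ +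
      33346148 ∷ + 12265623 ∷ + 3842275 ∷ + 1010810 ∷ + 219127 ∷ + 38116 ∷ + 5116 ∷ + 496 ∷ + 33 ∷ []
    ; e = 999988 ∷ 999848 ∷ 998848 ∷ 393361 ∷ 169370 ∷ 969285 ∷ 656889 ∷ 560944 ∷ 549951 ∷ 200626 ∷ 96500 ∷ 674849 ∷ 543756 ∷ 668202 ∷ 903625 ∷ 668202 ∷
      543756 ∷ 674849 ∷ 96500 ∷ 200626 ∷ 549951 ∷ 560944 ∷ 656889 ∷ 969285 ∷ 169370 ∷ 393361 ∷ 998848 ∷ 999848 ∷ 999988 ∷ 1000002 ∷ []
    ; inv = 583715 ∷ 930755 ∷ 755088 ∷ 164754 ∷ 735751 ∷ 965240 ∷ 131072 ∷ 613847 ∷ 352741 ∷ 199286 ∷ 295716 ∷ 844301 ∷ 176826 ∷ 508406 ∷ 454714 ∷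
      914421 ∷ 778210 ∷ 143071 ∷ 469128 ∷ 252574 ∷ 838106 ∷ 218033 ∷ 492398 ∷ 257912 ∷ 665471 ∷ 498263 ∷ 409127 ∷ 675417 ∷ 670713 ∷ 592446 ∷ [] }

  direct-36 : DirectData
  direct-36 = record
    { s-2 = 34 ; c = 1 ; x = 0 ; y = 0 ; n = 33 ; u = 805558 ; targets = 98 ∷ []
    ; E = + 36 ∷ + 630 ∷ + 7140 ∷ + 58905 ∷ + 376992 ∷ + 1947792 ∷ + 8347680 ∷ + 30260340 ∷ + 94143280 ∷ + 254186856 ∷ + 600805296 ∷ + 1251677700 ∷ +
      2310789600 ∷ + 3796297200 ∷ + 5567902560 ∷ + 7307872110 ∷ + 8597496600 ∷ + 9075135300 ∷ + 8597496600 ∷ + 7307872110 ∷ + 5567902560 ∷ + 3796297200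
      ∷ + 2310789600 ∷ + 1251677700 ∷ + 600805296 ∷ + 254186856 ∷ + 94143280 ∷ + 30260340 ∷ + 8347680 ∷ + 1947792 ∷ + 376992 ∷ + 58905 ∷ + 7140 ∷ + 630
      ∷ + 36 ∷ []
    ; C = + 30 ∷ + 508 ∷ + 5752 ∷ + 47452 ∷ + 303689 ∷ + 1569055 ∷ + 6724521 ∷ + 24376386 ∷ + 75837645 ∷ + 204761642 ∷ + 483982061 ∷ + 1008295960 ∷ +
      1861469465 ∷ + 3058128406 ∷ + 4485254995 ∷ + 5886897181 ∷ + 6925761389 ∷ + 7310525911 ∷ + 6925761389 ∷ + 5886897181 ∷ + 4485254995 ∷ + 3058128406
      ∷ + 1861469465 ∷ + 1008295960 ∷ + 483982061 ∷ + 204761642 ∷ + 75837645 ∷ + 24376386 ∷ + 6724521 ∷ + 1569055 ∷ + 303689 ∷ + 47452 ∷ + 5752 ∷ + 508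
      ∷ + 29 ∷ []
    ; e = 499984 ∷ 333136 ∷ 748366 ∷ 989531 ∷ 279229 ∷ 768123 ∷ 159438 ∷ 162695 ∷ 939278 ∷ 311015 ∷ 231280 ∷ 811595 ∷ 547618 ∷ 336505 ∷ 504163 ∷ 181367
      ∷ 580333 ∷ 181367 ∷ 504163 ∷ 336505 ∷ 547618 ∷ 811595 ∷ 231280 ∷ 311015 ∷ 939278 ∷ 162695 ∷ 159438 ∷ 768123 ∷ 279229 ∷ 989531 ∷ 748366 ∷ 333136 ∷
      499984 ∷ 1000002 ∷ []
    ; inv = 809760 ∷ 142054 ∷ 246451 ∷ 114682 ∷ 541234 ∷ 694431 ∷ 361419 ∷ 603590 ∷ 560321 ∷ 862206 ∷ 780842 ∷ 821518 ∷ 920740 ∷ 96463 ∷ 227624 ∷ 439638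
      ∷ 916515 ∷ 831918 ∷ 664856 ∷ 323155 ∷ 239540 ∷ 494177 ∷ 998007 ∷ 658428 ∷ 931810 ∷ 185085 ∷ 43276 ∷ 788785 ∷ 765742 ∷ 388281 ∷ 985272 ∷ 889854 ∷
      920623 ∷ 92579 ∷ [] }

  direct-37 : DirectData
  direct-37 = record
    { s-2 = 35 ; c = 37 ; x = 1 ; y = 2 ; n = 29 ; u = 1 ; targets = 101 ∷ []
    ; E = + 1 ∷ + 15 ∷ + 160 ∷ + 1225 ∷ + 7228 ∷ + 34177 ∷ + 132965 ∷ + 433705 ∷ + 1202526 ∷ + 2863641 ∷ + 5902746 ∷ + 10593955 ∷ + 16627817 ∷ +
      22895995 ∷ + 27717756 ∷ + 29536971 ∷ + 27717756 ∷ + 22895995 ∷ + 16627817 ∷ + 10593955 ∷ + 5902746 ∷ + 2863641 ∷ + 1202526 ∷ + 433705 ∷ + 132965 ∷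
      + 34177 ∷ + 7228 ∷ + 1225 ∷ + 160 ∷ + 15 ∷ + 1 ∷ []
    ; C = + 1 ∷ + 1 ∷ + 1 ∷ + 1 ∷ + 1 ∷ + 1 ∷ + 1 ∷ + 1 ∷ + 2 ∷ + 3 ∷ + 6 ∷ + 11 ∷ + 17 ∷ + 23 ∷ + 28 ∷ + 30 ∷ + 28 ∷ + 23 ∷ + 17 ∷ + 11 ∷ + 6 ∷ + 3 ∷ +
      2 ∷ + 1 ∷ + 1 ∷ + 1 ∷ + 1 ∷ + 1 ∷ + 1 ∷ + 1 ∷ + 0 ∷ []
    ; e = 999988 ∷ 999843 ∷ 998778 ∷ 992775 ∷ 965826 ∷ 867038 ∷ 566298 ∷ 797480 ∷ 136368 ∷ 97272 ∷ 406078 ∷ 372234 ∷ 104074 ∷ 282328 ∷ 463119 ∷ 282328 ∷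
      104074 ∷ 372234 ∷ 406078 ∷ 97272 ∷ 136368 ∷ 797480 ∷ 566298 ∷ 867038 ∷ 965826 ∷ 992775 ∷ 998778 ∷ 999843 ∷ 999988 ∷ 1000002 ∷ []
    ; inv = 0 ∷ 226168 ∷ 166343 ∷ 743329 ∷ 432213 ∷ 715005 ∷ 279813 ∷ 951410 ∷ 486390 ∷ 386972 ∷ 705580 ∷ 977990 ∷ 439684 ∷ 111060 ∷ 489295 ∷ 395281 ∷
      959999 ∷ 321480 ∷ 865605 ∷ 476460 ∷ 612131 ∷ 591326 ∷ 498340 ∷ 90589 ∷ 321000 ∷ 59947 ∷ 188791 ∷ 795903 ∷ 397736 ∷ 732022 ∷ [] }

  -- For s = 38 and s = 39 the approximants leave no exponent over, so the product is empty and its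
  -- inverse is 1.
  direct-38 : DirectData
  direct-38 = record
    { s-2 = 36 ; c = 1 ; x = 0 ; y = 0 ; n = 35 ; u = 605265 ; targets = []
    ; E = + 38 ∷ + 703 ∷ + 8436 ∷ + 73815 ∷ + 501942 ∷ + 2760681 ∷ + 12620256 ∷ + 48903492 ∷ + 163011640 ∷ + 472733756 ∷ + 1203322288 ∷ + 2707475148 ∷ +
      5414950296 ∷ + 9669554100 ∷ + 15471286560 ∷ + 22239974430 ∷ + 28781143380 ∷ + 33578000610 ∷ + 35345263800 ∷ + 33578000610 ∷ + 28781143380 ∷ +
      22239974430 ∷ + 15471286560 ∷ + 9669554100 ∷ + 5414950296 ∷ + 2707475148 ∷ + 1203322288 ∷ + 472733756 ∷ + 163011640 ∷ + 48903492 ∷ + 12620256 ∷ +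
      2760681 ∷ + 501942 ∷ + 73815 ∷ + 8436 ∷ + 703 ∷ + 38 ∷ []
    ; C = + 24 ∷ + 426 ∷ + 5107 ∷ + 44678 ∷ + 303808 ∷ + 1670939 ∷ + 7638577 ∷ + 29599484 ∷ + 98664945 ∷ + 286128339 ∷ + 728326680 ∷ + 1638735030 ∷ +
      3277470059 ∷ + 5852625105 ∷ + 9364200168 ∷ + 13461037741 ∷ + 17420166488 ∷ + 20323527569 ∷ + 21393186915 ∷ + 20323527569 ∷ + 17420166488 ∷ +
      13461037741 ∷ + 9364200168 ∷ + 5852625105 ∷ + 3277470059 ∷ + 1638735030 ∷ + 728326680 ∷ + 286128339 ∷ + 98664945 ∷ + 29599484 ∷ + 7638577 ∷ +
      1670939 ∷ + 303808 ∷ + 44678 ∷ + 5107 ∷ + 426 ∷ + 23 ∷ []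
    ; e = 499983 ∷ 999781 ∷ 498059 ∷ 986794 ∷ 427352 ∷ 667891 ∷ 713072 ∷ 710235 ∷ 559677 ∷ 333720 ∷ 750870 ∷ 501737 ∷ 538815 ∷ 862104 ∷ 739273 ∷ 603764
      ∷ 371057 ∷ 653745 ∷ 371057 ∷ 603764 ∷ 739273 ∷ 862104 ∷ 538815 ∷ 501737 ∷ 750870 ∷ 333720 ∷ 559677 ∷ 710235 ∷ 713072 ∷ 667891 ∷ 427352 ∷ 986794 ∷
      498059 ∷ 999781 ∷ 499983 ∷ 1000002 ∷ []
    ; inv = 0 ∷ 0 ∷ 0 ∷ 0 ∷ 0 ∷ 0 ∷ 0 ∷ 0 ∷ 0 ∷ 0 ∷ 0 ∷ 0 ∷ 0 ∷ 0 ∷ 0 ∷ 0 ∷ 0 ∷ 0 ∷ 0 ∷ 0 ∷ 0 ∷ 0 ∷ 0 ∷ 0 ∷ 0 ∷ 0 ∷ 0 ∷ 0 ∷ 0 ∷ 0 ∷ 0 ∷ 0 ∷ 0 ∷ 0 ∷ 0 ∷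
      1 ∷ [] }

  direct-39 : DirectData
  direct-39 = record
    { s-2 = 37 ; c = 1 ; x = 1 ; y = 0 ; n = 35 ; u = 743592 ; targets = []
    ; E = + 39 ∷ + 702 ∷ + 8437 ∷ + 73814 ∷ + 501943 ∷ + 2760680 ∷ + 12620257 ∷ + 48903491 ∷ + 163011641 ∷ + 472733755 ∷ + 1203322289 ∷ + 2707475147 ∷ +
      5414950297 ∷ + 9669554099 ∷ + 15471286561 ∷ + 22239974429 ∷ + 28781143381 ∷ + 33578000609 ∷ + 35345263801 ∷ + 33578000609 ∷ + 28781143381 ∷ +
      22239974429 ∷ + 15471286561 ∷ + 9669554099 ∷ + 5414950297 ∷ + 2707475147 ∷ + 1203322289 ∷ + 472733755 ∷ + 163011641 ∷ + 48903491 ∷ + 12620257 ∷ +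
      2760680 ∷ + 501943 ∷ + 73814 ∷ + 8437 ∷ + 702 ∷ + 39 ∷ []
    ; C = + 30 ∷ + 523 ∷ + 6274 ∷ + 54888 ∷ + 373240 ∷ + 2052814 ∷ + 9384294 ∷ + 36364136 ∷ + 121213789 ∷ + 351519984 ∷ + 894778144 ∷ + 2013250820 ∷ +
      4026501642 ∷ + 7190181502 ∷ + 11504290404 ∷ + 16537417454 ∷ + 21401363765 ∷ + 24968257725 ∷ + 26282376554 ∷ + 24968257725 ∷ + 21401363765 ∷ +
      16537417454 ∷ + 11504290404 ∷ + 7190181502 ∷ + 4026501642 ∷ + 2013250820 ∷ + 894778144 ∷ + 351519984 ∷ + 121213789 ∷ + 36364136 ∷ + 9384294 ∷ +
      2052814 ∷ + 373240 ∷ + 54888 ∷ + 6274 ∷ + 523 ∷ + 29 ∷ []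
    ; e = 999985 ∷ 333118 ∷ 664776 ∷ 320464 ∷ 595882 ∷ 9738 ∷ 412736 ∷ 486895 ∷ 211992 ∷ 812344 ∷ 244436 ∷ 258102 ∷ 960898 ∷ 404100 ∷ 643394 ∷ 126743 ∷
      925647 ∷ 816470 ∷ 925647 ∷ 126743 ∷ 643394 ∷ 404100 ∷ 960898 ∷ 258102 ∷ 244436 ∷ 812344 ∷ 211992 ∷ 486895 ∷ 412736 ∷ 9738 ∷ 595882 ∷ 320464 ∷
      664776 ∷ 333118 ∷ 999985 ∷ 1000002 ∷ []
    ; inv = 0 ∷ 0 ∷ 0 ∷ 0 ∷ 0 ∷ 0 ∷ 0 ∷ 0 ∷ 0 ∷ 0 ∷ 0 ∷ 0 ∷ 0 ∷ 0 ∷ 0 ∷ 0 ∷ 0 ∷ 0 ∷ 0 ∷ 0 ∷ 0 ∷ 0 ∷ 0 ∷ 0 ∷ 0 ∷ 0 ∷ 0 ∷ 0 ∷ 0 ∷ 0 ∷ 0 ∷ 0 ∷ 0 ∷ 0 ∷ 0 ∷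
      1 ∷ [] }

  Beukers : ℕ → Set₁
  Beukers s = ∀ r → s ℕ.< r → ∀ M → Modulus.I M (F s) → Modulus.I M (F r) → Trivial M

  beukers-8 : Beukers 8
  beukers-8 = small-s direct-8 certificate-8 [] 3 28 tt tt tt tt tt tt tt tt tt

  beukers-9 : Beukers 9
  beukers-9 = small-s direct-9 certificate-9 [] 3 8 tt tt tt tt tt tt tt tt tt

  beukers-10 : Beukers 10
  beukers-10 = small-s direct-10 certificate-10 [] 3 8 tt tt tt tt tt tt tt tt tt

  beukers-11 : Beukers 11
  beukers-11 = small-s direct-11 certificate-11 [] 4 40 tt tt tt tt tt tt tt tt tt

  beukers-12 : Beukers 12
  beukers-12 = small-s direct-12 universal approximants 5 32 tt tt universal-valid tt approximants-valid tt tt tt tt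

  beukers-13 : Beukers 13
  beukers-13 = small-s direct-13 universal approximants 5 15 tt tt universal-valid tt approximants-valid tt tt tt tt

  beukers-14 : Beukers 14
  beukers-14 = small-s direct-14 universal approximants 5 10 tt tt universal-valid tt approximants-valid tt tt tt tt

  beukers-15 : Beukers 15
  beukers-15 = small-s direct-15 universal approximants 5 8 tt tt universal-valid tt approximants-valid tt tt tt tt

  beukers-16 : Beukers 16
  beukers-16 = small-s direct-16 universal approximants 5 6 tt tt universal-valid tt approximants-valid tt tt tt tt

  beukers-17 : Beukers 17
  beukers-17 = small-s direct-17 universal approximants 5 5 tt tt universal-valid tt approximants-valid tt tt tt tt

  beukers-18 : Beukers 18
  beukers-18 = small-s direct-18 universal approximants 5 5 tt tt universal-valid tt approximants-valid tt tt tt tt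

  beukers-19 : Beukers 19
  beukers-19 = small-s direct-19 universal approximants 5 4 tt tt universal-valid tt approximants-valid tt tt tt tt

  beukers-20 : Beukers 20
  beukers-20 = small-s direct-20 universal approximants 5 4 tt tt universal-valid tt approximants-valid tt tt tt tt

  beukers-21 : Beukers 21
  beukers-21 = small-s direct-21 universal approximants 5 3 tt tt universal-valid tt approximants-valid tt tt tt tt

  beukers-22 : Beukers 22
  beukers-22 = small-s direct-22 universal approximants 5 3 tt tt universal-valid tt approximants-valid tt tt tt tt

  beukers-23 : Beukers 23
  beukers-23 = small-s direct-23 universal approximants 5 3 tt tt universal-valid tt approximants-valid tt tt tt tt

  beukers-24 : Beukers 24
  beukers-24 = small-s direct-24 universal approximants 5 3 tt tt universal-valid tt approximants-valid tt tt tt tt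

  beukers-25 : Beukers 25
  beukers-25 = small-s direct-25 universal approximants 5 3 tt tt universal-valid tt approximants-valid tt tt tt tt

  beukers-26 : Beukers 26
  beukers-26 = small-s direct-26 universal approximants 5 2 tt tt universal-valid tt approximants-valid tt tt tt tt

  beukers-27 : Beukers 27
  beukers-27 = small-s direct-27 universal approximants 5 2 tt tt universal-valid tt approximants-valid tt tt tt tt

  beukers-28 : Beukers 28
  beukers-28 = small-s direct-28 universal approximants 5 2 tt tt universal-valid tt approximants-valid tt tt tt tt

  beukers-29 : Beukers 29
  beukers-29 = small-s direct-29 universal approximants 5 2 tt tt universal-valid tt approximants-valid tt tt tt tt

  beukers-30 : Beukers 30
  beukers-30 = small-s direct-30 universal approximants 5 2 tt tt universal-valid tt approximants-valid tt tt tt tt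

  beukers-31 : Beukers 31
  beukers-31 = small-s direct-31 universal approximants 5 2 tt tt universal-valid tt approximants-valid tt tt tt tt

  beukers-32 : Beukers 32
  beukers-32 = small-s direct-32 universal approximants 5 2 tt tt universal-valid tt approximants-valid tt tt tt tt

  beukers-33 : Beukers 33
  beukers-33 = small-s direct-33 universal approximants 5 2 tt tt universal-valid tt approximants-valid tt tt tt tt

  beukers-34 : Beukers 34
  beukers-34 = small-s direct-34 universal approximants 5 2 tt tt universal-valid tt approximants-valid tt tt tt tt

  beukers-35 : Beukers 35
  beukers-35 = small-s direct-35 universal approximants 5 2 tt tt universal-valid tt approximants-valid tt tt tt tt

  beukers-36 : Beukers 36
  beukers-36 = small-s direct-36 universal approximants 5 2 tt tt universal-valid tt approximants-valid tt tt tt tt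

  beukers-37 : Beukers 37
  beukers-37 = small-s direct-37 universal approximants 5 2 tt tt universal-valid tt approximants-valid tt tt tt tt

  beukers-38 : Beukers 38
  beukers-38 = small-s direct-38 universal approximants 5 2 tt tt universal-valid tt approximants-valid tt tt tt tt

  beukers-39 : Beukers 39
  beukers-39 = small-s direct-39 universal approximants 5 2 tt tt universal-valid tt approximants-valid tt tt tt tt

  beukers-small : All (λ i → Beukers (8 ℕ.+ i)) (upTo 32)
  beukers-small = beukers-8 ∷ beukers-9 ∷ beukers-10 ∷ beukers-11 ∷ beukers-12 ∷ beukers-13 ∷ beukers-14 ∷ beukers-15 ∷ beukers-16 ∷ beukers-17 ∷ beukers-18 ∷ beukers-19 ∷ beukers-20 ∷ beukers-21 ∷ beukers-22 ∷ beukers-23 ∷ beukers-24 ∷ beukers-25 ∷ beukers-26 ∷ beukers-27 ∷ beukers-28 ∷ beukers-29 ∷ beukers-30 ∷ beukers-31 ∷ beukers-32 ∷ beukers-33 ∷ beukers-34 ∷ beukers-35 ∷ beukers-36 ∷ beukers-37 ∷ beukers-38 ∷ beukers-39 ∷ []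

  beukers : ∀ s → 8 ℕ.≤ s → Beukers s
  beukers s 8≤s = decide (40 ℕ.≤? s)
    where
    decide : Dec (40 ℕ.≤ s) → Beukers s
    decide (yes h) = λ r → LargeS.large-s universal universal-valid tt tt tt tt tt tt tt s r h
    decide (no h)  = subst Beukers (ℕₚ.m+[n∸m]≡n 8≤s) (All.lookup beukers-small (∈-upTo⁺ (ℕₚ.∸-monoˡ-< (ℕₚ.≰⇒> h) 8≤s)))

open CertificateTables

-- Roots modulo a prime, and digit codes for coefficient vectors.

module RootsModuloPrime where
  open import Data.Integer using (_+_; _*_; _-_; -_; _^_; _⊖_)
  open import Data.Integer.Properties
  open import Data.Integer.Divisibility.Signed

  geometric : ∀ k (t y : ℕ) → (+ t) ^ suc k - (+ y) ^ suc k ≡ (+ t - + y) * ev (suc k) (λ i → (+ y) ^ (k ℕ.∸ i)) t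
  geometric zero    t y = l (+ t) (+ y)
    where
    l : ∀ t y → t * 1ℤ - y * 1ℤ ≡ (t - y) * (0ℤ + 1ℤ * 1ℤ)
    l = solve-∀
  geometric (suc k) t y = begin
    + t * U - + y * Z ≡⟨ l₁ (+ t) (+ y) U Z ⟩
    (+ t - + y) * U + + y * (U - Z) ≡⟨ cong (λ z → (+ t - + y) * U + + y * z) (geometric k t y) ⟩
    (+ t - + y) * U + + y * ((+ t - + y) * G) ≡⟨ l₂ (+ t - + y) U (+ y) G ⟩
    (+ t - + y) * (+ y * G + 1ℤ * U) ≡⟨ cong₂ (λ u v → (+ t - + y) * (u + v * U)) (trans (sym (ev-* (suc k) (+ y) (λ i → (+ y) ^ (k ℕ.∸ i)) t)) (ev-cong (suc k) (λ i i<k → cong ((+ y) ^_) (sym (ℕₚ.+-∸-assoc 1 (ℕₚ.≤-pred i<k)))) t)) (cong ((+ y) ^_) (sym (ℕₚ.n∸n≡0 k))) ⟩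
    (+ t - + y) * ev (suc (suc k)) (λ i → (+ y) ^ (suc k ℕ.∸ i)) t ∎
    where
    open ≡-Reasoning
    U = (+ t) ^ suc k
    Z = (+ y) ^ suc k
    G = ev (suc k) (λ i → (+ y) ^ (k ℕ.∸ i)) t
    l₁ : ∀ t y U Z → t * U - y * Z ≡ (t - y) * U + y * (U - Z)
    l₁ = solve-∀
    l₂ : ∀ d U y G → d * U + y * (d * G) ≡ d * (y * G + 1ℤ * U)
    l₂ = solve-∀

  divide : ∀ k (a : Fn) y → ∃ λ (b : Fn) → (∀ t → ev (suc (suc k)) a t - ev (suc (suc k)) a y ≡ (+ t - + y) * ev (suc k) b t) × b k ≡ a (suc k)
  divide zero    a y = (λ _ → a 1) , (λ t → l (a 0) (a 1) (+ t) (+ y)) , refl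
    where
    l : ∀ a b t y → 0ℤ + a * 1ℤ + b * (t * 1ℤ) - (0ℤ + a * 1ℤ + b * (y * 1ℤ)) ≡ (t - y) * (0ℤ + b * 1ℤ)
    l = solve-∀
  divide (suc k) a y = b , eq , top
    where
    ih = divide k a y
    b₀ = cut (suc k) (proj₁ ih)
    g : Fn
    g i = (+ y) ^ (suc k ℕ.∸ i)
    c = a (suc (suc k))
    b : Fn
    b i = b₀ i + c * g i
    top : b (suc k) ≡ c
    top = trans (cong₂ (λ u v → u + c * (+ y) ^ v) (cut-≥ (suc k) (proj₁ ih) (suc k) ℕₚ.≤-refl) (ℕₚ.n∸n≡0 k)) (l c)
      where
      l : ∀ c → 0ℤ + c * 1ℤ ≡ c
      l = solve-∀
    l₁ : ∀ u v c T Z → u + c * T - (v + c * Z) ≡ (u - v) + c * (T - Z)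
    l₁ = solve-∀
    l₂ : ∀ d B c G → d * B + c * (d * G) ≡ d * (B + c * G)
    l₂ = solve-∀
    eq : ∀ t → ev (suc (suc (suc k))) a t - ev (suc (suc (suc k))) a y ≡ (+ t - + y) * ev (suc (suc k)) b t
    eq t = trans (l₁ (ev (suc (suc k)) a t) (ev (suc (suc k)) a y) c ((+ t) ^ suc (suc k)) ((+ y) ^ suc (suc k)))
      (trans (cong₂ (λ u v → u + c * v) (proj₁ (proj₂ ih) t) (geometric (suc k) t y))
        (trans (l₂ (+ t - + y) (ev (suc k) (proj₁ ih) t) c (ev (suc (suc k)) g t))
          (cong ((+ t - + y) *_) (sym (trans (ev-+ (suc (suc k)) b₀ (λ i → c * g i) t) (cong₂ _+_
            (trans (cong (λ z → ev (suc k) b₀ t + z * (+ t) ^ suc k) (cut-≥ (suc k) (proj₁ ih) (suc k) ℕₚ.≤-refl))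
              (trans (+-identityʳ (ev (suc k) b₀ t)) (ev-cong (suc k) (cut-< (suc k) (proj₁ ih)) t)))
            (ev-* (suc (suc k)) c g t)))))))

  module _ (p : ℕ) (pr : Prime p) where

    euclid : ∀ u v → + p ∣ u * v → (+ p ∣ u) ⊎ (+ p ∣ v)
    euclid u v h with euclidsLemma (∣ u ∣) (∣ v ∣) pr (subst (p ℕ∣.∣_) (abs-* u v) (∣⇒∣ᵤ h))
    ... | inj₁ d = inj₁ (∣ᵤ⇒∣ d)
    ... | inj₂ d = inj₂ (∣ᵤ⇒∣ d)

    distinct : ∀ {t y} → t ℕ.< p → y ℕ.< p → y ≢ t → ¬ + p ∣ + t - + y
    distinct {t} {y} t<p y<p y≢t h = y≢t (sym (+-injective (i-j≡0⇒i≡j (+ t) (+ y) (∣-small {+ p} h lt))))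
      where
      lt : ∣ + t - + y ∣ ℕ.< p
      lt = subst (ℕ._< p) (sym (trans (cong ∣_∣ (m-n≡m⊖n t y)) (∣m⊖n∣≡∣n⊖m∣' t y))) (ℕₚ.≤-<-trans (ℕₚ.∣m-n∣≤m⊔n t y) (ℕₚ.⊔-lub t<p y<p))
        where
        ∣m⊖n∣≡∣n⊖m∣' : ∀ t y → ∣ t ⊖ y ∣ ≡ ℕ.∣ t - y ∣
        ∣m⊖n∣≡∣n⊖m∣' t y with ℕₚ.≤-total t y
        ... | inj₁ t≤y = trans (cong ∣_∣ (⊖-≤ t≤y)) (trans (∣-i∣≡∣i∣ (+ (y ℕ.∸ t))) (sym (ℕₚ.m≤n⇒∣m-n∣≡n∸m t≤y)))
        ... | inj₂ y≤t = trans (cong ∣_∣ (⊖-≥ y≤t)) (sym (ℕₚ.m≤n⇒∣n-m∣≡n∸m y≤t))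

    roots : ∀ n (a : Fn) ys → n ℕ.≤ length ys → All (ℕ._< p) ys → AllPairs _≢_ ys → All (λ y → + p ∣ ev n a y) ys → ∀ i → i ℕ.< n → + p ∣ a i
    roots (suc n) a (y ∷ ys) (s≤s n≤) (y<p ∷ ys<p) (y≢ ∷ uniq) (vy ∷ vys) i i<1+n = pick (ℕₚ.m<1+n⇒m<n∨m≡n i<1+n)
      where
      top : ∀ n → n ℕ.≤ length ys → + p ∣ ev (suc n) a y → All (λ y → + p ∣ ev (suc n) a y) ys → + p ∣ a n
      top zero    _  vy vys = subst (+ p ∣_) (l (a 0)) vy
        where
        l : ∀ a → 0ℤ + a * 1ℤ ≡ a
        l = solve-∀
      top (suc k) n≤ vy vys = subst (+ p ∣_) (proj₂ (proj₂ qt)) (roots (suc k) (proj₁ qt) ys n≤ ys<p uniq (go ys<p y≢ vys) k (ℕₚ.n<1+n k))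
        where
        qt = divide k a y
        pickʳ : ∀ t → t ℕ.< p → y ≢ t → (+ p ∣ (+ t - + y)) ⊎ (+ p ∣ ev (suc k) (proj₁ qt) t) → + p ∣ ev (suc k) (proj₁ qt) t
        pickʳ t t<p y≢t (inj₁ d) = ⊥-elim (distinct t<p y<p y≢t d)
        pickʳ t t<p y≢t (inj₂ d) = d
        go : ∀ {ts} → All (ℕ._< p) ts → All (y ≢_) ts → All (λ t → + p ∣ ev (suc (suc k)) a t) ts → All (λ t → + p ∣ ev (suc k) (proj₁ qt) t) ts
        go []        []         []        = []
        go {t ∷ _} (t<p ∷ ts<p) (y≢t ∷ y≢ts) (v ∷ vs) = pickʳ t t<p y≢t (euclid (+ t - + y) (ev (suc k) (proj₁ qt) t) (subst (+ p ∣_) (proj₁ (proj₂ qt) t) (∣m∣n⇒∣m-n v vy))) ∷ go ts<p y≢ts vs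
      a-top : + p ∣ a n
      a-top = top n n≤ vy vys
      lower : All (λ y → + p ∣ ev n a y) ys
      lower = All.map (λ {t} v → ∣m+n∣n⇒∣m {m = ev n a t} {n = a n * (+ t) ^ n} v (∣m⇒∣m*n ((+ t) ^ n) a-top)) vys
      pick : i ℕ.< n ⊎ i ≡ n → + p ∣ a i
      pick (inj₁ i<n)  = roots n a ys n≤ ys<p uniq lower i i<n
      pick (inj₂ refl) = a-top

  -- Counting values needs a bound for each single coefficient instead of their sum. Such a bound is
  -- multiplied by at most the coefficient sum of the other factor in a product.
  record Mx (n b : ℕ) (A : Fn) : Set where
    constructor mx
    field
      coef    : Fn
      isEv    : ∀ t → A t ≡ ev n coef t
      bounded : ∀ i → i ℕ.< n → ∣ coef i ∣ ℕ.≤ b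

  Mx-cast : ∀ {n b c A B} → b ℕ.≤ c → (∀ t → A t ≡ B t) → Mx n b A → Mx n c B
  Mx-cast b≤c e (mx a ea na) = mx a (λ t → trans (sym (e t)) (ea t)) (λ i h → ℕₚ.≤-trans (na i h) b≤c)

  Mx-+ : ∀ {n b c A B} → Mx n b A → Mx n c B → Mx n (b ℕ.+ c) (λ t → A t + B t)
  Mx-+ {n} (mx a ea na) (mx b eb nb) = mx (λ i → a i + b i)
    (λ t → trans (cong₂ _+_ (ea t) (eb t)) (sym (ev-+ n a b t)))
    (λ i h → ℕₚ.≤-trans (∣i+j∣≤∣i∣+∣j∣ (a i) (b i)) (ℕₚ.+-mono-≤ (na i h) (nb i h)))

  Mx-scale : ∀ {n b A} k → Mx n b A → Mx n (∣ k ∣ ℕ.* b) (λ t → k * A t)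
  Mx-scale {n} k (mx a ea na) = mx (λ i → k * a i)
    (λ t → trans (cong (k *_) (ea t)) (sym (ev-* n k a t)))
    (λ i h → ℕₚ.≤-trans (ℕₚ.≤-reflexive (abs-* k (a i))) (ℕₚ.*-monoʳ-≤ (∣ k ∣) (na i h)))

  Mx-t* : ∀ {n b A} → Mx n b A → Mx (suc n) b (λ t → + t * A t)
  Mx-t* {n} {b} (mx a ea na) = mx (shift a)
    (λ t → trans (cong (+ t *_) (ea t)) (sym (ev-shift n a t))) bd
    where
    bd : ∀ i → i ℕ.< suc n → ∣ shift a i ∣ ℕ.≤ b
    bd zero    _       = z≤n
    bd (suc i) (s≤s h) = na i h

  Mx-suc : ∀ {n b A} → Mx n b A → Mx (suc n) b A
  Mx-suc {n} {b} (mx a ea na) = mx (cut n a)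
    (λ t → trans (ea t) (trans (ev-cong n (λ i i<n → sym (cut-< n a i i<n)) t)
      (sym (trans (cong (λ z → ev n (cut n a) t + z * (+ t) ^ n) (cut-≥ n a n ℕₚ.≤-refl)) (+-identityʳ _)))))
    bd
    where
    bd : ∀ i → i ℕ.< suc n → ∣ cut n a i ∣ ℕ.≤ b
    bd i h with ℕₚ.m<1+n⇒m<n∨m≡n h
    ... | inj₁ i<n  = subst (λ z → ∣ z ∣ ℕ.≤ b) (sym (cut-< n a i i<n)) (na i i<n)
    ... | inj₂ refl = subst (λ z → ∣ z ∣ ℕ.≤ b) (sym (cut-≥ n a n ℕₚ.≤-refl)) z≤n

  Mx-t^ : ∀ i {n b A} → Mx n b A → Mx (i ℕ.+ n) b (λ t → (+ t) ^ i * A t)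
  Mx-t^ zero    {A = A} p = Mx-cast ℕₚ.≤-refl (λ t → sym (*-identityˡ (A t))) p
  Mx-t^ (suc i) {A = A} p = Mx-cast ℕₚ.≤-refl (λ t → sym (*-assoc (+ t) ((+ t) ^ i) (A t))) (Mx-t* (Mx-t^ i p))

  Mx-ev* : ∀ n (a : Fn) {m c B} → Mx m c B → Mx (n ℕ.+ m) (norm (suc n) a ℕ.* c) (λ t → ev (suc n) a t * B t)
  Mx-ev* zero    a {m} {c} {B} p = Mx-cast ℕₚ.≤-refl (λ t → l (a 0) (B t)) (Mx-scale (a 0) p)
    where
    l : ∀ a b → a * b ≡ (0ℤ + a * 1ℤ) * b
    l = solve-∀
  Mx-ev* (suc n) a {m} {c} {B} p =
    Mx-cast (ℕₚ.≤-reflexive (sym (ℕₚ.*-distribʳ-+ c (norm (suc n) a) (∣ a (suc n) ∣))))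
      (λ t → l (ev (suc n) a t) (a (suc n)) ((+ t) ^ suc n) (B t))
      (Mx-+ (Mx-suc (Mx-ev* n a p)) (Mx-scale (a (suc n)) (Mx-t^ (suc n) p)))
    where
    l : ∀ u v w x → u * x + v * (w * x) ≡ (u + v * w) * x
    l = solve-∀

  module Digits (T : ℕ) .{{_ : ℕ.NonZero T}} where
    -- Coefficient vectors are read as numbers in base `T`, which turns a box of vectors into an
    -- initial segment of the natural numbers, as the pigeonhole principle requires.
    encode : ℕ → (ℕ → ℕ) → ℕ
    encode zero    d = 0
    encode (suc n) d = d 0 ℕ.+ encode n (λ i → d (suc i)) ℕ.* T

    digit : ℕ → ℕ → ℕ
    digit x zero    = x % T
    digit x (suc i) = digit (x / T) i

    digit< : ∀ x i → digit x i ℕ.< T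
    digit< x zero    = m%n<n x T
    digit< x (suc i) = digit< (x / T) i

    encode-digit : ∀ n x → x ℕ.< T ℕ.^ n → encode n (digit x) ≡ x
    encode-digit zero    x h = sym (ℕₚ.n<1⇒n≡0 h)
    encode-digit (suc n) x h = trans (cong (λ z → x % T ℕ.+ z ℕ.* T) (encode-digit n (x / T) (m<n*o⇒m/o<n (subst (x ℕ.<_) (ℕₚ.*-comm T (T ℕ.^ n)) h)))) (sym (m≡m%n+[m/n]*n x T))

    encode-cong : ∀ n {d d' : ℕ → ℕ} → (∀ i → i ℕ.< n → d i ≡ d' i) → encode n d ≡ encode n d'
    encode-cong zero    e = refl
    encode-cong (suc n) e = cong₂ (λ u v → u ℕ.+ v ℕ.* T) (e 0 (s≤s z≤n)) (encode-cong n (λ i h → e (suc i) (s≤s h)))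

    encode< : ∀ n d → (∀ i → i ℕ.< n → d i ℕ.< T) → encode n d ℕ.< T ℕ.^ n
    encode< zero    d h = s≤s z≤n
    encode< (suc n) d h = begin-strict
      d 0 ℕ.+ e ℕ.* T <⟨ ℕₚ.+-monoˡ-< (e ℕ.* T) (h 0 (s≤s z≤n)) ⟩
      suc e ℕ.* T     ≤⟨ ℕₚ.*-monoˡ-≤ T (encode< n (λ i → d (suc i)) (λ i l → h (suc i) (s≤s l))) ⟩
      T ℕ.^ n ℕ.* T   ≡⟨ ℕₚ.*-comm (T ℕ.^ n) T ⟩
      T ℕ.^ suc n ∎
      where
      open ℕₚ.≤-Reasoning
      e = encode n (λ i → d (suc i))

    split : ∀ a b e e' → a ℕ.< T → b ℕ.< T → a ℕ.+ e ℕ.* T ≡ b ℕ.+ e' ℕ.* T → a ≡ b × e ≡ e'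
    split a b e e' a<T b<T h = a≡b , ℕₚ.*-cancelʳ-≡ e e' T (ℕₚ.+-cancelˡ-≡ a _ _ (trans h (cong (ℕ._+ e' ℕ.* T) (sym a≡b))))
      where
      a≡b : a ≡ b
      a≡b = trans (sym (trans ([m+kn]%n≡m%n a e T) (m<n⇒m%n≡m a<T))) (trans (cong (_% T) h) (trans ([m+kn]%n≡m%n b e' T) (m<n⇒m%n≡m b<T)))

    encode-injective : ∀ n d d' → (∀ i → i ℕ.< n → d i ℕ.< T) → (∀ i → i ℕ.< n → d' i ℕ.< T) → encode n d ≡ encode n d' → ∀ i → i ℕ.< n → d i ≡ d' i
    encode-injective (suc n) d d' b b' h zero    _       = proj₁ (split (d 0) (d' 0) (encode n (λ i → d (suc i))) (encode n (λ i → d' (suc i))) (b 0 (s≤s z≤n)) (b' 0 (s≤s z≤n)) h)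
    encode-injective (suc n) d d' b b' h (suc i) (s≤s l) = encode-injective n (λ i → d (suc i)) (λ i → d' (suc i)) (λ i l → b (suc i) (s≤s l)) (λ i l → b' (suc i) (s≤s l))
      (proj₂ (split (d 0) (d' 0) (encode n (λ i → d (suc i))) (encode n (λ i → d' (suc i))) (b 0 (s≤s z≤n)) (b' 0 (s≤s z≤n)) h)) i l

open RootsModuloPrime

-- Siegel's method: a relation between `F s` and `F r`.

module Pigeonhole where
  open import Data.Integer using (_+_; _*_; _-_; -_; _^_)
  open import Data.Integer.Properties
  open import Data.Integer.Divisibility.Signed

  ev-truncate : ∀ n L (d : Fn) → L ℕ.≤ n → (∀ i → L ℕ.≤ i → i ℕ.< n → d i ≡ 0ℤ) → ∀ t → ev n d t ≡ ev L d t
  ev-truncate zero    zero d _  _ t = refl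
  ev-truncate (suc n) L    d le z t with ℕₚ.m≤n⇒m<n∨m≡n le
  ... | inj₂ refl      = refl
  ... | inj₁ (s≤s L≤n) = trans (cong (λ u → ev n d t + u * (+ t) ^ n) (z n L≤n (ℕₚ.n<1+n n)))
    (trans (+-identityʳ (ev n d t)) (ev-truncate n L d L≤n (λ i h l → z i h (ℕₚ.m<n⇒m<1+n l)) t))

  shifted : ∀ h B → ∣ h ∣ ℕ.≤ B → + ∣ h + + B ∣ ≡ h + + B
  shifted (+ n)    B le = refl
  shifted -[1+ n ] B le = trans (cong (λ z → + ∣ z ∣) (⊖-≥ le)) (sym (⊖-≥ le))

  record Relation (nU nV : ℕ) (Fs Fr : Fn) : Set where
    field
      U V      : Fn
      bU bV    : ℕ
      pU       : P nU bU U
      pV       : P nV bV V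
      relation : ∀ t → U t * Fs t + V t * Fr t ≡ 0ℤ
      U≢0      : ¬ Eventually (λ t → U t ≡ 0ℤ)
      V≢0      : ¬ Eventually (λ t → V t ≡ 0ℤ)

  -- More pairs (U, V) with small coefficients than values of U Fs + V Fr: the latter have small coefficients
  -- and vanish modulo p at the given points.
  module Collision (p : ℕ) (pr : Prime p) (s r m₁ m₂ nU nV : ℕ) (same : m₂ ℕ.+ nV ≡ m₁ ℕ.+ nU)
    (Fs Fr : Fn) (fs fr : Fn) (eFs : ∀ t → Fs t ≡ ev (suc m₁) fs t) (eFr : ∀ t → Fr t ≡ ev (suc m₂) fr t)
    (ns : norm (suc m₁) fs ℕ.≤ 2 ℕ.^ s) (nr : norm (suc m₂) fr ℕ.≤ 2 ℕ.^ r)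
    (Fs≢0 : ∀ t → 1 ℕ.≤ t → Fs t ≢ 0ℤ) (Fr≢0 : ∀ t → 1 ℕ.≤ t → Fr t ≢ 0ℤ)
    (ys : List ℕ) (ys< : All (ℕ._< p) ys) (uniq : AllPairs _≢_ ys)
    (vs : All (λ y → + p ∣ Fs y) ys) (vr : All (λ y → + p ∣ Fr y) ys) (L≤ : length ys ℕ.≤ m₁ ℕ.+ nU) where

    private
      instance
        p≢0 : ℕ.NonZero p
        p≢0 = prime⇒nonZero pr
      n = m₁ ℕ.+ nU
      L = length ys
      T₁ = p ℕ.* 2 ℕ.^ r
      T₂ = p ℕ.* 2 ℕ.^ s
      -- Chosen such that `γ p = 4 B`: the coefficients, made nonnegative by adding `B`, are at most
      -- `2 B`, so their quotients by `p` are digits below `γ`.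
      γ = 2 ℕ.^ (3 ℕ.+ (r ℕ.+ s))
      B = p ℕ.* 2 ℕ.^ (1 ℕ.+ (r ℕ.+ s))
      instance
        T₁≢0 : ℕ.NonZero T₁
        T₁≢0 = ℕₚ.m*n≢0 p (2 ℕ.^ r) {{p≢0}} {{ℕₚ.m^n≢0 2 r}}
        T₂≢0 : ℕ.NonZero T₂
        T₂≢0 = ℕₚ.m*n≢0 p (2 ℕ.^ s) {{p≢0}} {{ℕₚ.m^n≢0 2 s}}
        γ≢0 : ℕ.NonZero γ
        γ≢0 = ℕₚ.m^n≢0 2 (3 ℕ.+ (r ℕ.+ s))
        T₁^≢0 : ℕ.NonZero (T₁ ℕ.^ nU)
        T₁^≢0 = ℕₚ.m^n≢0 T₁ nU
        γ^≢0 : ℕ.NonZero (γ ℕ.^ n)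
        γ^≢0 = ℕₚ.m^n≢0 γ n
      module D₁ = Digits T₁
      module D₂ = Digits T₂
      module Dγ = Digits γ
      module Dp = Digits p
      module DΓ = Digits (γ ℕ.^ n)

      u v : ℕ → ℕ → ℕ
      u x i = D₁.digit (x % T₁ ℕ.^ nU) i
      v x i = D₂.digit (x / T₁ ℕ.^ nU) i

      H : ℕ → Fn
      H x t = ev (suc m₁) fs t * ev nU (λ i → + u x i) t + ev (suc m₂) fr t * ev nV (λ i → + v x i) t

      mH : ∀ x → Mx n B (H x)
      mH x = Mx-cast le (λ _ → refl) (Mx-+ (Mx-ev* m₁ fs mU) (subst (λ z → Mx z (norm (suc m₂) fr ℕ.* T₂) (λ t → ev (suc m₂) fr t * ev nV (λ i → + v x i) t)) same (Mx-ev* m₂ fr mV)))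
        where
        mU : Mx nU T₁ (ev nU (λ i → + u x i))
        mU = mx (λ i → + u x i) (λ _ → refl) (λ i _ → ℕₚ.<⇒≤ (D₁.digit< (x % T₁ ℕ.^ nU) i))
        mV : Mx nV T₂ (ev nV (λ i → + v x i))
        mV = mx (λ i → + v x i) (λ _ → refl) (λ i _ → ℕₚ.<⇒≤ (D₂.digit< (x / T₁ ℕ.^ nU) i))
        l : ∀ p a b → a ℕ.* (p ℕ.* b) ℕ.+ b ℕ.* (p ℕ.* a) ≡ p ℕ.* (2 ℕ.* (b ℕ.* a))
        l = ℕR.solve-∀
        le : norm (suc m₁) fs ℕ.* T₁ ℕ.+ norm (suc m₂) fr ℕ.* T₂ ℕ.≤ B
        le = ℕₚ.≤-trans (ℕₚ.+-mono-≤ (ℕₚ.*-monoˡ-≤ T₁ ns) (ℕₚ.*-monoˡ-≤ T₂ nr))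
          (ℕₚ.≤-reflexive (trans (l p (2 ℕ.^ s) (2 ℕ.^ r)) (cong (λ z → p ℕ.* (2 ℕ.* z)) (sym (ℕₚ.^-distribˡ-+-* 2 r s)))))

      h : ℕ → Fn
      h x = Mx.coef (mH x)

      z : ℕ → ℕ → ℕ
      z x i = ∣ h x i + + B ∣

      z-h : ∀ x i → i ℕ.< n → + z x i ≡ h x i + + B
      z-h x i i<n = shifted (h x i) B (Mx.bounded (mH x) i i<n)

      z< : ∀ x i → i ℕ.< n → z x i ℕ.< γ ℕ.* p
      z< x i i<n = begin-strict
        ∣ h x i + + B ∣  ≤⟨ ∣i+j∣≤∣i∣+∣j∣ (h x i) (+ B) ⟩
        ∣ h x i ∣ ℕ.+ B  ≤⟨ ℕₚ.+-monoˡ-≤ B (Mx.bounded (mH x) i i<n) ⟩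
        B ℕ.+ B          ≡⟨ l p (2 ℕ.^ (r ℕ.+ s)) ⟩
        w                <⟨ ℕₚ.m<m*n w 2 {{nz}} (s≤s (s≤s z≤n)) ⟩
        w ℕ.* 2          ≡⟨ l' p (2 ℕ.^ (r ℕ.+ s)) ⟩
        γ ℕ.* p ∎
        where
        open ℕₚ.≤-Reasoning
        w = p ℕ.* (4 ℕ.* 2 ℕ.^ (r ℕ.+ s))
        nz : ℕ.NonZero w
        nz = ℕₚ.m*n≢0 p (4 ℕ.* 2 ℕ.^ (r ℕ.+ s)) {{p≢0}} {{ℕₚ.m*n≢0 4 (2 ℕ.^ (r ℕ.+ s)) {{_}} {{ℕₚ.m^n≢0 2 (r ℕ.+ s)}}}}
        l : ∀ p e → p ℕ.* (2 ℕ.* e) ℕ.+ p ℕ.* (2 ℕ.* e) ≡ p ℕ.* (4 ℕ.* e)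
        l = ℕR.solve-∀
        l' : ∀ p e → p ℕ.* (4 ℕ.* e) ℕ.* 2 ≡ 2 ℕ.* (2 ℕ.* (2 ℕ.* e)) ℕ.* p
        l' = ℕR.solve-∀

      k = n ℕ.∸ L
      -- A value is recorded by the quotients by `p` of all its coefficients, but by the residues of
      -- the upper `n - L` ones only: the remaining residues are determined by the vanishing at the
      -- `L` given points. This saves a factor p^L.
      code₁ code₂ code : ℕ → ℕ
      code₁ x = Dγ.encode n (λ i → z x i / p)
      code₂ x = Dp.encode k (λ i → z x (L ℕ.+ i) % p)
      code x = code₁ x ℕ.+ code₂ x ℕ.* γ ℕ.^ n

      digit₁ : ∀ x i → i ℕ.< n → z x i / p ℕ.< γ
      digit₁ x i i<n = m<n*o⇒m/o<n (z< x i i<n)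

      code₁< : ∀ x → code₁ x ℕ.< γ ℕ.^ n
      code₁< x = Dγ.encode< n _ (digit₁ x)

      code< : ∀ x → code x ℕ.< p ℕ.^ k ℕ.* γ ℕ.^ n
      code< x = ℕₚ.<-≤-trans (ℕₚ.+-monoˡ-< (code₂ x ℕ.* γ ℕ.^ n) (code₁< x))
        (ℕₚ.*-monoˡ-≤ (γ ℕ.^ n) (Dp.encode< k _ (λ i _ → m%n<n (z x (L ℕ.+ i)) p)))

      Same : ℕ → ℕ → Set
      Same x x' = ∀ t → H x t ≡ H x' t

      -- Equal quotients leave a difference with coefficients below `p` in absolute value, and equal
      -- residues make it zero from index `L` on. It vanishes modulo `p` at `L` points, so by
      -- `roots` the other coefficients are divisible by `p` and hence zero.
      code-injective : ∀ x x' → code x ≡ code x' → Same x x'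
      code-injective x x' e t = i-j≡0⇒i≡j (H x t) (H x' t) (trans (d-ev t) (ev-0 n d≡0 t))
        where
        d : Fn
        d i = h x i + -[1+ 0 ] * h x' i
        d-ev : ∀ t → H x t - H x' t ≡ ev n d t
        d-ev t = trans (cong₂ (λ a b → a - b) (Mx.isEv (mH x) t) (Mx.isEv (mH x') t)) (sym (trans (ev-+ n (h x) (λ i → -[1+ 0 ] * h x' i) t)
          (cong (_+_ (ev n (h x) t)) (trans (ev-* n -[1+ 0 ] (h x') t) (-1*i≡-i (ev n (h x') t))))))
        e₁₂ = DΓ.split (code₁ x) (code₁ x') (code₂ x) (code₂ x') (code₁< x) (code₁< x') e
        q≡ : ∀ i → i ℕ.< n → z x i / p ≡ z x' i / p
        q≡ = Dγ.encode-injective n _ _ (digit₁ x) (digit₁ x') (proj₁ e₁₂)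
        m≡ : ∀ i → i ℕ.< k → z x (L ℕ.+ i) % p ≡ z x' (L ℕ.+ i) % p
        m≡ = Dp.encode-injective k _ _ (λ i _ → m%n<n (z x (L ℕ.+ i)) p) (λ i _ → m%n<n (z x' (L ℕ.+ i)) p) (proj₂ e₁₂)
        l₁ : ∀ a b B → a + -[1+ 0 ] * b ≡ a + B - (b + B)
        l₁ = solve-∀
        d-z : ∀ i → i ℕ.< n → d i ≡ + z x i - + z x' i
        d-z i i<n = trans (l₁ (h x i) (h x' i) (+ B)) (cong₂ _-_ (sym (z-h x i i<n)) (sym (z-h x' i i<n)))
        z-split : ∀ x i → + z x i ≡ + (z x i % p) + + (z x i / p) * + p
        z-split x i = trans (cong +_ (m≡m%n+[m/n]*n (z x i) p)) (trans (pos-+ (z x i % p) (z x i / p ℕ.* p)) (cong (_+_ (+ (z x i % p))) (pos-* (z x i / p) p)))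
        d-rem : ∀ i → i ℕ.< n → d i ≡ + (z x i % p) - + (z x' i % p)
        d-rem i i<n = trans (d-z i i<n) (trans (cong₂ _-_ (z-split x i) (trans (z-split x' i) (cong (λ w → + (z x' i % p) + + w * + p) (sym (q≡ i i<n)))))
          (l₂ (+ (z x i % p)) (+ (z x' i % p)) (+ (z x i / p) * + p)))
          where
          l₂ : ∀ a b c → a + c - (b + c) ≡ a - b
          l₂ = solve-∀
        high : ∀ i → L ℕ.≤ i → i ℕ.< n → d i ≡ 0ℤ
        high i L≤i i<n = trans (d-rem i i<n) (i≡j⇒i-j≡0 (cong +_ (subst (λ w → z x w % p ≡ z x' w % p) (ℕₚ.m+[n∸m]≡n L≤i) (m≡ (i ℕ.∸ L) (ℕₚ.∸-monoˡ-< i<n L≤i)))))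
        H-root : ∀ x {y} → + p ∣ Fs y → + p ∣ Fr y → + p ∣ H x y
        H-root x {y} a b = ∣m∣n⇒∣m+n (∣m⇒∣m*n (ev nU (λ i → + u x i) y) (subst (+ p ∣_) (eFs y) a)) (∣m⇒∣m*n (ev nV (λ i → + v x i) y) (subst (+ p ∣_) (eFr y) b))
        vanish : ∀ {ts} → All (λ y → + p ∣ Fs y) ts → All (λ y → + p ∣ Fr y) ts → All (λ y → + p ∣ ev L d y) ts
        vanish []       []       = []
        vanish (_∷_ {y} a as) (b ∷ bs) = subst (+ p ∣_) (trans (d-ev y) (ev-truncate n L d L≤ high y)) (∣m∣n⇒∣m-n (H-root x a b) (H-root x' a b)) ∷ vanish as bs
        low : ∀ i → i ℕ.< n → i ℕ.< L → d i ≡ 0ℤ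
        low i i<n i<L with z x i % p ℕ.≟ z x' i % p
        ... | yes e = trans (d-rem i i<n) (i≡j⇒i-j≡0 (cong +_ e))
        ... | no ne = ⊥-elim (distinct p pr (m%n<n (z x i) p) (m%n<n (z x' i) p) (λ e → ne (sym e))
                        (subst (+ p ∣_) (d-rem i i<n) (roots p pr L d ys ℕₚ.≤-refl ys< uniq (vanish vs vr) i i<L)))
        d≡0 : ∀ i → i ℕ.< n → d i ≡ 0ℤ
        d≡0 i i<n with ℕₚ.≤-<-connex L i
        ... | inj₁ L≤i = high i L≤i i<n
        ... | inj₂ i<L = low i i<n i<L

      size = T₁ ℕ.^ nU ℕ.* T₂ ℕ.^ nV

      -- Distinct codes give U and V that are not both zero. If one of them vanished, the relation
      -- would make the other vanish too, since `Fs` and `Fr` are nonzero at positive arguments.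
      same⇒relation : ∀ x x' → x ℕ.< size → x' ℕ.< size → x ≢ x' → Same x x' → Relation nU nV Fs Fr
      same⇒relation x x' x< x'< x≢x' eq = record
        { U = U ; V = V ; bU = _ ; bV = _ ; pU = poly cU (λ _ → refl) ℕₚ.≤-refl ; pV = poly cV (λ _ → refl) ℕₚ.≤-refl
        ; relation = rel
        ; U≢0 = λ z → x≢x' (recover (ev-zero nU cU z) (ev-zero nV cV (other Fr Fr≢0 V U Fs (λ t → trans (+-comm (V t * Fr t) (U t * Fs t)) (rel t)) z)))
        ; V≢0 = λ z → x≢x' (recover (ev-zero nU cU (other Fs Fs≢0 U V Fr rel z)) (ev-zero nV cV z)) }
        where
        cU cV U V : Fn
        cU i = + u x i + -[1+ 0 ] * + u x' i
        cV i = + v x i + -[1+ 0 ] * + v x' i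
        U = ev nU cU
        V = ev nV cV
        diff : ∀ m (a b : Fn) t → ev m (λ i → a i + -[1+ 0 ] * b i) t ≡ ev m a t - ev m b t
        diff m a b t = trans (ev-+ m a (λ i → -[1+ 0 ] * b i) t) (cong (_+_ (ev m a t)) (trans (ev-* m -[1+ 0 ] b t) (-1*i≡-i (ev m b t))))
        l : ∀ a a' b b' f g → (a - a') * f + (b - b') * g ≡ f * a + g * b - (f * a' + g * b')
        l = solve-∀
        rel : ∀ t → U t * Fs t + V t * Fr t ≡ 0ℤ
        rel t = trans (cong₂ _+_ (cong₂ _*_ (diff nU (λ i → + u x i) (λ i → + u x' i) t) (eFs t)) (cong₂ _*_ (diff nV (λ i → + v x i) (λ i → + v x' i) t) (eFr t)))
          (trans (l (ev nU (λ i → + u x i) t) (ev nU (λ i → + u x' i) t) (ev nV (λ i → + v x i) t) (ev nV (λ i → + v x' i) t) (ev (suc m₁) fs t) (ev (suc m₂) fr t)) (i≡j⇒i-j≡0 (eq t)))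
        other : ∀ (G : Fn) → (∀ t → 1 ℕ.≤ t → G t ≢ 0ℤ) → ∀ (A C K : Fn) → (∀ t → A t * G t + C t * K t ≡ 0ℤ) → Eventually (λ t → C t ≡ 0ℤ) → Eventually (λ t → A t ≡ 0ℤ)
        other G G≢0 A C K rel (t₀ , z) = suc t₀ , λ t t₀<t →
          pick t (ℕₚ.≤-trans (s≤s z≤n) t₀<t) (i*j≡0⇒i≡0∨j≡0 (A t) (trans (sym (trans (cong (λ w → A t * G t + w * K t) (z t (ℕₚ.<⇒≤ t₀<t))) (l₀ (A t * G t) (K t)))) (rel t)))
          where
          l₀ : ∀ a k → a + 0ℤ * k ≡ a
          l₀ = solve-∀
          pick : ∀ t → 1 ℕ.≤ t → A t ≡ 0ℤ ⊎ G t ≡ 0ℤ → A t ≡ 0ℤ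
          pick t 1≤t (inj₁ e) = e
          pick t 1≤t (inj₂ e) = ⊥-elim (G≢0 t 1≤t e)
        equal : ∀ {a b} → + a + -[1+ 0 ] * + b ≡ 0ℤ → a ≡ b
        equal {a} {b} e = +-injective (i-j≡0⇒i≡j (+ a) (+ b) (trans (cong (_+_ (+ a)) (sym (-1*i≡-i (+ b)))) e))
        recover : (∀ i → i ℕ.< nU → cU i ≡ 0ℤ) → (∀ i → i ℕ.< nV → cV i ≡ 0ℤ) → x ≡ x'
        recover hU hV = trans (m≡m%n+[m/n]*n x (T₁ ℕ.^ nU)) (trans (cong₂ (λ a b → a ℕ.+ b ℕ.* T₁ ℕ.^ nU) eU eV) (sym (m≡m%n+[m/n]*n x' (T₁ ℕ.^ nU))))
          where
          eU : x % T₁ ℕ.^ nU ≡ x' % T₁ ℕ.^ nU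
          eU = trans (sym (D₁.encode-digit nU _ (m%n<n x (T₁ ℕ.^ nU)))) (trans (D₁.encode-cong nU (λ i i< → equal (hU i i<))) (D₁.encode-digit nU _ (m%n<n x' (T₁ ℕ.^ nU))))
          quot< : ∀ {x} → x ℕ.< size → x / T₁ ℕ.^ nU ℕ.< T₂ ℕ.^ nV
          quot< {x} h = m<n*o⇒m/o<n (subst (x ℕ.<_) (ℕₚ.*-comm (T₁ ℕ.^ nU) (T₂ ℕ.^ nV)) h)
          eV : x / T₁ ℕ.^ nU ≡ x' / T₁ ℕ.^ nU
          eV = trans (sym (D₂.encode-digit nV _ (quot< x<))) (trans (D₂.encode-cong nV (λ i i< → equal (hV i i<))) (D₂.encode-digit nV _ (quot< x'<)))

    collision : p ℕ.^ (m₁ ℕ.+ nU ℕ.∸ length ys) ℕ.* (2 ℕ.^ (3 ℕ.+ (r ℕ.+ s))) ℕ.^ (m₁ ℕ.+ nU) ℕ.< (p ℕ.* 2 ℕ.^ r) ℕ.^ nU ℕ.* (p ℕ.* 2 ℕ.^ s) ℕ.^ nV →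
      Relation nU nV Fs Fr
    collision lt = same⇒relation (toℕ i) (toℕ j) (toℕ<n i) (toℕ<n j) (ℕₚ.<⇒≢ i<j) (code-injective (toℕ i) (toℕ j)
        (trans (sym (toℕ-fromℕ< (code< (toℕ i)))) (trans (cong toℕ fi≡fj) (toℕ-fromℕ< (code< (toℕ j))))))
      where
      php = pigeonhole lt (λ i → fromℕ< (code< (toℕ i)))
      i = proj₁ php
      j = proj₁ (proj₂ php)
      i<j = proj₁ (proj₂ (proj₂ php))
      fi≡fj = proj₂ (proj₂ (proj₂ php))

open Pigeonhole

-- Counting common roots, and the final bound.

module CommonRoots where
  open import Defs using (N; isSol; _≡ᵇ_[mod_])
  open import Data.Integer using (_+_; _*_; _-_; -_; _^_)
  open import Data.Integer.Properties
  open import Data.Integer.Divisibility.Signed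

  congruent⇒∣ : ∀ p a b → T (a ≡ᵇ b [mod p ]) → + p ∣ + a - + b
  congruent⇒∣ (suc q) a b h = divides (+ (a / suc q) - + (b / suc q))
    (trans (cong₂ _-_ (decompose a) (trans (decompose b) (cong (λ z → + z + + (b / suc q) * + suc q) (sym (ℕₚ.≡ᵇ⇒≡ (a % suc q) (b % suc q) h)))))
      (l (+ (a % suc q)) (+ (a / suc q)) (+ (b / suc q)) (+ suc q)))
    where
    decompose : ∀ a → + a ≡ + (a % suc q) + + (a / suc q) * + suc q
    decompose a = trans (cong +_ (m≡m%n+[m/n]*n a (suc q))) (trans (pos-+ (a % suc q) _) (cong (_+_ (+ (a % suc q))) (pos-* (a / suc q) (suc q))))
    l : ∀ e a b p → e + a * p - (e + b * p) ≡ (a - b) * p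
    l = solve-∀

  congruent⇒F : ∀ p n y → T ((y ℕ.+ 1) ℕ.^ n ≡ᵇ (y ℕ.^ n ℕ.+ 1) [mod p ]) → + p ∣ F n y
  congruent⇒F p n y h = subst (+ p ∣_) (trans (cong₂ _-_ (pos-^ (y ℕ.+ 1) n) (cong (_+ 1ℤ) (pos-^ y n)))
    (trans (l (X y ^ n) (Y y ^ n)) (sym (F-def n y)))) (congruent⇒∣ p ((y ℕ.+ 1) ℕ.^ n) (y ℕ.^ n ℕ.+ 1) h)
    where
    l : ∀ a b → a - (b + 1ℤ) ≡ a - b - 1ℤ
    l = solve-∀

  record Solutions (p r s : ℕ) (ys : List ℕ) : Set where
    field
      below  : All (ℕ._< p) ys
      nonzero : All (0 ≢_) ys
      notlast : All (ℕ.pred p ≢_) ys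
      uniq   : AllPairs _≢_ ys
      rootʳ  : All (λ y → + p ∣ F r y) ys
      rootˢ  : All (λ y → + p ∣ F s y) ys

  isSol-sound : ∀ p r s y → T (isSol p r s y) → ¬ T (y ≡ᵇ 0 [mod p ]) × ¬ T ((y ℕ.+ 1) ≡ᵇ 0 [mod p ]) ×
    T ((y ℕ.+ 1) ℕ.^ r ≡ᵇ (y ℕ.^ r ℕ.+ 1) [mod p ]) × T ((y ℕ.+ 1) ℕ.^ s ≡ᵇ (y ℕ.^ s ℕ.+ 1) [mod p ])
  isSol-sound p r s y = split (y ≡ᵇ 0 [mod p ]) ((y ℕ.+ 1) ≡ᵇ 0 [mod p ])
    ((y ℕ.+ 1) ℕ.^ r ≡ᵇ (y ℕ.^ r ℕ.+ 1) [mod p ]) ((y ℕ.+ 1) ℕ.^ s ≡ᵇ (y ℕ.^ s ℕ.+ 1) [mod p ])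
    where
    split : ∀ a b c d → T (not a ∧ (not b ∧ (c ∧ d))) → ¬ T a × ¬ T b × T c × T d
    split false false true true _ = (λ ()) , (λ ()) , _ , _

  solutions : ∀ p r s → ℕ.NonZero p → Solutions p r s (filterᵇ (isSol p r s) (upTo p))
  solutions (suc q) r s _ = record
    { below   = Allₚ.filter⁺ (T? ∘ isSol p r s) (Allₚ.all-upTo p)
    ; nonzero = All.map (λ {y} h e → proj₁ h (subst (λ z → T (z ≡ᵇ 0 [mod p ])) e _)) sat
    ; notlast = All.map (λ {y} h e → proj₁ (proj₂ h) (subst (λ z → T ((z ℕ.+ 1) ≡ᵇ 0 [mod p ])) e
        (ℕₚ.≡⇒≡ᵇ ((q ℕ.+ 1) % p) 0 (trans (cong (_% p) (ℕₚ.+-comm q 1)) (n%n≡0 p))))) sat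
    ; uniq    = Uniqueₚ.filter⁺ (T? ∘ isSol p r s) (Uniqueₚ.upTo⁺ p)
    ; rootʳ   = All.map (λ {y} h → congruent⇒F p r y (proj₁ (proj₂ (proj₂ h)))) sat
    ; rootˢ   = All.map (λ {y} h → congruent⇒F p s y (proj₂ (proj₂ (proj₂ h)))) sat
    }
    where
    p = suc q
    sat = All.map (λ {y} → isSol-sound p r s y) (Allₚ.all-filter (T? ∘ isSol p r s) (upTo p))

  F-0 : ∀ n → F (suc n) 0 ≡ 0ℤ
  F-0 n = trans (F-def (suc n) 0) (cong₂ (λ u v → u - v - 1ℤ) (trans (sym (pos-^ 1 (suc n))) (cong +_ (ℕₚ.^-zeroˡ (suc n)))) (*-zeroˡ (0ℤ ^ n)))

  p∣F-pred : ∀ p m → ℕ.NonZero p → Odd (suc (suc m)) → + p ∣ F (suc (suc m)) (ℕ.pred p)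
  p∣F-pred (suc q) m _ od = subst (+ suc q ∣_) (sym (proj₂ e)) (∣m⇒∣m*n _ (subst (λ z → + suc q ∣ - + z) (ℕₚ.+-comm 1 q) (divides (- 1ℤ) (sym (-1*i≡-i (+ suc q))))))
    where e = F-X-odd m q od

  -- The leading coefficient of `F s` is `s`, which `p` does not divide because `s < p`, so the
  -- degree s - 1 bounds the number of roots.
  root-bound : ∀ p → Prime p → ∀ m → suc (suc m) ℕ.< p → ∀ ys → All (ℕ._< p) ys → AllPairs _≢_ ys →
    All (λ y → + p ∣ F (suc (suc m)) y) ys → length ys ℕ.≤ suc m
  root-bound p pr m s<p ys ys<p uniq vs = decide (length ys ℕ.≤? suc m)
    where
    s = suc (suc m)
    decide : Dec (length ys ℕ.≤ suc m) → length ys ℕ.≤ suc m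
    decide (yes h) = h
    decide (no h)  = ⊥-elim (ℕₚ.<⇒≱ s<p (ℕ∣.∣⇒≤ (∣⇒∣ᵤ (subst (λ z → + p ∣ + z) (bin-pred (suc m))
      (roots p pr s (λ i → + fc s i) ys (ℕₚ.≰⇒> h) ys<p uniq (All.map (λ {y} v → subst (+ p ∣_) (F-ev (suc m) y) v) vs) (suc m) ℕₚ.≤-refl)))))

  F≢0 : ∀ m t → 1 ℕ.≤ t → F (suc (suc m)) t ≢ 0ℤ
  F≢0 m t 1≤t e = ℕₚ.<⇒≱ (ℕₚ.m^n>0 t {{ℕ.>-nonZero 1≤t}} (suc m)) (subst (λ z → t ℕ.^ suc m ℕ.≤ ∣ z ∣) e (F-large m t))

  -- E bounds the loss of the pigeonhole argument in bits; the k common roots beyond 1 + d gain a factor p^k.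
  dependent : ∀ p → Prime p → ∀ d a b k E → let s = suc (suc (d ℕ.+ a)) ; r = suc (suc (d ℕ.+ b)) in
    ∀ ys → All (ℕ._< p) ys → AllPairs _≢_ ys → All (λ y → + p ∣ F s y) ys → All (λ y → + p ∣ F r y) ys →
    length ys ≡ suc d ℕ.+ k → k ℕ.≤ a → (3 ℕ.+ (r ℕ.+ s)) ℕ.* (suc (d ℕ.+ a) ℕ.+ b) ℕ.≤ E ℕ.+ (r ℕ.* b ℕ.+ s ℕ.* a) →
    2 ℕ.^ E ℕ.< p ℕ.^ k → Relation b a (F s) (F r)
  dependent p pr d a b k E ys ys<p uniq vs vr len k≤a exps big = Collision.collision p pr s r (suc (d ℕ.+ a)) (suc (d ℕ.+ b)) b a
    (l₁ d a b) (F s) (F r) (λ i → + fc s i) (λ i → + fc r i) (F-ev (suc (d ℕ.+ a))) (F-ev (suc (d ℕ.+ b)))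
    (norm-fc s s (ℕₚ.n≤1+n s)) (norm-fc r r (ℕₚ.n≤1+n r)) (F≢0 (d ℕ.+ a)) (F≢0 (d ℕ.+ b)) ys ys<p uniq vs vr L≤ lt
    where
    instance
      p≢0 : ℕ.NonZero p
      p≢0 = prime⇒nonZero pr
    s = suc (suc (d ℕ.+ a))
    r = suc (suc (d ℕ.+ b))
    n = suc (d ℕ.+ a) ℕ.+ b
    l₁ : ∀ d a b → suc (d ℕ.+ b) ℕ.+ a ≡ suc (d ℕ.+ a) ℕ.+ b
    l₁ = ℕR.solve-∀
    l₂ : ∀ d c k b → suc (d ℕ.+ (k ℕ.+ c)) ℕ.+ b ≡ c ℕ.+ b ℕ.+ (suc d ℕ.+ k)
    l₂ = ℕR.solve-∀
    c = a ℕ.∸ k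
    n≡ : n ≡ c ℕ.+ b ℕ.+ length ys
    n≡ = trans (cong (λ z → suc (d ℕ.+ z) ℕ.+ b) (sym (ℕₚ.m+[n∸m]≡n k≤a))) (trans (l₂ d c k b) (cong (c ℕ.+ b ℕ.+_) (sym len)))
    L≤ : length ys ℕ.≤ n
    L≤ = subst (length ys ℕ.≤_) (sym n≡) (ℕₚ.m≤n+m (length ys) (c ℕ.+ b))
    excess : n ℕ.∸ length ys ≡ c ℕ.+ b
    excess = trans (cong (ℕ._∸ length ys) n≡) (ℕₚ.m+n∸n≡m (c ℕ.+ b) (length ys))
    G = r ℕ.* b ℕ.+ s ℕ.* a
    P^ : ℕ → ℕ
    P^ = p ℕ.^_
    l₃ : ∀ x e g → x ℕ.* (e ℕ.* g) ≡ x ℕ.* g ℕ.* e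
    l₃ = ℕR.solve-∀
    l₄ : ∀ b s a r → b ℕ.* s ℕ.* (a ℕ.* r) ≡ b ℕ.* a ℕ.* (s ℕ.* r)
    l₄ = ℕR.solve-∀
    open ℕₚ.≤-Reasoning
    powers : P^ (c ℕ.+ b) ℕ.* P^ k ≡ P^ b ℕ.* P^ a
    powers = trans (sym (ℕₚ.^-distribˡ-+-* p (c ℕ.+ b) k)) (trans (cong P^ (trans (l c b k) (cong (b ℕ.+_) (ℕₚ.m+[n∸m]≡n k≤a)))) (ℕₚ.^-distribˡ-+-* p b a))
      where
      l : ∀ c b k → c ℕ.+ b ℕ.+ k ≡ b ℕ.+ (k ℕ.+ c)
      l = ℕR.solve-∀
    expand : ∀ x i → (p ℕ.* 2 ℕ.^ x) ℕ.^ i ≡ P^ i ℕ.* 2 ℕ.^ (x ℕ.* i)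
    expand x i = trans (*-^ p (2 ℕ.^ x) i) (cong (P^ i ℕ.*_) (ℕₚ.^-*-assoc 2 x i))
    lt : p ℕ.^ (n ℕ.∸ length ys) ℕ.* (2 ℕ.^ (3 ℕ.+ (r ℕ.+ s))) ℕ.^ n ℕ.< (p ℕ.* 2 ℕ.^ r) ℕ.^ b ℕ.* (p ℕ.* 2 ℕ.^ s) ℕ.^ a
    lt = begin-strict
      P^ (n ℕ.∸ length ys) ℕ.* (2 ℕ.^ (3 ℕ.+ (r ℕ.+ s))) ℕ.^ n ≡⟨ cong₂ (λ u v → P^ u ℕ.* v) excess (ℕₚ.^-*-assoc 2 (3 ℕ.+ (r ℕ.+ s)) n) ⟩
      P^ (c ℕ.+ b) ℕ.* 2 ℕ.^ ((3 ℕ.+ (r ℕ.+ s)) ℕ.* n)        ≤⟨ ℕₚ.*-monoʳ-≤ (P^ (c ℕ.+ b)) (ℕₚ.^-monoʳ-≤ 2 exps) ⟩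
      P^ (c ℕ.+ b) ℕ.* 2 ℕ.^ (E ℕ.+ G)                         ≡⟨ cong (P^ (c ℕ.+ b) ℕ.*_) (ℕₚ.^-distribˡ-+-* 2 E G) ⟩
      P^ (c ℕ.+ b) ℕ.* (2 ℕ.^ E ℕ.* 2 ℕ.^ G)                   ≡⟨ l₃ (P^ (c ℕ.+ b)) (2 ℕ.^ E) (2 ℕ.^ G) ⟩
      P^ (c ℕ.+ b) ℕ.* 2 ℕ.^ G ℕ.* 2 ℕ.^ E                     <⟨ ℕₚ.*-monoʳ-< (P^ (c ℕ.+ b) ℕ.* 2 ℕ.^ G) {{ℕₚ.m*n≢0 (P^ (c ℕ.+ b)) (2 ℕ.^ G) {{ℕₚ.m^n≢0 p (c ℕ.+ b)}} {{ℕₚ.m^n≢0 2 G}}}} big ⟩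
      P^ (c ℕ.+ b) ℕ.* 2 ℕ.^ G ℕ.* P^ k                        ≡⟨ sym (l₃ (P^ (c ℕ.+ b)) (P^ k) (2 ℕ.^ G)) ⟩
      P^ (c ℕ.+ b) ℕ.* (P^ k ℕ.* 2 ℕ.^ G)                      ≡⟨ sym (ℕₚ.*-assoc (P^ (c ℕ.+ b)) (P^ k) (2 ℕ.^ G)) ⟩
      P^ (c ℕ.+ b) ℕ.* P^ k ℕ.* 2 ℕ.^ G                        ≡⟨ cong₂ ℕ._*_ powers (ℕₚ.^-distribˡ-+-* 2 (r ℕ.* b) (s ℕ.* a)) ⟩
      P^ b ℕ.* P^ a ℕ.* (2 ℕ.^ (r ℕ.* b) ℕ.* 2 ℕ.^ (s ℕ.* a))  ≡⟨ sym (l₄ (P^ b) (2 ℕ.^ (r ℕ.* b)) (P^ a) (2 ℕ.^ (s ℕ.* a))) ⟩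
      P^ b ℕ.* 2 ℕ.^ (r ℕ.* b) ℕ.* (P^ a ℕ.* 2 ℕ.^ (s ℕ.* a))  ≡⟨ sym (cong₂ ℕ._*_ (expand r b) (expand s a)) ⟩
      (p ℕ.* 2 ℕ.^ r) ℕ.^ b ℕ.* (p ℕ.* 2 ℕ.^ s) ℕ.^ a ∎

  module _ (m : ℕ) (W : Fn) (pW : Poly W) where
    open Base m W pW using (modulus)

    base∈ : Modulus.I modulus (F (suc (suc m)))
    base∈ = 1 , s≤s z≤n , (0 , λ t _ → ∣n⇒∣m*n 1ℤ (∣n⇒∣m*n (Q t * (Q t * W t)) ∣-refl))

    other∈ : ∀ k (C : Fn) → (∀ t → W t * F k t ≡ C t * F (suc (suc m)) t) → Modulus.I modulus (F k)
    other∈ k C e = 1 , s≤s z≤n , (0 , λ t _ → subst (F (suc (suc m)) t ∣_)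
      (sym (trans (l (Q t) (W t) (F k t)) (cong (λ z → 1ℤ * (Q t * (Q t * z))) (e t))))
      (∣n⇒∣m*n 1ℤ (∣n⇒∣m*n (Q t) (∣n⇒∣m*n (Q t) (∣n⇒∣m*n (C t) ∣-refl)))))
      where
      l : ∀ Q W f → 1ℤ * (Q * (Q * W) * f) ≡ 1ℤ * (Q * (Q * (W * f)))
      l = solve-∀

  swap-relation : ∀ {nU nV Fs Fr} → Relation nU nV Fs Fr → Relation nV nU Fr Fs
  swap-relation {Fs = Fs} {Fr} R = record { U = V ; V = U ; pU = pV ; pV = pU ; U≢0 = V≢0 ; V≢0 = U≢0
    ; relation = λ t → trans (+-comm (V t * Fr t) (U t * Fs t)) (relation t) }
    where open Relation R

  transpose : ∀ {nU nV Fs Fr} (R : Relation nU nV Fs Fr) → let open Relation R in ∀ t → V t * Fr t ≡ - U t * Fs t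
  transpose {Fs = Fs} {Fr} R t = trans (l (U t * Fs t) (V t * Fr t)) (trans (cong (_- U t * Fs t) (relation t)) (trans (+-identityˡ (- (U t * Fs t))) (neg-distribˡ-* (U t) (Fs t))))
    where
    open Relation R
    l : ∀ u v → v ≡ u + v - u
    l = solve-∀


  -- Both polynomials lie in the ideal (F s) : Q² V, the second one by the relation. So `trivial`
  -- applies, and then V vanishes by degrees because it has only s - 7 coefficients.
  independent-odd : ∀ a k nU → Odd (7 ℕ.+ a) → (∀ M → Modulus.I M (F (7 ℕ.+ a)) → Modulus.I M (F k) → Trivial M) → ¬ Relation nU a (F (7 ℕ.+ a)) (F k)
  independent-odd a k nU od trivial R = trivial (Base.modulus (5 ℕ.+ a) V poly-V) (base∈ (5 ℕ.+ a) V poly-V) (other∈ (5 ℕ.+ a) V poly-V k (λ t → - U t) (transpose R))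
    (λ one → V≢0 (nontrivial-odd (5 ℕ.+ a) a bV V pV od ℕₚ.≤-refl one))
    where
    open Relation R
    poly-V : Poly V
    poly-V = a , bV , pV

  independent-even : ∀ a k nU → Even (6 ℕ.+ a) → (∀ M → Modulus.I M (F (6 ℕ.+ a)) → Modulus.I M (F k) → Trivial M) → ¬ Relation nU a (F (6 ℕ.+ a)) (F k)
  independent-even a k nU en trivial R = trivial (Base.modulus (4 ℕ.+ a) V poly-V) (base∈ (4 ℕ.+ a) V poly-V) (other∈ (4 ℕ.+ a) V poly-V k (λ t → - U t) (transpose R))
    (λ one → V≢0 (nontrivial-even (4 ℕ.+ a) a bV V pV en ℕₚ.≤-refl one))
    where
    open Relation R
    poly-V : Poly V
    poly-V = a , bV , pV

  module _ (p : ℕ) (pr : Prime p) (r s : ℕ) (s<p : s ℕ.< p) (ys : List ℕ) (sol : Solutions p r s ys) where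
    open Solutions sol

    below₀ : All (ℕ._< p) (0 ∷ ys)
    below₀ = ℕₚ.≤-<-trans z≤n s<p ∷ below

    roots₀ : ∀ n → 0 ℕ.< n → All (λ y → + p ∣ F n y) ys → All (λ y → + p ∣ F n y) (0 ∷ ys)
    roots₀ (suc n) _ vs = subst (+ p ∣_) (sym (F-0 n)) (divides 0ℤ refl) ∷ vs

    below₁ : All (ℕ._< p) (ℕ.pred p ∷ 0 ∷ ys)
    below₁ = ℕₚ.≤-reflexive (ℕₚ.suc-pred p {{prime⇒nonZero pr}}) ∷ below₀

    uniq₁ : 0 ℕ.< s → AllPairs _≢_ (ℕ.pred p ∷ 0 ∷ ys)
    uniq₁ 0<s = ((λ e → ℕₚ.<⇒≢ (ℕₚ.<-≤-trans 0<s (ℕₚ.<⇒≤pred s<p)) (sym e)) ∷ notlast) ∷ nonzero ∷ uniq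

    roots₁ : ∀ n → 1 ℕ.< n → Odd n → All (λ y → + p ∣ F n y) ys → All (λ y → + p ∣ F n y) (ℕ.pred p ∷ 0 ∷ ys)
    roots₁ (suc (suc m)) _ od vs = p∣F-pred p m (prime⇒nonZero pr) od ∷ roots₀ (suc (suc m)) (s≤s z≤n) vs
    roots₁ (suc zero) (s≤s ()) od vs

  -- Below s = 8 degrees suffice. `F s` has at most s - 1 roots modulo `p`, and 0 is one of them,
  -- which leaves at most 4 for s up to 6. For s = 7 the root - 1 is discounted as well.
  few-roots : ∀ p → Prime p → ∀ r m → suc (suc m) ℕ.< p → ∀ ys → Solutions p r (suc (suc m)) ys → m ℕ.≤ 5 → length ys ℕ.≤ 4
  few-roots p pr r m s<p ys sol m≤5 = decide (m ℕ.≟ 5)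
    where
    open Solutions sol
    s = suc (suc m)
    decide : Dec (m ≡ 5) → length ys ℕ.≤ 4
    decide (yes refl) = ℕₚ.+-cancelˡ-≤ 2 (length ys) 4 (root-bound p pr 5 s<p _ (below₁ p pr r 7 s<p ys sol) (uniq₁ p pr r 7 s<p ys sol (s≤s z≤n))
      (roots₁ p pr r 7 s<p ys sol 7 (s≤s (s≤s z≤n)) (3 , refl) rootˢ))
    decide (no m≢5)   = ℕₚ.+-cancelˡ-≤ 1 (length ys) 4 (ℕₚ.≤-trans (root-bound p pr m s<p _ (below₀ p pr r s s<p ys sol) (nonzero ∷ uniq)
      (roots₀ p pr r s s<p ys sol s (s≤s z≤n) rootˢ)) (ℕₚ.≤∧≢⇒< m≤5 m≢5))

  many-odd : ∀ p → Prime p → ∀ a b → 1 ℕ.≤ a → a ℕ.< b → Odd (7 ℕ.+ a) → Odd (7 ℕ.+ b) → 7 ℕ.+ a ℕ.< p →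
    ∀ ys → Solutions p (7 ℕ.+ b) (7 ℕ.+ a) ys → ∀ k → length ys ≡ 4 ℕ.+ k → p ℕ.^ k ℕ.≤ 2 ℕ.^ (12 ℕ.* (7 ℕ.+ b) ℕ.* (7 ℕ.+ a))
  many-odd p pr a b 1≤a a<b os or s<p ys sol k len = ℕₚ.≮⇒≥ λ big → independent-odd a r b os (beukers s (ℕₚ.+-monoʳ-≤ 7 1≤a) r (ℕₚ.+-monoʳ-< 7 a<b))
      -- With the roots 0 and - 1 there are 6 + k common roots, that is `suc d + k` for d = 5. The
      -- condition `k ≤ a` is the bound s - 1 for the number of roots of `F s`.
      (dependent p pr 5 a b k (12 ℕ.* r ℕ.* s) _ below* uniq* rootˢ* (roots₁ p pr r s s<p ys sol r (s≤s (s≤s z≤n)) or rootʳ) (cong (2 ℕ.+_) len)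
        (ℕₚ.+-cancelˡ-≤ 6 k a (subst (ℕ._≤ 6 ℕ.+ a) (cong (2 ℕ.+_) len) (root-bound p pr (5 ℕ.+ a) s<p _ below* uniq* rootˢ*))) exps big)
    where
    open Solutions sol
    s = 7 ℕ.+ a
    r = 7 ℕ.+ b
    below* = below₁ p pr r s s<p ys sol
    uniq* = uniq₁ p pr r s s<p ys sol (s≤s z≤n)
    rootˢ* = roots₁ p pr r s s<p ys sol s (s≤s (s≤s z≤n)) os rootˢ
    -- The constant 12 leaves room: the slack is a polynomial in `a` and `b` with nonnegative
    -- coefficients.
    l : ∀ a b → (3 ℕ.+ ((7 ℕ.+ b) ℕ.+ (7 ℕ.+ a))) ℕ.* (6 ℕ.+ a ℕ.+ b) ℕ.+ (10 ℕ.* a ℕ.* b ℕ.+ 68 ℕ.* (a ℕ.+ b) ℕ.+ 486) ≡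
      12 ℕ.* (7 ℕ.+ b) ℕ.* (7 ℕ.+ a) ℕ.+ ((7 ℕ.+ b) ℕ.* b ℕ.+ (7 ℕ.+ a) ℕ.* a)
    l = ℕR.solve-∀
    exps : (3 ℕ.+ (r ℕ.+ s)) ℕ.* (6 ℕ.+ a ℕ.+ b) ℕ.≤ 12 ℕ.* r ℕ.* s ℕ.+ (r ℕ.* b ℕ.+ s ℕ.* a)
    exps = subst ((3 ℕ.+ (r ℕ.+ s)) ℕ.* (6 ℕ.+ a ℕ.+ b) ℕ.≤_) (l a b) (ℕₚ.m≤m+n _ _)

  many-even : ∀ p → Prime p → ∀ a b → 2 ℕ.≤ a → a ℕ.< b → Even (6 ℕ.+ a) ⊎ Even (6 ℕ.+ b) → 6 ℕ.+ a ℕ.< p →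
    ∀ ys → Solutions p (6 ℕ.+ b) (6 ℕ.+ a) ys → ∀ k → length ys ≡ 4 ℕ.+ k → p ℕ.^ k ℕ.≤ 2 ℕ.^ (12 ℕ.* (6 ℕ.+ b) ℕ.* (6 ℕ.+ a))
  many-even p pr a b 2≤a a<b e s<p ys sol k len = ℕₚ.≮⇒≥ λ big → refute e
      (dependent p pr 4 a b k (12 ℕ.* r ℕ.* s) _ below* (nonzero ∷ uniq) rootˢ* (roots₀ p pr r s s<p ys sol r (s≤s z≤n) rootʳ) (cong (1 ℕ.+_) len)
        (ℕₚ.+-cancelˡ-≤ 5 k a (subst (ℕ._≤ 5 ℕ.+ a) (cong (1 ℕ.+_) len) (root-bound p pr (4 ℕ.+ a) s<p _ below* (nonzero ∷ uniq) rootˢ*))) exps big)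
    where
    open Solutions sol
    s = 6 ℕ.+ a
    r = 6 ℕ.+ b
    below* = below₀ p pr r s s<p ys sol
    rootˢ* = roots₀ p pr r s s<p ys sol s (s≤s z≤n) rootˢ
    trivial : ∀ M → Modulus.I M (F s) → Modulus.I M (F r) → Trivial M
    trivial = beukers s (ℕₚ.+-monoʳ-≤ 6 2≤a) r (ℕₚ.+-monoʳ-< 6 a<b)
    refute : Even s ⊎ Even r → ¬ Relation b a (F s) (F r)
    refute (inj₁ es) R = independent-even a r b es trivial R
    -- One even exponent is enough, because the relation is symmetric: here `F r` generates the
    -- ideal and U takes the place of V.
    refute (inj₂ er) R = independent-even b s a er (λ M i j → trivial M j i) (swap-relation R)
    l : ∀ a b → (3 ℕ.+ ((6 ℕ.+ b) ℕ.+ (6 ℕ.+ a))) ℕ.* (5 ℕ.+ a ℕ.+ b) ℕ.+ (10 ℕ.* a ℕ.* b ℕ.+ 58 ℕ.* (a ℕ.+ b) ℕ.+ 357) ≡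
      12 ℕ.* (6 ℕ.+ b) ℕ.* (6 ℕ.+ a) ℕ.+ ((6 ℕ.+ b) ℕ.* b ℕ.+ (6 ℕ.+ a) ℕ.* a)
    l = ℕR.solve-∀
    exps : (3 ℕ.+ (r ℕ.+ s)) ℕ.* (5 ℕ.+ a ℕ.+ b) ℕ.≤ 12 ℕ.* r ℕ.* s ℕ.+ (r ℕ.* b ℕ.+ s ℕ.* a)
    exps = subst ((3 ℕ.+ (r ℕ.+ s)) ℕ.* (5 ℕ.+ a ℕ.+ b) ℕ.≤_) (l a b) (ℕₚ.m≤m+n _ _)

  many : ∀ p → Prime p → ∀ r s → 8 ℕ.≤ s → s ℕ.< r → s ℕ.< p → ∀ ys → Solutions p r s ys → ∀ k → length ys ≡ 4 ℕ.+ k → p ℕ.^ k ℕ.≤ 2 ℕ.^ (12 ℕ.* r ℕ.* s)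
  many p pr r s 8≤s s<r s<p ys sol k len = decide (parity s) (parity r)
    where
    8≤r = ℕₚ.≤-trans 8≤s (ℕₚ.<⇒≤ s<r)
    six : Even s ⊎ Even r → (∃ λ a → 6 ℕ.+ a ≡ s) → (∃ λ b → 6 ℕ.+ b ≡ r) → p ℕ.^ k ℕ.≤ 2 ℕ.^ (12 ℕ.* r ℕ.* s)
    six e (a , refl) (b , refl) = many-even p pr a b (ℕₚ.+-cancelˡ-≤ 6 2 a 8≤s) (ℕₚ.+-cancelˡ-< 6 a b s<r) e s<p ys sol k len
    seven : Odd s → Odd r → (∃ λ a → 7 ℕ.+ a ≡ s) → (∃ λ b → 7 ℕ.+ b ≡ r) → p ℕ.^ k ℕ.≤ 2 ℕ.^ (12 ℕ.* r ℕ.* s)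
    seven os or (a , refl) (b , refl) = many-odd p pr a b (ℕₚ.+-cancelˡ-≤ 7 1 a 8≤s) (ℕₚ.+-cancelˡ-< 7 a b s<r) os or s<p ys sol k len
    at : ∀ {m} c d → c ℕ.+ d ℕ.≤ m → ∃ λ a → c ℕ.+ a ≡ m
    at c d h = ℕₚ.m≤n⇒∃[o]m+o≡n (ℕₚ.≤-trans (ℕₚ.m≤m+n c d) h)
    decide : Even s ⊎ Odd s → Even r ⊎ Odd r → p ℕ.^ k ℕ.≤ 2 ℕ.^ (12 ℕ.* r ℕ.* s)
    decide (inj₁ es) _         = six (inj₁ es) (at 6 2 8≤s) (at 6 2 8≤r)
    decide (inj₂ _)  (inj₁ er) = six (inj₂ er) (at 6 2 8≤s) (at 6 2 8≤r)
    decide (inj₂ os) (inj₂ or) = seven os or (at 7 1 8≤s) (at 7 1 8≤r)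

  2^⌊log₂n⌋≤n : ∀ n → 1 ℕ.≤ n → 2 ℕ.^ ⌊log₂ n ⌋ ℕ.≤ n
  2^⌊log₂n⌋≤n = <-rec _ step
    where
    open ℕₚ.≤-Reasoning
    step : ∀ n → (∀ {m} → m ℕ.< n → 1 ℕ.≤ m → 2 ℕ.^ ⌊log₂ m ⌋ ℕ.≤ m) → 1 ℕ.≤ n → 2 ℕ.^ ⌊log₂ n ⌋ ℕ.≤ n
    step (suc zero)    ih _ = ℕₚ.≤-refl
    step (suc (suc n)) ih _ = begin
      2 ℕ.^ ⌊log₂ m ⌋                      ≡⟨ cong (2 ℕ.^_) (sym (ℕₚ.m+[n∸m]≡n (⌊log₂⌋-mono-≤ {2} {m} (s≤s (s≤s z≤n))))) ⟩
      2 ℕ.* 2 ℕ.^ (⌊log₂ m ⌋ ℕ.∸ 1)        ≡⟨ cong (λ z → 2 ℕ.* 2 ℕ.^ z) (sym (⌊log₂⌊n/2⌋⌋≡⌊log₂n⌋∸1 m)) ⟩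
      2 ℕ.* 2 ℕ.^ ⌊log₂ ⌊ m /2⌋ ⌋          ≤⟨ ℕₚ.*-monoʳ-≤ 2 (ih (ℕₚ.⌊n/2⌋<n (suc n)) (s≤s z≤n)) ⟩
      2 ℕ.* ⌊ m /2⌋                        ≡⟨ cong (⌊ m /2⌋ ℕ.+_) (ℕₚ.+-identityʳ _) ⟩
      ⌊ m /2⌋ ℕ.+ ⌊ m /2⌋                  ≤⟨ ℕₚ.+-monoʳ-≤ ⌊ m /2⌋ (ℕₚ.⌊n/2⌋≤⌈n/2⌉ m) ⟩
      ⌊ m /2⌋ ℕ.+ ⌈ m /2⌉                  ≡⟨ ℕₚ.⌊n/2⌋+⌈n/2⌉≡n m ⟩
      m ∎
      where m = suc (suc n)

  bound : ∀ p r s → Prime p → 1 ℕ.< s → s ℕ.< r → N p r s ℕ.* ⌊log₂ p ⌋ ℕ.≤ 12 ℕ.* r ℕ.* s ℕ.+ 4 ℕ.* ⌊log₂ p ⌋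
  bound p r s pr 1<s s<r = decide (p ℕ.≤? s) (N p r s ℕ.≤? 4) (8 ℕ.≤? s)
    where
    open ℕₚ.≤-Reasoning
    L = ⌊log₂ p ⌋
    ν = N p r s
    p≢0 = prime⇒nonZero pr
    sol = solutions p r s p≢0
    2^L≤p : 2 ℕ.^ L ℕ.≤ p
    2^L≤p = 2^⌊log₂n⌋≤n p (ℕ.>-nonZero⁻¹ p {{p≢0}})
    few : ν ℕ.≤ 4 → ν ℕ.* L ℕ.≤ 12 ℕ.* r ℕ.* s ℕ.+ 4 ℕ.* L
    few h = ℕₚ.≤-trans (ℕₚ.*-monoˡ-≤ L h) (ℕₚ.m≤n+m (4 ℕ.* L) (12 ℕ.* r ℕ.* s))
    l : ∀ r s → s ℕ.* r ℕ.+ 11 ℕ.* r ℕ.* s ≡ 12 ℕ.* r ℕ.* s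
    l = ℕR.solve-∀
    -- The count is at most `p`, hence at most `s`, and the logarithm is at most `p`, hence at most
    -- `r`.
    small-p : p ℕ.≤ s → ν ℕ.* L ℕ.≤ 12 ℕ.* r ℕ.* s ℕ.+ 4 ℕ.* L
    small-p p≤s = begin
      ν ℕ.* L                              ≤⟨ ℕₚ.*-mono-≤ (ℕₚ.≤-trans (length-filter (T? ∘ isSol p r s) (upTo p)) (subst (ℕ._≤ s) (sym (length-upTo p)) p≤s))
                                                (ℕₚ.≤-trans (ℕₚ.<⇒≤ (n<m^n 2 L (s≤s (s≤s z≤n)))) (ℕₚ.≤-trans 2^L≤p (ℕₚ.≤-trans p≤s (ℕₚ.<⇒≤ s<r)))) ⟩
      s ℕ.* r                              ≤⟨ ℕₚ.m≤m+n (s ℕ.* r) (11 ℕ.* r ℕ.* s) ⟩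
      s ℕ.* r ℕ.+ 11 ℕ.* r ℕ.* s           ≡⟨ l r s ⟩
      12 ℕ.* r ℕ.* s                       ≤⟨ ℕₚ.m≤m+n (12 ℕ.* r ℕ.* s) (4 ℕ.* L) ⟩
      12 ℕ.* r ℕ.* s ℕ.+ 4 ℕ.* L ∎
    small-s′ : (∃ λ m → 2 ℕ.+ m ≡ s) → s ℕ.< p → ¬ 8 ℕ.≤ s → ν ℕ.* L ℕ.≤ 12 ℕ.* r ℕ.* s ℕ.+ 4 ℕ.* L
    small-s′ (m , refl) s<p 8≰s = few (few-roots p pr r m s<p _ sol (ℕₚ.+-cancelˡ-≤ 2 m 5 (ℕₚ.≤-pred (ℕₚ.≰⇒> 8≰s))))
    large : 8 ℕ.≤ s → s ℕ.< p → 4 ℕ.≤ ν → ν ℕ.* L ℕ.≤ 12 ℕ.* r ℕ.* s ℕ.+ 4 ℕ.* L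
    large 8≤s s<p 4≤ν = begin
      ν ℕ.* L                    ≡⟨ cong (ℕ._* L) (sym (ℕₚ.m+[n∸m]≡n 4≤ν)) ⟩
      (4 ℕ.+ k) ℕ.* L            ≡⟨ l′ L k ⟩
      L ℕ.* k ℕ.+ 4 ℕ.* L        ≤⟨ ℕₚ.+-monoˡ-≤ (4 ℕ.* L) Lk≤ ⟩
      12 ℕ.* r ℕ.* s ℕ.+ 4 ℕ.* L ∎
      where
      k = ν ℕ.∸ 4
      l′ : ∀ L k → (4 ℕ.+ k) ℕ.* L ≡ L ℕ.* k ℕ.+ 4 ℕ.* L
      l′ = ℕR.solve-∀
      Lk≤ : L ℕ.* k ℕ.≤ 12 ℕ.* r ℕ.* s
      Lk≤ = ℕₚ.≮⇒≥ λ lt → ℕₚ.<⇒≱ (ℕₚ.^-monoʳ-< 2 (s≤s (s≤s z≤n)) lt) (begin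
        2 ℕ.^ (L ℕ.* k)           ≡⟨ sym (ℕₚ.^-*-assoc 2 L k) ⟩
        (2 ℕ.^ L) ℕ.^ k           ≤⟨ ℕₚ.^-monoˡ-≤ k 2^L≤p ⟩
        p ℕ.^ k                   ≤⟨ many p pr r s 8≤s s<r s<p _ sol k (sym (ℕₚ.m+[n∸m]≡n 4≤ν)) ⟩
        2 ℕ.^ (12 ℕ.* r ℕ.* s) ∎)
    decide : Dec (p ℕ.≤ s) → Dec (ν ℕ.≤ 4) → Dec (8 ℕ.≤ s) → ν ℕ.* L ℕ.≤ 12 ℕ.* r ℕ.* s ℕ.+ 4 ℕ.* L
    decide (yes p≤s) _       _         = small-p p≤s
    decide (no p≰s)  (yes h) _         = few h
    decide (no p≰s)  (no h)  (yes 8≤s) = large 8≤s (ℕₚ.≰⇒> p≰s) (ℕₚ.<⇒≤ (ℕₚ.≰⇒> h))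
    decide (no p≰s)  (no h)  (no 8≰s)  = small-s′ (ℕₚ.m≤n⇒∃[o]m+o≡n 1<s) (ℕₚ.≰⇒> p≰s) 8≰s

open import Defs
open import Data.Nat using (ℕ; _+_; _*_; _≤_; _<_)
open import Data.Nat.Primality using (Prime)
open import Data.Nat.Logarithm using (⌊log₂_⌋)
open import Data.Product using (∃)

theorem1p4 : ∃ λ (c : ℕ) → ∀ (p r s : ℕ) → Prime p → 1 < s → s < r →
    N p r s * ⌊log₂ p ⌋ ≤ c * r * s + 4 * ⌊log₂ p ⌋
theorem1p4 = 12 , CommonRoots.bound
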